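{- There is an absolute constant $C>0$ such that for every integer $d>0$, there exists a deterministic algorithm in the adversarial comparator model (against an adaptive adversary) that, on $n$ input items, takes $d$ rounds, makes $n^{1+C/d}\,d$ comparisons (i.e. $n^{1+O(1/d)}d$), and returns a $2d$-approximate sorting.
   Context: Adversarial comparator model: we are given $n$ items with unknown real values, accessible only through a comparator which, given two items $x_i,x_j$, returns $\max\{x_i,x_j\}$ if $|x_i-x_j|>1$, and otherwise returns either one as chosen by an adversary; the adversary is adaptive (its choices may depend on previous queries and answers). In the round model, in each round the algorithm submits a set of comparisons, chosen based on answers of previous rounds, and receives all answers. For reals $a,b$ write $a\ge_k b$ if $a\ge b-k$. An ordering $y_1,\dots,y_n$ of the items is a $k$-approximate sorting if $y_j\ge_k y_i$ for all $j>i$.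
   Formalization: The unknown values of the n items are taken to be rational numbers instead of real numbers. -}

module Defs where

open import Data.Nat as ℕ using (ℕ; zero; suc)
open import Data.Integer using (+_)
open import Data.Rational using (ℚ; _-_; _<_; _≤_; _/_; 1ℚ)
open import Data.Fin using (Fin)
import Data.Fin as Fin
open import Data.Fin.Permutation using (Permutation′; _⟨$⟩ʳ_)
open import Data.Bool using (Bool; true; false)
open import Data.List using (List; []; _∷_; _++_; [_]; map; length)
open import Data.Nat.ListAction using (sum)
open import Data.List.Relation.Binary.Pointwise using (Pointwise)
open import Data.Product using (_×_; _,_; proj₁; proj₂)
open import Relation.Binary.PropositionalEquality using (_≡_)

Query : ℕ → Set
Query n = Fin n × Fin n

-- An answer to query (i , j) is a Bool: true means the comparator returned i
-- (as the max), false means it returned j.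
Answer : Set
Answer = Bool

RoundAnswers : Set
RoundAnswers = List Answer

-- Transcript of the interaction so far: for each past round (chronological),
-- the list of queries submitted and the list of answers received.
Transcript : ℕ → Set
Transcript n = List (List (Query n) × RoundAnswers)

-- A deterministic round algorithm on n items: in every round it chooses the
-- set (list) of comparisons as a function of all answers of previous rounds;
-- at the end it outputs an ordering (a permutation y_k = π k of the items).
record Algorithm (n : ℕ) : Set where
  field
    query  : List RoundAnswers → List (Query n)
    output : List RoundAnswers → Permutation′ n

Adversary : ℕ → Set
Adversary n = Transcript n → List (Query n) → RoundAnswers

LegalAnswer : {n : ℕ} → (Fin n → ℚ) → Query n → Answer → Set
LegalAnswer x (i , j) b = ((1ℚ < x i - x j) → b ≡ true) × ((1ℚ < x j - x i) → b ≡ false)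

LegalAdversary : {n : ℕ} → (Fin n → ℚ) → Adversary n → Set
LegalAdversary x adv = ∀ t qs → Pointwise (LegalAnswer x) qs (adv t qs)

transcript : {n : ℕ} → Algorithm n → Adversary n → ℕ → Transcript n
transcript A adv zero = []
transcript A adv (suc r) =
  let t  = transcript A adv r
      qs = Algorithm.query A (map proj₂ t)
  in t ++ [ (qs , adv t qs) ]

cost : {n : ℕ} → Algorithm n → Adversary n → ℕ → ℕ
cost A adv r = sum (map (λ p → length (proj₁ p)) (transcript A adv r))

result : {n : ℕ} → Algorithm n → Adversary n → ℕ → Permutation′ n
result A adv r = Algorithm.output A (map proj₂ (transcript A adv r))

_≥[_]_ : ℚ → ℚ → ℚ → Set
a ≥[ k ] b = b - k ≤ a

ApproxSorting : {n : ℕ} → ℚ → (Fin n → ℚ) → Permutation′ n → Set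
ApproxSorting k x π = ∀ i j → i Fin.< j → x (π ⟨$⟩ʳ j) ≥[ k ] x (π ⟨$⟩ʳ i)

ℕ→ℚ : ℕ → ℚ
ℕ→ℚ m = + m / 1

{-# OPTIONS --safe #-}
-- A network of sorters, each acting on at most m registers, becomes an algorithm once every
-- sorter is replaced by a round-robin tournament, which sorts its items up to an error of 2.
-- Order statistics are 1-Lipschitz in the sup norm, so after R rounds every register is within
-- 2R of its content in the exact run, and the output is a 4R-approximate sorting.
--
-- The network is of Ajtai–Komlós–Szemerédi type.  Registers sit in bags at the nodes of a g-ary
-- tree of depth k with n ≤ g ^ k.  At each step a bag is nearly sorted in two rounds along an
-- expander (an iterated zig-zag product of affine planes); the extreme registers go back to the
-- parent and the others to the children in order.  The numbers of strangers, registers in a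
-- bag not belonging below its node, stay exponentially small in the distance, and R = O(k) rounds
-- with m = g ^ O(1) sort.  For the least power g of 4, above a constant, with n ≤ g ^ (d / 104)
-- one has 4R ≤ 2d, and either g ^ d = n ^ O(1) or g is a constant and R g ^ O(1) is compared
-- with d directly.  For bounded d, or n ≤ d, one round comparing all pairs suffices.
module Submission where

open import Data.Product using (_×_; _,_; proj₁; proj₂; Σ-syntax; ∃-syntax)
open import Data.Sum using (inj₁; inj₂; _⊎_)
open import Relation.Nullary using (yes; no; ¬_; contradiction; does; Dec)
open import Relation.Nullary.Decidable using (from-yes; dec-true; dec-false; map′)
open import Relation.Binary.PropositionalEquality using (_≡_; refl; sym; trans; cong; cong₂; subst; module ≡-Reasoning; subst₂; _≢_)
open import Data.List.Relation.Unary.All as All using (All; []; _∷_)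
open import Data.List.Relation.Unary.AllPairs as AllPairs using (AllPairs; []; _∷_)
open import Data.Empty using (⊥; ⊥-elim)
open import Function.Base using (id; _∘_)
open import Data.Bool.Base using (Bool; true; false; not; if_then_else_)
open import Data.List.Relation.Unary.All.Properties using (++⁻ˡ; ++⁻ʳ; ++⁺; map⁺; map⁻)
open import Data.List.Relation.Unary.Any using (here; there; index)
open import Data.List.Membership.Propositional using (_∈_)

-- The error is proportional to the number of rounds, so only about d / 2 rounds are affordable.
-- With sorters of size n^O(1/d) this demands O(k) rounds for k levels; a number of rounds quadratic
-- in k, as in simpler recursive networks, would not do. The adversary never meets the analysis of
-- the network: strangers are counted in an exact run on the ranks 0, ..., N - 1 with ties broken,
-- and the adversarial run is only compared with it register by register. A bag can be far larger
-- than a sorter, hence the expanders: they spread each row of m registers over the rows of a second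
-- round. Rearrangements are not given as bijections: two lists agree as multisets if every weight
-- function has the same sum on both, and 0/1 weights given by a threshold reduce sorting to
-- counting. The exponents are tuned together: capacities grow by g^12 per level and shrink by g per
-- step, fringes are g^17 times smaller than capacities, near sorting filters by g^18, and the share
-- of strangers falls by g^19 per level of distance. The gaps absorb the few factors g lost in each
-- recurrence.

-- Integer sums over finite product spaces.

module Integral where

  open import Data.Nat as ℕ using (ℕ; zero; suc)
  import Data.Nat.Properties as ℕₚ
  open import Data.Integer using (ℤ; +_; -[1+_]; -_; _+_; _*_; _-_; _≤_; 0ℤ; 1ℤ; +≤+; nonNegative; positive; +<+)
  import Data.Integer.Properties as ℤₚ
  open import Data.Integer.Tactic.RingSolver using (solve-∀)

  -- [ n ] has n + 1 points, so that every space is inhabited.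
  data Space : Set where
    [_] : ℕ → Space
    _⊗_ : Space → Space → Space

  -- Points are bare naturals and pairs of them, so that arithmetic modulo q applies to them
  -- directly; being in range is recorded separately by `In`, and sums visit only points in range.
  El : Space → Set
  El [ n ] = ℕ
  El (a ⊗ b) = El a × El b

  size : Space → ℕ
  size [ n ] = suc n
  size (a ⊗ b) = size a ℕ.* size b

  size-NonZero : ∀ s → ℕ.NonZero (size s)
  size-NonZero [ n ] = _
  size-NonZero (a ⊗ b) = ℕₚ.m*n≢0 (size a) (size b) {{size-NonZero a}} {{size-NonZero b}}

  ∣_∣ˢ : Space → ℤ
  ∣ s ∣ˢ = + size s

  In : (s : Space) → El s → Set
  In [ n ] x = x ℕ.≤ n
  In (a ⊗ b) (x , y) = In a x × In b y

  ∑ᶻ : ℕ → (ℕ → ℤ) → ℤ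
  ∑ᶻ zero f = 0ℤ
  ∑ᶻ (suc n) f = ∑ᶻ n f + f n

  ∫ : (s : Space) → (El s → ℤ) → ℤ
  ∫ [ n ] f = ∑ᶻ (suc n) f
  ∫ (a ⊗ b) f = ∫ a (λ x → ∫ b (λ y → f (x , y)))

  ∑ᶻ-cong< : ∀ n {f g : ℕ → ℤ} → (∀ x → x ℕ.< n → f x ≡ g x) → ∑ᶻ n f ≡ ∑ᶻ n g
  ∑ᶻ-cong< zero e = refl
  ∑ᶻ-cong< (suc n) e = cong₂ _+_ (∑ᶻ-cong< n (λ x p → e x (ℕₚ.m<n⇒m<1+n p))) (e n ℕₚ.≤-refl)

  ∑ᶻ-+ : ∀ n (f g : ℕ → ℤ) → ∑ᶻ n (λ x → f x + g x) ≡ ∑ᶻ n f + ∑ᶻ n g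
  ∑ᶻ-+ zero f g = refl
  ∑ᶻ-+ (suc n) f g = trans (cong (_+ (f n + g n)) (∑ᶻ-+ n f g)) (lem (∑ᶻ n f) (∑ᶻ n g) (f n) (g n))
    where
    lem : ∀ a b c d → (a + b) + (c + d) ≡ (a + c) + (b + d)
    lem = solve-∀

  ∑ᶻ-* : ∀ n c (f : ℕ → ℤ) → ∑ᶻ n (λ x → c * f x) ≡ c * ∑ᶻ n f
  ∑ᶻ-* zero c f = sym (ℤₚ.*-zeroʳ c)
  ∑ᶻ-* (suc n) c f = trans (cong (_+ c * f n) (∑ᶻ-* n c f)) (sym (ℤₚ.*-distribˡ-+ c (∑ᶻ n f) (f n)))

  ∑ᶻ-const : ∀ n c → ∑ᶻ n (λ _ → c) ≡ + n * c
  ∑ᶻ-const zero c = sym (ℤₚ.*-zeroˡ c)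
  ∑ᶻ-const (suc n) c = trans (cong (_+ c) (∑ᶻ-const n c)) (sym (lem (+ n) c))
    where
    lem : ∀ m c → (1ℤ + m) * c ≡ m * c + c
    lem = solve-∀

  ∑ᶻ-mono : ∀ n {f g : ℕ → ℤ} → (∀ x → f x ≤ g x) → ∑ᶻ n f ≤ ∑ᶻ n g
  ∑ᶻ-mono zero e = ℤₚ.≤-refl
  ∑ᶻ-mono (suc n) e = ℤₚ.+-mono-≤ (∑ᶻ-mono n e) (e n)

  ∫-cong : ∀ s {f g : El s → ℤ} → (∀ x → f x ≡ g x) → ∫ s f ≡ ∫ s g
  ∫-cong [ n ] e = ∑ᶻ-cong< (suc n) (λ x _ → e x)
  ∫-cong (a ⊗ b) e = ∫-cong a (λ x → ∫-cong b (λ y → e (x , y)))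

  ∫-+ : ∀ s (f g : El s → ℤ) → ∫ s (λ x → f x + g x) ≡ ∫ s f + ∫ s g
  ∫-+ [ n ] f g = ∑ᶻ-+ (suc n) f g
  ∫-+ (a ⊗ b) f g = trans (∫-cong a (λ x → ∫-+ b _ _)) (∫-+ a _ _)

  ∫-* : ∀ s c (f : El s → ℤ) → ∫ s (λ x → c * f x) ≡ c * ∫ s f
  ∫-* [ n ] c f = ∑ᶻ-* (suc n) c f
  ∫-* (a ⊗ b) c f = trans (∫-cong a (λ x → ∫-* b c _)) (∫-* a c _)

  ∫-const : ∀ s c → ∫ s (λ _ → c) ≡ ∣ s ∣ˢ * c
  ∫-const [ n ] c = ∑ᶻ-const (suc n) c
  ∫-const (a ⊗ b) c = begin
    ∫ a (λ _ → ∫ b (λ _ → c)) ≡⟨ ∫-cong a (λ _ → ∫-const b c) ⟩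
    ∫ a (λ _ → ∣ b ∣ˢ * c)      ≡⟨ ∫-const a _ ⟩
    ∣ a ∣ˢ * (∣ b ∣ˢ * c)        ≡⟨ sym (ℤₚ.*-assoc ∣ a ∣ˢ ∣ b ∣ˢ c) ⟩
    ∣ a ∣ˢ * ∣ b ∣ˢ * c          ≡⟨ cong (_* c) (sym (ℤₚ.pos-* (size a) (size b))) ⟩
    ∣ a ⊗ b ∣ˢ * c              ∎
    where open ≡-Reasoning

  ∫-mono : ∀ s {f g : El s → ℤ} → (∀ x → f x ≤ g x) → ∫ s f ≤ ∫ s g
  ∫-mono [ n ] e = ∑ᶻ-mono (suc n) e
  ∫-mono (a ⊗ b) e = ∫-mono a (λ x → ∫-mono b (λ y → e (x , y)))

  ∫-*ʳ : ∀ s c (f : El s → ℤ) → ∫ s (λ x → f x * c) ≡ ∫ s f * c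
  ∫-*ʳ s c f = trans (∫-cong s (λ x → ℤₚ.*-comm (f x) c)) (trans (∫-* s c f) (ℤₚ.*-comm c _))

  ∫-zero : ∀ s → ∫ s (λ _ → 0ℤ) ≡ 0ℤ
  ∫-zero s = trans (∫-const s 0ℤ) (ℤₚ.*-zeroʳ ∣ s ∣ˢ)

  ∑ᶻ-∫-swap : ∀ n s (f : ℕ → El s → ℤ) → ∑ᶻ n (λ x → ∫ s (f x)) ≡ ∫ s (λ y → ∑ᶻ n (λ x → f x y))
  ∑ᶻ-∫-swap zero s f = sym (∫-zero s)
  ∑ᶻ-∫-swap (suc n) s f = trans (cong (_+ ∫ s (f n)) (∑ᶻ-∫-swap n s f)) (sym (∫-+ s _ _))

  ∫-swap : ∀ s t (f : El s → El t → ℤ) → ∫ s (λ x → ∫ t (f x)) ≡ ∫ t (λ y → ∫ s (λ x → f x y))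
  ∫-swap [ n ] t f = ∑ᶻ-∫-swap (suc n) t f
  ∫-swap (a ⊗ b) t f = trans (∫-cong a (λ x → ∫-swap b t _)) (∫-swap a t _)

  *-monoˡ : ∀ {c a b} → 0ℤ ≤ c → a ≤ b → c * a ≤ c * b
  *-monoˡ {c} c≥0 = ℤₚ.*-monoˡ-≤-nonNeg c {{nonNegative c≥0}}

  *-cancel : ∀ s {a b} → ∣ s ∣ˢ * a ≤ ∣ s ∣ˢ * b → a ≤ b
  *-cancel s {a} {b} = ℤₚ.*-cancelˡ-≤-pos a b ∣ s ∣ˢ {{positive (+<+ (pos s))}}
    where
    pos : ∀ s → 0 ℕ.< size s
    pos [ n ] = ℕ.s≤s ℕ.z≤n
    pos (a ⊗ b) = ℕₚ.*-mono-< (pos a) (pos b)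

  sq-≥0 : ∀ i → 0ℤ ≤ i * i
  sq-≥0 (+ n) = subst (0ℤ ≤_) (ℤₚ.pos-* n n) (+≤+ ℕ.z≤n)
  sq-≥0 -[1+ n ] = +≤+ ℕ.z≤n

  size-≥0 : ∀ s → 0ℤ ≤ ∣ s ∣ˢ
  size-≥0 s = +≤+ ℕ.z≤n

  *-≥0 : ∀ {a b} → 0ℤ ≤ a → 0ℤ ≤ b → 0ℤ ≤ a * b
  *-≥0 {a} {b} p q = subst (_≤ a * b) (ℤₚ.*-zeroʳ a) (*-monoˡ p q)

  ∫-≥0 : ∀ s {f : El s → ℤ} → (∀ x → 0ℤ ≤ f x) → 0ℤ ≤ ∫ s f
  ∫-≥0 s e = subst (_≤ ∫ s _) (∫-zero s) (∫-mono s e)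

  ∫-lin : ∀ s (a b : ℤ) (f g : El s → ℤ) → ∫ s (λ x → a * f x + b * g x) ≡ a * ∫ s f + b * ∫ s g
  ∫-lin s a b f g = trans (∫-+ s _ _) (cong₂ _+_ (∫-* s a f) (∫-* s b g))

  -- The deviation of f from its average, scaled by the number of points.
  dev : ∀ s → (El s → ℤ) → El s → ℤ
  dev s f x = ∣ s ∣ˢ * f x + (- ∫ s f)

  ∫-dev : ∀ s f → ∫ s (dev s f) ≡ 0ℤ
  ∫-dev s f = begin
    ∫ s (dev s f)                           ≡⟨ ∫-+ s _ _ ⟩
    ∫ s (λ x → ∣ s ∣ˢ * f x) + ∫ s (λ _ → - ∫ s f) ≡⟨ cong₂ _+_ (∫-* s ∣ s ∣ˢ f) (∫-const s _) ⟩
    ∣ s ∣ˢ * ∫ s f + ∣ s ∣ˢ * (- ∫ s f)        ≡⟨ lem ∣ s ∣ˢ (∫ s f) ⟩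
    0ℤ ∎
    where
    open ≡-Reasoning
    lem : ∀ a b → a * b + a * (- b) ≡ 0ℤ
    lem = solve-∀

  -- Splitting a function into a constant and an orthogonal mean-zero part underlies every spectral
  -- estimate below; the factors of the size stand in for the divisions of the usual variance
  -- identity.
  pythagoras : ∀ s f → ∣ s ∣ˢ * (∫ s f * ∫ s f) + ∫ s (λ x → dev s f x * dev s f x) ≡ ∣ s ∣ˢ * (∣ s ∣ˢ * ∫ s (λ x → f x * f x))
  pythagoras s f = begin
    n * (p * p) + ∫ s (λ x → dev s f x * dev s f x) ≡⟨ cong (λ z → n * (p * p) + z) (∫-cong s (λ x → e₁ n (f x) p)) ⟩
    n * (p * p) + ∫ s (λ x → (n * n) * (f x * f x) + ((- (n * p + n * p)) * f x + p * p))
      ≡⟨ cong (λ z → n * (p * p) + z) (trans (∫-+ s _ _) (cong₂ _+_ (∫-* s (n * n) (λ x → f x * f x)) (trans (∫-+ s (λ x → (- (n * p + n * p)) * f x) (λ _ → p * p)) (cong₂ _+_ (∫-* s (- (n * p + n * p)) f) (∫-const s (p * p)))))) ⟩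
    n * (p * p) + ((n * n) * q + ((- (n * p + n * p)) * p + n * (p * p))) ≡⟨ e₂ n p q ⟩
    n * (n * q) ∎
    where
    open ≡-Reasoning
    n = ∣ s ∣ˢ
    p = ∫ s f
    q = ∫ s (λ x → f x * f x)
    e₁ : ∀ n y p → (n * y + (- p)) * (n * y + (- p)) ≡ (n * n) * (y * y) + ((- (n * p + n * p)) * y + p * p)
    e₁ = solve-∀
    e₂ : ∀ n p q → n * (p * p) + ((n * n) * q + ((- (n * p + n * p)) * p + n * (p * p))) ≡ n * (n * q)
    e₂ = solve-∀

  a≤a+b : ∀ {a b} → 0ℤ ≤ b → a ≤ a + b
  a≤a+b {a} {b} p = subst (_≤ a + b) (ℤₚ.+-identityʳ a) (ℤₚ.+-monoʳ-≤ a p)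

  b≤a+b : ∀ {a b} → 0ℤ ≤ a → b ≤ a + b
  b≤a+b {a} {b} p = subst (_≤ a + b) (ℤₚ.+-identityˡ b) (ℤₚ.+-monoˡ-≤ b p)

  cauchy-schwarz : ∀ s f → ∫ s f * ∫ s f ≤ ∣ s ∣ˢ * ∫ s (λ x → f x * f x)
  cauchy-schwarz s f = *-cancel s (subst (∣ s ∣ˢ * (∫ s f * ∫ s f) ≤_) (pythagoras s f) (a≤a+b (∫-≥0 s (λ x → sq-≥0 (dev s f x)))))

-- Regular multigraphs, their expansion, and the composition, zig-zag and tensor products.

module Expander where

  open import Data.Nat as ℕ using (ℕ)
  import Data.Nat.Properties
  open import Data.Integer using (ℤ; +_; -_; _+_; _*_; _-_; _≤_; 0ℤ; +≤+)
  import Data.Integer.Properties as ℤₚ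
  open import Data.Integer.Tactic.RingSolver using (solve-∀)
  open Integral

  -- An |L|-regular multigraph: the l-th edge at v is the l′-th edge at v′, where
  -- rot (v , l) = (v′ , l′).  Invariance of sums under rot replaces bijectivity.
  record Graph (V L : Space) : Set where
    no-eta-equality
    field
      rot   : El (V ⊗ L) → El (V ⊗ L)
      rot-∫ : ∀ F → ∫ (V ⊗ L) (λ x → F (rot x)) ≡ ∫ (V ⊗ L) F
      rot-In : ∀ x → In (V ⊗ L) x → In (V ⊗ L) (rot x)
  open Graph public

  energy : ∀ s → (El s → ℤ) → ℤ
  energy s f = ∫ s (λ x → f x * f x)

  energy-≥0 : ∀ s f → 0ℤ ≤ energy s f
  energy-≥0 s f = ∫-≥0 s (λ x → sq-≥0 (f x))

  energy-* : ∀ s c f → energy s (λ x → c * f x) ≡ (c * c) * energy s f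
  energy-* s c f = trans (∫-cong s (λ x → lem c (f x))) (∫-* s (c * c) (λ x → f x * f x))
    where
    lem : ∀ c y → (c * y) * (c * y) ≡ (c * c) * (y * y)
    lem = solve-∀

  -- The adjacency operator without division by the degree; its norm is the degree, which is why
  -- squared degrees appear in all the bounds.
  adj : ∀ {V L} → Graph V L → (El V → ℤ) → El V → ℤ
  adj {V} {L} G f v = ∫ L (λ l → f (proj₁ (rot G (v , l))))

  -- Squared normalised second singular value at most 1/κ.
  record Expands {V L} (G : Graph V L) (κ : ℤ) : Set where
    constructor mkExpands
    field
      bound : ∀ f → ∫ V f ≡ 0ℤ → κ * energy V (adj G f) ≤ (∣ L ∣ˢ * ∣ L ∣ˢ) * energy V f
  open Expands public

  module _ {V L : Space} (G : Graph V L) where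

    private
      n = ∣ L ∣ˢ

    ∫-adj : ∀ f → ∫ V (adj G f) ≡ n * ∫ V f
    ∫-adj f = begin
      ∫ V (adj G f)               ≡⟨ rot-∫ G (λ x → f (proj₁ x)) ⟩
      ∫ V (λ v → ∫ L (λ _ → f v)) ≡⟨ ∫-cong V (λ v → ∫-const L (f v)) ⟩
      ∫ V (λ v → n * f v)         ≡⟨ ∫-* V n f ⟩
      n * ∫ V f                   ∎
      where open ≡-Reasoning

    -- Cauchy-Schwarz over the edges at each vertex; afterwards `rot` visits every edge end once, so
    -- the total is the energy of f times the degree again.
    adj-energy : ∀ f → energy V (adj G f) ≤ (n * n) * energy V f
    adj-energy f = begin
      energy V (adj G f)
        ≤⟨ ∫-mono V (λ v → cauchy-schwarz L (λ l → f (proj₁ (rot G (v , l))))) ⟩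
      ∫ V (λ v → n * ∫ L (λ l → f (proj₁ (rot G (v , l))) * f (proj₁ (rot G (v , l)))))
        ≡⟨ ∫-* V n (λ v → ∫ L (λ l → f (proj₁ (rot G (v , l))) * f (proj₁ (rot G (v , l))))) ⟩
      n * ∫ V (λ v → ∫ L (λ l → f (proj₁ (rot G (v , l))) * f (proj₁ (rot G (v , l)))))
        ≡⟨ cong (n *_) (rot-∫ G (λ x → f (proj₁ x) * f (proj₁ x))) ⟩
      n * ∫ V (λ v → ∫ L (λ _ → f v * f v))
        ≡⟨ cong (n *_) (trans (∫-cong V (λ v → ∫-const L (f v * f v))) (∫-* V n (λ v → f v * f v))) ⟩
      n * (n * energy V f) ≡⟨ sym (ℤₚ.*-assoc n n (energy V f)) ⟩
      (n * n) * energy V f ∎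
      where open ℤₚ.≤-Reasoning

    adj-lin : ∀ c f d v → adj G (λ v → c * f v + d) v ≡ c * adj G f v + n * d
    adj-lin c f d v = trans (∫-+ L (λ l → c * f (proj₁ (rot G (v , l)))) (λ _ → d))
      (cong₂ _+_ (∫-* L c (λ l → f (proj₁ (rot G (v , l))))) (∫-const L d))

  -- Paths made of one edge from each graph. Since `rot` need not be an involution, the returned
  -- labels stay in forward order.
  compose : ∀ {V L M} → Graph V L → Graph V M → Graph V (L ⊗ M)
  compose {V} {L} {M} G H .rot (v , l , m) =
    let x = rot G (v , l)
        y = rot H (proj₁ x , m)
    in proj₁ y , proj₂ x , proj₂ y
  compose {V} {L} {M} G H .rot-In (v , l , m) (pv , pl , pm) =
    let x = rot-In G (v , l) (pv , pl)
        y = rot-In H (proj₁ (rot G (v , l)) , m) (proj₁ x , pm)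
    in proj₁ y , proj₂ x , proj₂ y
  compose {V} {L} {M} G H .rot-∫ F = begin
    ∫ V (λ v → ∫ L (λ l → Φ (rot G (v , l)))) ≡⟨ rot-∫ G Φ ⟩
    ∫ V (λ v → ∫ L (λ l → Φ (v , l)))         ≡⟨ ∫-swap V L _ ⟩
    ∫ L (λ l → ∫ V (λ v → Φ (v , l)))
      ≡⟨ ∫-cong L (λ l → rot-∫ H (λ y → F (proj₁ y , l , proj₂ y))) ⟩
    ∫ L (λ l → ∫ V (λ v → ∫ M (λ m → F (v , l , m)))) ≡⟨ ∫-swap L V _ ⟩
    ∫ V (λ v → ∫ L (λ l → ∫ M (λ m → F (v , l , m)))) ∎
    where
    open ≡-Reasoning
    Φ : El (V ⊗ L) → ℤ
    Φ (v , l) = ∫ M (λ m → F (proj₁ (rot H (v , m)) , l , proj₂ (rot H (v , m))))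

  -- `adj H` keeps mean-zero functions mean-zero, so the bound for G still applies to its result and
  -- the two gains multiply.
  compose-expands : ∀ {V L M} (G : Graph V L) (H : Graph V M) {κ μ} → 0ℤ ≤ μ →
                    Expands G κ → Expands H μ → Expands (compose G H) (κ * μ)
  compose-expands {V} {L} {M} G H {κ} {μ} μ≥0 eG eH .bound f f≡0 = begin
    (κ * μ) * energy V (adj G (adj H f)) ≡⟨ e₁ κ μ (energy V (adj G (adj H f))) ⟩
    μ * (κ * energy V (adj G (adj H f))) ≤⟨ *-monoˡ μ≥0 (bound eG (adj H f) (trans (∫-adj H f) (trans (cong (∣ M ∣ˢ *_) f≡0) (ℤₚ.*-zeroʳ ∣ M ∣ˢ)))) ⟩
    μ * ((l * l) * energy V (adj H f))   ≡⟨ e₂ μ (l * l) (energy V (adj H f)) ⟩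
    (l * l) * (μ * energy V (adj H f))   ≤⟨ *-monoˡ (sq-≥0 l) (bound eH f f≡0) ⟩
    (l * l) * ((m * m) * energy V f)     ≡⟨ e₃ l m (energy V f) ⟩
    ((l * m) * (l * m)) * energy V f     ≡⟨ cong (λ z → (z * z) * energy V f) (sym (ℤₚ.pos-* (size L) (size M))) ⟩
    (∣ L ⊗ M ∣ˢ * ∣ L ⊗ M ∣ˢ) * energy V f ∎
    where
    open ℤₚ.≤-Reasoning
    l = ∣ L ∣ˢ
    m = ∣ M ∣ˢ
    e₁ : ∀ a b c → (a * b) * c ≡ b * (a * c)
    e₁ = solve-∀
    e₂ : ∀ a b c → a * (b * c) ≡ b * (a * c)
    e₂ = solve-∀
    e₃ : ∀ l m e → (l * l) * ((m * m) * e) ≡ ((l * m) * (l * m)) * e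
    e₃ = solve-∀

  module _ {V L J : Space} (G : Graph V L) (H : Graph L J) where

    private
      Ω = V ⊗ L
      n = ∣ L ∣ˢ
      j = ∣ J ∣ˢ

      inside : (El Ω → ℤ) → El Ω → ℤ
      inside x p = adj H (λ a → x (proj₁ p , a)) (proj₂ p)

      across : (El Ω → ℤ) → El Ω → ℤ
      across x p = x (rot G p)

      lift : (El V → ℤ) → El Ω → ℤ
      lift φ p = φ (proj₁ p)

      cloud : (El Ω → ℤ) → El V → ℤ
      cloud x v = ∫ L (λ a → x (v , a))

      defect : (El Ω → ℤ) → El Ω → ℤ
      defect x p = dev L (λ a → x (proj₁ p , a)) (proj₂ p)

      pythagoras′ : ∀ x → n * energy V (cloud x) + energy Ω (defect x) ≡ n * (n * energy Ω x)
      pythagoras′ x = begin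
        n * energy V (cloud x) + energy Ω (defect x)
          ≡⟨ cong (_+ energy Ω (defect x)) (sym (∫-* V n (λ v → cloud x v * cloud x v))) ⟩
        ∫ V (λ v → n * (cloud x v * cloud x v)) + energy Ω (defect x)
          ≡⟨ sym (∫-+ V _ _) ⟩
        ∫ V (λ v → n * (cloud x v * cloud x v) + ∫ L (λ a → defect x (v , a) * defect x (v , a)))
          ≡⟨ ∫-cong V (λ v → pythagoras L (λ a → x (v , a))) ⟩
        ∫ V (λ v → n * (n * ∫ L (λ a → x (v , a) * x (v , a))))
          ≡⟨ ∫-* V n (λ v → n * ∫ L (λ a → x (v , a) * x (v , a))) ⟩
        n * ∫ V (λ v → n * ∫ L (λ a → x (v , a) * x (v , a)))
          ≡⟨ cong (n *_) (∫-* V n (λ v → ∫ L (λ a → x (v , a) * x (v , a)))) ⟩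
        n * (n * energy Ω x) ∎
        where open ≡-Reasoning

      inside-energy : ∀ x → energy Ω (inside x) ≤ (j * j) * energy Ω x
      inside-energy x = begin
        energy Ω (inside x) ≤⟨ ∫-mono V (λ v → adj-energy H (λ a → x (v , a))) ⟩
        ∫ V (λ v → (j * j) * energy L (λ a → x (v , a))) ≡⟨ ∫-* V (j * j) (λ v → energy L (λ a → x (v , a))) ⟩
        (j * j) * energy Ω x ∎
        where open ℤₚ.≤-Reasoning

      across-energy : ∀ x → energy Ω (across x) ≡ energy Ω x
      across-energy x = rot-∫ G (λ p → x p * x p)

      lift-energy : ∀ φ → energy Ω (lift φ) ≡ n * energy V φ
      lift-energy φ = trans (∫-cong V (λ v → ∫-const L (φ v * φ v))) (∫-* V n (λ v → φ v * φ v))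

      inside-defect-energy : ∀ κ → Expands H κ → ∀ x → κ * energy Ω (inside (defect x)) ≤ (j * j) * energy Ω (defect x)
      inside-defect-energy κ eH x = begin
        κ * energy Ω (inside (defect x)) ≡⟨ sym (∫-* V κ (λ v → energy L (adj H (λ a → defect x (v , a))))) ⟩
        ∫ V (λ v → κ * energy L (adj H (λ a → defect x (v , a))))
          ≤⟨ ∫-mono V (λ v → bound eH (λ a → defect x (v , a)) (∫-dev L (λ a → x (v , a)))) ⟩
        ∫ V (λ v → (j * j) * energy L (λ a → defect x (v , a))) ≡⟨ ∫-* V (j * j) (λ v → energy L (λ a → defect x (v , a))) ⟩
        (j * j) * energy Ω (defect x) ∎
        where open ℤₚ.≤-Reasoning

      inside-defect : ∀ x p → inside (defect x) p ≡ n * inside x p + j * (- cloud x (proj₁ p))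
      inside-defect x p = adj-lin H n (λ a → x (proj₁ p , a)) (- cloud x (proj₁ p)) (proj₂ p)

      inside-defect′ : ∀ x p → inside (defect x) p ≡ defect (inside x) p
      inside-defect′ x p = trans (inside-defect x p) (cong (λ z → n * inside x p + z) (trans (lem j (cloud x (proj₁ p)))
        (cong -_ (sym (∫-adj H (λ a → x (proj₁ p , a)))))))
        where
        lem : ∀ a b → a * (- b) ≡ - (a * b)
        lem = solve-∀

    -- An H-step inside the cloud of a vertex, the edge of G named by the position reached, and an
    -- H-step inside the new cloud.
    zigzag : Graph (V ⊗ L) (J ⊗ J)
    zigzag .rot ((v , a) , (i , k)) =
      let x = rot H (a , i)
          y = rot G (v , proj₁ x)
          z = rot H (proj₂ y , k)
      in (proj₁ y , proj₁ z) , (proj₂ x , proj₂ z)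
    zigzag .rot-In ((v , a) , (i , k)) ((pv , pa) , (pi , pk)) =
      let x = rot-In H (a , i) (pa , pi)
          y = rot-In G (v , proj₁ (rot H (a , i))) (pv , proj₁ x)
          z = rot-In H (proj₂ (rot G (v , proj₁ (rot H (a , i)))) , k) (proj₂ y , pk)
      in (proj₁ y , proj₁ z) , (proj₂ x , proj₂ z)
    zigzag .rot-∫ F = begin
      ∫ V (λ v → ∫ L (λ a → ∫ J (λ i → X (rot G (v , proj₁ (rot H (a , i)))) (proj₂ (rot H (a , i))))))
        ≡⟨ ∫-cong V (λ v → rot-∫ H (λ x → X (rot G (v , proj₁ x)) (proj₂ x))) ⟩
      ∫ Ω (λ p → ∫ J (λ i → X (rot G p) i)) ≡⟨ ∫-swap Ω J (λ p i → X (rot G p) i) ⟩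
      ∫ J (λ i → ∫ Ω (λ p → X (rot G p) i)) ≡⟨ ∫-cong J (λ i → rot-∫ G (λ p → X p i)) ⟩
      ∫ J (λ i → ∫ V (λ v → ∫ L (λ a → X (v , a) i)))
        ≡⟨ ∫-cong J (λ i → ∫-cong V (λ v → rot-∫ H (λ z → F ((v , proj₁ z) , (i , proj₂ z))))) ⟩
      ∫ J (λ i → ∫ Ω (λ p → ∫ J (λ k → F (p , (i , k))))) ≡⟨ ∫-swap J Ω (λ i p → ∫ J (λ k → F (p , (i , k)))) ⟩
      ∫ Ω (λ p → ∫ J (λ i → ∫ J (λ k → F (p , (i , k))))) ∎
      where
      open ≡-Reasoning
      X : El Ω → El J → ℤ
      X y i = ∫ J (λ k → F ((proj₁ y , proj₁ (rot H (proj₂ y , k))) , (i , proj₂ (rot H (proj₂ y , k)))))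

    private
      module Bound (κ : ℤ) (κ≥0 : 0ℤ ≤ κ) (eG : Expands G κ) (eH : Expands H κ)
                   (f : El Ω → ℤ) (f≡0 : ∫ Ω f ≡ 0ℤ) where
        open ℤₚ.≤-Reasoning

        φ = cloud f
        r = defect f
        u = across (lift φ)
        s = defect u
        Z = inside (across (inside f))

        -- Only the first H-step gains: `r` has mean zero on every cloud. The edge of G preserves
        -- the energy, and the last H-step costs at most the trivial factor.
        step₁ : κ * energy Ω (inside (across (inside r))) ≤ ((j * j) * (j * j)) * energy Ω r
        step₁ = begin
          κ * energy Ω (inside (across (inside r))) ≤⟨ *-monoˡ κ≥0 (inside-energy (across (inside r))) ⟩
          κ * ((j * j) * energy Ω (across (inside r))) ≡⟨ cong (λ z → κ * ((j * j) * z)) (across-energy (inside r)) ⟩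
          κ * ((j * j) * energy Ω (inside r)) ≡⟨ e₁ κ (j * j) (energy Ω (inside r)) ⟩
          (j * j) * (κ * energy Ω (inside r)) ≤⟨ *-monoˡ (sq-≥0 j) (inside-defect-energy κ eH f) ⟩
          (j * j) * ((j * j) * energy Ω r) ≡⟨ sym (ℤₚ.*-assoc (j * j) (j * j) (energy Ω r)) ⟩
          ((j * j) * (j * j)) * energy Ω r ∎
          where
          e₁ : ∀ a b c → a * (b * c) ≡ b * (a * c)
          e₁ = solve-∀

        -- By unfolding, `cloud u` is `adj G φ`, and φ has mean zero because f does. This is where
        -- the expansion of G enters.
        ψ-energy : κ * energy V (cloud u) ≤ (n * n) * energy V φ
        ψ-energy = bound eG φ f≡0

        s-energy : energy Ω s ≤ n * (n * (n * energy V φ))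
        s-energy = begin
          energy Ω s ≤⟨ b≤a+b (*-≥0 (size-≥0 L) (energy-≥0 V (cloud u))) ⟩
          n * energy V (cloud u) + energy Ω s ≡⟨ pythagoras′ u ⟩
          n * (n * energy Ω u) ≡⟨ cong (λ z → n * (n * z)) (trans (across-energy (lift φ)) (lift-energy φ)) ⟩
          n * (n * (n * energy V φ)) ∎

        -- `u` is split once more. On cloud sums G has gained κ already; on defects the last H-step
        -- does, because `inside` commutes with taking defects. The two contributions add up to the
        -- factor 2.
        step₂ : κ * energy Ω (inside u) ≤ (+ 2 * (j * j)) * (n * energy V φ)
        step₂ = *-cancel L (*-cancel L (begin
          n * (n * (κ * energy Ω (inside u))) ≡⟨ e₁ n κ (energy Ω (inside u)) ⟩
          κ * (n * (n * energy Ω (inside u))) ≡⟨ cong (κ *_) (sym (pythagoras′ (inside u))) ⟩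
          κ * (n * energy V (cloud (inside u)) + energy Ω (defect (inside u)))
            ≡⟨ cong₂ (λ a b → κ * (n * a + b)) (trans (∫-cong V (λ v → cong₂ _*_ (∫-adj H (λ a → u (v , a))) (∫-adj H (λ a → u (v , a))))) (energy-* V j (cloud u)))
                 (sym (∫-cong Ω (λ p → cong₂ _*_ (inside-defect′ u p) (inside-defect′ u p)))) ⟩
          κ * (n * ((j * j) * energy V (cloud u)) + energy Ω (inside s))
            ≡⟨ e₂ κ n (j * j) (energy V (cloud u)) (energy Ω (inside s)) ⟩
          (n * (j * j)) * (κ * energy V (cloud u)) + κ * energy Ω (inside s)
            ≤⟨ ℤₚ.+-mono-≤ (*-monoˡ (*-≥0 (size-≥0 L) (sq-≥0 j)) ψ-energy)
                 (ℤₚ.≤-trans (inside-defect-energy κ eH u) (*-monoˡ (sq-≥0 j) s-energy)) ⟩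
          (n * (j * j)) * ((n * n) * energy V φ) + (j * j) * (n * (n * (n * energy V φ)))
            ≡⟨ e₃ n (j * j) (energy V φ) ⟩
          n * (n * ((+ 2 * (j * j)) * (n * energy V φ))) ∎))
          where
          e₁ : ∀ n k x → n * (n * (k * x)) ≡ k * (n * (n * x))
          e₁ = solve-∀
          e₂ : ∀ k n q a b → k * (n * (q * a) + b) ≡ (n * q) * (k * a) + k * b
          e₂ = solve-∀
          e₃ : ∀ n q e → (n * q) * ((n * n) * e) + q * (n * (n * (n * e))) ≡ n * (n * ((+ 2 * q) * (n * e)))
          e₃ = solve-∀

        -- n f is its defect plus the lift of its cloud sums, and a function constant on clouds
        -- passes the first H-step with the plain factor j.
        split : ∀ p → n * Z p ≡ inside (across (inside r)) p + j * inside u p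
        split p = begin-equality
          n * Z p ≡⟨ sym (∫-* J n (λ i → inside f (q i))) ⟩
          ∫ J (λ i → n * inside f (q i)) ≡⟨ ∫-cong J (λ i → trans (e (n * inside f (q i)) j (φ (proj₁ (q i)))) (cong (_+ j * φ (proj₁ (q i))) (sym (inside-defect f (q i))))) ⟩
          ∫ J (λ i → inside r (q i) + j * φ (proj₁ (q i))) ≡⟨ ∫-+ J _ _ ⟩
          inside (across (inside r)) p + ∫ J (λ i → j * φ (proj₁ (q i))) ≡⟨ cong (λ z → inside (across (inside r)) p + z) (∫-* J j (λ i → φ (proj₁ (q i)))) ⟩
          inside (across (inside r)) p + j * inside u p ∎
          where
          q : El J → El Ω
          q i = rot G (proj₁ p , proj₁ (rot H (proj₂ p , i)))
          e : ∀ x j y → x ≡ (x + j * (- y)) + j * y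
          e = solve-∀

        parallelogram : ∀ a b → (a + b) * (a + b) ≤ + 2 * (a * a) + + 2 * (b * b)
        parallelogram a b = subst ((a + b) * (a + b) ≤_) (e a b) (a≤a+b (sq-≥0 (a - b)))
          where
          e : ∀ a b → (a + b) * (a + b) + (a - b) * (a - b) ≡ + 2 * (a * a) + + 2 * (b * b)
          e = solve-∀

        -- The parallelogram inequality costs one factor 2 and `step₂` another, hence the 4.
        -- Doubling the first term as well lets `pythagoras′` recombine the two parts.
        main : κ * energy Ω Z ≤ + 4 * (((j * j) * (j * j)) * energy Ω f)
        main = *-cancel L (*-cancel L (begin
          n * (n * (κ * energy Ω Z)) ≡⟨ e₁ n κ (energy Ω Z) ⟩
          κ * ((n * n) * energy Ω Z) ≡⟨ cong (κ *_) (sym (energy-* Ω n Z)) ⟩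
          κ * energy Ω (λ p → n * Z p)
            ≡⟨ cong (κ *_) (∫-cong Ω (λ p → cong₂ _*_ (split p) (split p))) ⟩
          κ * ∫ Ω (λ p → (W p + j * inside u p) * (W p + j * inside u p))
            ≤⟨ *-monoˡ κ≥0 (∫-mono Ω (λ p → parallelogram (W p) (j * inside u p))) ⟩
          κ * ∫ Ω (λ p → + 2 * (W p * W p) + + 2 * ((j * inside u p) * (j * inside u p)))
            ≡⟨ cong (κ *_) (trans (∫-lin Ω (+ 2) (+ 2) (λ p → W p * W p) (λ p → (j * inside u p) * (j * inside u p)))
                 (cong (λ z → + 2 * energy Ω W + + 2 * z) (energy-* Ω j (inside u)))) ⟩
          κ * (+ 2 * energy Ω W + + 2 * ((j * j) * energy Ω (inside u)))
            ≡⟨ e₂ κ (energy Ω W) (j * j) (energy Ω (inside u)) ⟩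
          + 2 * (κ * energy Ω W) + (+ 2 * (j * j)) * (κ * energy Ω (inside u))
            ≤⟨ ℤₚ.+-mono-≤ (*-monoˡ {+ 2} (+≤+ ℕ.z≤n) step₁) (*-monoˡ (*-≥0 {+ 2} (+≤+ ℕ.z≤n) (sq-≥0 j)) step₂) ⟩
          + 2 * (((j * j) * (j * j)) * energy Ω r) + (+ 2 * (j * j)) * ((+ 2 * (j * j)) * (n * energy V φ))
            ≤⟨ a≤a+b (*-≥0 {+ 2} (+≤+ ℕ.z≤n) (*-≥0 (*-≥0 (sq-≥0 j) (sq-≥0 j)) (energy-≥0 Ω r))) ⟩
          (+ 2 * (((j * j) * (j * j)) * energy Ω r) + (+ 2 * (j * j)) * ((+ 2 * (j * j)) * (n * energy V φ))) + + 2 * (((j * j) * (j * j)) * energy Ω r)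
            ≡⟨ e₃ (j * j) (energy Ω r) (n * energy V φ) ⟩
          + 4 * (((j * j) * (j * j)) * (n * energy V φ + energy Ω r))
            ≡⟨ cong (λ z → + 4 * (((j * j) * (j * j)) * z)) (pythagoras′ f) ⟩
          + 4 * (((j * j) * (j * j)) * (n * (n * energy Ω f))) ≡⟨ e₄ ((j * j) * (j * j)) n (energy Ω f) ⟩
          n * (n * (+ 4 * (((j * j) * (j * j)) * energy Ω f))) ∎))
          where
          W = inside (across (inside r))
          e₁ : ∀ n k x → n * (n * (k * x)) ≡ k * ((n * n) * x)
          e₁ = solve-∀
          e₂ : ∀ k a q b → k * (+ 2 * a + + 2 * (q * b)) ≡ + 2 * (k * a) + (+ 2 * q) * (k * b)
          e₂ = solve-∀
          e₃ : ∀ q r p → (+ 2 * ((q * q) * r) + (+ 2 * q) * ((+ 2 * q) * p)) + + 2 * ((q * q) * r) ≡ + 4 * ((q * q) * (p + r))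
          e₃ = solve-∀
          e₄ : ∀ q n e → + 4 * (q * (n * (n * e))) ≡ n * (n * (+ 4 * (q * e)))
          e₄ = solve-∀

    zigzag-expands : ∀ {κ} → 0ℤ ≤ κ → Expands G (+ 4 * κ) → Expands H (+ 4 * κ) → Expands zigzag κ
    zigzag-expands {κ} κ≥0 eG eH .bound f f≡0 = ℤₚ.*-cancelˡ-≤-pos (κ * energy Ω (adj zigzag f)) ((∣ J ⊗ J ∣ˢ * ∣ J ⊗ J ∣ˢ) * energy Ω f) (+ 4) (begin
      + 4 * (κ * energy Ω (adj zigzag f)) ≡⟨ sym (ℤₚ.*-assoc (+ 4) κ (energy Ω (adj zigzag f))) ⟩
      (+ 4 * κ) * energy Ω (adj zigzag f) ≤⟨ Bound.main (+ 4 * κ) (*-≥0 {+ 4} (+≤+ ℕ.z≤n) κ≥0) eG eH f f≡0 ⟩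
      + 4 * (((j * j) * (j * j)) * energy Ω f) ≡⟨ cong (λ z → + 4 * ((z * z) * energy Ω f)) (sym (ℤₚ.pos-* (size J) (size J))) ⟩
      + 4 * ((∣ J ⊗ J ∣ˢ * ∣ J ⊗ J ∣ˢ) * energy Ω f) ∎)
      where open ℤₚ.≤-Reasoning

  module _ {V W L M : Space} (G : Graph V L) (H : Graph W M) where

    private
      n = ∣ W ∣ˢ
      l = ∣ L ∣ˢ
      m = ∣ M ∣ˢ

    tensor : Graph (V ⊗ W) (L ⊗ M)
    tensor .rot ((v , w) , (i , k)) =
      let x = rot G (v , i)
          y = rot H (w , k)
      in (proj₁ x , proj₁ y) , (proj₂ x , proj₂ y)
    tensor .rot-In ((v , w) , (i , k)) ((pv , pw) , (pi , pk)) =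
      let x = rot-In G (v , i) (pv , pi)
          y = rot-In H (w , k) (pw , pk)
      in (proj₁ x , proj₁ y) , (proj₂ x , proj₂ y)
    tensor .rot-∫ F = begin
      ∫ V (λ v → ∫ W (λ w → ∫ L (λ i → X (rot G (v , i)) w))) ≡⟨ ∫-cong V (λ v → ∫-swap W L (λ w i → X (rot G (v , i)) w)) ⟩
      ∫ V (λ v → ∫ L (λ i → ∫ W (X (rot G (v , i)))))
        ≡⟨ rot-∫ G (λ x → ∫ W (X x)) ⟩
      ∫ V (λ v → ∫ L (λ i → ∫ W (λ w → ∫ M (λ k → F ((v , proj₁ (rot H (w , k))) , (i , proj₂ (rot H (w , k))))))))
        ≡⟨ ∫-cong V (λ v → ∫-cong L (λ i → rot-∫ H (λ y → F ((v , proj₁ y) , (i , proj₂ y))))) ⟩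
      ∫ V (λ v → ∫ L (λ i → ∫ W (λ w → ∫ M (λ k → F ((v , w) , (i , k))))))
        ≡⟨ ∫-cong V (λ v → ∫-swap L W (λ i w → ∫ M (λ k → F ((v , w) , (i , k))))) ⟩
      ∫ V (λ v → ∫ W (λ w → ∫ L (λ i → ∫ M (λ k → F ((v , w) , (i , k)))))) ∎
      where
      open ≡-Reasoning
      X : El (V ⊗ L) → El W → ℤ
      X x w = ∫ M (λ k → F ((proj₁ x , proj₁ (rot H (w , k))) , (proj₂ x , proj₂ (rot H (w , k)))))

    -- Split along W. On the W-averages the product acts as a multiple of G, which gains κ; on the
    -- W-defects H gains κ while G costs only the trivial factor.
    tensor-expands : ∀ κ → 0ℤ ≤ κ → Expands G κ → Expands H κ → Expands tensor κ
    tensor-expands κ κ≥0 eG eH .bound f f≡0 = *-cancel W (*-cancel W (begin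
      n * (n * (κ * energy Ω Z)) ≡⟨ e₁ n κ (energy Ω Z) ⟩
      κ * (n * (n * energy Ω Z)) ≡⟨ cong (κ *_) (sym (pyth Z)) ⟩
      κ * (n * energy V (λ v → ∫ W (λ w → Z (v , w))) + energy Ω (defect Z))
        ≡⟨ cong₂ (λ a b → κ * (n * a + b))
            (trans (∫-cong V (λ v → cong₂ _*_ (ZV v) (ZV v))) (energy-* V m (adj G φ)))
            (∫-cong Ω (λ p → cong₂ _*_ (Zd p) (Zd p))) ⟩
      κ * (n * ((m * m) * energy V (adj G φ)) + energy Ω (λ p → adj G (λ v → y (v , proj₂ p)) (proj₁ p)))
        ≡⟨ e₂ κ n (m * m) (energy V (adj G φ)) (energy Ω (λ p → adj G (λ v → y (v , proj₂ p)) (proj₁ p))) ⟩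
      (n * (m * m)) * (κ * energy V (adj G φ)) + κ * energy Ω (λ p → adj G (λ v → y (v , proj₂ p)) (proj₁ p))
        ≤⟨ ℤₚ.+-mono-≤ (*-monoˡ (*-≥0 (size-≥0 W) (sq-≥0 m)) (bound eG φ f≡0)) (ℤₚ.≤-trans (*-monoˡ κ≥0 adj-y) κy) ⟩
      (n * (m * m)) * ((l * l) * energy V φ) + (l * l) * ((m * m) * energy Ω (defect f))
        ≡⟨ e₃ n (m * m) (l * l) (energy V φ) (energy Ω (defect f)) ⟩
      ((l * l) * (m * m)) * (n * energy V φ + energy Ω (defect f)) ≡⟨ cong (((l * l) * (m * m)) *_) (pyth f) ⟩
      ((l * l) * (m * m)) * (n * (n * energy Ω f)) ≡⟨ e₄ l m n (energy Ω f) ⟩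
      n * (n * (((l * m) * (l * m)) * energy Ω f)) ≡⟨ cong (λ z → n * (n * ((z * z) * energy Ω f))) (sym (ℤₚ.pos-* (size L) (size M))) ⟩
      n * (n * ((∣ L ⊗ M ∣ˢ * ∣ L ⊗ M ∣ˢ) * energy Ω f)) ∎))
      where
      open ℤₚ.≤-Reasoning
      Ω = V ⊗ W
      Z = adj tensor f
      defect : (El Ω → ℤ) → El Ω → ℤ
      defect x p = dev W (λ w → x (proj₁ p , w)) (proj₂ p)
      φ : El V → ℤ
      φ v = ∫ W (λ w → f (v , w))
      y : El Ω → ℤ
      y p = adj H (λ w → defect f (proj₁ p , w)) (proj₂ p)
      e₁ : ∀ n k x → n * (n * (k * x)) ≡ k * (n * (n * x))
      e₁ = solve-∀
      e₂ : ∀ k n q a b → k * (n * (q * a) + b) ≡ (n * q) * (k * a) + k * b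
      e₂ = solve-∀
      e₃ : ∀ n q s a b → (n * q) * (s * a) + s * (q * b) ≡ (s * q) * (n * a + b)
      e₃ = solve-∀
      e₄ : ∀ l m n e → ((l * l) * (m * m)) * (n * (n * e)) ≡ n * (n * (((l * m) * (l * m)) * e))
      e₄ = solve-∀
      pyth : ∀ x → n * energy V (λ v → ∫ W (λ w → x (v , w))) + energy Ω (defect x) ≡ n * (n * energy Ω x)
      pyth x = begin-equality
        n * energy V (λ v → ∫ W (λ w → x (v , w))) + energy Ω (defect x)
          ≡⟨ cong (_+ energy Ω (defect x)) (sym (∫-* V n (λ v → ∫ W (λ w → x (v , w)) * ∫ W (λ w → x (v , w))))) ⟩
        ∫ V (λ v → n * (∫ W (λ w → x (v , w)) * ∫ W (λ w → x (v , w)))) + energy Ω (defect x)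
          ≡⟨ sym (∫-+ V _ _) ⟩
        ∫ V (λ v → n * (∫ W (λ w → x (v , w)) * ∫ W (λ w → x (v , w))) + energy W (dev W (λ w → x (v , w))))
          ≡⟨ ∫-cong V (λ v → pythagoras W (λ w → x (v , w))) ⟩
        ∫ V (λ v → n * (n * energy W (λ w → x (v , w)))) ≡⟨ ∫-* V n (λ v → n * energy W (λ w → x (v , w))) ⟩
        n * ∫ V (λ v → n * energy W (λ w → x (v , w))) ≡⟨ cong (n *_) (∫-* V n (λ v → energy W (λ w → x (v , w)))) ⟩
        n * (n * energy Ω x) ∎
      ZV : ∀ v → ∫ W (λ w → Z (v , w)) ≡ m * adj G φ v
      ZV v = begin-equality
        ∫ W (λ w → Z (v , w)) ≡⟨ ∫-swap W L (λ w i → adj H (λ w′ → f (proj₁ (rot G (v , i)) , w′)) w) ⟩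
        ∫ L (λ i → ∫ W (adj H (λ w′ → f (proj₁ (rot G (v , i)) , w′))))
          ≡⟨ ∫-cong L (λ i → ∫-adj H (λ w′ → f (proj₁ (rot G (v , i)) , w′))) ⟩
        ∫ L (λ i → m * φ (proj₁ (rot G (v , i)))) ≡⟨ ∫-* L m (λ i → φ (proj₁ (rot G (v , i)))) ⟩
        m * adj G φ v ∎
      Zd : ∀ p → defect Z p ≡ adj G (λ v → y (v , proj₂ p)) (proj₁ p)
      Zd (v , w) = begin-equality
        n * Z (v , w) + (- ∫ W (λ w → Z (v , w))) ≡⟨ cong (λ z → n * Z (v , w) + (- z)) (ZV v) ⟩
        n * Z (v , w) + (- (m * adj G φ v)) ≡⟨ cong (λ z → n * Z (v , w) + z) (lem m (adj G φ v)) ⟩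
        n * Z (v , w) + (- m) * adj G φ v
          ≡⟨ sym (∫-lin L n (- m) (λ i → adj H (λ w′ → f (proj₁ (rot G (v , i)) , w′)) w) (λ i → φ (proj₁ (rot G (v , i))))) ⟩
        ∫ L (λ i → n * adj H (λ w′ → f (proj₁ (rot G (v , i)) , w′)) w + (- m) * φ (proj₁ (rot G (v , i))))
          ≡⟨ ∫-cong L (λ i → sym (trans (adj-lin H n (λ w′ → f (proj₁ (rot G (v , i)) , w′)) (- φ (proj₁ (rot G (v , i)))) w)
               (cong (λ z → n * adj H (λ w′ → f (proj₁ (rot G (v , i)) , w′)) w + z) (lem′ m (φ (proj₁ (rot G (v , i)))))))) ⟩
        adj G (λ v → y (v , w)) v ∎
        where
        lem : ∀ a b → - (a * b) ≡ (- a) * b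
        lem = solve-∀
        lem′ : ∀ a b → a * (- b) ≡ (- a) * b
        lem′ = solve-∀
      adj-y : energy Ω (λ p → adj G (λ v → y (v , proj₂ p)) (proj₁ p)) ≤ (l * l) * energy Ω y
      adj-y = begin
        energy Ω (λ p → adj G (λ v → y (v , proj₂ p)) (proj₁ p)) ≡⟨ ∫-swap V W _ ⟩
        ∫ W (λ w → energy V (adj G (λ v → y (v , w)))) ≤⟨ ∫-mono W (λ w → adj-energy G (λ v → y (v , w))) ⟩
        ∫ W (λ w → (l * l) * energy V (λ v → y (v , w))) ≡⟨ ∫-* W (l * l) (λ w → energy V (λ v → y (v , w))) ⟩
        (l * l) * ∫ W (λ w → energy V (λ v → y (v , w))) ≡⟨ cong ((l * l) *_) (∫-swap W V (λ w v → y (v , w) * y (v , w))) ⟩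
        (l * l) * energy Ω y ∎
      κy : κ * ((l * l) * energy Ω y) ≤ (l * l) * ((m * m) * energy Ω (defect f))
      κy = begin
        κ * ((l * l) * energy Ω y) ≡⟨ lem κ (l * l) (energy Ω y) ⟩
        (l * l) * (κ * energy Ω y) ≡⟨ cong ((l * l) *_) (sym (∫-* V κ (λ v → energy W (λ w → y (v , w))))) ⟩
        (l * l) * ∫ V (λ v → κ * energy W (adj H (dev W (λ w → f (v , w)))))
          ≤⟨ *-monoˡ (sq-≥0 l) (∫-mono V (λ v → bound eH (dev W (λ w → f (v , w))) (∫-dev W (λ w → f (v , w))))) ⟩
        (l * l) * ∫ V (λ v → (m * m) * energy W (dev W (λ w → f (v , w))))
          ≡⟨ cong ((l * l) *_) (∫-* V (m * m) (λ v → energy W (dev W (λ w → f (v , w))))) ⟩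
        (l * l) * ((m * m) * energy Ω (defect f)) ∎
        where
        lem : ∀ a b c → a * (b * c) ≡ b * (a * c)
        lem = solve-∀

-- Point-line incidence over a prime field as an expander.

module AffinePlane where

  open import Data.Nat as ℕ using (ℕ; zero; suc; NonZero)
  import Data.Nat.Properties as ℕₚ
  open import Data.Nat.DivMod using (_%_; [m+kn]%n≡m%n; [m+n]%n≡m%n; m<n⇒m%n≡m; m%n<n)
  open import Data.Nat.GCD using (module Bézout)
  open import Data.Nat.Coprimality using (prime⇒coprime; coprime-Bézout)
  open import Data.Nat.Primality using (Prime)
  import Data.Nat.Tactic.RingSolver as ℕ-Solver
  open import Data.Integer using (ℤ; +_; _+_; _*_; _≤_; 0ℤ; +≤+)
  import Data.Integer.Properties as ℤₚ
  open import Data.Integer.Tactic.RingSolver using (solve-∀)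
  open import Relation.Binary using (tri<; tri≈; tri>)
  open import Algebra.Properties.AbelianGroup ℤₚ.+-0-abelianGroup using (∙-cancelʳ)
  open Integral
  open Expander

  -- Serves to replace all off-diagonal terms of a row at once while leaving the diagonal one alone,
  -- without subtraction.
  ∑ᶻ-except : ∀ n c → c ℕ.< n → (h g : ℕ → ℤ) → (∀ x → x ℕ.< n → ¬ x ≡ c → h x ≡ g x) →
              ∑ᶻ n h + g c ≡ ∑ᶻ n g + h c
  ∑ᶻ-except (suc n) c c<n h g e with n ℕ.≟ c
  ... | yes refl = trans (cong (λ z → (z + h n) + g n) (∑ᶻ-cong< n (λ x x<n → e x (ℕₚ.m<n⇒m<1+n x<n) (λ { refl → ℕₚ.n≮n x x<n })))) (lem (∑ᶻ n g) (h n) (g n))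
    where
    lem : ∀ a b c → (a + b) + c ≡ (a + c) + b
    lem = solve-∀
  ... | no n≢c = begin
    (∑ᶻ n h + h n) + g c ≡⟨ lem (∑ᶻ n h) (h n) (g c) ⟩
    (∑ᶻ n h + g c) + h n ≡⟨ cong₂ _+_ (∑ᶻ-except n c (ℕₚ.≤∧≢⇒< (ℕ.s≤s⁻¹ c<n) (λ p → n≢c (sym p))) h g (λ x x<n → e x (ℕₚ.m<n⇒m<1+n x<n))) (e n ℕₚ.≤-refl n≢c) ⟩
    (∑ᶻ n g + h c) + g n ≡⟨ lem (∑ᶻ n g) (h c) (g n) ⟩
    (∑ᶻ n g + g n) + h c ∎
    where
    open ≡-Reasoning
    lem : ∀ a b c → (a + b) + c ≡ (a + c) + b
    lem = solve-∀

  ∑ᶻ-suc : ∀ n (P : ℕ → ℤ) → ∑ᶻ n (λ x → P (suc x)) + P 0 ≡ ∑ᶻ n P + P n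
  ∑ᶻ-suc zero P = refl
  ∑ᶻ-suc (suc n) P = begin
    (∑ᶻ n (λ x → P (suc x)) + P (suc n)) + P 0 ≡⟨ lem (∑ᶻ n (λ x → P (suc x))) (P (suc n)) (P 0) ⟩
    (∑ᶻ n (λ x → P (suc x)) + P 0) + P (suc n) ≡⟨ cong (_+ P (suc n)) (∑ᶻ-suc n P) ⟩
    (∑ᶻ n P + P n) + P (suc n) ∎
    where
    open ≡-Reasoning
    lem : ∀ a b c → (a + b) + c ≡ (a + c) + b
    lem = solve-∀

  module _ (q : ℕ) where

    Periodic : (ℕ → ℤ) → Set
    Periodic P = ∀ x → P (q ℕ.+ x) ≡ P x

    periodic-* : ∀ {P} → Periodic P → ∀ k x → P (k ℕ.* q ℕ.+ x) ≡ P x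
    periodic-* per zero x = refl
    periodic-* {P} per (suc k) x = trans (cong P (ℕₚ.+-assoc q (k ℕ.* q) x)) (trans (per _) (periodic-* per k x))

    shift₁ : ∀ P → Periodic P → ∑ᶻ q (λ x → P (suc x)) ≡ ∑ᶻ q P
    shift₁ P per = ∙-cancelʳ (P 0) _ _ (trans (∑ᶻ-suc q P) (cong (λ z → ∑ᶻ q P + z) (trans (cong P (sym (ℕₚ.+-identityʳ q))) (per 0))))

    shift : ∀ s P → Periodic P → ∑ᶻ q (λ x → P (s ℕ.+ x)) ≡ ∑ᶻ q P
    shift zero P per = refl
    shift (suc s) P per = trans (sym (∑ᶻ-cong< q (λ x _ → cong P (ℕₚ.+-suc s x))))
      (trans (shift₁ (λ x → P (s ℕ.+ x)) (λ x → trans (cong P (lem s q x)) (per (s ℕ.+ x)))) (shift s P per))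
      where
      lem : ∀ s q x → s ℕ.+ (q ℕ.+ x) ≡ q ℕ.+ (s ℕ.+ x)
      lem = ℕ-Solver.solve-∀

    -- The sum over the progression a ↦ a δ + x is invariant under x ↦ x + δ, hence
    -- under x ↦ x + 1 when δ is invertible.
    module _ {{_ : NonZero q}} (δ : ℕ) (bez : Bézout.Identity 1 q δ) (P : ℕ → ℤ) (per : Periodic P) where

      private
        T : ℕ → ℤ
        T x = ∑ᶻ q (λ a → P (a ℕ.* δ ℕ.+ x))

        T-δ : ∀ x → T (δ ℕ.+ x) ≡ T x
        T-δ x = trans (∑ᶻ-cong< q (λ a _ → cong P (lem a δ x))) (shift₁ (λ a → P (a ℕ.* δ ℕ.+ x))
          (λ a → trans (cong P (lem′ q a δ x)) (periodic-* per δ _)))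
          where
          lem : ∀ a δ x → a ℕ.* δ ℕ.+ (δ ℕ.+ x) ≡ suc a ℕ.* δ ℕ.+ x
          lem = ℕ-Solver.solve-∀
          lem′ : ∀ q a δ x → (q ℕ.+ a) ℕ.* δ ℕ.+ x ≡ δ ℕ.* q ℕ.+ (a ℕ.* δ ℕ.+ x)
          lem′ = ℕ-Solver.solve-∀

        T-*δ : ∀ k x → T (k ℕ.* δ ℕ.+ x) ≡ T x
        T-*δ zero x = refl
        T-*δ (suc k) x = trans (cong T (ℕₚ.+-assoc δ (k ℕ.* δ) x)) (trans (T-δ (k ℕ.* δ ℕ.+ x)) (T-*δ k x))

        T-*q : ∀ k x → T (k ℕ.* q ℕ.+ x) ≡ T x
        T-*q k x = ∑ᶻ-cong< q (λ a _ → trans (cong P (lem (a ℕ.* δ) (k ℕ.* q) x)) (periodic-* per k _))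
          where
          lem : ∀ a k x → a ℕ.+ (k ℕ.+ x) ≡ k ℕ.+ (a ℕ.+ x)
          lem = ℕ-Solver.solve-∀

        T-suc : Bézout.Identity 1 q δ → ∀ x → T (suc x) ≡ T x
        T-suc (Bézout.+- u v eq) x = trans (sym (T-*δ v (suc x))) (trans (cong T (trans (ℕₚ.+-suc (v ℕ.* δ) x) (cong (ℕ._+ x) eq))) (T-*q u x))
        T-suc (Bézout.-+ u v eq) x = trans (sym (T-*q u (suc x))) (trans (cong T (trans (ℕₚ.+-suc (u ℕ.* q) x) (cong (ℕ._+ x) eq))) (T-*δ v x))

        T-0 : ∀ x → T x ≡ T 0
        T-0 zero = refl
        T-0 (suc x) = trans (T-suc bez x) (T-0 x)

      progression : ∀ x → ∑ᶻ q (λ a → P (a ℕ.* δ ℕ.+ x)) ≡ ∑ᶻ q P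
      progression x = trans (T-0 x) (ℤₚ.*-cancelˡ-≡ (+ q) (T 0) (∑ᶻ q P) (begin
        -- T is constant, so q times its value is its sum over all x; after swapping the sums each
        -- inner sum runs over a full period.
        + q * T 0 ≡⟨ sym (∑ᶻ-const q (T 0)) ⟩
        ∑ᶻ q (λ _ → T 0) ≡⟨ sym (∑ᶻ-cong< q (λ x _ → T-0 x)) ⟩
        ∑ᶻ q T ≡⟨ swap q q (λ x a → P (a ℕ.* δ ℕ.+ x)) ⟩
        ∑ᶻ q (λ a → ∑ᶻ q (λ x → P (a ℕ.* δ ℕ.+ x))) ≡⟨ ∑ᶻ-cong< q (λ a _ → shift (a ℕ.* δ) P per) ⟩
        ∑ᶻ q (λ _ → ∑ᶻ q P) ≡⟨ ∑ᶻ-const q (∑ᶻ q P) ⟩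
        + q * ∑ᶻ q P ∎))
        where
        open ≡-Reasoning
        swap : ∀ m n (f : ℕ → ℕ → ℤ) → ∑ᶻ m (λ x → ∑ᶻ n (f x)) ≡ ∑ᶻ n (λ y → ∑ᶻ m (λ x → f x y))
        swap zero n f = sym (trans (∑ᶻ-const n 0ℤ) (ℤₚ.*-zeroʳ (+ n)))
        swap (suc m) n f = trans (cong (_+ ∑ᶻ n (f m)) (swap m n f)) (sym (∑ᶻ-+ n _ _))

  -- Points (a , b) of the affine plane over ℤ/q; the c-th edge leads to (c , b + a c).
  module _ (q′ : ℕ) where

    private
      q = suc q′
      Z = [ q′ ]

      periodic-% : ∀ f → Periodic q (λ x → f (x % q))
      periodic-% f x = cong f (trans (cong (_% q) (ℕₚ.+-comm q x)) ([m+n]%n≡m%n x q))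

      ∑-% : ∀ f → ∑ᶻ q (λ x → f (x % q)) ≡ ∑ᶻ q f
      ∑-% f = ∑ᶻ-cong< q (λ x x<q → cong f (m<n⇒m%n≡m x<q))

      ∑-+% : ∀ s f → ∑ᶻ q (λ x → f ((s ℕ.+ x) % q)) ≡ ∑ᶻ q f
      ∑-+% s f = trans (shift q s (λ x → f (x % q)) (periodic-% f)) (∑-% f)

    affinePlane : Graph (Z ⊗ Z) Z
    affinePlane .rot ((a , b) , c) = (c , (a ℕ.* c ℕ.+ b) % q) , a
    affinePlane .rot-In ((a , b) , c) ((pa , pb) , pc) = (pc , ℕ.s≤s⁻¹ (m%n<n (a ℕ.* c ℕ.+ b) q)) , pa
    affinePlane .rot-∫ F = begin
      ∫ Z (λ a → ∫ Z (λ b → ∫ Z (λ c → F ((c , (a ℕ.* c ℕ.+ b) % q) , a))))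
        ≡⟨ ∫-cong Z (λ a → ∫-swap Z Z (λ b c → F ((c , (a ℕ.* c ℕ.+ b) % q) , a))) ⟩
      ∫ Z (λ a → ∫ Z (λ c → ∫ Z (λ b → F ((c , (a ℕ.* c ℕ.+ b) % q) , a))))
        ≡⟨ ∫-cong Z (λ a → ∫-cong Z (λ c → ∑-+% (a ℕ.* c) (λ y → F ((c , y) , a)))) ⟩
      ∫ Z (λ a → ∫ Z (λ c → ∫ Z (λ b → F ((c , b) , a)))) ≡⟨ ∫-swap Z Z (λ a c → ∫ Z (λ b → F ((c , b) , a))) ⟩
      ∫ Z (λ c → ∫ Z (λ a → ∫ Z (λ b → F ((c , b) , a)))) ≡⟨ ∫-cong Z (λ c → ∫-swap Z Z (λ a b → F ((c , b) , a))) ⟩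
      ∫ Z (λ c → ∫ Z (λ b → ∫ Z (λ a → F ((c , b) , a)))) ∎
      where open ≡-Reasoning

    module _ (prime : Prime q) where

      private
        -- δ represents c′ - c modulo q. It is a nonzero residue, hence prime to q, and the Bézout
        -- identity makes the multiples of δ run through all residues.
        difference : ∀ c c′ → c ℕ.< q → c′ ℕ.< q → ¬ c ≡ c′ →
                     Σ[ δ ∈ ℕ ] Σ[ k ∈ ℕ ] (Bézout.Identity 1 q δ × δ ℕ.+ c ≡ c′ ℕ.+ k ℕ.* q)
        difference c c′ c<q c′<q c≢c′ with ℕₚ.<-cmp c c′
        ... | tri≈ _ e _ = contradiction e c≢c′
        ... | tri< c<c′ _ _ = c′ ℕ.∸ c , 0
            , coprime-Bézout (prime⇒coprime prime {{ℕ.>-nonZero (ℕₚ.m<n⇒0<n∸m c<c′)}} (ℕₚ.≤-<-trans (ℕₚ.m∸n≤m c′ c) c′<q))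
            , trans (ℕₚ.m∸n+n≡m (ℕₚ.<⇒≤ c<c′)) (sym (ℕₚ.+-identityʳ c′))
        ... | tri> _ _ c′<c = q ℕ.∸ (c ℕ.∸ c′) , 1
            , coprime-Bézout (prime⇒coprime prime {{ℕ.>-nonZero (ℕₚ.m<n⇒0<n∸m (ℕₚ.≤-<-trans (ℕₚ.m∸n≤m c c′) c<q))}} (ℕₚ.∸-monoʳ-< (ℕₚ.m<n⇒0<n∸m c′<c) (ℕₚ.≤-trans (ℕₚ.m∸n≤m c c′) (ℕₚ.<⇒≤ c<q))))
            , (begin
               q ℕ.∸ (c ℕ.∸ c′) ℕ.+ c ≡⟨ cong (λ z → q ℕ.∸ (c ℕ.∸ c′) ℕ.+ z) (sym (ℕₚ.m∸n+n≡m (ℕₚ.<⇒≤ c′<c))) ⟩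
               q ℕ.∸ (c ℕ.∸ c′) ℕ.+ (c ℕ.∸ c′ ℕ.+ c′) ≡⟨ sym (ℕₚ.+-assoc (q ℕ.∸ (c ℕ.∸ c′)) _ c′) ⟩
               (q ℕ.∸ (c ℕ.∸ c′) ℕ.+ (c ℕ.∸ c′)) ℕ.+ c′ ≡⟨ cong (ℕ._+ c′) (ℕₚ.m∸n+n≡m (ℕₚ.≤-trans (ℕₚ.m∸n≤m c c′) (ℕₚ.<⇒≤ c<q))) ⟩
               q ℕ.+ c′ ≡⟨ ℕₚ.+-comm q c′ ⟩
               c′ ℕ.+ q ≡⟨ cong (c′ ℕ.+_) (sym (ℕₚ.*-identityˡ q)) ⟩
               c′ ℕ.+ 1 ℕ.* q ∎)
            where open ≡-Reasoning

      -- Squaring the neighbour sums gives correlations between columns c and c′. Two points in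
      -- different columns lie on exactly one line y = a x + b, so the correlation factors into
      -- column sums, which cancel since f has mean zero; only the diagonal is left.
      affinePlane-expands : Expands affinePlane (+ q)
      affinePlane-expands .bound f f≡0 = begin
        + q * energy (Z ⊗ Z) (adj affinePlane f) ≤⟨ *-monoˡ {+ q} (+≤+ ℕ.z≤n) le ⟩
        + q * (+ q * energy (Z ⊗ Z) f) ≡⟨ sym (ℤₚ.*-assoc (+ q) (+ q) (energy (Z ⊗ Z) f)) ⟩
        (+ q * + q) * energy (Z ⊗ Z) f ∎
        where
        open ℤₚ.≤-Reasoning
        φ : ℕ → ℤ
        φ c = ∑ᶻ q (λ y → f (c , y))
        R : ℕ → ℤ
        R c = ∑ᶻ q (λ y → f (c , y) * f (c , y))
        X : ℕ → ℕ → ℕ → ℤ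
        X a b c = f (c , (a ℕ.* c ℕ.+ b) % q)
        Y : ℕ → ℕ → ℤ
        Y c c′ = ∑ᶻ q (λ a → ∑ᶻ q (λ b → X a b c * X a b c′))

        diagonal : ∀ c → Y c c ≡ + q * R c
        diagonal c = trans (∑ᶻ-cong< q (λ a _ → ∑-+% (a ℕ.* c) (λ y → f (c , y) * f (c , y)))) (∑ᶻ-const q (R c))

        off-diagonal : ∀ c c′ → c ℕ.< q → c′ ℕ.< q → ¬ c ≡ c′ → Y c c′ ≡ φ c * φ c′
        off-diagonal c c′ c<q c′<q c≢c′ with difference c c′ c<q c′<q c≢c′
        ... | δ , k , bez , eq = begin-equality
          Y c c′ ≡⟨ ∑ᶻ-cong< q (λ a _ → trans (∑ᶻ-cong< q (λ b _ → cong (λ z → X a b c * f (c′ , z)) (sym (align a b)))) (shift q (a ℕ.* c) (Q a) (Q-per a))) ⟩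
          ∫ Z (λ a → ∫ Z (Q a)) ≡⟨ ∫-swap Z Z Q ⟩
          ∫ Z (λ b → ∫ Z (λ a → Q a b)) ≡⟨ ∫-cong Z (λ b → trans (∫-* Z (f (c , b % q)) (λ a → P′ (a ℕ.* δ ℕ.+ b)))
              (cong (f (c , b % q) *_) (trans (progression q δ bez P′ (periodic-% (λ y → f (c′ , y))) b) (∑-% (λ y → f (c′ , y)))))) ⟩
          ∫ Z (λ b → f (c , b % q) * φ c′) ≡⟨ ∫-*ʳ Z (φ c′) (λ b → f (c , b % q)) ⟩
          ∫ Z (λ b → f (c , b % q)) * φ c′ ≡⟨ cong (_* φ c′) (∑-% (λ y → f (c , y))) ⟩
          φ c * φ c′ ∎
          where
          P′ : ℕ → ℤ
          P′ y = f (c′ , y % q)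
          Q : ℕ → ℕ → ℤ
          Q a y = f (c , y % q) * P′ (a ℕ.* δ ℕ.+ y)
          align : ∀ a b → (a ℕ.* δ ℕ.+ (a ℕ.* c ℕ.+ b)) % q ≡ (a ℕ.* c′ ℕ.+ b) % q
          align a b = trans (cong (_% q) (trans (l₁ a δ c b) (trans (cong (λ z → a ℕ.* z ℕ.+ b) eq) (l₂ a c′ k q b)))) ([m+kn]%n≡m%n (a ℕ.* c′ ℕ.+ b) (a ℕ.* k) q)
            where
            l₁ : ∀ a δ c b → a ℕ.* δ ℕ.+ (a ℕ.* c ℕ.+ b) ≡ a ℕ.* (δ ℕ.+ c) ℕ.+ b
            l₁ = ℕ-Solver.solve-∀
            l₂ : ∀ a c k q b → a ℕ.* (c ℕ.+ k ℕ.* q) ℕ.+ b ≡ (a ℕ.* c ℕ.+ b) ℕ.+ a ℕ.* k ℕ.* q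
            l₂ = ℕ-Solver.solve-∀
          Q-per : ∀ a → Periodic q (Q a)
          Q-per a x = cong₂ _*_ (periodic-% (λ y → f (c , y)) x)
            (trans (cong P′ (lem (a ℕ.* δ) q x)) (periodic-% (λ y → f (c′ , y)) (a ℕ.* δ ℕ.+ x)))
            where
            lem : ∀ a q x → a ℕ.+ (q ℕ.+ x) ≡ q ℕ.+ (a ℕ.+ x)
            lem = ℕ-Solver.solve-∀

        -- Adding the missing square completes the off-diagonal products to φ c times the sum of all
        -- column sums, which is zero.
        row : ∀ c → c ℕ.< q → ∑ᶻ q (Y c) ≤ + q * R c
        row c c<q = begin
          ∑ᶻ q (Y c) ≤⟨ a≤a+b (sq-≥0 (φ c)) ⟩
          ∑ᶻ q (Y c) + φ c * φ c ≡⟨ ∑ᶻ-except q c c<q (Y c) (λ c′ → φ c * φ c′) (λ c′ c′<q c′≢c → off-diagonal c c′ c<q c′<q (λ e → c′≢c (sym e))) ⟩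
          ∑ᶻ q (λ c′ → φ c * φ c′) + Y c c ≡⟨ cong₂ _+_ (trans (∑ᶻ-* q (φ c) φ) (trans (cong (φ c *_) f≡0) (ℤₚ.*-zeroʳ (φ c)))) (diagonal c) ⟩
          0ℤ + + q * R c ≡⟨ ℤₚ.+-identityˡ (+ q * R c) ⟩
          + q * R c ∎

        ∑ᶻ-mono< : ∀ n {f g : ℕ → ℤ} → (∀ x → x ℕ.< n → f x ≤ g x) → ∑ᶻ n f ≤ ∑ᶻ n g
        ∑ᶻ-mono< zero e = ℤₚ.≤-refl
        ∑ᶻ-mono< (suc n) e = ℤₚ.+-mono-≤ (∑ᶻ-mono< n (λ x p → e x (ℕₚ.m<n⇒m<1+n p))) (e n ℕₚ.≤-refl)

        le : energy (Z ⊗ Z) (adj affinePlane f) ≤ + q * energy (Z ⊗ Z) f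
        le = begin
          ∫ Z (λ a → ∫ Z (λ b → ∫ Z (X a b) * ∫ Z (X a b)))
            ≡⟨ ∫-cong Z (λ a → ∫-cong Z (λ b → trans (sym (∫-*ʳ Z (∫ Z (X a b)) (X a b))) (∫-cong Z (λ c → sym (∫-* Z (X a b c) (X a b)))))) ⟩
          ∫ Z (λ a → ∫ Z (λ b → ∫ (Z ⊗ Z) (λ p → X a b (proj₁ p) * X a b (proj₂ p))))
            ≡⟨ ∫-swap (Z ⊗ Z) (Z ⊗ Z) (λ y p → X (proj₁ y) (proj₂ y) (proj₁ p) * X (proj₁ y) (proj₂ y) (proj₂ p)) ⟩
          ∑ᶻ q (λ c → ∑ᶻ q (Y c)) ≤⟨ ∑ᶻ-mono< q row ⟩
          ∑ᶻ q (λ c → + q * R c) ≡⟨ ∑ᶻ-* q (+ q) R ⟩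
          + q * energy (Z ⊗ Z) f ∎

-- Expanders of constant degree by the iterated zig-zag product.

module ExpanderFamily where

  open import Data.Nat as ℕ using (ℕ; zero; suc)
  import Data.Nat.Properties as ℕₚ
  open import Data.Nat.Primality using (Prime; prime?)
  open import Data.Integer using (ℤ; +_; _*_; _≤_; 0ℤ; +≤+)
  import Data.Integer.Properties as ℤₚ
  open Integral
  open Expander
  open AffinePlane

  Expands-≤ : ∀ {V L} (G : Graph V L) {κ κ′} → κ′ ≤ κ → Expands G κ → Expands G κ′
  Expands-≤ {V} G {κ} {κ′} le e .bound f f≡0 = ℤₚ.≤-trans
    (ℤₚ.*-monoʳ-≤-nonNeg (energy V (adj G f)) {{Data.Integer.nonNegative (energy-≥0 V (adj G f))}} le) (bound e f f≡0)
    where import Data.Integer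

  -- Regroups labels so that the degree space of a squared graph is literally the vertex space of
  -- the gadget in `Iterate`.
  reassociate : ∀ {V A B C} → Graph V (A ⊗ (B ⊗ C)) → Graph V ((A ⊗ B) ⊗ C)
  reassociate G .rot (v , ((a , b) , c)) =
    let x = rot G (v , (a , (b , c)))
    in proj₁ x , ((proj₁ (proj₂ x) , proj₁ (proj₂ (proj₂ x))) , proj₂ (proj₂ (proj₂ x)))
  reassociate G .rot-In (v , ((a , b) , c)) (pv , ((pa , pb) , pc)) =
    let x = rot-In G (v , (a , (b , c))) (pv , (pa , (pb , pc)))
    in proj₁ x , ((proj₁ (proj₂ x) , proj₁ (proj₂ (proj₂ x))) , proj₂ (proj₂ (proj₂ x)))
  reassociate G .rot-∫ F = rot-∫ G (λ { (v , (a , (b , c))) → F (v , ((a , b) , c)) })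

  reassociate-expands : ∀ {V A B C} (G : Graph V (A ⊗ (B ⊗ C))) {κ} → Expands G κ → Expands (reassociate {V} {A} {B} {C} G) κ
  reassociate-expands {V} {A} {B} {C} G {κ} e .bound f f≡0 =
    subst (λ n → κ * energy V (adj G f) ≤ (+ n * + n) * energy V f) (sym (ℕₚ.*-assoc (size A) (size B) (size C))) (bound e f f≡0)

  loops : ∀ L → Graph [ 0 ] L
  loops L .rot x = x
  loops L .rot-In x p = p
  loops L .rot-∫ F = refl

  -- On one vertex the only mean-zero function is zero, so the recursion can start with any
  -- expansion constant.
  loops-expands : ∀ L κ → Expands (loops L) κ
  loops-expands L κ .bound f f≡0 = ℤₚ.≤-reflexive (trans (vanish (adj (loops L) f) (trans (∫-cong L (λ _ → f0)) (∫-zero L)) κ) (sym (vanish f f0 (∣ L ∣ˢ * ∣ L ∣ˢ))))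
    where
    f0 : f 0 ≡ 0ℤ
    f0 = trans (sym (ℤₚ.+-identityˡ (f 0))) f≡0
    vanish : ∀ (g : ℕ → ℤ) → g 0 ≡ 0ℤ → ∀ c → c * energy [ 0 ] g ≡ 0ℤ
    vanish g g0 c = trans (cong (λ z → c * (0ℤ Data.Integer.+ z * z)) g0) (ℤₚ.*-zeroʳ c)
      where import Data.Integer

  power : ℕ → Space → Space
  power zero L = [ 0 ]
  power (suc e) L = L ⊗ power e L

  pow : ∀ {V L} → Graph V L → (e : ℕ) → Graph V (power e L)
  pow G zero .rot x = x
  pow G zero .rot-In x p = p
  pow G zero .rot-∫ F = refl
  pow G (suc e) = compose G (pow G e)

  pow-expands : ∀ {V L} (G : Graph V L) {k} → Expands G (+ k) → ∀ e → Expands (pow G e) (+ (k ℕ.^ e))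
  pow-expands {V} G eG zero .bound f f≡0 = ℤₚ.≤-reflexive (cong (+ 1 *_) (∫-cong V (λ v → cong₂ _*_ (ℤₚ.+-identityˡ (f v)) (ℤₚ.+-identityˡ (f v)))))
  pow-expands {V} {L} G {k} eG (suc e) = subst (Expands (pow G (suc e))) (sym (ℤₚ.pos-* k (k ℕ.^ e)))
    (compose-expands G (pow G e) {+ k} {+ (k ℕ.^ e)} (+≤+ ℕ.z≤n) eG (pow-expands G eG e))

  tower : Space → ℕ → Space
  tower W zero = [ 0 ]
  tower W (suc s) = tower W s ⊗ W

  record Family : Set where
    field
      L W     : Space
      W>1     : 1 ℕ.< size W
      graph   : ∀ s → Graph (tower W s) L
      expands : ∀ s → Expands (graph s) (+ 4)

  private
    module Iterate (q′ : ℕ) (prime : Prime (suc q′)) (large : 256 ℕ.≤ suc q′) where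
      Z = [ q′ ]
      AP = affinePlane q′
      -- The tensor square and two zig-zag products lead from q^2 to q^8 vertices, ending at degree
      -- q^2. Each zig-zag product divides the expansion by 4, so 256 is needed at the start to
      -- leave 16.
      X₁ = tensor AP AP
      X₂ = zigzag X₁ AP
      X₃ = zigzag X₂ AP

      AP-expands : ∀ {k} → k ℕ.≤ suc q′ → Expands AP (+ k)
      AP-expands le = Expands-≤ AP (+≤+ le) (affinePlane-expands q′ prime)

      X₁-expands : Expands X₁ (+ 256)
      X₁-expands = tensor-expands AP AP (+ 256) (+≤+ ℕ.z≤n) (AP-expands large) (AP-expands large)

      X₂-expands : Expands X₂ (+ 64)
      X₂-expands = zigzag-expands X₁ AP {+ 64} (+≤+ ℕ.z≤n) X₁-expands (AP-expands large)

      X₃-expands : Expands X₃ (+ 16)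
      X₃-expands = zigzag-expands X₂ AP {+ 16} (+≤+ ℕ.z≤n) X₂-expands (AP-expands (ℕₚ.≤-trans (ℕₚ.m≤m+n 64 192) large))

      Λ = (Z ⊗ Z) ⊗ (Z ⊗ Z)
      W₃ = (((Z ⊗ Z) ⊗ (Z ⊗ Z)) ⊗ (Z ⊗ Z)) ⊗ (Z ⊗ Z)

      W₃>1 : 1 ℕ.< size W₃
      W₃>1 = wider (((Z ⊗ Z) ⊗ (Z ⊗ Z)) ⊗ (Z ⊗ Z)) (Z ⊗ Z) (wider ((Z ⊗ Z) ⊗ (Z ⊗ Z)) (Z ⊗ Z) (wider (Z ⊗ Z) (Z ⊗ Z) (wider Z Z (ℕₚ.≤-trans (ℕₚ.m≤m+n 2 254) large))))
        where
        wider : ∀ a b → 1 ℕ.< size a → 1 ℕ.< size (a ⊗ b)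
        wider a b lt = ℕₚ.≤-trans lt (ℕₚ.m≤m*n (size a) (size b) {{size-NonZero b}})

      squared : ∀ {V} → Graph V Λ → Graph V W₃
      squared {V} G = reassociate {V} {Λ} {Z ⊗ Z} {Z ⊗ Z} (compose G G)

      -- Squaring lifts the expansion from 4 to 16 and the degree from q^4 to q^8; the zig-zag
      -- product with `X₃` returns both to 4 and q^4. This dictates the shape of `X₃`: q^8 vertices,
      -- degree q^2, expansion 16.
      E : ∀ s → Graph (tower W₃ s) Λ
      E zero = loops Λ
      E (suc s) = zigzag (squared (E s)) X₃

      E-expands : ∀ s → Expands (E s) (+ 4)
      E-expands zero = loops-expands Λ (+ 4)
      E-expands (suc s) = zigzag-expands (squared (E s)) X₃ {+ 4} (+≤+ ℕ.z≤n)
        (reassociate-expands {tower W₃ s} {Λ} {Z ⊗ Z} {Z ⊗ Z} (compose (E s) (E s)) {+ 16}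
          (compose-expands (E s) (E s) {+ 4} {+ 4} (+≤+ ℕ.z≤n) (E-expands s) (E-expands s)))
        X₃-expands

  opaque
    -- 257 is the least prime not below 256. The family is sealed so that its sizes, powers of 257,
    -- stay symbolic.
    expanders : Family
    expanders = record { L = Λ ; W = W₃ ; W>1 = W₃>1 ; graph = E ; expands = E-expands }
      where open Iterate 256 (from-yes (prime? 257)) (ℕₚ.n≤1+n 256)

-- Natural sums, and lists seen as multisets through weights.

module Sums where

  open import Data.Nat
  open import Data.Nat.Properties
  open import Data.Nat.Tactic.RingSolver using (solve-∀)
  open import Data.List.Base using (List; []; _∷_; _++_; length; take; drop)
  open import Data.List.Properties using (++-assoc; ++-identityʳ; take-[])
  import Data.Integer as ℤ
  import Data.Integer.Properties as ℤₚ
  open Integral hiding (a≤a+b; b≤a+b)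

  private variable
    A : Set

  +-interchange : ∀ a b c d → (a + b) + (c + d) ≡ (a + c) + (b + d)
  +-interchange = solve-∀

  ∑ : ℕ → (ℕ → ℕ) → ℕ
  ∑ zero f = 0
  ∑ (suc n) f = ∑ n f + f n

  ∑-cong< : ∀ n {f g : ℕ → ℕ} → (∀ x → x < n → f x ≡ g x) → ∑ n f ≡ ∑ n g
  ∑-cong< zero e = refl
  ∑-cong< (suc n) e = cong₂ _+_ (∑-cong< n (λ x p → e x (m<n⇒m<1+n p))) (e n ≤-refl)

  ∑-cong : ∀ n {f g : ℕ → ℕ} → (∀ x → f x ≡ g x) → ∑ n f ≡ ∑ n g
  ∑-cong n e = ∑-cong< n (λ x _ → e x)

  ∑-mono< : ∀ n {f g : ℕ → ℕ} → (∀ x → x < n → f x ≤ g x) → ∑ n f ≤ ∑ n g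
  ∑-mono< zero e = z≤n
  ∑-mono< (suc n) e = +-mono-≤ (∑-mono< n (λ x p → e x (m<n⇒m<1+n p))) (e n ≤-refl)

  ∑-mono : ∀ n {f g : ℕ → ℕ} → (∀ x → f x ≤ g x) → ∑ n f ≤ ∑ n g
  ∑-mono n e = ∑-mono< n (λ x _ → e x)

  ∑-+ : ∀ n (f g : ℕ → ℕ) → ∑ n (λ x → f x + g x) ≡ ∑ n f + ∑ n g
  ∑-+ zero f g = refl
  ∑-+ (suc n) f g = trans (cong (_+ (f n + g n)) (∑-+ n f g)) (+-interchange (∑ n f) (∑ n g) (f n) (g n))

  ∑-* : ∀ n c (f : ℕ → ℕ) → ∑ n (λ x → c * f x) ≡ c * ∑ n f
  ∑-* zero c f = sym (*-zeroʳ c)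
  ∑-* (suc n) c f = trans (cong (_+ c * f n) (∑-* n c f)) (sym (*-distribˡ-+ c (∑ n f) (f n)))

  ∑-*ʳ : ∀ n c (f : ℕ → ℕ) → ∑ n (λ x → f x * c) ≡ ∑ n f * c
  ∑-*ʳ n c f = trans (∑-cong n (λ x → *-comm (f x) c)) (trans (∑-* n c f) (*-comm c _))

  ∑-const : ∀ n c → ∑ n (λ _ → c) ≡ n * c
  ∑-const zero c = refl
  ∑-const (suc n) c = trans (cong (_+ c) (∑-const n c)) (+-comm (n * c) c)

  ∑-zero : ∀ n {f : ℕ → ℕ} → (∀ x → x < n → f x ≡ 0) → ∑ n f ≡ 0
  ∑-zero n e = trans (∑-cong< n e) (trans (∑-const n 0) (*-zeroʳ n))

  ∑-split : ∀ m n (f : ℕ → ℕ) → ∑ (m + n) f ≡ ∑ m f + ∑ n (λ x → f (m + x))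
  ∑-split m zero f = trans (cong (λ z → ∑ z f) (+-identityʳ m)) (sym (+-identityʳ _))
  ∑-split m (suc n) f = trans (cong (λ z → ∑ z f) (+-suc m n)) (trans (cong (_+ f (m + n)) (∑-split m n f)) (+-assoc (∑ m f) _ _))

  ∑-suc : ∀ n (f : ℕ → ℕ) → ∑ (suc n) f ≡ f 0 + ∑ n (λ x → f (suc x))
  ∑-suc n f = ∑-split 1 n f

  ∑-grid : ∀ m n (f : ℕ → ℕ) → ∑ (m * n) f ≡ ∑ m (λ x → ∑ n (λ y → f (x * n + y)))
  ∑-grid zero n f = refl
  ∑-grid (suc m) n f = trans (cong (λ z → ∑ z f) (+-comm n (m * n))) (trans (∑-split (m * n) n f) (cong (_+ ∑ n (λ y → f (m * n + y))) (∑-grid m n f)))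

  ∑-≥ : ∀ n i (f : ℕ → ℕ) → i < n → f i ≤ ∑ n f
  ∑-≥ (suc n) i f i<n with i ≟ n
  ... | yes refl = m≤n+m (f n) (∑ n f)
  ... | no i≢n = ≤-trans (∑-≥ n i f (≤∧≢⇒< (s≤s⁻¹ i<n) i≢n)) (m≤m+n _ _)

  ∑-⊆ : ∀ {m n} (f : ℕ → ℕ) → m ≤ n → ∑ m f ≤ ∑ n f
  ∑-⊆ {m} {n} f le = subst (λ z → ∑ m f ≤ ∑ z f) (m+[n∸m]≡n le) (≤-trans (m≤m+n _ _) (≤-reflexive (sym (∑-split m (n ∸ m) f))))

  ∑-support : ∀ n N (f : ℕ → ℕ) → (∀ x → f x ≤ 1) → (∀ x → N ≤ x → f x ≡ 0) → ∑ n f ≤ N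
  ∑-support n N f le z with ≤-total n N
  ... | inj₁ n≤N = ≤-trans (∑-mono n le) (≤-trans (≤-reflexive (trans (∑-const n 1) (*-identityʳ n))) n≤N)
  ... | inj₂ N≤n = subst (λ z → ∑ z f ≤ N) (m+[n∸m]≡n N≤n) (≤-trans (≤-reflexive (trans (∑-split N (n ∸ N) f) (trans (cong (λ y → ∑ N f + y) (∑-zero (n ∸ N) (λ x _ → z (N + x) (m≤m+n N x)))) (+-identityʳ _))))
     (≤-trans (∑-mono N le) (≤-reflexive (trans (∑-const N 1) (*-identityʳ N)))))

  ∮ : (s : Space) → (El s → ℕ) → ℕ
  ∮ [ n ] f = ∑ (suc n) f
  ∮ (a ⊗ b) f = ∮ a (λ x → ∮ b (λ y → f (x , y)))

  ∮-cong : ∀ s {f g : El s → ℕ} → (∀ x → f x ≡ g x) → ∮ s f ≡ ∮ s g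
  ∮-cong [ n ] e = ∑-cong (suc n) e
  ∮-cong (a ⊗ b) e = ∮-cong a (λ x → ∮-cong b (λ y → e (x , y)))

  ∮-mono : ∀ s {f g : El s → ℕ} → (∀ x → In s x → f x ≤ g x) → ∮ s f ≤ ∮ s g
  ∮-mono [ n ] e = ∑-mono< (suc n) (λ x p → e x (s≤s⁻¹ p))
  ∮-mono (a ⊗ b) e = ∮-mono a (λ x p → ∮-mono b (λ y p′ → e (x , y) (p , p′)))

  ∮-+ : ∀ s (f g : El s → ℕ) → ∮ s (λ x → f x + g x) ≡ ∮ s f + ∮ s g
  ∮-+ [ n ] f g = ∑-+ (suc n) f g
  ∮-+ (a ⊗ b) f g = trans (∮-cong a (λ x → ∮-+ b _ _)) (∮-+ a _ _)

  ∮-* : ∀ s c (f : El s → ℕ) → ∮ s (λ x → c * f x) ≡ c * ∮ s f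
  ∮-* [ n ] c f = ∑-* (suc n) c f
  ∮-* (a ⊗ b) c f = trans (∮-cong a (λ x → ∮-* b c _)) (∮-* a c _)

  ∮-const : ∀ s c → ∮ s (λ _ → c) ≡ size s * c
  ∮-const [ n ] c = ∑-const (suc n) c
  ∮-const (a ⊗ b) c = trans (∮-cong a (λ _ → ∮-const b c)) (trans (∮-const a _) (sym (*-assoc (size a) (size b) c)))

  ∮-∑-swap : ∀ s n (f : El s → ℕ → ℕ) → ∮ s (λ x → ∑ n (f x)) ≡ ∑ n (λ i → ∮ s (λ x → f x i))
  ∮-∑-swap s zero f = trans (∮-const s 0) (*-zeroʳ (size s))
  ∮-∑-swap s (suc n) f = trans (∮-+ s _ _) (cong (_+ ∮ s (λ x → f x n)) (∮-∑-swap s n f))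

  ∮-∫ : ∀ s (f : El s → ℕ) → ℤ.+ ∮ s f ≡ ∫ s (λ x → ℤ.+ f x)
  ∮-∫ [ n ] f = cast (suc n)
    where
    cast : ∀ n → ℤ.+ ∑ n f ≡ ∑ᶻ n (λ x → ℤ.+ f x)
    cast zero = refl
    cast (suc n) = trans (ℤₚ.pos-+ (∑ n f) (f n)) (cong (ℤ._+ (ℤ.+ f n)) (cast n))
  ∮-∫ (a ⊗ b) f = trans (∮-∫ a _) (∫-cong a (λ x → ∮-∫ b _))

  -- Mixed-radix numbering; `∮-idx` shows that it meets every number below the size once.
  idx : (s : Space) → El s → ℕ
  idx [ n ] x = x
  idx (a ⊗ b) (x , y) = idx a x * size b + idx b y

  ∮-idx : ∀ s (f : ℕ → ℕ) → ∮ s (λ x → f (idx s x)) ≡ ∑ (size s) f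
  ∮-idx [ n ] f = refl
  ∮-idx (a ⊗ b) f = trans (∮-cong a (λ x → ∮-idx b (λ y → f (idx a x * size b + y))))
    (trans (∮-idx a (λ x → ∑ (size b) (λ y → f (x * size b + y)))) (sym (∑-grid (size a) (size b) f)))

  -- Equality of these sums for all weights plays the part of a permutation; it survives
  -- concatenation, chunking and transposition without tracking positions.
  wt : (A → ℕ) → List A → ℕ
  wt w [] = 0
  wt w (x ∷ xs) = w x + wt w xs

  wt-++ : ∀ (w : A → ℕ) xs ys → wt w (xs ++ ys) ≡ wt w xs + wt w ys
  wt-++ w [] ys = refl
  wt-++ w (x ∷ xs) ys = trans (cong (λ z → w x + z) (wt-++ w xs ys)) (sym (+-assoc (w x) _ _))

  wt-cong : ∀ {w v : A → ℕ} → (∀ x → w x ≡ v x) → ∀ xs → wt w xs ≡ wt v xs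
  wt-cong e [] = refl
  wt-cong e (x ∷ xs) = cong₂ _+_ (e x) (wt-cong e xs)

  wt-mono : ∀ {w v : A → ℕ} → (∀ x → w x ≤ v x) → ∀ xs → wt w xs ≤ wt v xs
  wt-mono e [] = z≤n
  wt-mono e (x ∷ xs) = +-mono-≤ (e x) (wt-mono e xs)

  wt-+ : ∀ (w v : A → ℕ) xs → wt (λ x → w x + v x) xs ≡ wt w xs + wt v xs
  wt-+ w v [] = refl
  wt-+ w v (x ∷ xs) = trans (cong (λ z → (w x + v x) + z) (wt-+ w v xs)) (+-interchange (w x) (v x) _ _)

  wt-1 : ∀ (xs : List A) → wt (λ _ → 1) xs ≡ length xs
  wt-1 [] = refl
  wt-1 (x ∷ xs) = cong suc (wt-1 xs)

  wt-drop-≤ : ∀ (w : A → ℕ) n xs → wt w (drop n xs) ≤ wt w xs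
  wt-drop-≤ w zero xs = ≤-refl
  wt-drop-≤ w (suc n) [] = z≤n
  wt-drop-≤ w (suc n) (x ∷ xs) = ≤-trans (wt-drop-≤ w n xs) (m≤n+m _ (w x))

  wt-take-drop : ∀ (w : A → ℕ) n xs → wt w (take n xs) + wt w (drop n xs) ≡ wt w xs
  wt-take-drop w zero xs = refl
  wt-take-drop w (suc n) [] = refl
  wt-take-drop w (suc n) (x ∷ xs) = trans (+-assoc (w x) _ _) (cong (λ z → w x + z) (wt-take-drop w n xs))

  collect : ℕ → (ℕ → List A) → List A
  collect zero F = []
  collect (suc n) F = collect n F ++ F n

  wt-collect : ∀ (w : A → ℕ) n F → wt w (collect n F) ≡ ∑ n (λ x → wt w (F x))
  wt-collect w zero F = refl
  wt-collect w (suc n) F = trans (wt-++ w (collect n F) (F n)) (cong (_+ wt w (F n)) (wt-collect w n F))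

  collect-split : ∀ m n (F : ℕ → List A) → collect (m + n) F ≡ collect m F ++ collect n (λ x → F (m + x))
  collect-split m zero F = trans (cong (λ z → collect z F) (+-identityʳ m)) (sym (++-identityʳ _))
  collect-split m (suc n) F = trans (cong (λ z → collect z F) (+-suc m n)) (trans (cong (_++ F (m + n)) (collect-split m n F)) (++-assoc (collect m F) _ _))

  gather : (s : Space) → (El s → List A) → List A
  gather [ n ] F = collect (suc n) F
  gather (a ⊗ b) F = gather a (λ x → gather b (λ y → F (x , y)))

  wt-gather : ∀ (w : A → ℕ) s F → wt w (gather s F) ≡ ∮ s (λ x → wt w (F x))
  wt-gather w [ n ] F = wt-collect w (suc n) F
  wt-gather w (a ⊗ b) F = trans (wt-gather w a _) (∮-cong a (λ x → wt-gather w b _))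

  -- At most one entry: positions past the end contribute nothing, so ragged rows need no padding.
  at : List A → ℕ → List A
  at [] i = []
  at (x ∷ xs) zero = x ∷ []
  at (x ∷ xs) (suc i) = at xs i

  wt-at : ∀ (w : A → ℕ) n xs → ∑ n (λ i → wt w (at xs i)) ≡ wt w (take n xs)
  wt-at w zero xs = refl
  wt-at w (suc n) [] = ∑-zero (suc n) (λ _ _ → refl)
  wt-at w (suc n) (x ∷ xs) = trans (∑-suc n _) (cong₂ _+_ (+-identityʳ (w x)) (wt-at w n xs))

  at-drop : ∀ m i (xs : List A) → at xs (m + i) ≡ at (drop m xs) i
  at-drop zero i xs = refl
  at-drop (suc m) i [] = refl
  at-drop (suc m) i (x ∷ xs) = at-drop m i xs

  take-all : ∀ n (xs : List A) → length xs ≤ n → take n xs ≡ xs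
  take-all n [] le = take-[] n
  take-all (suc n) (x ∷ xs) le = cong (x ∷_) (take-all n xs (s≤s⁻¹ le))

  wt-take-≤ : ∀ (w : A → ℕ) n xs → wt w (take n xs) ≤ wt w xs
  wt-take-≤ w n xs = subst (wt w (take n xs) ≤_) (wt-take-drop w n xs) (m≤m+n _ _)

  wt-chunks : ∀ (w : A → ℕ) n m xs → ∑ n (λ x → wt w (take m (drop (x * m) xs))) ≡ wt w (take (n * m) xs)
  wt-chunks w zero m xs = refl
  wt-chunks w (suc n) m xs = begin
    ∑ n (λ x → wt w (take m (drop (x * m) xs))) + wt w (take m (drop (n * m) xs)) ≡⟨ cong (_+ wt w (take m (drop (n * m) xs))) (wt-chunks w n m xs) ⟩
    wt w (take (n * m) xs) + wt w (take m (drop (n * m) xs)) ≡⟨ sym (wt-++ w (take (n * m) xs) _) ⟩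
    wt w (take (n * m) xs ++ take m (drop (n * m) xs)) ≡⟨ cong (wt w) (take-+ (n * m) m xs) ⟩
    wt w (take (n * m + m) xs) ≡⟨ cong (λ z → wt w (take z xs)) (+-comm (n * m) m) ⟩
    wt w (take (suc n * m) xs) ∎
    where
    open ≡-Reasoning
    take-+ : ∀ {B : Set} a b (xs : List B) → take a xs ++ take b (drop a xs) ≡ take (a + b) xs
    take-+ zero b xs = refl
    take-+ (suc a) b [] = take-[] b
    take-+ (suc a) b (x ∷ xs) = cong (x ∷_) (take-+ a b xs)

  Descending : (A → ℕ) → List A → Set
  Descending w = AllPairs (λ x y → w y ≤ w x)

  module _ (w : A → ℕ) (w≤1 : ∀ x → w x ≤ 1) where

    private
      zeros : ∀ {x : A} xs → w x ≡ 0 → All (λ y → w y ≤ w x) xs → wt w xs ≡ 0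
      zeros [] e [] = refl
      zeros {x} (y ∷ ys) e (p ∷ ps) = cong₂ _+_ (n≤0⇒n≡0 (subst (w y ≤_) e p)) (zeros {x} ys e ps)

    -- In descending order of 0/1 weights all ones come first, so dropping n entries removes n ones,
    -- or all of them.
    wt-drop-descending : ∀ xs n → Descending w xs → wt w (drop n xs) ≤ wt w xs ∸ n
    wt-drop-descending xs zero d = ≤-refl
    wt-drop-descending [] (suc n) d = z≤n
    wt-drop-descending (x ∷ xs) (suc n) (p ∷ d) with w x in eq | w≤1 x
    ... | zero | _ = ≤-trans (wt-drop-≤ w n xs) (≤-trans (≤-reflexive (zeros xs eq (subst (λ z → All (λ y → w y ≤ z) xs) (sym eq) p))) z≤n)
    ... | suc zero | _ = wt-drop-descending xs n d
    ... | suc (suc _) | s≤s ()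

    wt-at-≤1 : ∀ xs i → wt w (at xs i) ≤ 1
    wt-at-≤1 [] i = z≤n
    wt-at-≤1 (x ∷ xs) zero = subst (_≤ 1) (sym (+-identityʳ (w x))) (w≤1 x)
    wt-at-≤1 (x ∷ xs) (suc i) = wt-at-≤1 xs i

    wt-at-beyond : ∀ xs i → Descending w xs → wt w xs ≤ i → wt w (at xs i) ≡ 0
    wt-at-beyond xs i d le = n≤0⇒n≡0 (begin
      wt w (at xs i)             ≡⟨ cong (λ z → wt w (at xs z)) (sym (+-identityʳ i)) ⟩
      wt w (at xs (i + 0))       ≡⟨ cong (wt w) (at-drop i 0 xs) ⟩
      wt w (at (drop i xs) 0)    ≡⟨ wt-at w 1 (drop i xs) ⟩
      wt w (take 1 (drop i xs))  ≤⟨ wt-take-≤ w 1 (drop i xs) ⟩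
      wt w (drop i xs)           ≤⟨ wt-drop-descending xs i d ⟩
      wt w xs ∸ i                ≡⟨ m≤n⇒m∸n≡0 le ⟩
      0                          ∎)
      where open ≤-Reasoning

-- Near sorting in two rounds along an expander.

module NearSort where

  open import Data.Nat using (ℕ; zero; suc; NonZero; z≤n)
  import Data.Nat as ℕ
  import Data.Nat.Properties as ℕₚ
  open import Data.Nat.DivMod using (_/_; m/n*n≤m; m≡m%n+[m/n]*n; m%n<n; m*n/n≡m; /-monoˡ-≤)
  import Data.Nat.Tactic.RingSolver as ℕ-Solver
  open import Data.Integer using (ℤ; +_; -_; _+_; _*_; _-_; _≤_; 0ℤ; +≤+)
  import Data.Integer as ℤ
  import Data.Integer.Properties as ℤₚ
  open import Data.Integer.Tactic.RingSolver using (solve-∀)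
  open import Data.List.Base using (List; []; _∷_; _++_; length; take; drop)
  open import Data.List.Properties using (length-take; ++-identityʳ)
  open Integral
  open Expander
  open Sums

  rot-∮ : ∀ {V L} (G : Graph V L) F → ∮ (V ⊗ L) (λ x → F (rot G x)) ≡ ∮ (V ⊗ L) F
  rot-∮ {V} {L} G F = ℤₚ.+-injective (trans (∮-∫ (V ⊗ L) _) (trans (rot-∫ G (λ x → + F x)) (sym (∮-∫ (V ⊗ L) F))))

  wt-drop-++ : ∀ {A : Set} (w : A → ℕ) n xs ys → length xs ℕ.≤ n → wt w (drop n (xs ++ ys)) ℕ.≤ wt w ys
  wt-drop-++ w n [] ys le = wt-drop-≤ w n ys
  wt-drop-++ w (suc n) (x ∷ xs) ys le = wt-drop-++ w n xs ys (ℕ.s≤s⁻¹ le)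

  m<[1+m/n]*n : ∀ m n .{{_ : NonZero n}} → m ℕ.< suc (m / n) ℕ.* n
  m<[1+m/n]*n m n = ℕₚ.≤-<-trans (ℕₚ.≤-reflexive (m≡m%n+[m/n]*n m n)) (ℕₚ.+-monoˡ-< (m / n ℕ.* n) (m%n<n m n))

  -- Two rounds of sorting: the rows of a matrix whose rows are indexed by V, each
  -- of D blocks of K = |Λ| cells; then new rows, row b receiving the ℓ′-th cell of every
  -- block of row a whenever edge (b , ℓ) is (a , ℓ′).  The output is read columnwise.
  module Layers {V Λ : Space} (Γ : Graph V Λ) (D : ℕ) {A : Set} (xs : List A) where

    K = size Λ
    M = size V

    private instance
      K≢0 : NonZero (size Λ)
      K≢0 = size-NonZero Λ

    m = D ℕ.* K

    row₁ : El V → List A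
    row₁ v = take m (drop (idx V v ℕ.* m) xs)

    cells : El (V ⊗ Λ) → List A
    cells (a , ℓ) = collect D (λ c → at (row₁ a) (c ℕ.* K ℕ.+ idx Λ ℓ))

    row₂ : El V → List A
    row₂ b = gather Λ (λ ℓ → cells (rot Γ (b , ℓ)))

    groups₁ groups₂ : List (List A)
    groups₁ = gather V (λ v → row₁ v ∷ [])
    groups₂ = gather V (λ v → row₂ v ∷ [])

    column : ℕ → List A
    column p = gather V (λ b → at (row₂ b) p)

    out : List A
    out = collect m column

    length-row₁ : ∀ v → length (row₁ v) ℕ.≤ m
    length-row₁ v = ℕₚ.≤-trans (ℕₚ.≤-reflexive (length-take m _)) (ℕₚ.m⊓n≤m m _)

    length-row₂ : ∀ b → length (row₂ b) ℕ.≤ m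
    length-row₂ b = begin
      length (row₂ b) ≡⟨ sym (wt-1 (row₂ b)) ⟩
      wt (λ _ → 1) (row₂ b) ≡⟨ wt-gather (λ _ → 1) Λ (λ ℓ → cells (rot Γ (b , ℓ))) ⟩
      ∮ Λ (λ ℓ → wt (λ _ → 1) (cells (rot Γ (b , ℓ)))) ≤⟨ ∮-mono Λ (λ ℓ _ → cells-≤ (rot Γ (b , ℓ))) ⟩
      ∮ Λ (λ _ → D) ≡⟨ ∮-const Λ D ⟩
      K ℕ.* D ≡⟨ ℕₚ.*-comm K D ⟩
      m ∎
      where
      open ℕₚ.≤-Reasoning
      cells-≤ : ∀ x → wt (λ _ → 1) (cells x) ℕ.≤ D
      cells-≤ (a , ℓ) = begin
        wt (λ _ → 1) (cells (a , ℓ)) ≡⟨ wt-collect (λ _ → 1) D (λ c → at (row₁ a) (c ℕ.* K ℕ.+ idx Λ ℓ)) ⟩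
        ∑ D (λ c → wt (λ _ → 1) (at (row₁ a) (c ℕ.* K ℕ.+ idx Λ ℓ))) ≤⟨ ∑-mono D (λ c → wt-at-≤1 (λ _ → 1) (λ _ → ℕₚ.≤-refl) (row₁ a) _) ⟩
        ∑ D (λ _ → 1) ≡⟨ trans (∑-const D 1) (ℕₚ.*-identityʳ D) ⟩
        D ∎

    -- A cell class (a , ℓ) goes to one row only, because `rot` meets every pair once; so nothing is
    -- lost or duplicated between the rounds.
    wt-row₂ : ∀ w → ∮ V (λ b → wt w (row₂ b)) ≡ ∮ V (λ a → wt w (row₁ a))
    wt-row₂ w = begin
      ∮ V (λ b → wt w (row₂ b)) ≡⟨ ∮-cong V (λ b → wt-gather w Λ (λ ℓ → cells (rot Γ (b , ℓ)))) ⟩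
      ∮ (V ⊗ Λ) (λ x → wt w (cells (rot Γ x))) ≡⟨ rot-∮ Γ (λ x → wt w (cells x)) ⟩
      ∮ (V ⊗ Λ) (λ x → wt w (cells x))
        ≡⟨ ∮-cong (V ⊗ Λ) (λ { (a , ℓ) → wt-collect w D (λ c → at (row₁ a) (c ℕ.* K ℕ.+ idx Λ ℓ)) }) ⟩
      ∮ V (λ a → ∮ Λ (λ ℓ → ∑ D (λ c → wt w (at (row₁ a) (c ℕ.* K ℕ.+ idx Λ ℓ)))))
        ≡⟨ ∮-cong V (λ a → trans (∮-∑-swap Λ D _) (∑-cong D (λ c → ∮-idx Λ (λ i → wt w (at (row₁ a) (c ℕ.* K ℕ.+ i)))))) ⟩
      ∮ V (λ a → ∑ D (λ c → ∑ K (λ i → wt w (at (row₁ a) (c ℕ.* K ℕ.+ i)))))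
        ≡⟨ ∮-cong V (λ a → trans (sym (∑-grid D K (λ i → wt w (at (row₁ a) i))))
             (trans (wt-at w m (row₁ a)) (cong (wt w) (take-all m (row₁ a) (length-row₁ a))))) ⟩
      ∮ V (λ a → wt w (row₁ a)) ∎
      where open ≡-Reasoning

    module _ (fits : length xs ℕ.≤ M ℕ.* m) where

      wt-row₁ : ∀ w → ∮ V (λ v → wt w (row₁ v)) ≡ wt w xs
      wt-row₁ w = trans (∮-idx V (λ i → wt w (take m (drop (i ℕ.* m) xs))))
        (trans (wt-chunks w M m xs) (cong (wt w) (take-all (M ℕ.* m) xs fits)))

      wt-out : ∀ w → wt w out ≡ wt w xs
      wt-out w = begin
        wt w out ≡⟨ wt-collect w m column ⟩
        ∑ m (λ p → wt w (column p)) ≡⟨ ∑-cong m (λ p → wt-gather w V (λ b → at (row₂ b) p)) ⟩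
        ∑ m (λ p → ∮ V (λ b → wt w (at (row₂ b) p))) ≡⟨ sym (∮-∑-swap V m (λ b p → wt w (at (row₂ b) p))) ⟩
        ∮ V (λ b → ∑ m (λ p → wt w (at (row₂ b) p)))
          ≡⟨ ∮-cong V (λ b → trans (wt-at w m (row₂ b)) (cong (wt w) (take-all m (row₂ b) (length-row₂ b)))) ⟩
        ∮ V (λ b → wt w (row₂ b)) ≡⟨ wt-row₂ w ⟩
        ∮ V (λ a → wt w (row₁ a)) ≡⟨ wt-row₁ w ⟩
        wt w xs ∎
        where open ≡-Reasoning

      wt-groups₁ : ∀ w → wt (wt w) groups₁ ≡ wt w xs
      wt-groups₁ w = trans (wt-gather (wt w) V (λ v → row₁ v ∷ [])) (trans (∮-cong V (λ v → ℕₚ.+-identityʳ _)) (wt-row₁ w))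

      wt-groups₂ : ∀ w → wt (wt w) groups₂ ≡ wt w xs
      wt-groups₂ w = trans (wt-gather (wt w) V (λ v → row₂ v ∷ [])) (trans (∮-cong V (λ v → ℕₚ.+-identityʳ _)) (trans (wt-row₂ w) (wt-row₁ w)))

      -- The weights mark one 0/1 property of the contents before, between and after the two rounds
      -- of row sorting. Assuming only counts per row and descending order, this is the 0-1
      -- principle for a single threshold.
      module Analysis
        (w₀ w₁ w₂ : A → ℕ) (w₁≤1 : ∀ x → w₁ x ℕ.≤ 1) (w₂≤1 : ∀ x → w₂ x ℕ.≤ 1)
        (keep₁ : ∀ v → In V v → wt w₁ (row₁ v) ≡ wt w₀ (row₁ v))
        (desc₁ : ∀ v → In V v → Descending w₁ (row₁ v))
        (keep₂ : ∀ v → In V v → wt w₂ (row₂ v) ≡ wt w₁ (row₂ v))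
        (desc₂ : ∀ v → In V v → Descending w₂ (row₂ v)) where

        o = wt w₀ xs

        s : El V → ℕ
        s b = wt w₁ (row₂ b)

        ∮-equal : ∀ {f g : El V → ℕ} → (∀ x → In V x → f x ≡ g x) → ∮ V f ≡ ∮ V g
        ∮-equal e = ℕₚ.≤-antisym (∮-mono V (λ x p → ℕₚ.≤-reflexive (e x p))) (∮-mono V (λ x p → ℕₚ.≤-reflexive (sym (e x p))))

        ∮-ones : ∮ V (λ a → wt w₁ (row₁ a)) ≡ o
        ∮-ones = trans (∮-equal keep₁) (wt-row₁ w₀)

        ∮-s : ∮ V s ≡ o
        ∮-s = trans (wt-row₂ w₁) ∮-ones

        length-columns : ∀ p → length (collect p column) ℕ.≤ p ℕ.* M
        length-columns p = begin
          length (collect p column) ≡⟨ sym (wt-1 (collect p column)) ⟩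
          wt (λ _ → 1) (collect p column) ≡⟨ wt-collect (λ _ → 1) p column ⟩
          ∑ p (λ i → wt (λ _ → 1) (column i)) ≡⟨ ∑-cong p (λ i → wt-gather (λ _ → 1) V (λ b → at (row₂ b) i)) ⟩
          ∑ p (λ i → ∮ V (λ b → wt (λ _ → 1) (at (row₂ b) i))) ≤⟨ ∑-mono p (λ i → ∮-mono V (λ b _ → wt-at-≤1 (λ _ → 1) (λ _ → ℕₚ.≤-refl) (row₂ b) i)) ⟩
          ∑ p (λ i → ∮ V (λ b → 1)) ≡⟨ trans (∑-const p _) (cong (p ℕ.*_) (trans (∮-const V 1) (ℕₚ.*-identityʳ M))) ⟩
          p ℕ.* M ∎
          where open ℕₚ.≤-Reasoning

        -- The first P columns fit into the first X output positions, so each row leaves behind only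
        -- its ones in excess of P.
        leftover : ∀ X P → P ℕ.* M ℕ.≤ X → wt w₂ (drop X out) ℕ.≤ ∮ V (λ b → s b ℕ.∸ P)
        leftover X P le with ℕₚ.≤-total m P
        ... | inj₁ m≤P = begin
          wt w₂ (drop X out) ≡⟨ cong (λ z → wt w₂ (drop X z)) (sym (++-identityʳ out)) ⟩
          wt w₂ (drop X (out ++ [])) ≤⟨ wt-drop-++ w₂ X out [] (ℕₚ.≤-trans (length-columns m) (ℕₚ.≤-trans (ℕₚ.*-monoˡ-≤ M m≤P) le)) ⟩
          0 ≤⟨ z≤n ⟩
          ∮ V (λ b → s b ℕ.∸ P) ∎
          where open ℕₚ.≤-Reasoning
        ... | inj₂ P≤m = begin
          wt w₂ (drop X out) ≡⟨ cong (λ z → wt w₂ (drop X z)) (trans (cong (λ z → collect z column) (sym (ℕₚ.m+[n∸m]≡n P≤m))) (collect-split P (m ℕ.∸ P) column)) ⟩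
          wt w₂ (drop X (collect P column ++ collect (m ℕ.∸ P) (λ r → column (P ℕ.+ r))))
            ≤⟨ wt-drop-++ w₂ X (collect P column) _ (ℕₚ.≤-trans (length-columns P) le) ⟩
          wt w₂ (collect (m ℕ.∸ P) (λ r → column (P ℕ.+ r))) ≡⟨ wt-collect w₂ (m ℕ.∸ P) _ ⟩
          ∑ (m ℕ.∸ P) (λ r → wt w₂ (column (P ℕ.+ r))) ≡⟨ ∑-cong (m ℕ.∸ P) (λ r → wt-gather w₂ V (λ b → at (row₂ b) (P ℕ.+ r))) ⟩
          ∑ (m ℕ.∸ P) (λ r → ∮ V (λ b → wt w₂ (at (row₂ b) (P ℕ.+ r)))) ≡⟨ sym (∮-∑-swap V (m ℕ.∸ P) _) ⟩
          ∮ V (λ b → ∑ (m ℕ.∸ P) (λ r → wt w₂ (at (row₂ b) (P ℕ.+ r)))) ≤⟨ ∮-mono V (λ b p → tail b p) ⟩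
          ∮ V (λ b → s b ℕ.∸ P) ∎
          where
          open ℕₚ.≤-Reasoning
          tail : ∀ b → In V b → ∑ (m ℕ.∸ P) (λ r → wt w₂ (at (row₂ b) (P ℕ.+ r))) ℕ.≤ s b ℕ.∸ P
          tail b p = begin
            ∑ (m ℕ.∸ P) (λ r → wt w₂ (at (row₂ b) (P ℕ.+ r))) ≡⟨ ∑-cong (m ℕ.∸ P) (λ r → cong (wt w₂) (at-drop P r (row₂ b))) ⟩
            ∑ (m ℕ.∸ P) (λ r → wt w₂ (at (drop P (row₂ b)) r)) ≡⟨ wt-at w₂ (m ℕ.∸ P) (drop P (row₂ b)) ⟩
            wt w₂ (take (m ℕ.∸ P) (drop P (row₂ b))) ≤⟨ wt-take-≤ w₂ (m ℕ.∸ P) _ ⟩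
            wt w₂ (drop P (row₂ b)) ≤⟨ wt-drop-descending w₂ w₂≤1 (row₂ b) P (desc₂ b p) ⟩
            wt w₂ (row₂ b) ℕ.∸ P ≡⟨ cong (ℕ._∸ P) (keep₂ b p) ⟩
            s b ℕ.∸ P ∎

        h : El V → ℕ
        h a = wt w₁ (row₁ a) / K

        -- In a sorted row with r ones, the cells at a fixed offset in the D blocks contain at most
        -- one more than r / K ones.
        s-bound : ∀ b → In V b → s b ℕ.≤ ∮ Λ (λ ℓ → suc (h (proj₁ (rot Γ (b , ℓ)))))
        s-bound b p = ℕₚ.≤-trans (ℕₚ.≤-reflexive (wt-gather w₁ Λ (λ ℓ → cells (rot Γ (b , ℓ)))))
          (∮-mono Λ (λ ℓ q → cell-bound (rot Γ (b , ℓ)) (proj₁ (rot-In Γ (b , ℓ) (p , q)))))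
          where
          cell-bound : ∀ x → In V (proj₁ x) → wt w₁ (cells x) ℕ.≤ suc (h (proj₁ x))
          cell-bound (a , ℓ) pa = ℕₚ.≤-trans (ℕₚ.≤-reflexive (wt-collect w₁ D _))
            (∑-support D (suc (h a)) _ (λ c → wt-at-≤1 w₁ w₁≤1 (row₁ a) _)
              (λ c le → wt-at-beyond w₁ w₁≤1 (row₁ a) _ (desc₁ a pa)
                (ℕₚ.≤-trans (ℕₚ.<⇒≤ (m<[1+m/n]*n (wt w₁ (row₁ a)) K)) (ℕₚ.≤-trans (ℕₚ.*-monoˡ-≤ K le) (ℕₚ.m≤m+n _ _)))))

        h≤D : ∀ a → h a ℕ.≤ D
        h≤D a = ℕₚ.≤-trans (/-monoˡ-≤ K (ℕₚ.≤-trans (wt-mono w₁≤1 (row₁ a)) (ℕₚ.≤-trans (ℕₚ.≤-reflexive (wt-1 (row₁ a))) (length-row₁ a)))) (ℕₚ.≤-reflexive (m*n/n≡m D K))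

        H = ∫ V (λ a → + h a)

        K*H≤o : + K * H ≤ + o
        K*H≤o = ℤₚ.≤-trans (ℤₚ.≤-reflexive (trans (cong (+ K *_) (sym (∮-∫ V h))) (sym (ℤₚ.pos-* K (∮ V h)))))
          (+≤+ (ℕₚ.≤-trans (ℕₚ.≤-reflexive (sym (∮-* V K h)))
            (ℕₚ.≤-trans (∮-mono V (λ a _ → ℕₚ.≤-trans (ℕₚ.≤-reflexive (ℕₚ.*-comm K (h a))) (m/n*n≤m _ K))) (ℕₚ.≤-reflexive ∮-ones))))

        y : El V → ℤ
        y = adj Γ (dev V (λ a → + h a))

        Y = energy V y

        -- The neighbour sum of `h` is its mean plus the fluctuation `y`, which the expander makes
        -- small. The mean costs at most o because the floors in `h` only lose ones.
        mean-bound : ∀ b → In V b → + M * + s b ≤ (+ M * + K + y b) + + o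
        mean-bound b p = begin
          + M * + s b ≤⟨ *-monoˡ {+ M} (+≤+ z≤n) (+≤+ (s-bound b p)) ⟩
          + M * + ∮ Λ (λ ℓ → suc (h (proj₁ (rot Γ (b , ℓ))))) ≡⟨ cong (+ M *_) (trans (∮-∫ Λ _) (trans (∫-+ Λ (λ _ → + 1) (λ ℓ → + h (proj₁ (rot Γ (b , ℓ))))) (cong (_+ N) (∫-const Λ (+ 1))))) ⟩
          + M * (+ K * + 1 + N) ≡⟨ e (+ M) (+ K) N H ⟩
          (+ M * + K + (+ M * N + + K * (- H))) + + K * H ≡⟨ cong (λ z → (+ M * + K + z) + + K * H) (sym (adj-lin Γ (+ M) (λ a → + h a) (- H) b)) ⟩
          (+ M * + K + y b) + + K * H ≤⟨ ℤₚ.+-monoʳ-≤ (+ M * + K + y b) K*H≤o ⟩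
          (+ M * + K + y b) + + o ∎
          where
          open ℤₚ.≤-Reasoning
          N = adj Γ (λ a → + h a) b
          e : ∀ M K N H → M * (K * + 1 + N) ≡ (M * K + (M * N + K * (- H))) + K * H
          e = solve-∀

        -- A second-moment estimate with free T, from T y ≤ T^2 + y^2. With Q = - T the main term
        -- vanishes and a Chebyshev bound remains, as in `few-left`; a nonnegative Q serves
        -- `balanced`.
        excess-bound : ∀ P T Q → 0ℤ ≤ T → 0ℤ ≤ T * T + T * Q → (+ M * + K + + o) + (- (+ M * + P)) ≤ Q →
                       T * (+ M * + ∮ V (λ b → s b ℕ.∸ P)) ≤ + M * (T * T + T * Q) + Y
        excess-bound P T Q T≥0 TQ≥0 le = begin
          T * (+ M * + ∮ V (λ b → s b ℕ.∸ P)) ≡⟨ cong (λ z → T * (+ M * z)) (∮-∫ V _) ⟩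
          T * (+ M * ∫ V (λ b → + (s b ℕ.∸ P))) ≡⟨ trans (cong (T *_) (sym (∫-* V (+ M) (λ b → + (s b ℕ.∸ P))))) (sym (∫-* V T _)) ⟩
          ∫ V (λ b → T * (+ M * + (s b ℕ.∸ P))) ≤⟨ ∫-mono-In V (λ b p → pointwise′ b p (ℕₚ.≤-total (s b) P)) ⟩
          ∫ V (λ b → (T * T + T * Q) + y b * y b) ≡⟨ trans (∫-+ V (λ _ → T * T + T * Q) (λ b → y b * y b)) (cong (_+ Y) (∫-const V (T * T + T * Q))) ⟩
          + M * (T * T + T * Q) + Y ∎
          where
          open ℤₚ.≤-Reasoning
          ∑ᶻ-mono< : ∀ n {f g : ℕ → ℤ} → (∀ x → x ℕ.< n → f x ≤ g x) → ∑ᶻ n f ≤ ∑ᶻ n g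
          ∑ᶻ-mono< zero e = ℤₚ.≤-refl
          ∑ᶻ-mono< (suc n) e = ℤₚ.+-mono-≤ (∑ᶻ-mono< n (λ x p → e x (ℕₚ.m<n⇒m<1+n p))) (e n ℕₚ.≤-refl)
          ∫-mono-In : ∀ s {f g : El s → ℤ} → (∀ x → In s x → f x ≤ g x) → ∫ s f ≤ ∫ s g
          ∫-mono-In [ n ] e = ∑ᶻ-mono< (suc n) (λ x p → e x (ℕ.s≤s⁻¹ p))
          ∫-mono-In (a ⊗ b) e = ∫-mono-In a (λ x p → ∫-mono-In b (λ y q → e (x , y) (p , q)))
          amgm : ∀ T y → T * y ≤ T * T + y * y
          amgm T y = ℤₚ.*-cancelˡ-≤-pos (T * y) (T * T + y * y) (+ 2) (begin
            + 2 * (T * y) ≤⟨ a≤a+b (ℤₚ.+-mono-≤ (sq-≥0 (T - y)) (ℤₚ.+-mono-≤ (sq-≥0 T) (sq-≥0 y))) ⟩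
            + 2 * (T * y) + ((T - y) * (T - y) + (T * T + y * y)) ≡⟨ e T y ⟩
            + 2 * (T * T + y * y) ∎)
            where
            e : ∀ T y → + 2 * (T * y) + ((T - y) * (T - y) + (T * T + y * y)) ≡ + 2 * (T * T + y * y)
            e = solve-∀
          pointwise′ : ∀ b → In V b → s b ℕ.≤ P ⊎ P ℕ.≤ s b → T * (+ M * + (s b ℕ.∸ P)) ≤ (T * T + T * Q) + y b * y b
          pointwise′ b p (inj₁ sb≤P) = subst (_≤ (T * T + T * Q) + y b * y b)
              (sym (trans (cong (λ z → T * (+ M * + z)) (ℕₚ.m≤n⇒m∸n≡0 sb≤P)) (trans (cong (T *_) (ℤₚ.*-zeroʳ (+ M))) (ℤₚ.*-zeroʳ T))))
              (ℤₚ.+-mono-≤ TQ≥0 (sq-≥0 (y b)))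
          pointwise′ b p (inj₂ P≤sb) = begin
            T * (+ M * + (s b ℕ.∸ P)) ≡⟨ cong (λ z → T * (+ M * z)) (sym (trans (ℤₚ.m-n≡m⊖n (s b) P) (ℤₚ.⊖-≥ P≤sb))) ⟩
            T * (+ M * (+ s b + (- + P))) ≡⟨ cong (T *_) (e₁ (+ M) (+ s b) (+ P)) ⟩
            T * (+ M * + s b + (- (+ M * + P))) ≤⟨ *-monoˡ T≥0 (ℤₚ.+-monoˡ-≤ (- (+ M * + P)) (mean-bound b p)) ⟩
            T * (((+ M * + K + y b) + + o) + (- (+ M * + P))) ≡⟨ cong (T *_) (e₂ (+ M * + K) (y b) (+ o) (- (+ M * + P))) ⟩
            T * (y b + ((+ M * + K + + o) + (- (+ M * + P)))) ≤⟨ *-monoˡ T≥0 (ℤₚ.+-monoʳ-≤ (y b) le) ⟩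
            T * (y b + Q) ≡⟨ ℤₚ.*-distribˡ-+ T (y b) Q ⟩
            T * y b + T * Q ≤⟨ ℤₚ.+-monoˡ-≤ (T * Q) (amgm T (y b)) ⟩
            (T * T + y b * y b) + T * Q ≡⟨ e₃ (T * T) (y b * y b) (T * Q) ⟩
            (T * T + T * Q) + y b * y b ∎
            where
            e₁ : ∀ M s P → M * (s + (- P)) ≡ M * s + (- (M * P))
            e₁ = solve-∀
            e₂ : ∀ a y o p → ((a + y) + o) + p ≡ y + ((a + o) + p)
            e₂ = solve-∀
            e₃ : ∀ a b c → (a + b) + c ≡ (a + c) + b
            e₃ = solve-∀

        module _ (κ : ℕ) (eΓ : Expands Γ (+ κ)) where

          Y-bound : + κ * Y ≤ (+ K * + K) * (+ M * (+ M * energy V (λ a → + h a)))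
          Y-bound = begin
            + κ * Y ≤⟨ bound eΓ (dev V (λ a → + h a)) (∫-dev V (λ a → + h a)) ⟩
            (+ K * + K) * energy V (dev V (λ a → + h a)) ≤⟨ *-monoˡ (sq-≥0 (+ K)) (ℤₚ.≤-trans (b≤a+b (*-≥0 (size-≥0 V) (sq-≥0 H))) (ℤₚ.≤-reflexive (pythagoras V (λ a → + h a)))) ⟩
            (+ K * + K) * (+ M * (+ M * energy V (λ a → + h a))) ∎
            where open ℤₚ.≤-Reasoning

          -- P exceeds the mean o / M by 2 K, so leftover ones come from fluctuations of size M K
          -- alone. The energy of `h` is at most D times its sum, hence at most D o / K, which makes
          -- the bound proportional to the number of ones.
          few-left : ∀ X P → P ℕ.* M ℕ.≤ X → 2 ℕ.* (M ℕ.* K) ℕ.+ o ℕ.≤ M ℕ.* P → κ ℕ.* wt w₂ (drop X out) ℕ.≤ D ℕ.* o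
          few-left X P PM≤X le = ℕₚ.≤-trans (ℕₚ.*-monoʳ-≤ κ (leftover X P PM≤X)) (ℤ.drop‿+≤+ (subst₂ _≤_ (sym (ℤₚ.pos-* κ _)) (sym (ℤₚ.pos-* D o)) main))
            where
            open ℤₚ.≤-Reasoning
            E = + ∮ V (λ b → s b ℕ.∸ P)
            T = + M * + K
            T≥0 : 0ℤ ≤ T
            T≥0 = *-≥0 (size-≥0 V) (size-≥0 Λ)
            energy-h : energy V (λ a → + h a) ≤ + D * H
            energy-h = ℤₚ.≤-trans (∫-mono V (λ a → ℤₚ.*-monoʳ-≤-nonNeg (+ h a) (+≤+ (h≤D a)))) (ℤₚ.≤-reflexive (∫-* V (+ D) (λ a → + h a)))
            le′ : (+ M * + K + + o) + (- (+ M * + P)) ≤ - T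
            le′ = ℤₚ.≤-trans (ℤₚ.+-monoʳ-≤ (T + + o) (ℤₚ.neg-mono-≤ (subst₂ _≤_ (trans (ℤₚ.pos-+ (2 ℕ.* (M ℕ.* K)) o) (cong (_+ + o) (trans (ℤₚ.pos-* 2 (M ℕ.* K)) (cong (+ 2 *_) (ℤₚ.pos-* M K))))) (ℤₚ.pos-* M P) (+≤+ le)))) (ℤₚ.≤-reflexive (e T (+ o)))
              where
              e : ∀ T o → (T + o) + (- (+ 2 * T + o)) ≡ - T
              e = solve-∀
            step : T * (+ M * E) ≤ Y
            step = ℤₚ.≤-trans (excess-bound P T (- T) T≥0 (ℤₚ.≤-reflexive (sym (e₁ T))) le′) (ℤₚ.≤-reflexive (e₂ (+ M) T Y))
              where
              e₁ : ∀ T → T * T + T * (- T) ≡ 0ℤ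
              e₁ = solve-∀
              e₂ : ∀ M T Y → M * (T * T + T * (- T)) + Y ≡ Y
              e₂ = solve-∀
            main : + κ * E ≤ + D * + o
            main = *-cancel V (*-cancel Λ (*-cancel V (begin
              + M * (+ K * (+ M * (+ κ * E))) ≡⟨ e₁ (+ M) (+ K) (+ κ) E ⟩
              + κ * (T * (+ M * E)) ≤⟨ *-monoˡ {+ κ} (+≤+ z≤n) step ⟩
              + κ * Y ≤⟨ Y-bound ⟩
              (+ K * + K) * (+ M * (+ M * energy V (λ a → + h a))) ≤⟨ *-monoˡ (sq-≥0 (+ K)) (*-monoˡ {+ M} (+≤+ z≤n) (*-monoˡ {+ M} (+≤+ z≤n) energy-h)) ⟩
              (+ K * + K) * (+ M * (+ M * (+ D * H))) ≡⟨ e₂ (+ K) (+ M) (+ D) H ⟩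
              (+ M * (+ K * (+ M * + D))) * (+ K * H) ≤⟨ *-monoˡ (*-≥0 (size-≥0 V) (*-≥0 (size-≥0 Λ) (*-≥0 (size-≥0 V) (+≤+ z≤n)))) K*H≤o ⟩
              (+ M * (+ K * (+ M * + D))) * + o ≡⟨ e₃ (+ M) (+ K) (+ D) (+ o) ⟩
              + M * (+ K * (+ M * (+ D * + o))) ∎)))
              where
              e₁ : ∀ M K k E → M * (K * (M * (k * E))) ≡ k * ((M * K) * (M * E))
              e₁ = solve-∀
              e₂ : ∀ K M D H → (K * K) * (M * (M * (D * H))) ≡ (M * (K * (M * D))) * (K * H)
              e₂ = solve-∀
              e₃ : ∀ M K D o → (M * (K * (M * D))) * o ≡ M * (K * (M * (D * o)))
              e₃ = solve-∀

          -- Without room above the mean an additive error is unavoidable. κ ≥ D^2 keeps the mean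
          -- square of `y` within (M K)^2, so rounding and fluctuation together cost a few multiples
          -- of M K.
          balanced : 0 ℕ.< D → D ℕ.* D ℕ.≤ κ → ∀ X P → P ℕ.* M ℕ.≤ X → X ℕ.≤ P ℕ.* M ℕ.+ M →
                     wt w₂ (drop X out) ℕ.≤ (o ℕ.∸ X) ℕ.+ 4 ℕ.* (M ℕ.* K)
          balanced D>0 D²≤κ X P PM≤X X≤ = ℕₚ.≤-trans (leftover X P PM≤X) (ℕₚ.≤-trans (ℤ.drop‿+≤+ main) final)
            where
            open ℤₚ.≤-Reasoning
            E = + ∮ V (λ b → s b ℕ.∸ P)
            T = + M * + K
            q = (M ℕ.* K ℕ.+ o) ℕ.∸ M ℕ.* P
            T≥0 : 0ℤ ≤ T
            T≥0 = *-≥0 (size-≥0 V) (size-≥0 Λ)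
            energy-h : energy V (λ a → + h a) ≤ + M * (+ D * + D)
            energy-h = ℤₚ.≤-trans (∫-mono V (λ a → ℤₚ.≤-trans (*-monoˡ {+ h a} (+≤+ z≤n) (+≤+ (h≤D a))) (ℤₚ.*-monoʳ-≤-nonNeg (+ D) (+≤+ (h≤D a))))) (ℤₚ.≤-reflexive (∫-const V (+ D * + D)))
            Y-small : Y ≤ + M * (T * T)
            Y-small = ℤₚ.*-cancelˡ-≤-pos _ _ (+ (D ℕ.* D)) {{ℤ.positive (ℤ.+<+ (ℕₚ.*-mono-< D>0 D>0))}} (begin
              + (D ℕ.* D) * Y ≤⟨ ℤₚ.*-monoʳ-≤-nonNeg Y {{ℤ.nonNegative (energy-≥0 V y)}} (+≤+ D²≤κ) ⟩
              + κ * Y ≤⟨ Y-bound ⟩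
              (+ K * + K) * (+ M * (+ M * energy V (λ a → + h a))) ≤⟨ *-monoˡ (sq-≥0 (+ K)) (*-monoˡ {+ M} (+≤+ z≤n) (*-monoˡ {+ M} (+≤+ z≤n) energy-h)) ⟩
              (+ K * + K) * (+ M * (+ M * (+ M * (+ D * + D)))) ≡⟨ e₁ (+ K) (+ M) (+ D) ⟩
              (+ D * + D) * (+ M * (T * T)) ≡⟨ cong (_* (+ M * (T * T))) (sym (ℤₚ.pos-* D D)) ⟩
              + (D ℕ.* D) * (+ M * (T * T)) ∎)
              where
              e₁ : ∀ K M D → (K * K) * (M * (M * (M * (D * D)))) ≡ (D * D) * (M * ((M * K) * (M * K)))
              e₁ = solve-∀
            le′ : (+ M * + K + + o) + (- (+ M * + P)) ≤ + q
            le′ = subst (_≤ + q) (cong₂ (λ a b → (a + + o) + (- b)) (ℤₚ.pos-* M K) (ℤₚ.pos-* M P)) (lem (M ℕ.* K ℕ.+ o) (M ℕ.* P))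
              where
              lem : ∀ a b → + a + (- + b) ≤ + (a ℕ.∸ b)
              lem a b with ℕₚ.≤-total a b
              ... | inj₂ b≤a = ℤₚ.≤-reflexive (trans (ℤₚ.m-n≡m⊖n a b) (ℤₚ.⊖-≥ b≤a))
              ... | inj₁ a≤b = ℤₚ.≤-trans (ℤₚ.+-monoˡ-≤ (- + b) (+≤+ a≤b)) (ℤₚ.≤-trans (ℤₚ.≤-reflexive (ℤₚ.+-inverseʳ (+ b))) (+≤+ z≤n))
            main : E ≤ + (2 ℕ.* (M ℕ.* K) ℕ.+ q)
            main = *-cancel V (*-cancel Λ (*-cancel V (begin
              + M * (+ K * (+ M * E)) ≡⟨ e₁ (+ M) (+ K) E ⟩
              T * (+ M * E) ≤⟨ excess-bound P T (+ q) T≥0 (ℤₚ.+-mono-≤ (sq-≥0 T) (*-≥0 T≥0 (+≤+ z≤n))) le′ ⟩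
              + M * (T * T + T * + q) + Y ≤⟨ ℤₚ.+-monoʳ-≤ (+ M * (T * T + T * + q)) Y-small ⟩
              + M * (T * T + T * + q) + + M * (T * T) ≡⟨ e₂ (+ M) (+ K) (+ q) ⟩
              + M * (+ K * (+ M * (+ 2 * (+ M * + K) + + q))) ≡⟨ cong (λ z → + M * (+ K * (+ M * (z + + q)))) (sym (trans (ℤₚ.pos-* 2 (M ℕ.* K)) (cong (+ 2 *_) (ℤₚ.pos-* M K)))) ⟩
              + M * (+ K * (+ M * + (2 ℕ.* (M ℕ.* K) ℕ.+ q))) ∎)))
              where
              e₁ : ∀ M K E → M * (K * (M * E)) ≡ (M * K) * (M * E)
              e₁ = solve-∀
              e₂ : ∀ M K q → M * ((M * K) * (M * K) + (M * K) * q) + M * ((M * K) * (M * K)) ≡ M * (K * (M * (+ 2 * (M * K) + q)))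
              e₂ = solve-∀
            final : 2 ℕ.* (M ℕ.* K) ℕ.+ q ℕ.≤ (o ℕ.∸ X) ℕ.+ 4 ℕ.* (M ℕ.* K)
            final = ℕₚ.≤-trans (ℕₚ.+-monoʳ-≤ (2 ℕ.* (M ℕ.* K)) q≤) (ℕₚ.≤-reflexive (lem (M ℕ.* K) (o ℕ.∸ X)))
              where
              lem : ∀ a b → 2 ℕ.* a ℕ.+ (b ℕ.+ 2 ℕ.* a) ≡ b ℕ.+ 4 ℕ.* a
              lem = ℕ-Solver.solve-∀
              q≤ : q ℕ.≤ (o ℕ.∸ X) ℕ.+ 2 ℕ.* (M ℕ.* K)
              q≤ = ℕₚ.m≤n+o⇒m∸n≤o (M ℕ.* K ℕ.+ o) (M ℕ.* P) (ℕ-bound)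
                where
                module R = ℕₚ.≤-Reasoning
                ℕ-bound : M ℕ.* K ℕ.+ o ℕ.≤ M ℕ.* P ℕ.+ ((o ℕ.∸ X) ℕ.+ 2 ℕ.* (M ℕ.* K))
                ℕ-bound = R.begin
                  M ℕ.* K ℕ.+ o R.≤⟨ ℕₚ.+-monoʳ-≤ (M ℕ.* K) (ℕₚ.m≤n+m∸n o X) ⟩
                  M ℕ.* K ℕ.+ (X ℕ.+ (o ℕ.∸ X)) R.≤⟨ ℕₚ.+-monoʳ-≤ (M ℕ.* K) (ℕₚ.+-monoˡ-≤ (o ℕ.∸ X) X≤) ⟩
                  M ℕ.* K ℕ.+ ((P ℕ.* M ℕ.+ M) ℕ.+ (o ℕ.∸ X)) R.≤⟨ ℕₚ.+-monoʳ-≤ (M ℕ.* K) (ℕₚ.+-monoˡ-≤ (o ℕ.∸ X) (ℕₚ.+-monoʳ-≤ (P ℕ.* M) (ℕₚ.m≤m*n M K))) ⟩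
                  M ℕ.* K ℕ.+ ((P ℕ.* M ℕ.+ M ℕ.* K) ℕ.+ (o ℕ.∸ X)) R.≡⟨ e (M ℕ.* K) P M (o ℕ.∸ X) ⟩
                  M ℕ.* P ℕ.+ ((o ℕ.∸ X) ℕ.+ 2 ℕ.* (M ℕ.* K)) R.∎
                  where
                  e : ∀ a P M b → a ℕ.+ ((P ℕ.* M ℕ.+ a) ℕ.+ b) ≡ M ℕ.* P ℕ.+ (b ℕ.+ 2 ℕ.* a)
                  e = ℕ-Solver.solve-∀

-- Calculus of upper bounds by powers of g.

module PowerBounds where

  open import Data.Nat
  open import Data.Nat.Properties
  open import Data.Nat.Tactic.RingSolver using (solve-∀)
  open Sums

  module Powers (g : ℕ) (g≥8 : 8 ≤ g) where

    -- The inequality a ≤ g ^ (y - x) between rationals.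
    record Bd (a x y : ℕ) : Set where
      constructor bd
      field unbd : a * g ^ x ≤ g ^ y
    open Bd public

    g≥1 : 1 ≤ g
    g≥1 = ≤-trans (s≤s z≤n) g≥8

    g≥2 : 2 ≤ g
    g≥2 = ≤-trans (s≤s (s≤s z≤n)) g≥8

    instance
      g≢0 : NonZero g
      g≢0 = >-nonZero g≥1

    g^>0 : ∀ n → 0 < g ^ n
    g^>0 n = m^n>0 g n

    g^≢0 : ∀ n → NonZero (g ^ n)
    g^≢0 n = >-nonZero (g^>0 n)

    -- The inequality y - x ≤ y′ - x′ is stated with an explicit slack s, as an equation within
    -- reach of the ring solver.
    Bd-shift : ∀ {a x y} x′ y′ s → x′ + y + s ≡ x + y′ → Bd a x y → Bd a x′ y′
    Bd-shift {a} {x} {y} x′ y′ s eq (bd b) = bd (*-cancelʳ-≤ (a * g ^ x′) (g ^ y′) (g ^ x) {{g^≢0 x}} (begin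
      a * g ^ x′ * g ^ x    ≡⟨ lem a (g ^ x′) (g ^ x) ⟩
      a * g ^ x * g ^ x′    ≤⟨ *-monoˡ-≤ (g ^ x′) b ⟩
      g ^ y * g ^ x′        ≡⟨ sym (^-distribˡ-+-* g y x′) ⟩
      g ^ (y + x′)          ≤⟨ ^-monoʳ-≤ g (≤-trans (m≤m+n (y + x′) s) (≤-reflexive (trans (cong (_+ s) (+-comm y x′)) eq))) ⟩
      g ^ (x + y′)          ≡⟨ trans (^-distribˡ-+-* g x y′) (*-comm (g ^ x) (g ^ y′)) ⟩
      g ^ y′ * g ^ x        ∎))
      where
      open ≤-Reasoning
      lem : ∀ a b c → a * b * c ≡ a * c * b
      lem = solve-∀

    Bd-≤ : ∀ {a b x y} → a ≤ b → Bd b x y → Bd a x y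
    Bd-≤ {x = x} le (bd b) = bd (≤-trans (*-monoˡ-≤ (g ^ x) le) b)

    Bd-* : ∀ c {a x y} → c ≤ g → Bd a (suc x) y → Bd (c * a) x y
    Bd-* c {a} {x} le (bd b) = bd (≤-trans (*-monoˡ-≤ (g ^ x) (*-monoˡ-≤ a le)) (≤-trans (≤-reflexive (lem g a (g ^ x))) b))
      where
      lem : ∀ g a x → g * a * x ≡ a * (g * x)
      lem = solve-∀

    Bd-+ : ∀ {a b x y} → Bd a (suc x) y → Bd b (suc x) y → Bd (a + b) x y
    Bd-+ {a} {b} {x} {y} (bd p) (bd q) = bd (*-cancelˡ-≤ 2 (begin
      2 * ((a + b) * g ^ x)                   ≡⟨ lem a b (g ^ x) ⟩
      a * (2 * g ^ x) + b * (2 * g ^ x)       ≤⟨ +-mono-≤ (*-monoʳ-≤ a (*-monoˡ-≤ (g ^ x) g≥2)) (*-monoʳ-≤ b (*-monoˡ-≤ (g ^ x) g≥2)) ⟩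
      a * g ^ suc x + b * g ^ suc x           ≤⟨ +-mono-≤ p q ⟩
      g ^ y + g ^ y                           ≡⟨ cong (λ z → g ^ y + z) (sym (+-identityʳ (g ^ y))) ⟩
      2 * g ^ y                               ∎))
      where
      open ≤-Reasoning
      lem : ∀ a b x → 2 * ((a + b) * x) ≡ a * (2 * x) + b * (2 * x)
      lem = solve-∀

    -- A natural number below 1 is zero; this turns approximate bounds into exact statements once
    -- the exponent is negative.
    Bd-zero : ∀ {a x y} → y < x → Bd a x y → a ≡ 0
    Bd-zero {zero} lt b = refl
    Bd-zero {suc a} {x} {y} lt (bd b) = contradiction (≤-trans (m≤m+n (g ^ x) _) b) (<⇒≱ (^-monoʳ-< g g≥2 lt))

    Bd-vac : ∀ {x y} → Bd 0 x y
    Bd-vac = bd z≤n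

    Bd-scale : ∀ {a b x y} n → a * g ^ n ≤ b → Bd b x y → Bd a (x + n) y
    Bd-scale {a} {b} {x} n le (bd p) = bd (≤-trans (≤-reflexive (trans (cong (a *_) (^-distribˡ-+-* g x n)) (lem a (g ^ x) (g ^ n)))) (≤-trans (*-monoˡ-≤ (g ^ x) le) p))
      where
      lem : ∀ a x n → a * (x * n) ≡ a * n * x
      lem = solve-∀

    Bd-∑ : ∀ n (f : ℕ → ℕ) {x y} → n ≤ g → (∀ i → i < n → Bd (f i) (suc x) y) → Bd (∑ n f) x y
    Bd-∑ n f {x} {y} n≤g b = bd (*-cancelˡ-≤ g (begin
      g * (∑ n f * g ^ x)   ≡⟨ lem g (∑ n f) (g ^ x) ⟩
      ∑ n f * g ^ suc x     ≡⟨ sym (∑-*ʳ n (g ^ suc x) f) ⟩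
      ∑ n (λ i → f i * g ^ suc x) ≤⟨ ∑-mono< n (λ i i<n → unbd (b i i<n)) ⟩
      ∑ n (λ _ → g ^ y)     ≡⟨ ∑-const n (g ^ y) ⟩
      n * g ^ y             ≤⟨ *-monoˡ-≤ (g ^ y) n≤g ⟩
      g * g ^ y             ∎))
      where
      open ≤-Reasoning
      lem : ∀ g a x → g * (a * x) ≡ a * (g * x)
      lem = solve-∀

    Bd-∑^ : ∀ m (f : ℕ → ℕ) {x y} → (∀ i → i < g ^ m → Bd (f i) x y) → Bd (∑ (g ^ m) f) x (m + y)
    Bd-∑^ m f {x} {y} b = bd (begin
      ∑ (g ^ m) f * g ^ x              ≡⟨ sym (∑-*ʳ (g ^ m) (g ^ x) f) ⟩
      ∑ (g ^ m) (λ i → f i * g ^ x)    ≤⟨ ∑-mono< (g ^ m) (λ i i<n → unbd (b i i<n)) ⟩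
      ∑ (g ^ m) (λ _ → g ^ y)          ≡⟨ ∑-const (g ^ m) (g ^ y) ⟩
      g ^ m * g ^ y                    ≡⟨ sym (^-distribˡ-+-* g m y) ⟩
      g ^ (m + y)                      ∎)
      where open ≤-Reasoning

    private
      halving : ∀ n (a : ℕ → ℕ) z → (∀ i → i < n → a i * 2 ^ i ≤ z) → ∑ n a ≤ 2 * z
      halving zero a z b = z≤n
      halving (suc n) a z b = begin
        ∑ (suc n) a                         ≡⟨ ∑-suc n a ⟩
        a 0 + ∑ n (λ i → a (suc i))         ≤⟨ +-mono-≤ (≤-trans (≤-reflexive (sym (*-identityʳ (a 0)))) (b 0 (s≤s z≤n)))
            (*-cancelˡ-≤ 2 (≤-trans (≤-reflexive (sym (∑-* n 2 (λ i → a (suc i))))) (halving n (λ i → 2 * a (suc i)) z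
              (λ i i<n → ≤-trans (≤-reflexive (lem (a (suc i)) (2 ^ i))) (b (suc i) (s≤s i<n)))))) ⟩
        z + z                               ≡⟨ cong (λ y → z + y) (sym (+-identityʳ z)) ⟩
        2 * z                               ∎
        where
        open ≤-Reasoning
        lem : ∀ a p → 2 * a * p ≡ a * (2 * p)
        lem = solve-∀

    -- The ratio g^-6 is the one that arises in `strays-few`; from it the proof extracts a halving
    -- per term, so the sum stays within twice the bound for its first term.
    Bd-geometric : ∀ n (f : ℕ → ℕ) {x y} → (∀ i → i < n → Bd (f i) (suc x + 6 * i) y) → Bd (∑ n f) x y
    Bd-geometric n f {x} {y} b = bd (*-cancelˡ-≤ g (begin
      g * (∑ n f * g ^ x)         ≡⟨ lem g (∑ n f) (g ^ x) ⟩
      ∑ n f * g ^ suc x           ≡⟨ sym (∑-*ʳ n (g ^ suc x) f) ⟩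
      ∑ n (λ i → f i * g ^ suc x) ≤⟨ halving n (λ i → f i * g ^ suc x) (g ^ y) bound ⟩
      2 * g ^ y                   ≤⟨ *-monoˡ-≤ (g ^ y) g≥2 ⟩
      g * g ^ y                   ∎))
      where
      open ≤-Reasoning
      lem : ∀ g a x → g * (a * x) ≡ a * (g * x)
      lem = solve-∀
      bound : ∀ i → i < n → f i * g ^ suc x * 2 ^ i ≤ g ^ y
      bound i i<n = begin
        f i * g ^ suc x * 2 ^ i         ≡⟨ *-assoc (f i) (g ^ suc x) (2 ^ i) ⟩
        f i * (g ^ suc x * 2 ^ i)       ≤⟨ *-monoʳ-≤ (f i) (*-monoʳ-≤ (g ^ suc x) (≤-trans (^-monoˡ-≤ i g≥2) (^-monoʳ-≤ g (m≤n*m i 6)))) ⟩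
        f i * (g ^ suc x * g ^ (6 * i)) ≡⟨ cong (f i *_) (sym (^-distribˡ-+-* g (suc x) (6 * i))) ⟩
        f i * g ^ (suc x + 6 * i)       ≤⟨ unbd (b i i<n) ⟩
        g ^ y                           ∎

    Bd-+₅ : ∀ {a b c d e x y} → Bd a (suc x) y → Bd b (suc x) y → Bd c (suc x) y → Bd d (suc x) y → Bd e (suc x) y →
            Bd (a + (b + (c + (d + e)))) x y
    Bd-+₅ {a} {b} {c} {d} {e} {x} {y} (bd p) (bd q) (bd r) (bd s) (bd t) = bd (*-cancelˡ-≤ g (begin
      g * ((a + (b + (c + (d + e)))) * g ^ x) ≡⟨ lem g a b c d e (g ^ x) ⟩
      a * g ^ suc x + (b * g ^ suc x + (c * g ^ suc x + (d * g ^ suc x + e * g ^ suc x)))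
        ≤⟨ +-mono-≤ p (+-mono-≤ q (+-mono-≤ r (+-mono-≤ s t))) ⟩
      g ^ y + (g ^ y + (g ^ y + (g ^ y + g ^ y))) ≡⟨ lem′ (g ^ y) ⟩
      5 * g ^ y ≤⟨ *-monoˡ-≤ (g ^ y) (≤-trans (m≤m+n 5 3) g≥8) ⟩
      g * g ^ y ∎))
      where
      open ≤-Reasoning
      lem : ∀ g a b c d e x → g * ((a + (b + (c + (d + e)))) * x) ≡ a * (g * x) + (b * (g * x) + (c * (g * x) + (d * (g * x) + e * (g * x))))
      lem = solve-∀
      lem′ : ∀ z → z + (z + (z + (z + z))) ≡ 5 * z
      lem′ = solve-∀

-- Parameters of the near sorter and its two guarantees.

module Separator where

  open import Data.Nat
  open import Data.Nat.Properties
  open import Data.Nat.DivMod using (_/_; m/n*n≤m)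
  open import Data.Nat.Tactic.RingSolver using (solve-∀)
  open import Data.Integer.Base using (+_)
  open import Data.List.Base using (List; []; _∷_; length; drop)
  open Integral hiding (a≤a+b; b≤a+b)
  open Expander
  open ExpanderFamily
  open Sums
  open NearSort

  All-collect⁻ : ∀ {A : Set} {P : A → Set} n {F : ℕ → List A} → All P (collect n F) → ∀ x → x < n → All P (F x)
  All-collect⁻ (suc n) {F} all x x<n with x ≟ n
  ... | yes refl = ++⁻ʳ (collect n F) all
  ... | no x≢n = All-collect⁻ n (++⁻ˡ (collect n F) all) x (≤∧≢⇒< (s≤s⁻¹ x<n) x≢n)

  All-gather⁻ : ∀ {A : Set} {P : A → Set} s {F : El s → List A} → All P (gather s F) → ∀ x → In s x → All P (F x)
  All-gather⁻ [ n ] all x x≤n = All-collect⁻ (suc n) all x (s≤s x≤n)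
  All-gather⁻ (a ⊗ b) all (x , y) (p , q) = All-gather⁻ b (All-gather⁻ a all x p) y q

  All-collect⁺ : ∀ {A : Set} {P : A → Set} n {F : ℕ → List A} → (∀ x → x < n → All P (F x)) → All P (collect n F)
  All-collect⁺ zero f = []
  All-collect⁺ (suc n) f = ++⁺ (All-collect⁺ n (λ x p → f x (m<n⇒m<1+n p))) (f n ≤-refl)

  All-gather⁺ : ∀ {A : Set} {P : A → Set} s {F : El s → List A} → (∀ x → All P (F x)) → All P (gather s F)
  All-gather⁺ [ n ] f = All-collect⁺ (suc n) (λ x _ → f x)
  All-gather⁺ (a ⊗ b) f = All-gather⁺ a (λ x → All-gather⁺ b (λ y → f (x , y)))

  Sorts : ∀ {A : Set} → (A → ℕ) → (A → ℕ) → List A → Set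
  Sorts w w′ xs = wt w′ xs ≡ wt w xs × Descending w′ xs

  size-tower : ∀ W s → size (tower W s) ≡ size W ^ s
  size-tower W zero = refl
  size-tower W (suc s) = trans (cong (_* size W) (size-tower W s)) (*-comm (size W ^ s) (size W))

  n≤b^n : ∀ {b} → 1 < b → ∀ n → n ≤ b ^ n
  n≤b^n b>1 zero = z≤n
  n≤b^n {b} b>1 (suc n) = begin
    suc n         ≤⟨ +-mono-≤ {1} (m^n>0 b {{>-nonZero (<⇒≤ b>1)}} n) (n≤b^n b>1 n) ⟩
    b ^ n + b ^ n ≡⟨ cong (λ z → b ^ n + z) (sym (+-identityʳ (b ^ n))) ⟩
    2 * b ^ n     ≤⟨ *-monoˡ-≤ (b ^ n) b>1 ⟩
    b * b ^ n     ∎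
    where open ≤-Reasoning

  module _ (m B : ℕ) where

    private
      find : ∀ c n → c ≤ B ^ n * m → Σ[ s ∈ ℕ ] (c ≤ B ^ s * m × (s ≡ 0 ⊎ B ^ s * m ≤ B * c))
      find c zero le = 0 , le , inj₁ refl
      find c (suc n) le with c ≤? B ^ n * m
      ... | yes le′ = find c n le′
      ... | no ≰ = suc n , le , inj₂ (≤-trans (≤-reflexive (*-assoc B (B ^ n) m)) (*-monoʳ-≤ B (<⇒≤ (≰⇒> ≰))))

    -- Vertex numbers are powers of B, so the matrix exceeds the list by at most a factor B, unless
    -- a single row is enough.
    depth : 1 < B → 0 < m → ∀ c → Σ[ s ∈ ℕ ] (c ≤ B ^ s * m × (s ≡ 0 ⊎ B ^ s * m ≤ B * c))
    depth B>1 m>0 c = find c c (≤-trans (n≤b^n B>1 c) (m≤m*n (B ^ c) m {{>-nonZero m>0}}))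

  -- D = g^18 is the filtering factor. The 36 p-th power of a graph of expansion 4 has expansion
  -- 4^(36 p) = D^2, as `balanced` asks.
  module Params (fam : Family) (p : ℕ) where
    open Family fam

    B g D κ K m : ℕ
    B = size W
    g = 4 ^ p
    D = g ^ 18
    κ = 4 ^ (p * 36)
    Λ = power (p * 36) L
    K = size Λ
    m = D * K

    κ≡ : κ ≡ D * D
    κ≡ = trans (sym (^-*-assoc 4 p 36)) (^-distribˡ-+-* g 18 18)

  module NearSorter (fam : Family) (p : ℕ) (B>1 : 1 < size (Family.W fam)) (g-large : 6 * size (Family.W fam) ≤ 4 ^ p) where
    open Family fam
    open Params fam p public

    g>0 : 0 < g
    g>0 = m^n>0 4 p

    D>0 : 0 < D
    D>0 = m^n>0 g {{>-nonZero g>0}} 18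

    K>0 : 0 < K
    K>0 = >-nonZero⁻¹ K {{size-NonZero Λ}}

    m>0 : 0 < m
    m>0 = *-mono-< D>0 K>0

    private module Impl {A : Set} (xs : List A) where
      private
        c = length xs
        found = depth m B B>1 m>0 c
        s = proj₁ found
        V = tower W s
        Γ : Graph V Λ
        Γ = pow (graph s) (p * 36)
        M = size V
        module 𝓛 = Layers Γ D xs
        fits : c ≤ M * m
        fits = subst (λ z → c ≤ z * m) (sym (size-tower W s)) (proj₁ (proj₂ found))
        instance
          M≢0 : NonZero M
          M≢0 = size-NonZero V

      nearSort₁ nearSort₂ : List (List A)
      nearSort₁ = 𝓛.groups₁
      nearSort₂ = 𝓛.groups₂

      nearSorted : List A
      nearSorted = 𝓛.out

      wt-nearSort₁ : ∀ w → wt (wt w) nearSort₁ ≡ wt w xs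
      wt-nearSort₁ = 𝓛.wt-groups₁ fits

      wt-nearSort₂ : ∀ w → wt (wt w) nearSort₂ ≡ wt w xs
      wt-nearSort₂ = 𝓛.wt-groups₂ fits

      wt-nearSorted : ∀ w → wt w nearSorted ≡ wt w xs
      wt-nearSorted = 𝓛.wt-out fits

      small₁ : All (λ ys → length ys ≤ m) nearSort₁
      small₁ = All-gather⁺ V (λ v → 𝓛.length-row₁ v ∷ [])

      small₂ : All (λ ys → length ys ≤ m) nearSort₂
      small₂ = All-gather⁺ V (λ v → 𝓛.length-row₂ v ∷ [])

      module _ (w₀ w₁ w₂ : A → ℕ) (w₁≤1 : ∀ x → w₁ x ≤ 1) (w₂≤1 : ∀ x → w₂ x ≤ 1)
               (sorts₁ : All (Sorts w₀ w₁) nearSort₁) (sorts₂ : All (Sorts w₁ w₂) nearSort₂) where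

        private
          row-sorts₁ : ∀ v → In V v → Sorts w₀ w₁ (𝓛.row₁ v)
          row-sorts₁ v q = All.head (All-gather⁻ V sorts₁ v q)
          row-sorts₂ : ∀ v → In V v → Sorts w₁ w₂ (𝓛.row₂ v)
          row-sorts₂ v q = All.head (All-gather⁻ V sorts₂ v q)
          module 𝓐 = 𝓛.Analysis fits w₀ w₁ w₂ w₁≤1 w₂≤1
            (λ v q → proj₁ (row-sorts₁ v q)) (λ v q → proj₂ (row-sorts₁ v q))
            (λ v q → proj₁ (row-sorts₂ v q)) (λ v q → proj₂ (row-sorts₂ v q))
          o = wt w₀ xs

          -- With one vertex the matrix is a single row, and the output is sorted exactly.
          single : s ≡ 0 → ∀ X → wt w₂ (drop X nearSorted) ≤ o ∸ X
          single s≡0 X = ≤-trans (𝓐.leftover X X (≤-reflexive (trans (cong (X *_) (cong (λ z → size (tower W z)) s≡0)) (*-identityʳ X)))) (one s≡0 𝓐.s 𝓐.∮-s)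
            where
            one : ∀ {s} → s ≡ 0 → (f : El (tower W s) → ℕ) → ∮ (tower W s) f ≡ o → ∮ (tower W s) (λ b → f b ∸ X) ≤ o ∸ X
            one refl f e = ≤-reflexive (cong (_∸ X) e)

          spread : ℕ
          spread = M * K

          spread-bound : B ^ s * m ≤ B * c → spread * D ≤ B * c
          spread-bound le = ≤-trans (≤-reflexive (trans (lem M K D) (cong (_* m) (size-tower W s)))) le
            where
            lem : ∀ a b c → a * b * c ≡ a * (c * b)
            lem = solve-∀

          dense : Expands Γ (+ κ)
          dense = pow-expands (graph s) (expands s) (p * 36)

          quotient : ∀ X → X ≤ X / M * M + M
          quotient X = <⇒≤ (<-≤-trans (m<[1+m/n]*n X M) (≤-reflexive (+-comm M (X / M * M))))

        -- When the ones fill at most half of F, the cut is far enough above their mean number per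
        -- row for `few-left`. Of the 18 factors g, one pays for 6 B, hence g ^ 17 in the
        -- hypothesis.
        extract : ∀ F X → F ≤ X → c ≤ g ^ 17 * F → 2 * o ≤ F → wt w₂ (drop X nearSorted) * g ^ 18 ≤ o
        extract F X F≤X c≤ 2o≤F = by (proj₂ (proj₂ found))
          where
          open ≤-Reasoning
          by : s ≡ 0 ⊎ B ^ s * m ≤ B * c → wt w₂ (drop X nearSorted) * g ^ 18 ≤ o
          by (inj₁ s≡0) = ≤-trans (*-monoˡ-≤ (g ^ 18) (≤-trans (single s≡0 X) (≤-reflexive (m≤n⇒m∸n≡0 (≤-trans (m≤n*m o 2) (≤-trans 2o≤F F≤X)))))) z≤n
          by (inj₂ le) = *-cancelʳ-≤ (wt w₂ (drop X nearSorted) * g ^ 18) o D {{>-nonZero D>0}} (begin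
            wt w₂ (drop X nearSorted) * D * D ≡⟨ trans (*-assoc (wt w₂ (drop X nearSorted)) D D) (trans (cong (wt w₂ (drop X nearSorted) *_) (sym κ≡)) (*-comm (wt w₂ (drop X nearSorted)) κ)) ⟩
            κ * wt w₂ (drop X nearSorted) ≤⟨ 𝓐.few-left κ dense X (X / M) (m/n*n≤m X M) room ⟩
            D * o ≡⟨ *-comm D o ⟩
            o * D ∎)
            where
            spread≤ : 6 * spread ≤ F
            spread≤ = *-cancelʳ-≤ (6 * spread) F (B * g ^ 17) {{m*n≢0 B (g ^ 17) {{>-nonZero (<⇒≤ B>1)}} {{>-nonZero (m^n>0 g {{>-nonZero g>0}} 17)}}}} (begin
              6 * spread * (B * g ^ 17) ≡⟨ e₁ spread B (g ^ 17) ⟩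
              6 * B * (spread * g ^ 17) ≤⟨ *-monoˡ-≤ (spread * g ^ 17) g-large ⟩
              g * (spread * g ^ 17) ≡⟨ e₂ g spread (g ^ 17) ⟩
              spread * D ≤⟨ spread-bound le ⟩
              B * c ≤⟨ *-monoʳ-≤ B c≤ ⟩
              B * (g ^ 17 * F) ≡⟨ e₃ B (g ^ 17) F ⟩
              F * (B * g ^ 17) ∎)
              where
              e₁ : ∀ s b x → 6 * s * (b * x) ≡ 6 * b * (s * x)
              e₁ = solve-∀
              e₂ : ∀ g s x → g * (s * x) ≡ s * (g * x)
              e₂ = solve-∀
              e₃ : ∀ b x F → b * (x * F) ≡ F * (b * x)
              e₃ = solve-∀
            -- Rounding X down to a multiple of M loses at most M, which is at most `spread`;
            -- doubling 2 + 1 yields the 6 of `g-large`.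
            room : 2 * spread + o ≤ M * (X / M)
            room = +-cancelʳ-≤ M (2 * spread + o) (M * (X / M)) (*-cancelˡ-≤ 2 (begin
              2 * (2 * spread + o + M) ≤⟨ *-monoʳ-≤ 2 (+-monoʳ-≤ (2 * spread + o) (m≤m*n M K {{>-nonZero K>0}})) ⟩
              2 * (2 * spread + o + spread) ≡⟨ e spread o ⟩
              6 * spread + 2 * o ≤⟨ +-mono-≤ spread≤ 2o≤F ⟩
              F + F ≡⟨ cong (λ z → F + z) (sym (+-identityʳ F)) ⟩
              2 * F ≤⟨ *-monoʳ-≤ 2 (≤-trans F≤X (≤-trans (quotient X) (≤-reflexive (cong (_+ M) (*-comm (X / M) M))))) ⟩
              2 * (M * (X / M) + M) ∎))
              where
              e : ∀ s o → 2 * (2 * s + o + s) ≡ 6 * s + 2 * o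
              e = solve-∀

        balance : ∀ X → Σ[ e ∈ ℕ ] (wt w₂ (drop X nearSorted) ≤ (o ∸ X) + e × e * g ^ 17 ≤ c)
        balance X = by (proj₂ (proj₂ found))
          where
          open ≤-Reasoning
          by : s ≡ 0 ⊎ B ^ s * m ≤ B * c → Σ[ e ∈ ℕ ] (wt w₂ (drop X nearSorted) ≤ (o ∸ X) + e × e * g ^ 17 ≤ c)
          by (inj₁ s≡0) = 0 , ≤-trans (single s≡0 X) (m≤m+n _ 0) , z≤n
          by (inj₂ le) = 4 * spread , 𝓐.balanced κ dense D>0 (≤-reflexive (sym κ≡)) X (X / M) (m/n*n≤m X M) (quotient X) ,
            *-cancelˡ-≤ (6 * B) {{m*n≢0 6 B {{_}} {{>-nonZero (<⇒≤ B>1)}}}} (begin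
              6 * B * (4 * spread * g ^ 17) ≤⟨ *-monoˡ-≤ (4 * spread * g ^ 17) g-large ⟩
              g * (4 * spread * g ^ 17) ≡⟨ e₁ g spread (g ^ 17) ⟩
              4 * (spread * D) ≤⟨ *-monoʳ-≤ 4 (spread-bound le) ⟩
              4 * (B * c) ≤⟨ *-monoˡ-≤ (B * c) {4} {6} (m≤m+n 4 2) ⟩
              6 * (B * c) ≡⟨ sym (*-assoc 6 B c) ⟩
              6 * B * c ∎)
            where
            e₁ : ∀ g s x → g * (4 * s * x) ≡ 4 * (s * (g * x))
            e₁ = solve-∀

    opaque
      nearSort₁ nearSort₂ : {A : Set} → List A → List (List A)
      nearSort₁ = Impl.nearSort₁
      nearSort₂ = Impl.nearSort₂

      nearSorted : {A : Set} → List A → List A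
      nearSorted = Impl.nearSorted

      wt-nearSort₁ : ∀ {A : Set} (xs : List A) w → wt (wt w) (nearSort₁ xs) ≡ wt w xs
      wt-nearSort₁ = Impl.wt-nearSort₁

      wt-nearSort₂ : ∀ {A : Set} (xs : List A) w → wt (wt w) (nearSort₂ xs) ≡ wt w xs
      wt-nearSort₂ = Impl.wt-nearSort₂

      wt-nearSorted : ∀ {A : Set} (xs : List A) w → wt w (nearSorted xs) ≡ wt w xs
      wt-nearSorted = Impl.wt-nearSorted

      small₁ : ∀ {A : Set} (xs : List A) → All (λ ys → length ys ≤ m) (nearSort₁ xs)
      small₁ = Impl.small₁

      small₂ : ∀ {A : Set} (xs : List A) → All (λ ys → length ys ≤ m) (nearSort₂ xs)
      small₂ = Impl.small₂

    record NearSorting {A : Set} (xs : List A) (w₀ w₁ w₂ : A → ℕ) : Set where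
      field
        w₁≤1   : ∀ x → w₁ x ≤ 1
        w₂≤1   : ∀ x → w₂ x ≤ 1
        sorts₁ : All (Sorts w₀ w₁) (nearSort₁ xs)
        sorts₂ : All (Sorts w₁ w₂) (nearSort₂ xs)

    opaque
      unfolding nearSort₁ nearSort₂ nearSorted

      extract : ∀ {A : Set} (xs : List A) {w₀ w₁ w₂} → NearSorting xs w₀ w₁ w₂ → ∀ F X → F ≤ X →
                length xs ≤ g ^ 17 * F → 2 * wt w₀ xs ≤ F → wt w₂ (drop X (nearSorted xs)) * g ^ 18 ≤ wt w₀ xs
      extract xs {w₀} {w₁} {w₂} s = Impl.extract xs w₀ w₁ w₂ w₁≤1 w₂≤1 sorts₁ sorts₂
        where open NearSorting s

      balance : ∀ {A : Set} (xs : List A) {w₀ w₁ w₂} → NearSorting xs w₀ w₁ w₂ → ∀ X →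
                Σ[ e ∈ ℕ ] (wt w₂ (drop X (nearSorted xs)) ≤ (wt w₀ xs ∸ X) + e × e * g ^ 17 ≤ length xs)
      balance xs {w₀} {w₁} {w₂} s = Impl.balance xs w₀ w₁ w₂ w₁≤1 w₂≤1 sorts₁ sorts₂
        where open NearSorting s

-- Sizes of the bags over time.

module BagSizes where

  open import Data.Nat hiding (parity)
  open import Data.Nat.Properties
  open import Data.Nat.DivMod using (_/_; _%_; m/n*n≤m; m≡m%n+[m/n]*n; m%n<n; m*n/n≡m)
  open import Data.Nat.Divisibility using (_∣_; divides; ∣m+n∣m⇒∣n; m∣m*n; n∣m⇒m%n≡0)
  open import Data.Nat.Tactic.RingSolver using (solve-∀)
  open import Data.Bool.Properties using (not-involutive)
  open Sums

  -- A bag on level i holds sz t i registers at time t; it passes w t i of them to each of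
  -- its g children and the remaining up t i, among them F t i extreme ones at either end,
  -- to its parent.  Its capacity is g ^ (k + 12 i - t).
  module Sizes (g k : ℕ) (g≥8 : 8 ≤ g) (k≥2 : 2 ≤ k) where
    open PowerBounds.Powers g g≥8 public

    -- The fringe is g ^ 17 times smaller than the capacity. Where this would fall below g the bag
    -- is closed and has none; nor does the root, to which no rank is foreign.
    F : ℕ → ℕ → ℕ
    F t zero = 0
    F t (suc i) = if does (t + 18 ≤? k + 12 * suc i) then g ^ ((k + 12 * suc i) ∸ (t + 17)) else 0

    w up sz fromParent fromKids : ℕ → ℕ → ℕ
    w t i = if does (i <? k) then (sz t i ∸ 2 * F t i) / g else 0
    up t i = sz t i ∸ g * w t i
    sz zero zero = g ^ k
    sz zero (suc i) = 0
    sz (suc t) i = fromParent t i + fromKids t i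
    -- The root is its own parent; `up-closed` shows that it never sends anything up.
    fromParent t zero = up t 0
    fromParent t (suc i) = w t i
    fromKids t i = if does (i <? k) then g * up t (suc i) else 0

    w-< : ∀ t {i} → i < k → w t i ≡ (sz t i ∸ 2 * F t i) / g
    w-< t {i} i<k = cong (λ b → if b then (sz t i ∸ 2 * F t i) / g else 0) (dec-true (i <? k) i<k)

    w-≮ : ∀ t {i} → ¬ i < k → w t i ≡ 0
    w-≮ t {i} i≮k = cong (λ b → if b then (sz t i ∸ 2 * F t i) / g else 0) (dec-false (i <? k) i≮k)

    w-k : ∀ t → w t k ≡ 0
    w-k t = w-≮ t (n≮n k)

    fromKids-< : ∀ t {i} → i < k → fromKids t i ≡ g * up t (suc i)
    fromKids-< t {i} i<k = cong (λ b → if b then g * up t (suc i) else 0) (dec-true (i <? k) i<k)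

    fromKids-≮ : ∀ t {i} → ¬ i < k → fromKids t i ≡ 0
    fromKids-≮ t {i} i≮k = cong (λ b → if b then g * up t (suc i) else 0) (dec-false (i <? k) i≮k)

    fromKids-k : ∀ t → fromKids t k ≡ 0
    fromKids-k t = fromKids-≮ t (n≮n k)

    F-open : ∀ t i → 1 ≤ i → t + 18 ≤ k + 12 * i → F t i ≡ g ^ ((k + 12 * i) ∸ (t + 17))
    F-open t (suc i) _ le = cong (λ b → if b then g ^ ((k + 12 * suc i) ∸ (t + 17)) else 0) (dec-true (t + 18 ≤? k + 12 * suc i) le)

    F-closed : ∀ t i → k + 12 * i < t + 18 → F t i ≡ 0
    F-closed t zero lt = refl
    F-closed t (suc i) lt = cong (λ b → if b then g ^ ((k + 12 * suc i) ∸ (t + 17)) else 0) (dec-false (t + 18 ≤? k + 12 * suc i) (<⇒≱ lt))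

    F-scale : ∀ t i → 1 ≤ i → t + 18 ≤ k + 12 * i → F t i * g ^ (t + 17) ≡ g ^ (k + 12 * i)
    F-scale t i i≥1 le = trans (cong (_* g ^ (t + 17)) (F-open t i i≥1 le))
      (trans (sym (^-distribˡ-+-* g ((k + 12 * i) ∸ (t + 17)) (t + 17))) (cong (g ^_) (m∸n+n≡m (≤-trans (+-monoʳ-≤ t (n≤1+n 17)) le))))

    F-≥g : ∀ t i → 1 ≤ i → t + 18 ≤ k + 12 * i → g ≤ F t i
    F-≥g t i i≥1 le = subst (g ≤_) (sym (F-open t i i≥1 le)) (≤-trans (≤-reflexive (sym (^-identityʳ g)))
      (^-monoʳ-≤ g {1} (m+n≤o⇒n≤o∸m (t + 17) (≤-trans (≤-reflexive (+-assoc t 17 1)) le))))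
      where
      m+n≤o⇒n≤o∸m : ∀ m {n o} → m + n ≤ o → n ≤ o ∸ m
      m+n≤o⇒n≤o∸m m {n} le = m+n≤o⇒m≤o∸n n (≤-trans (≤-reflexive (+-comm n m)) le)

    g*w≤ : ∀ t i → g * w t i + 2 * F t i ≤ sz t i ⊎ w t i ≡ 0
    g*w≤ t i with i <? k
    ... | no i≮k = inj₂ (w-≮ t i≮k)
    ... | yes i<k with ≤-total (2 * F t i) (sz t i)
    ...   | inj₂ ≥ = inj₂ (trans (w-< t i<k) (trans (cong (_/ g) (m≤n⇒m∸n≡0 ≥)) (m*n/n≡m 0 g)))
    ...   | inj₁ ≤ = inj₁ (≤-trans (+-monoˡ-≤ (2 * F t i) (≤-trans (≤-reflexive (trans (*-comm g (w t i)) (cong (_* g) (w-< t i<k)))) (m/n*n≤m (sz t i ∸ 2 * F t i) g))) (≤-reflexive (m∸n+n≡m ≤)))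

    g*w≤sz : ∀ t i → g * w t i ≤ sz t i
    g*w≤sz t i with g*w≤ t i
    ... | inj₁ le = m+n≤o⇒m≤o (g * w t i) le
    ... | inj₂ e = subst (_≤ sz t i) (sym (trans (cong (g *_) e) (*-zeroʳ g))) z≤n

    sz≡ : ∀ t i → g * w t i + up t i ≡ sz t i
    sz≡ t i = m+[n∸m]≡n (g*w≤sz t i)

    up-< : ∀ t i → i < k → up t i ≤ 2 * F t i + g
    up-< t i i<k = +-cancelˡ-≤ (g * w t i) _ _ (begin
      g * w t i + up t i ≡⟨ sz≡ t i ⟩
      sz t i ≤⟨ m≤n+m∸n (sz t i) (2 * F t i) ⟩
      2 * F t i + (sz t i ∸ 2 * F t i) ≤⟨ +-monoʳ-≤ (2 * F t i) (<⇒≤ bound) ⟩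
      2 * F t i + (g + g * w t i) ≡⟨ lem (2 * F t i) g (g * w t i) ⟩
      g * w t i + (2 * F t i + g) ∎)
      where
      open ≤-Reasoning
      bound : sz t i ∸ 2 * F t i < g + g * w t i
      bound = <-≤-trans (≤-<-trans (≤-reflexive (m≡m%n+[m/n]*n (sz t i ∸ 2 * F t i) g)) (+-monoˡ-< ((sz t i ∸ 2 * F t i) / g * g) (m%n<n (sz t i ∸ 2 * F t i) g)))
        (≤-reflexive (cong (λ z → g + z) (trans (*-comm _ g) (cong (g *_) (sym (w-< t i<k))))))
      lem : ∀ a b c → a + (b + c) ≡ c + (a + b)
      lem = solve-∀

    par : ℕ → Bool
    par zero = false
    par (suc n) = not (par n)

    -- `parity`: every register changes its level by one at each step, starting at the root.
    -- `closed`: a level whose capacity has shrunk to 1 is empty, the last two levels excepted.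
    record Inv (t : ℕ) : Set where
      field
        total  : ∑ (suc k) (λ i → g ^ i * sz t i) ≡ g ^ k
        parity : ∀ i → par (t + i) ≡ true → sz t i ≡ 0
        closed : ∀ j → suc j < k → k + 12 * j ≤ t → sz t j ≡ 0
        cap    : ∀ i → i ≤ k → Bd (sz t i) t (k + 12 * i)
    open Inv public

    private
      par-suc : ∀ t j → par (t + suc j) ≡ not (par (t + j))
      par-suc t j = cong par (+-suc t j)

      even-odd : ∀ {b} → b ≢ true → not b ≡ true
      even-odd {true} ne = contradiction refl ne
      even-odd {false} ne = refl

    module _ {t : ℕ} (I : Inv t) where

      sz-leaf : sz t k ≤ 1
      sz-leaf = *-cancelˡ-≤ (g ^ k) {{g^≢0 k}} (≤-trans (∑-≥ (suc k) k (λ i → g ^ i * sz t i) ≤-refl)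
        (≤-reflexive (trans (total I) (sym (*-identityʳ (g ^ k))))))

      -- The level next to i has the wrong parity; those nearer the root have a capacity smaller by
      -- at least g^24 and are already empty.
      lower-empty : ∀ i → i < k → k + 12 * i < t + 18 → sz t i ≢ 0 → ∀ j → j < i → sz t j ≡ 0
      lower-empty i i<k lt ne j j<i with suc j ≟ i
      ... | yes refl = parity I j (flip (even-odd {par (t + suc j)} (λ e → ne (parity I i e))))
        where
        flip : not (par (t + suc j)) ≡ true → par (t + j) ≡ true
        flip e = trans (sym (not-involutive _)) (trans (cong not (sym (par-suc t j))) e)
      ... | no sj≢i = closed I j (<-trans j+1<i i<k) (+-cancelʳ-≤ 24 _ _ (begin
          k + 12 * j + 24     ≡⟨ lem k j ⟩
          k + 12 * (2 + j)    ≤⟨ +-monoʳ-≤ k (*-monoʳ-≤ 12 j+1<i) ⟩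
          k + 12 * i          ≤⟨ <⇒≤ lt ⟩
          t + 18              ≤⟨ +-monoʳ-≤ t (m≤m+n 18 6) ⟩
          t + 24              ∎))
        where
        open ≤-Reasoning
        j+1<i : suc j < i
        j+1<i = ≤∧≢⇒< j<i sj≢i
        lem : ∀ k j → k + 12 * j + 24 ≡ k + 12 * (2 + j)
        lem = solve-∀

      -- With nothing nearer the root, the total g^k is g^i sz t i plus a multiple of g^(i + 1), and
      -- i < k.
      g∣sz : ∀ i → i < k → (∀ j → j < i → sz t j ≡ 0) → g ∣ sz t i
      g∣sz i i<k z = ∣m+n∣m⇒∣n (subst (g ∣_) (sym sum≡) (m∣m*n (g ^ (k ∸ suc i)))) (m∣m*n S)
        where
        r = k ∸ suc i
        S = ∑ (suc r) (λ j → g ^ j * sz t (i + suc j))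
        f : ℕ → ℕ
        f j = g ^ j * sz t j
        suck≡ : suc k ≡ i + suc (suc r)
        suck≡ = trans (cong suc (sym (m+[n∸m]≡n i<k))) (lem i r)
          where
          lem : ∀ i r → suc (suc i + r) ≡ i + suc (suc r)
          lem = solve-∀
        sum≡ : g * S + sz t i ≡ g * g ^ r
        sum≡ = *-cancelˡ-≡ _ _ (g ^ i) {{g^≢0 i}} (begin
          g ^ i * (g * S + sz t i) ≡⟨ lem (g ^ i) g S (sz t i) ⟩
          g ^ i * sz t i + g ^ i * g * S ≡⟨ cong₂ _+_ (cong f (sym (+-identityʳ i))) (sym (∑-* (suc r) (g ^ i * g) _)) ⟩
          f (i + 0) + ∑ (suc r) (λ j → g ^ i * g * (g ^ j * sz t (i + suc j)))
            ≡⟨ cong (λ z → f (i + 0) + z) (∑-cong (suc r) (λ j → trans (lem′ (g ^ i) g (g ^ j) (sz t (i + suc j)))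
                 (cong (_* sz t (i + suc j)) (sym (^-distribˡ-+-* g i (suc j)))))) ⟩
          f (i + 0) + ∑ (suc r) (λ j → f (i + suc j)) ≡⟨ sym (∑-suc (suc r) (λ j → f (i + j))) ⟩
          ∑ (suc (suc r)) (λ j → f (i + j)) ≡⟨ cong (_+ ∑ (suc (suc r)) (λ j → f (i + j))) (sym (∑-zero i (λ j j<i → trans (cong (g ^ j *_) (z j j<i)) (*-zeroʳ (g ^ j))))) ⟩
          ∑ i f + ∑ (suc (suc r)) (λ j → f (i + j)) ≡⟨ sym (∑-split i (suc (suc r)) f) ⟩
          ∑ (i + suc (suc r)) f ≡⟨ cong (λ z → ∑ z f) (sym suck≡) ⟩
          ∑ (suc k) f ≡⟨ total I ⟩
          g ^ k ≡⟨ cong (g ^_) (trans (sym (m+[n∸m]≡n i<k)) (sym (+-suc i r))) ⟩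
          g ^ (i + suc r) ≡⟨ ^-distribˡ-+-* g i (suc r) ⟩
          g ^ i * (g * g ^ r) ∎)
          where
          open ≡-Reasoning
          lem : ∀ a g S s → a * (g * S + s) ≡ a * s + a * g * S
          lem = solve-∀
          lem′ : ∀ a g b s → a * g * (b * s) ≡ a * (g * b) * s
          lem′ = solve-∀

      -- Without a fringe only the remainder modulo g could go up, and divisibility of the size
      -- leaves no remainder.
      up-closed : ∀ i → i < k → i ≡ 0 ⊎ k + 12 * i < t + 18 → up t i ≡ 0
      up-closed i i<k c = trans (cong (sz t i ∸_) (trans (*-comm g (w t i)) w*g)) (n∸n≡0 (sz t i))
        where
        F≡0 : ∀ i → i ≡ 0 ⊎ k + 12 * i < t + 18 → F t i ≡ 0
        F≡0 i (inj₁ refl) = refl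
        F≡0 i (inj₂ lt) = F-closed t i lt
        low : ∀ i → i < k → i ≡ 0 ⊎ k + 12 * i < t + 18 → sz t i ≢ 0 → ∀ j → j < i → sz t j ≡ 0
        low i i<k (inj₁ refl) ne j ()
        low i i<k (inj₂ lt) ne = lower-empty i i<k lt ne
        div : g ∣ sz t i
        div with sz t i ≟ 0
        ... | yes e = subst (g ∣_) (sym e) (divides 0 refl)
        ... | no ne = g∣sz i i<k (low i i<k c ne)
        w*g : w t i * g ≡ sz t i
        w*g = begin
          w t i * g ≡⟨ cong (_* g) (trans (w-< t i<k) (cong (λ z → (sz t i ∸ 2 * z) / g) (F≡0 i c))) ⟩
          sz t i / g * g ≡⟨ sym (cong (_+ sz t i / g * g) (n∣m⇒m%n≡0 (sz t i) g div)) ⟩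
          sz t i % g + sz t i / g * g ≡⟨ sym (m≡m%n+[m/n]*n (sz t i) g) ⟩
          sz t i ∎
          where open ≡-Reasoning

      module _ (t≤ : t + 18 ≤ k + 12 * k) where

        -- Fringes and remainder make at most 3 F in an open inner bag, and a leaf holds at most one
        -- register; one factor g above F covers both.
        up-bound : ∀ i → i ≤ k → Bd (up t i) (t + 16) (k + 12 * i)
        up-bound zero _ = subst (λ z → Bd z (t + 16) (k + 0)) (sym (up-closed 0 (≤-trans (s≤s z≤n) k≥2) (inj₁ refl))) Bd-vac
        up-bound (suc i) le with t + 18 ≤? k + 12 * suc i
        ... | no ≰ = subst (λ z → Bd z (t + 16) (k + 12 * suc i)) (sym (up-closed (suc i) (≤∧≢⇒< le (λ e → ≰ (subst (λ z → t + 18 ≤ k + 12 * z) (sym e) t≤))) (inj₂ (≰⇒> ≰)))) Bd-vac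
        ... | yes o = bd (begin
          up t (suc i) * g ^ (t + 16) ≤⟨ *-monoˡ-≤ (g ^ (t + 16)) up≤ ⟩
          F t (suc i) * g * g ^ (t + 16) ≡⟨ trans (*-assoc (F t (suc i)) g _) (cong (λ z → F t (suc i) * g ^ z) (sym (+-suc t 16))) ⟩
          F t (suc i) * g ^ (t + 17) ≡⟨ F-scale t (suc i) (s≤s z≤n) o ⟩
          g ^ (k + 12 * suc i) ∎)
          where
          open ≤-Reasoning
          F≥g = F-≥g t (suc i) (s≤s z≤n) o
          up≤ : up t (suc i) ≤ F t (suc i) * g
          up≤ with suc i ≟ k
          ... | yes e = begin
            up t (suc i) ≤⟨ m∸n≤m (sz t (suc i)) (g * w t (suc i)) ⟩
            sz t (suc i) ≡⟨ cong (sz t) e ⟩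
            sz t k ≤⟨ sz-leaf ⟩
            1 ≤⟨ *-mono-≤ {1} {F t (suc i)} {1} {g} (≤-trans g≥1 F≥g) g≥1 ⟩
            F t (suc i) * g ∎
          ... | no ne = begin
            up t (suc i) ≤⟨ up-< t (suc i) (≤∧≢⇒< le ne) ⟩
            2 * F t (suc i) + g ≤⟨ +-monoʳ-≤ (2 * F t (suc i)) F≥g ⟩
            2 * F t (suc i) + F t (suc i) ≡⟨ lem (F t (suc i)) ⟩
            F t (suc i) * 3 ≤⟨ *-monoʳ-≤ (F t (suc i)) (≤-trans (m≤m+n 3 5) g≥8) ⟩
            F t (suc i) * g ∎
            where
            lem : ∀ x → 2 * x + x ≡ x * 3
            lem = solve-∀

        w-bound : ∀ i → i ≤ k → Bd (w t i) (t + 1) (k + 12 * i)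
        w-bound i le = Bd-scale 1 (≤-trans (≤-reflexive (trans (cong (w t i *_) (^-identityʳ g)) (*-comm (w t i) g))) (g*w≤sz t i)) (cap I i le)

        private
          total′ : ∑ (suc k) (λ i → g ^ i * sz (suc t) i) ≡ g ^ k
          total′ = trans (begin
            ∑ (suc k) (λ i → g ^ i * (fromParent t i + fromKids t i))
              ≡⟨ trans (∑-cong (suc k) (λ i → *-distribˡ-+ (g ^ i) (fromParent t i) (fromKids t i))) (∑-+ (suc k) (λ i → g ^ i * fromParent t i) (λ i → g ^ i * fromKids t i)) ⟩
            ∑ (suc k) (λ i → g ^ i * fromParent t i) + ∑ (suc k) (λ i → g ^ i * fromKids t i)
              ≡⟨ cong₂ _+_ (∑-suc k (λ i → g ^ i * fromParent t i)) (trans (cong₂ _+_ (∑-cong< k (λ i i<k → trans (cong (g ^ i *_) (fromKids-< t i<k)) (l₁ (g ^ i) g (up t (suc i))))) (trans (cong (g ^ k *_) (fromKids-k t)) (*-zeroʳ (g ^ k)))) (+-identityʳ _)) ⟩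
            (1 * up t 0 + ∑ k (λ i → g ^ suc i * w t i)) + ∑ k (λ i → g ^ suc i * up t (suc i))
              ≡⟨ l₂ (1 * up t 0) _ _ ⟩
            (1 * up t 0 + ∑ k (λ i → g ^ suc i * up t (suc i))) + ∑ k (λ i → g ^ suc i * w t i)
              ≡⟨ cong₂ _+_ (sym (∑-suc k (λ i → g ^ i * up t i))) (trans (∑-cong k (λ i → l₃ (g ^ i) g (w t i))) (sym (trans (cong (λ z → ∑ k (λ i → g ^ i * (g * w t i)) + g ^ k * (g * z)) (w-k t)) (l₄ _ (g ^ k) g)))) ⟩
            ∑ (suc k) (λ i → g ^ i * up t i) + ∑ (suc k) (λ i → g ^ i * (g * w t i))
              ≡⟨ sym (∑-+ (suc k) (λ i → g ^ i * up t i) (λ i → g ^ i * (g * w t i))) ⟩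
            ∑ (suc k) (λ i → g ^ i * up t i + g ^ i * (g * w t i))
              ≡⟨ ∑-cong (suc k) (λ i → trans (sym (*-distribˡ-+ (g ^ i) (up t i) (g * w t i))) (cong (g ^ i *_) (trans (+-comm (up t i) (g * w t i)) (sz≡ t i)))) ⟩
            ∑ (suc k) (λ i → g ^ i * sz t i) ∎) (total I)
            where
            open ≡-Reasoning
            l₁ : ∀ a g u → a * (g * u) ≡ g * a * u
            l₁ = solve-∀
            l₂ : ∀ a b c → (a + b) + c ≡ (a + c) + b
            l₂ = solve-∀
            l₃ : ∀ a g u → g * a * u ≡ a * (g * u)
            l₃ = solve-∀
            l₄ : ∀ a b g → a + b * (g * 0) ≡ a
            l₄ = solve-∀

          if-zero : ∀ i → up t (suc i) ≡ 0 → fromKids t i ≡ 0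
          if-zero i e with i <? k
          ... | yes i<k = trans (fromKids-< t i<k) (trans (cong (g *_) e) (*-zeroʳ g))
          ... | no i≮k = fromKids-≮ t i≮k

          up-zero : ∀ i → sz t i ≡ 0 → up t i ≡ 0
          up-zero i e = n≤0⇒n≡0 (≤-trans (m∸n≤m (sz t i) (g * w t i)) (≤-reflexive e))

          w-zero : ∀ i → sz t i ≡ 0 → w t i ≡ 0
          w-zero i e = n≤0⇒n≡0 (*-cancelˡ-≤ g (≤-trans (g*w≤sz t i) (≤-reflexive (trans e (sym (*-zeroʳ g))))))

          parity′ : ∀ i → par (suc t + i) ≡ true → sz (suc t) i ≡ 0
          parity′ zero e = cong₂ _+_ (up-closed 0 (≤-trans (s≤s z≤n) k≥2) (inj₁ refl))
            (if-zero 0 (up-zero 1 (parity I 1 (trans (par-suc t 0) e))))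
          parity′ (suc i) e = cong₂ _+_ (w-zero i (parity I i (trans (sym (not-involutive _)) (trans (cong not (sym (par-suc t i))) e))))
            (if-zero (suc i) (up-zero (2 + i) (parity I (2 + i) (trans (par-suc t (suc i)) e))))

          closed′ : ∀ j → suc j < k → k + 12 * j ≤ suc t → sz (suc t) j ≡ 0
          closed′ j sj<k le = cong₂ _+_ (parent j sj<k le) (if-zero j (up-closed (suc j) sj<k (inj₂ (begin-strict
              k + 12 * suc j       ≡⟨ lem k j ⟩
              k + 12 * j + 12      ≤⟨ +-monoˡ-≤ 12 le ⟩
              suc t + 12           <⟨ n<1+n _ ⟩
              suc (suc t + 12)     ≡⟨ lem′ t ⟩
              t + 14               ≤⟨ +-monoʳ-≤ t (m≤m+n 14 4) ⟩
              t + 18               ∎))))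
            where
            open ≤-Reasoning
            lem : ∀ k j → k + 12 * suc j ≡ k + 12 * j + 12
            lem = solve-∀
            lem′ : ∀ t → suc (suc t + 12) ≡ t + 14
            lem′ = solve-∀
            parent : ∀ j → suc j < k → k + 12 * j ≤ suc t → fromParent t j ≡ 0
            parent zero _ _ = up-closed 0 (≤-trans (s≤s z≤n) k≥2) (inj₁ refl)
            parent (suc j) lt le = w-zero j (closed I j (<-trans (n<1+n (suc j)) lt) (s≤s⁻¹ (≤-trans (≤-trans (m≤m+n _ 11) (≤-reflexive (lem₂ k j))) le)))
              where
              lem₂ : ∀ k j → suc (k + 12 * j) + 11 ≡ k + 12 * suc j
              lem₂ = solve-∀

          -- Measured by the old capacity of the receiving bag, the parent sends at most g^-13 and
          -- all children together at most g^(1 + 12 - 16) = g^-3, whereas the new capacity is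
          -- smaller by g only.
          cap′ : ∀ i → i ≤ k → Bd (sz (suc t) i) (suc t) (k + 12 * i)
          cap′ i le = Bd-+ {fromParent t i} {fromKids t i} {suc t} (parent i le) kids
            where
            parent : ∀ i → i ≤ k → Bd (fromParent t i) (suc (suc t)) (k + 12 * i)
            parent zero _ = subst (λ z → Bd z (suc (suc t)) (k + 0)) (sym (up-closed 0 (≤-trans (s≤s z≤n) k≥2) (inj₁ refl))) Bd-vac
            parent (suc i) le = Bd-shift {w t i} {t + 1} {k + 12 * i} (suc (suc t)) (k + 12 * suc i) 11 (lem t k i) (w-bound i (≤-trans (n≤1+n i) le))
              where
              lem : ∀ t k i → suc (suc t) + (k + 12 * i) + 11 ≡ t + 1 + (k + 12 * suc i)
              lem = solve-∀
            kids : Bd (fromKids t i) (suc (suc t)) (k + 12 * i)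
            kids with i <? k
            ... | no i≮k = subst (λ z → Bd z (suc (suc t)) (k + 12 * i)) (sym (fromKids-≮ t i≮k)) Bd-vac
            ... | yes i<k = subst (λ z → Bd z (suc (suc t)) (k + 12 * i)) (sym (fromKids-< t i<k)) (Bd-* g {up t (suc i)} {suc (suc t)} ≤-refl (Bd-shift {up t (suc i)} {t + 16} {k + 12 * suc i} (suc (suc (suc t))) (k + 12 * i) 1 (lem t k i) (up-bound (suc i) i<k)))
              where
              lem : ∀ t k i → suc (suc (suc t)) + (k + 12 * suc i) + 1 ≡ t + 16 + (k + 12 * i)
              lem = solve-∀

        inv-suc : Inv (suc t)
        inv-suc = record { total = total′ ; parity = parity′ ; closed = closed′ ; cap = cap′ }

    inv-zero : Inv 0
    inv-zero = record
      { total = trans (∑-suc k (λ i → g ^ i * sz 0 i)) (trans (cong (λ z → 1 * g ^ k + z) (∑-zero k (λ i _ → *-zeroʳ (g ^ suc i)))) (trans (+-identityʳ _) (*-identityˡ (g ^ k))))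
      ; parity = λ { zero () ; (suc i) _ → refl }
      ; closed = λ { j lt le → contradiction (≤-trans k≥2 (m+n≤o⇒m≤o k le)) (λ ()) }
      ; cap = λ { zero _ → bd (≤-reflexive (trans (*-identityʳ (g ^ k)) (cong (g ^_) (sym (+-identityʳ k))))) ; (suc i) _ → Bd-vac }
      }

    inv : ∀ t → t + 17 ≤ k + 12 * k → Inv t
    inv zero _ = inv-zero
    inv (suc t) le = inv-suc (inv t (≤-trans (n≤1+n (t + 17)) le)) (≤-trans (≤-reflexive (+-suc t 17)) le)

-- Traffic of registers between the bags.

module Bags where

  open import Data.Nat hiding (parity)
  open import Data.Nat.Properties
  open import Data.Nat.DivMod using (_/_; _%_; m%n<n; m*n/n≡m; m<n⇒m%n≡m; m<n⇒m/n≡0; [m+kn]%n≡m%n; +-distrib-/-∣ˡ)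
  open import Data.Nat.Divisibility using (n∣m*n)
  open import Data.Nat.Tactic.RingSolver using (solve-∀)
  open import Data.List.Base using (List; []; _++_; length; take; drop; upTo)
  open import Data.List.Properties using (length-take; length-drop; length-++; length-upTo)
  open ExpanderFamily
  open Integral using (size)
  open Sums
  open Separator

  div-child : ∀ q c g .{{_ : NonZero g}} → c < g → (q * g + c) / g ≡ q
  div-child q c g c<g = trans (+-distrib-/-∣ˡ c (n∣m*n q)) (trans (cong₂ _+_ (m*n/n≡m q g) (m<n⇒m/n≡0 c<g)) (+-identityʳ q))

  mod-child : ∀ q c g .{{_ : NonZero g}} → c < g → (q * g + c) % g ≡ c
  mod-child q c g c<g = trans (cong (_% g) (+-comm (q * g) c)) (trans ([m+kn]%n≡m%n c q g) (m<n⇒m%n≡m c<g))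

  wt-upTo : ∀ f n → wt f (upTo n) ≡ ∑ n f
  wt-upTo f n = go f n
    where
    open import Data.List.Base using (applyUpTo)
    apply : ∀ (h : ℕ → ℕ) f n → wt f (applyUpTo h n) ≡ ∑ n (λ x → f (h x))
    apply h f zero = refl
    apply h f (suc n) = trans (cong (λ z → f (h 0) + z) (apply (λ x → h (suc x)) f n)) (sym (∑-suc n (λ x → f (h x))))
    go : ∀ f n → wt f (upTo n) ≡ ∑ n f
    go f n = apply (λ x → x) f n

  module Tree (fam : Family) (p k : ℕ) (B>1 : 1 < size (Family.W fam)) (g-large : 6 * size (Family.W fam) ≤ 4 ^ p)
              (g≥8 : 8 ≤ 4 ^ p) (k≥2 : 2 ≤ k) where

    open NearSorter fam p B>1 g-large public
    open BagSizes.Sizes g k g≥8 k≥2 public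

    N : ℕ
    N = g ^ k

    -- X covers the high fringe and the remainder of the division by g, so that F low registers and
    -- g equal blocks are left. If w t i = 0, everything is sent up.
    module Split (t i : ℕ) (xs : List ℕ) where
      X : ℕ
      X = sz t i ∸ F t i ∸ g * w t i

      -- Lists of register names: the read-out order of the near sorter, which does not depend on
      -- the contents.
      sorted₁ hi rest sorted₂ lo mid sent : List ℕ
      sorted₁ = nearSorted xs
      hi = take X sorted₁
      rest = drop X sorted₁
      sorted₂ = nearSorted rest
      lo = take (F t i) sorted₂
      mid = drop (F t i) sorted₂
      sent = hi ++ lo

      part : ℕ → List ℕ
      part c = take (w t i) (drop (c * w t i) mid)

      length-sorted₁ : length sorted₁ ≡ length xs
      length-sorted₁ = trans (sym (wt-1 sorted₁)) (trans (wt-nearSorted xs (λ _ → 1)) (wt-1 xs))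

      length-sorted₂ : length sorted₂ ≡ length rest
      length-sorted₂ = trans (sym (wt-1 sorted₂)) (trans (wt-nearSorted rest (λ _ → 1)) (wt-1 rest))

      wt-sent-mid : ∀ f → wt f sent + wt f mid ≡ wt f xs
      wt-sent-mid f = begin
        wt f (hi ++ lo) + wt f mid ≡⟨ cong (_+ wt f mid) (wt-++ f hi lo) ⟩
        wt f hi + wt f lo + wt f mid ≡⟨ +-assoc (wt f hi) _ _ ⟩
        wt f hi + (wt f lo + wt f mid) ≡⟨ cong (λ z → wt f hi + z) (trans (wt-take-drop f (F t i) sorted₂) (wt-nearSorted rest f)) ⟩
        wt f hi + wt f rest ≡⟨ trans (wt-take-drop f X sorted₁) (wt-nearSorted xs f) ⟩
        wt f xs ∎
        where open ≡-Reasoning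

      module _ (len : length xs ≡ sz t i) where

        length-rest : length rest ≡ sz t i ∸ X
        length-rest = trans (length-drop X sorted₁) (cong (_∸ X) (trans length-sorted₁ len))

        X≤ : X ≤ sz t i
        X≤ = ≤-trans (m∸n≤m _ (g * w t i)) (m∸n≤m (sz t i) (F t i))

        length-rest′ : w t i ≢ 0 → length rest ≡ F t i + g * w t i × F t i ≤ X
        length-rest′ ne with g*w≤ t i
        ... | inj₂ e = contradiction e ne
        ... | inj₁ le = trans length-rest (trans (cong (sz t i ∸_) X≡) (m∸[m∸n]≡n (≤-trans (≤-trans (≤-reflexive (+-comm (F t i) (g * w t i))) (+-monoʳ-≤ (g * w t i) (m≤m+n (F t i) _))) le))) ,
            subst (F t i ≤_) (sym X≡) (m+n≤o⇒m≤o∸n (F t i) (≤-trans (≤-reflexive (lem (F t i) (g * w t i))) le))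
          where
          X≡ : X ≡ sz t i ∸ (F t i + g * w t i)
          X≡ = ∸-+-assoc (sz t i) (F t i) (g * w t i)
          lem : ∀ a b → a + (a + b) ≡ b + 2 * a
          lem = solve-∀

        length-mid : length mid ≡ g * w t i
        length-mid with w t i ≟ 0
        ... | no ne = trans (length-drop (F t i) sorted₂) (trans (cong (_∸ F t i) (trans length-sorted₂ (proj₁ (length-rest′ ne)))) (m+n∸m≡n (F t i) _))
        ... | yes e = trans (length-drop (F t i) sorted₂) (trans (cong (_∸ F t i) (trans length-sorted₂ length-rest)) (trans (m≤n⇒m∸n≡0 (≤-trans (∸-monoʳ-≤ (sz t i) (≤-reflexive (sym X≡))) (m∸[m∸n]≤n (sz t i) (F t i)))) (sym (trans (cong (g *_) e) (*-zeroʳ g)))))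
          where
          X≡ : X ≡ sz t i ∸ F t i
          X≡ = cong (sz t i ∸ F t i ∸_) (trans (cong (g *_) e) (*-zeroʳ g))
          m∸[m∸n]≤n : ∀ m n → m ∸ (m ∸ n) ≤ n
          m∸[m∸n]≤n m n = m≤n+o⇒m∸n≤o m (m ∸ n) (≤-trans (m≤n+m∸n m n) (≤-reflexive (+-comm n (m ∸ n))))

        length-sent : length sent ≡ up t i
        length-sent = +-cancelʳ-≡ (g * w t i) (length sent) (up t i) (begin
          length sent + g * w t i ≡⟨ cong (length sent +_) (sym length-mid) ⟩
          length sent + length mid ≡⟨ cong₂ _+_ (sym (wt-1 sent)) (sym (wt-1 mid)) ⟩
          wt (λ _ → 1) sent + wt (λ _ → 1) mid ≡⟨ wt-sent-mid (λ _ → 1) ⟩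
          wt (λ _ → 1) xs ≡⟨ trans (wt-1 xs) len ⟩
          sz t i ≡⟨ sym (sz≡ t i) ⟩
          g * w t i + up t i ≡⟨ +-comm (g * w t i) _ ⟩
          up t i + g * w t i ∎)
          where open ≡-Reasoning

        length-part : ∀ c → c < g → length (part c) ≡ w t i
        length-part c c<g = trans (length-take (w t i) _) (m≤n⇒m⊓n≡m (begin
          w t i                         ≡⟨ sym (m+n∸n≡m (w t i) (c * w t i)) ⟩
          suc c * w t i ∸ c * w t i     ≤⟨ ∸-monoˡ-≤ (c * w t i) (*-monoˡ-≤ (w t i) c<g) ⟩
          g * w t i ∸ c * w t i         ≡⟨ sym (trans (length-drop (c * w t i) mid) (cong (_∸ c * w t i) length-mid)) ⟩
          length (drop (c * w t i) mid) ∎))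
          where open ≤-Reasoning

        wt-parts : ∀ f → ∑ g (λ c → wt f (part c)) ≡ wt f mid
        wt-parts f = trans (wt-chunks f g (w t i) mid) (cong (wt f) (take-all (g * w t i) mid (≤-reflexive length-mid)))

        wt-split : ∀ f → wt f sent + ∑ g (λ c → wt f (part c)) ≡ wt f xs
        wt-split f = trans (cong (wt f sent +_) (wt-parts f)) (wt-sent-mid f)

    -- Names rather than contents: the traffic is fixed in advance, which is what makes this a
    -- network. Child c of node q is node q g + c of the next level.
    bag ups kids : ℕ → ℕ → ℕ → List ℕ
    block : ℕ → ℕ → ℕ → ℕ → List ℕ
    bag zero zero q = upTo N
    bag zero (suc i) q = []
    bag (suc t) zero q = ups t 0 q ++ kids t 0 q
    bag (suc t) (suc i) q = block t i (q / g) (q % g) ++ kids t (suc i) q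
    ups t i q = Split.sent t i (bag t i q)
    kids t i q = if does (i <? k) then collect g (λ c → ups t (suc i) (q * g + c)) else []
    block t i q c = Split.part t i (bag t i q) c

    kids-< : ∀ t {i} q → i < k → kids t i q ≡ collect g (λ c → ups t (suc i) (q * g + c))
    kids-< t {i} q i<k = cong (λ b → if b then collect g (λ c → ups t (suc i) (q * g + c)) else []) (dec-true (i <? k) i<k)

    kids-≮ : ∀ t {i} q → ¬ i < k → kids t i q ≡ []
    kids-≮ t {i} q i≮k = cong (λ b → if b then collect g (λ c → ups t (suc i) (q * g + c)) else []) (dec-false (i <? k) i≮k)

    length-bag : ∀ t i q → length (bag t i q) ≡ sz t i
    length-kids : ∀ t i q → length (kids t i q) ≡ fromKids t i
    length-kids t i q with i <? k
    ... | no i≮k = trans (cong length (kids-≮ t q i≮k)) (sym (fromKids-≮ t i≮k))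
    ... | yes i<k = begin
      length (kids t i q) ≡⟨ cong length (kids-< t q i<k) ⟩
      length (collect g (λ c → ups t (suc i) (q * g + c))) ≡⟨ sym (wt-1 (collect g (λ c → ups t (suc i) (q * g + c)))) ⟩
      wt (λ _ → 1) (collect g (λ c → ups t (suc i) (q * g + c))) ≡⟨ wt-collect (λ _ → 1) g (λ c → ups t (suc i) (q * g + c)) ⟩
      ∑ g (λ c → wt (λ _ → 1) (ups t (suc i) (q * g + c))) ≡⟨ ∑-cong g (λ c → trans (wt-1 (ups t (suc i) (q * g + c))) (Split.length-sent t (suc i) _ (length-bag t (suc i) (q * g + c)))) ⟩
      ∑ g (λ c → up t (suc i)) ≡⟨ ∑-const g _ ⟩
      g * up t (suc i) ≡⟨ sym (fromKids-< t i<k) ⟩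
      fromKids t i ∎
      where open ≡-Reasoning
    length-bag zero zero q = length-upTo N
    length-bag zero (suc i) q = refl
    length-bag (suc t) zero q = trans (length-++ (ups t 0 q)) (cong₂ _+_ (Split.length-sent t 0 _ (length-bag t 0 q)) (length-kids t 0 q))
    length-bag (suc t) (suc i) q = trans (length-++ (block t i (q / g) (q % g)))
      (cong₂ _+_ (Split.length-part t i _ (length-bag t i (q / g)) (q % g) (m%n<n q g)) (length-kids t (suc i) q))

    ∑-children : ∀ i (f : ℕ → ℕ) → ∑ (g ^ suc i) f ≡ ∑ (g ^ i) (λ q → ∑ g (λ c → f (q * g + c)))
    ∑-children i f = trans (cong (λ z → ∑ z f) (*-comm g (g ^ i))) (∑-grid (g ^ i) g f)

    everything : ℕ → (ℕ → ℕ) → ℕ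
    everything t f = ∑ (suc k) (λ i → ∑ (g ^ i) (λ q → wt f (bag t i q)))

    -- In this form the bags are known to partition the registers at every time: what leaves a bag,
    -- upwards or in a block, reappears in exactly one bag.
    conserved : ∀ t f → everything t f ≡ ∑ N f
    conserved zero f = trans (∑-suc k _) (trans (cong₂ _+_ (wt-upTo f N) (∑-zero k (λ i _ → ∑-zero (g ^ suc i) (λ _ _ → refl)))) (+-identityʳ _))
    conserved (suc t) f = trans (begin
      everything (suc t) f
        ≡⟨ trans (∑-cong (suc k) (λ i → trans (∑-cong (g ^ i) (λ q → decompose i q)) (∑-+ (g ^ i) (par′ i) (λ q → wt f (kids t i q))))) (∑-+ (suc k) _ _) ⟩
      ∑ (suc k) (λ i → ∑ (g ^ i) (par′ i)) + ∑ (suc k) (λ i → ∑ (g ^ i) (λ q → wt f (kids t i q)))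
        ≡⟨ cong₂ _+_ (trans (∑-suc k _) (cong (λ z → U 0 + z) (∑-cong k parents))) kids-sum ⟩
      (U 0 + ∑ k Bk) + ∑ k (λ i → U (suc i)) ≡⟨ lem (U 0) _ _ ⟩
      (U 0 + ∑ k (λ i → U (suc i))) + ∑ k Bk ≡⟨ cong₂ _+_ (sym (∑-suc k U)) (sym (trans (cong (∑ k Bk +_) Bk-k) (+-identityʳ _))) ⟩
      ∑ (suc k) U + ∑ (suc k) Bk ≡⟨ sym (∑-+ (suc k) U Bk) ⟩
      ∑ (suc k) (λ i → U i + Bk i) ≡⟨ ∑-cong (suc k) (λ i → trans (sym (∑-+ (g ^ i) _ _)) (∑-cong (g ^ i) (λ q → Split.wt-split t i _ (length-bag t i q) f))) ⟩
      everything t f ∎) (conserved t f)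
      where
      open ≡-Reasoning
      par′ : ℕ → ℕ → ℕ
      par′ zero q = wt f (ups t 0 q)
      par′ (suc i) q = wt f (block t i (q / g) (q % g))
      U Bk : ℕ → ℕ
      U i = ∑ (g ^ i) (λ q → wt f (ups t i q))
      Bk i = ∑ (g ^ i) (λ q → ∑ g (λ c → wt f (block t i q c)))
      decompose : ∀ i q → wt f (bag (suc t) i q) ≡ par′ i q + wt f (kids t i q)
      decompose zero q = wt-++ f (ups t 0 q) _
      decompose (suc i) q = wt-++ f (block t i (q / g) (q % g)) _
      parents : ∀ i → ∑ (g ^ suc i) (par′ (suc i)) ≡ Bk i
      parents i = trans (∑-children i _) (∑-cong (g ^ i) (λ q → ∑-cong< g (λ c c<g → cong₂ (λ a b → wt f (block t i a b)) (div-child q c g c<g) (mod-child q c g c<g))))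
      kids-sum : ∑ (suc k) (λ i → ∑ (g ^ i) (λ q → wt f (kids t i q))) ≡ ∑ k (λ i → U (suc i))
      kids-sum = trans (cong₂ _+_
        (∑-cong< k (λ i i<k → trans (∑-cong (g ^ i) (λ q → trans (cong (wt f) (kids-< t q i<k)) (wt-collect f g (λ c → ups t (suc i) (q * g + c))))) (sym (∑-children i (λ q → wt f (ups t (suc i) q))))))
        (∑-zero (g ^ k) (λ q _ → cong (wt f) (kids-≮ t q (n≮n k))))) (+-identityʳ _)
      Bk-k : Bk k ≡ 0
      Bk-k = ∑-zero (g ^ k) (λ q _ → ∑-zero g (λ c _ → cong (λ z → wt f (take z (drop (c * z) (Split.mid t k (bag t k q))))) (w-k t)))
      lem : ∀ a b c → (a + b) + c ≡ (a + c) + b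
      lem = solve-∀

-- One time step of a bag in four rounds.

module Stages where

  open import Data.Nat hiding (parity)
  open import Data.Nat.Properties
  open import Data.Nat.Tactic.RingSolver using (solve-∀)
  open import Data.List.Base using (List; []; _∷_; _++_; length; take; drop; map)
  open import Data.List.Properties using (length-take; take-[]; drop-drop)
  open ExpanderFamily
  open Integral using (size)
  open Sums
  open Separator
  open Bags

  χ : Bool → ℕ
  χ b = if b then 1 else 0

  ones zeros : ℕ → ℕ → ℕ
  ones Z r = χ (does (Z ≤? r))
  zeros Z r = χ (does (r <? Z))

  χ≤1 : ∀ b → χ b ≤ 1
  χ≤1 false = z≤n
  χ≤1 true = ≤-refl

  ones≤1 : ∀ Z r → ones Z r ≤ 1
  ones≤1 Z r = χ≤1 (does (Z ≤? r))

  zeros≤1 : ∀ Z r → zeros Z r ≤ 1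
  zeros≤1 Z r = χ≤1 (does (r <? Z))

  ones-≥ : ∀ {Z r} → Z ≤ r → ones Z r ≡ 1
  ones-≥ {Z} {r} le = cong χ (dec-true (Z ≤? r) le)

  ones-< : ∀ {Z r} → r < Z → ones Z r ≡ 0
  ones-< {Z} {r} lt = cong χ (dec-false (Z ≤? r) (<⇒≱ lt))

  zeros-< : ∀ {Z r} → r < Z → zeros Z r ≡ 1
  zeros-< {Z} {r} lt = cong χ (dec-true (r <? Z) lt)

  zeros-≥ : ∀ {Z r} → Z ≤ r → zeros Z r ≡ 0
  zeros-≥ {Z} {r} le = cong χ (dec-false (r <? Z) (≤⇒≯ le))

  ones-mono : ∀ Z {r r′} → r ≤ r′ → ones Z r ≤ ones Z r′
  ones-mono Z {r} {r′} le with Z ≤? r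
  ... | yes Z≤r = ≤-trans (χ≤1 _) (≤-reflexive (sym (ones-≥ (≤-trans Z≤r le))))
  ... | no Z≰r = ≤-trans (≤-reflexive (ones-< (≰⇒> Z≰r))) z≤n

  zeros-anti : ∀ Z {r r′} → r ≤ r′ → zeros Z r′ ≤ zeros Z r
  zeros-anti Z {r} {r′} le with r′ <? Z
  ... | yes r′<Z = ≤-trans (χ≤1 _) (≤-reflexive (sym (zeros-< (≤-<-trans le r′<Z))))
  ... | no r′≮Z = ≤-trans (≤-reflexive (zeros-≥ (≮⇒≥ r′≮Z))) z≤n

  ones+zeros : ∀ Z r → ones Z r + zeros Z r ≡ 1
  ones+zeros Z r with Z ≤? r
  ... | yes le = cong₂ _+_ (ones-≥ le) (zeros-≥ le)
  ... | no ≰ = cong₂ _+_ (ones-< (≰⇒> ≰)) (zeros-< (≰⇒> ≰))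

  -- `u` and `u′` are the contents before and after a round; equal sums for all weights mean that
  -- the contents are permuted within the group.
  Rearranges SortsDown SortsUp : (ℕ → ℕ) → (ℕ → ℕ) → List ℕ → Set
  Rearranges u u′ xs = ∀ (W : ℕ → ℕ) → wt (λ x → W (u′ x)) xs ≡ wt (λ x → W (u x)) xs
  SortsDown u u′ xs = Rearranges u u′ xs × AllPairs (λ x y → u′ y ≤ u′ x) xs
  SortsUp u u′ xs = Rearranges u u′ xs × AllPairs (λ x y → u′ x ≤ u′ y) xs

  singletons : List ℕ → List (List ℕ)
  singletons = map (λ x → x ∷ [])

  wt-singletons : ∀ f xs → wt (wt f) (singletons xs) ≡ wt f xs
  wt-singletons f [] = refl
  wt-singletons f (x ∷ xs) = cong₂ _+_ (+-identityʳ (f x)) (wt-singletons f xs)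

  rearranges-concat : ∀ {u u′} xs gs → (∀ f → wt (wt f) gs ≡ wt f xs) → All (Rearranges u u′) gs → Rearranges u u′ xs
  rearranges-concat {u} {u′} xs gs eq all W = trans (sym (eq (λ x → W (u′ x)))) (trans (go gs all) (eq (λ x → W (u x))))
    where
    go : ∀ gs → All (Rearranges u u′) gs → wt (wt (λ x → W (u′ x))) gs ≡ wt (wt (λ x → W (u x))) gs
    go [] [] = refl
    go (g ∷ gs) (p ∷ ps) = cong₂ _+_ (p W) (go gs ps)

  downs-ones : ∀ {u u′} Z xs → SortsDown u u′ xs → Sorts (λ x → ones Z (u x)) (λ x → ones Z (u′ x)) xs
  downs-ones Z xs (r , d) = r (ones Z) , AllPairs.map (ones-mono Z) d

  ups-zeros : ∀ {u u′} Z xs → SortsUp u u′ xs → Sorts (λ x → zeros Z (u x)) (λ x → zeros Z (u′ x)) xs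
  ups-zeros Z xs (r , d) = r (zeros Z) , AllPairs.map (zeros-anti Z) d

  wt-length : ∀ Z (u : ℕ → ℕ) xs → wt (λ x → ones Z (u x)) xs + wt (λ x → zeros Z (u x)) xs ≡ length xs
  wt-length Z u xs = trans (sym (wt-+ (λ x → ones Z (u x)) (λ x → zeros Z (u x)) xs)) (trans (wt-cong (λ x → ones+zeros Z (u x)) xs) (wt-1 xs))

  module Stage (fam : Family) (p k : ℕ) (B>1 : 1 < size (Family.W fam)) (g-large : 6 * size (Family.W fam) ≤ 4 ^ p)
               (g≥8 : 8 ≤ 4 ^ p) (k≥2 : 2 ≤ k) where

    open Bags.Tree fam p k B>1 g-large g≥8 k≥2 public

    module _ (t i : ℕ) (xs : List ℕ) where
      open Split t i xs

      round₁ round₂ round₃ round₄ : List (List ℕ)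
      round₁ = nearSort₁ xs
      round₂ = nearSort₂ xs
      -- The registers already cut off at the high end idle in groups of one, so that the round
      -- still covers the whole bag.
      round₃ = nearSort₁ rest ++ singletons hi
      round₄ = nearSort₂ rest ++ singletons hi

      wt-round₃ : ∀ f → wt (wt f) round₃ ≡ wt f xs
      wt-round₃ f = begin
        wt (wt f) round₃ ≡⟨ wt-++ (wt f) (nearSort₁ rest) (singletons hi) ⟩
        wt (wt f) (nearSort₁ rest) + wt (wt f) (singletons hi) ≡⟨ cong₂ _+_ (wt-nearSort₁ rest f) (wt-singletons f hi) ⟩
        wt f rest + wt f hi ≡⟨ +-comm (wt f rest) _ ⟩
        wt f hi + wt f rest ≡⟨ trans (wt-take-drop f X sorted₁) (wt-nearSorted xs f) ⟩
        wt f xs ∎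
        where open ≡-Reasoning

      wt-round₄ : ∀ f → wt (wt f) round₄ ≡ wt f xs
      wt-round₄ f = begin
        wt (wt f) round₄ ≡⟨ wt-++ (wt f) (nearSort₂ rest) (singletons hi) ⟩
        wt (wt f) (nearSort₂ rest) + wt (wt f) (singletons hi) ≡⟨ cong₂ _+_ (wt-nearSort₂ rest f) (wt-singletons f hi) ⟩
        wt f rest + wt f hi ≡⟨ +-comm (wt f rest) _ ⟩
        wt f hi + wt f rest ≡⟨ trans (wt-take-drop f X sorted₁) (wt-nearSorted xs f) ⟩
        wt f xs ∎
        where open ≡-Reasoning

    -- Two descending rounds on the whole bag, then two ascending ones on the rest: either extreme
    -- is read off at the front of a list, where `extract` applies.
    record BagStage (t i : ℕ) (xs : List ℕ) (u₀ u₁ u₂ u₃ u₄ : ℕ → ℕ) : Set where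
      field
        step₁ : All (SortsDown u₀ u₁) (round₁ t i xs)
        step₂ : All (SortsDown u₁ u₂) (round₂ t i xs)
        step₃ : All (SortsUp u₂ u₃) (round₃ t i xs)
        step₄ : All (SortsUp u₃ u₄) (round₄ t i xs)

    module _ {t i : ℕ} {xs : List ℕ} {u₀ u₁ u₂ u₃ u₄ : ℕ → ℕ} (len : length xs ≡ sz t i)
             (stage : BagStage t i xs u₀ u₁ u₂ u₃ u₄) where
      open BagStage stage
      open Split t i xs

      private
        first : Rearranges u₀ u₂ xs
        first W = trans (rearranges-concat {u₁} {u₂} xs (nearSort₂ xs) (wt-nearSort₂ xs) (All.map proj₁ step₂) W)
                        (rearranges-concat {u₀} {u₁} xs (nearSort₁ xs) (wt-nearSort₁ xs) (All.map proj₁ step₁) W)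

        second : Rearranges u₂ u₄ xs
        second W = trans (rearranges-concat {u₃} {u₄} xs (round₄ t i xs) (wt-round₄ t i xs) (All.map proj₁ step₄) W)
                         (rearranges-concat {u₂} {u₃} xs (round₃ t i xs) (wt-round₃ t i xs) (All.map proj₁ step₃) W)

        in-rest : Rearranges u₂ u₄ rest
        in-rest W = trans (rearranges-concat {u₃} {u₄} rest (nearSort₂ rest) (wt-nearSort₂ rest) (All.map proj₁ (++⁻ˡ _ step₄)) W)
                          (rearranges-concat {u₂} {u₃} rest (nearSort₁ rest) (wt-nearSort₁ rest) (All.map proj₁ (++⁻ˡ _ step₃)) W)

        near-ones : ∀ Z → NearSorting xs (λ x → ones Z (u₀ x)) (λ x → ones Z (u₁ x)) (λ x → ones Z (u₂ x))
        near-ones Z = record { w₁≤1 = λ x → χ≤1 _ ; w₂≤1 = λ x → χ≤1 _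
          ; sorts₁ = All.map (λ {g} → downs-ones Z g) step₁ ; sorts₂ = All.map (λ {g} → downs-ones Z g) step₂ }

        near-zeros : ∀ Z → NearSorting rest (λ x → zeros Z (u₂ x)) (λ x → zeros Z (u₃ x)) (λ x → zeros Z (u₄ x))
        near-zeros Z = record { w₁≤1 = λ x → χ≤1 _ ; w₂≤1 = λ x → χ≤1 _
          ; sorts₁ = All.map (λ {g} → ups-zeros Z g) (++⁻ˡ _ step₃) ; sorts₂ = All.map (λ {g} → ups-zeros Z g) (++⁻ˡ _ step₄) }

        rest-≤ : ∀ W → wt (λ x → W (u₂ x)) rest ≤ wt (λ x → W (u₀ x)) xs
        rest-≤ W = ≤-trans (wt-drop-≤ _ X sorted₁) (≤-reflexive (trans (wt-nearSorted xs (λ x → W (u₂ x))) (first W)))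

        length-rest-≤ : length rest ≤ sz t i
        length-rest-≤ = ≤-trans (≤-reflexive (length-rest len)) (m∸n≤m (sz t i) X)

        part-empty : ∀ f c → w t i ≡ 0 → wt f (part c) ≡ 0
        part-empty f c e = cong (λ z → wt f (take z (drop (c * z) mid))) e

        part-≤ : ∀ f c → wt f (part c) ≤ wt f mid
        part-≤ f c = ≤-trans (wt-take-≤ f (w t i) _) (wt-drop-≤ f (c * w t i) mid)

      stage-total : Rearranges u₀ u₄ xs
      stage-total W = trans (second W) (first W)

      sent-total : ∀ W → wt (λ x → W (u₄ x)) sent ≤ wt (λ x → W (u₀ x)) xs
      sent-total W = ≤-trans (m≤m+n _ (wt (λ x → W (u₄ x)) mid)) (≤-reflexive (trans (wt-sent-mid (λ x → W (u₄ x))) (trans (second W) (first W))))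

      part-total : ∀ W c → wt (λ x → W (u₄ x)) (part c) ≤ wt (λ x → W (u₀ x)) xs
      part-total W c = ≤-trans (part-≤ _ c) (≤-trans (m≤n+m _ (wt (λ x → W (u₄ x)) sent)) (≤-reflexive (trans (wt-sent-mid (λ x → W (u₄ x))) (trans (second W) (first W)))))

      -- High strangers are removed by the first pass; the second merely permutes what it finds in
      -- `rest`.
      filter-ones : ∀ Z c → sz t i ≤ g ^ 17 * F t i → 2 * wt (λ x → ones Z (u₀ x)) xs ≤ F t i →
                    wt (λ x → ones Z (u₄ x)) (part c) * g ^ 18 ≤ wt (λ x → ones Z (u₀ x)) xs
      filter-ones Z c szF oF with w t i ≟ 0
      ... | yes e = subst (λ z → z * g ^ 18 ≤ wt (λ x → ones Z (u₀ x)) xs) (sym (part-empty (λ x → ones Z (u₄ x)) c e)) z≤n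
      ... | no ne = ≤-trans (*-monoˡ-≤ (g ^ 18) (begin
          wt (λ x → ones Z (u₄ x)) (part c) ≤⟨ part-≤ _ c ⟩
          wt (λ x → ones Z (u₄ x)) mid ≤⟨ wt-drop-≤ _ (F t i) sorted₂ ⟩
          wt (λ x → ones Z (u₄ x)) sorted₂ ≡⟨ wt-nearSorted rest _ ⟩
          wt (λ x → ones Z (u₄ x)) rest ≡⟨ in-rest (ones Z) ⟩
          wt (λ x → ones Z (u₂ x)) rest ∎))
        (extract xs (near-ones Z) (F t i) X (proj₂ (length-rest′ len ne)) (≤-trans (≤-reflexive len) szF) oF)
        where open ≤-Reasoning

      filter-zeros : ∀ Z c → sz t i ≤ g ^ 17 * F t i → 2 * wt (λ x → zeros Z (u₀ x)) xs ≤ F t i →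
                     wt (λ x → zeros Z (u₄ x)) (part c) * g ^ 18 ≤ wt (λ x → zeros Z (u₀ x)) xs
      filter-zeros Z c szF oF = ≤-trans (*-monoˡ-≤ (g ^ 18) (part-≤ _ c))
        (≤-trans (extract rest (near-zeros Z) (F t i) (F t i) ≤-refl (≤-trans length-rest-≤ szF) (≤-trans (*-monoʳ-≤ 2 (rest-≤ (zeros Z))) oF)) (rest-≤ (zeros Z)))

      balance-zeros : ∀ Z c → Σ[ e ∈ ℕ ] (wt (λ x → zeros Z (u₄ x)) (part c) ≤ (wt (λ x → zeros Z (u₀ x)) xs ∸ c * w t i) + e × e * g ^ 17 ≤ sz t i)
      balance-zeros Z c with balance rest (near-zeros Z) (F t i + c * w t i)
      ... | e , le , small = e , (begin
          wt (λ x → zeros Z (u₄ x)) (part c) ≤⟨ wt-take-≤ _ (w t i) _ ⟩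
          wt (λ x → zeros Z (u₄ x)) (drop (c * w t i) (drop (F t i) sorted₂)) ≡⟨ cong (wt _) (drop-drop (F t i) (c * w t i) sorted₂) ⟩
          wt (λ x → zeros Z (u₄ x)) (drop (F t i + c * w t i) sorted₂) ≤⟨ le ⟩
          (wt (λ x → zeros Z (u₂ x)) rest ∸ (F t i + c * w t i)) + e ≤⟨ +-monoˡ-≤ e (∸-mono (rest-≤ (zeros Z)) (m≤n+m (c * w t i) (F t i))) ⟩
          (wt (λ x → zeros Z (u₀ x)) xs ∸ c * w t i) + e ∎) , ≤-trans small length-rest-≤
        where open ≤-Reasoning

      -- The second pass is ascending and controls zeros, so ones are counted by complement: a
      -- prefix of length X′ contains all zeros but (z - X′) + e, and the remaining places are ones.
      balance-ones : ∀ Z c → c < g → Σ[ e ∈ ℕ ] (wt (λ x → ones Z (u₄ x)) (part c) ≤ (wt (λ x → ones Z (u₀ x)) xs ∸ (g ∸ suc c) * w t i) + e × e * g ^ 17 ≤ sz t i)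
      balance-ones Z c c<g with w t i ≟ 0
      ... | yes e = 0 , subst (λ z → z ≤ (wt (λ x → ones Z (u₀ x)) xs ∸ (g ∸ suc c) * w t i) + 0) (sym (part-empty (λ x → ones Z (u₄ x)) c e)) z≤n , z≤n
      ... | no ne with balance rest (near-zeros Z) (F t i + suc c * w t i)
      ...   | e , le , small = e , main , ≤-trans small length-rest-≤
        where
        open ≤-Reasoning
        X′ = F t i + suc c * w t i
        one zero′ : ℕ → ℕ
        one x = ones Z (u₄ x)
        zero′ x = zeros Z (u₄ x)
        z = wt (λ x → zeros Z (u₂ x)) rest
        o = wt (λ x → ones Z (u₂ x)) rest
        part⊆ : wt one (part c) ≤ wt one (take X′ sorted₂)
        part⊆ = begin
          wt one (take (w t i) (drop (c * w t i) (drop (F t i) sorted₂))) ≡⟨ cong (λ z → wt one (take (w t i) z)) (drop-drop (F t i) (c * w t i) sorted₂) ⟩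
          wt one (take (w t i) (drop (F t i + c * w t i) sorted₂)) ≤⟨ take-drop-≤ (w t i) (F t i + c * w t i) sorted₂ ⟩
          wt one (take (F t i + c * w t i + w t i) sorted₂) ≡⟨ cong (λ z → wt one (take z sorted₂)) (lem (F t i) (c * w t i) (w t i)) ⟩
          wt one (take X′ sorted₂) ∎
          where
          lem : ∀ a b c → a + b + c ≡ a + (c + b)
          lem = solve-∀
          take-drop-≤ : ∀ a b ys → wt one (take a (drop b ys)) ≤ wt one (take (b + a) ys)
          take-drop-≤ a zero ys = ≤-refl
          take-drop-≤ a (suc b) [] = ≤-reflexive (cong (wt one) (take-[] a))
          take-drop-≤ a (suc b) (y ∷ ys) = ≤-trans (take-drop-≤ a b ys) (m≤n+m _ (one y))
        taken : wt one (take X′ sorted₂) + z ≤ X′ + wt zero′ (drop X′ sorted₂)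
        taken = begin
          wt one (take X′ sorted₂) + z ≡⟨ cong (λ y → wt one (take X′ sorted₂) + y) (sym (trans (wt-nearSorted rest zero′) (in-rest (zeros Z)))) ⟩
          wt one (take X′ sorted₂) + wt zero′ sorted₂ ≡⟨ cong (λ y → wt one (take X′ sorted₂) + y) (sym (wt-take-drop zero′ X′ sorted₂)) ⟩
          wt one (take X′ sorted₂) + (wt zero′ (take X′ sorted₂) + wt zero′ (drop X′ sorted₂)) ≡⟨ sym (+-assoc (wt one (take X′ sorted₂)) _ _) ⟩
          wt one (take X′ sorted₂) + wt zero′ (take X′ sorted₂) + wt zero′ (drop X′ sorted₂) ≡⟨ cong (_+ wt zero′ (drop X′ sorted₂)) (wt-length Z u₄ (take X′ sorted₂)) ⟩
          length (take X′ sorted₂) + wt zero′ (drop X′ sorted₂) ≤⟨ +-monoˡ-≤ _ (≤-trans (≤-reflexive (length-take X′ sorted₂)) (m⊓n≤m X′ _)) ⟩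
          X′ + wt zero′ (drop X′ sorted₂) ∎
        few : wt one (take X′ sorted₂) ≤ (X′ ∸ z) + e
        few = +-cancelʳ-≤ z _ _ (begin
          wt one (take X′ sorted₂) + z ≤⟨ taken ⟩
          X′ + wt zero′ (drop X′ sorted₂) ≤⟨ +-monoʳ-≤ X′ le ⟩
          X′ + ((z ∸ X′) + e) ≡⟨ sym (+-assoc X′ _ e) ⟩
          -- X′ + (z ∸ X′) and (X′ ∸ z) + z are both the maximum of z and X′.
          X′ + (z ∸ X′) + e ≡⟨ cong (_+ e) (trans (+-comm X′ (z ∸ X′)) (swap-max z X′)) ⟩
          (X′ ∸ z) + z + e ≡⟨ lem (X′ ∸ z) z e ⟩
          (X′ ∸ z) + e + z ∎)
          where
          lem : ∀ a b c → a + b + c ≡ a + c + b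
          lem = solve-∀
          swap-max : ∀ a b → (a ∸ b) + b ≡ (b ∸ a) + a
          swap-max zero zero = refl
          swap-max zero (suc b) = sym (+-identityʳ (suc b))
          swap-max (suc a) zero = +-identityʳ (suc a)
          swap-max (suc a) (suc b) = trans (+-suc (a ∸ b) b) (trans (cong suc (swap-max a b)) (sym (+-suc (b ∸ a) a)))
        -- The rest has F + g w = o + z registers, so X′ - z falls short of o by the g - c - 1
        -- blocks behind block c.
        excess : X′ ∸ z ≤ o ∸ (g ∸ suc c) * w t i
        excess with ≤-total X′ z
        ... | inj₁ X′≤z = ≤-trans (≤-reflexive (m≤n⇒m∸n≡0 X′≤z)) z≤n
        ... | inj₂ z≤X′ = m+n≤o⇒m≤o∸n (X′ ∸ z) (+-cancelʳ-≤ z _ _ (≤-reflexive (begin-equality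
          X′ ∸ z + (g ∸ suc c) * w t i + z ≡⟨ lem (X′ ∸ z) ((g ∸ suc c) * w t i) z ⟩
          X′ ∸ z + z + (g ∸ suc c) * w t i ≡⟨ cong (_+ (g ∸ suc c) * w t i) (m∸n+n≡m z≤X′) ⟩
          X′ + (g ∸ suc c) * w t i ≡⟨ sym (lem′ (F t i) (suc c) (g ∸ suc c) (w t i)) ⟩
          F t i + (suc c + (g ∸ suc c)) * w t i ≡⟨ cong (λ y → F t i + y * w t i) (m+[n∸m]≡n c<g) ⟩
          F t i + g * w t i ≡⟨ sym (proj₁ (length-rest′ len ne)) ⟩
          length rest ≡⟨ sym (wt-length Z u₂ rest) ⟩
          o + z ∎)))
          where
          lem : ∀ a b c → a + b + c ≡ a + c + b
          lem = solve-∀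
          lem′ : ∀ f a b w → f + (a + b) * w ≡ f + a * w + b * w
          lem′ = solve-∀
        main : wt one (part c) ≤ (wt (λ x → ones Z (u₀ x)) xs ∸ (g ∸ suc c) * w t i) + e
        main = ≤-trans part⊆ (≤-trans few (+-monoˡ-≤ e (≤-trans excess (∸-monoˡ-≤ ((g ∸ suc c) * w t i) (rest-≤ (ones Z))))))

-- Strangers stay exponentially few.

module StrangerBounds where

  open import Data.Nat hiding (parity)
  open import Data.Nat.Properties
  open import Data.Nat.DivMod using (_/_; _%_; m%n<n; m/n*n≤m; m≡m%n+[m/n]*n; m<n*o⇒m/o<n)
  open import Data.Nat.Tactic.RingSolver using (solve-∀)
  open import Data.List.Base using ([]; _∷_)
  open ExpanderFamily
  open Integral using (size)
  open Sums
  open Separator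
  open Bags using (div-child)
  open Stages

  module Strangers (fam : Family) (p k : ℕ) (B>1 : 1 < size (Family.W fam)) (g-large : 6 * size (Family.W fam) ≤ 4 ^ p)
                   (g≥8 : 8 ≤ 4 ^ p) (k≥2 : 2 ≤ k) where

    open Stages.Stage fam p k B>1 g-large g≥8 k≥2 public

    -- Node a of level j is responsible for the ranks in [a G , (a + 1) G), G = g ^ (k - j).
    width : ℕ → ℕ
    width j = g ^ (k ∸ j)

    -- The ranks too high (true) or too low (false) for a node.
    alien : Bool → ℕ → ℕ → ℕ → ℕ
    alien true j a = ones (suc a * width j)
    alien false j a = zeros (a * width j)

    native : ℕ → ℕ → ℕ → ℕ
    native j a r = ones (a * width j) r * zeros (suc a * width j) r

    alien≤1 : ∀ h j a r → alien h j a r ≤ 1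
    alien≤1 true j a r = χ≤1 _
    alien≤1 false j a r = χ≤1 _

    ∑-native : ∀ j a → ∑ N (native j a) ≤ width j
    ∑-native j a = begin
      ∑ N (native j a) ≤⟨ ∑-⊆ (native j a) (m≤n+m N Z) ⟩
      ∑ (Z + N) (native j a) ≡⟨ ∑-split Z N (native j a) ⟩
      ∑ Z (native j a) + ∑ N (λ r → native j a (Z + r)) ≡⟨ cong (_+ ∑ N (λ r → native j a (Z + r))) (∑-zero Z (λ r r<Z → cong (_* zeros (suc a * width j) r) (ones-< r<Z))) ⟩
      ∑ N (λ r → native j a (Z + r)) ≤⟨ ∑-support N (width j) _ (λ r → *-mono-≤ {ones Z (Z + r)} {1} {zeros (suc a * width j) (Z + r)} {1} (ones≤1 Z (Z + r)) (zeros≤1 (suc a * width j) (Z + r)))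
        (λ r le → trans (cong (ones Z (Z + r) *_) (zeros-≥ (≤-trans (≤-reflexive (+-comm (width j) Z)) (+-monoʳ-≤ Z le)))) (*-zeroʳ (ones Z (Z + r)))) ⟩
      width j ∎
      where
      open ≤-Reasoning
      Z = a * width j

    native-or-alien : ∀ j a r → 1 ≤ native j a r + (alien true j a r + alien false j a r)
    native-or-alien j a r with r <? a * width j
    ... | yes lt = ≤-trans (≤-reflexive (sym (zeros-< lt))) (≤-trans (m≤n+m (alien false j a r) (alien true j a r)) (m≤n+m (alien true j a r + alien false j a r) (native j a r)))
    ... | no ≮ with suc a * width j ≤? r
    ...   | yes le = ≤-trans (≤-reflexive (sym (ones-≥ le))) (≤-trans (m≤m+n (alien true j a r) (alien false j a r)) (m≤n+m (alien true j a r + alien false j a r) (native j a r)))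
    ...   | no ≰ = ≤-trans (≤-reflexive (sym (cong₂ _*_ (ones-≥ (≮⇒≥ ≮)) (zeros-< (≰⇒> ≰))))) (m≤m+n (native j a r) (alien true j a r + alien false j a r))

    beyond : Bool → ℕ → ℕ → ℕ
    beyond true c c′ = χ (does (c <? c′))
    beyond false c c′ = χ (does (c′ <? c))

    number-beyond : Bool → ℕ → ℕ
    number-beyond true c = g ∸ suc c
    number-beyond false c = c

    number-beyond≤g : ∀ h c → c < g → number-beyond h c ≤ g
    number-beyond≤g true c _ = m∸n≤m g (suc c)
    number-beyond≤g false c c<g = <⇒≤ c<g

    ∑-beyond : ∀ h c → c < g → ∑ g (beyond h c) ≤ number-beyond h c
    ∑-beyond false c _ = ∑-support g c _ (λ x → χ≤1 _) (λ x le → cong χ (dec-false (x <? c) (≤⇒≯ le)))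
    ∑-beyond true c c<g = begin
      ∑ g (beyond true c) ≡⟨ cong (λ z → ∑ z (beyond true c)) (sym (m+[n∸m]≡n c<g)) ⟩
      ∑ (suc c + (g ∸ suc c)) (beyond true c) ≡⟨ ∑-split (suc c) (g ∸ suc c) (beyond true c) ⟩
      ∑ (suc c) (beyond true c) + ∑ (g ∸ suc c) (λ x → beyond true c (suc c + x))
        ≡⟨ cong (_+ ∑ (g ∸ suc c) (λ x → beyond true c (suc c + x))) (∑-zero (suc c) (λ x x≤c → cong χ (dec-false (c <? x) (≤⇒≯ (s≤s⁻¹ x≤c))))) ⟩
      ∑ (g ∸ suc c) (λ x → beyond true c (suc c + x)) ≤⟨ ∑-mono (g ∸ suc c) (λ x → χ≤1 _) ⟩
      ∑ (g ∸ suc c) (λ x → 1) ≡⟨ trans (∑-const (g ∸ suc c) 1) (*-identityʳ _) ⟩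
      g ∸ suc c ∎
      where open ≤-Reasoning

    width>0 : ∀ j → 0 < width j
    width>0 j = g^>0 (k ∸ j)

    width-suc : ∀ j → suc j ≤ k → width j ≡ g * width (suc j)
    width-suc j le = cong (g ^_) (sym (suc-pred-∸ le))
      where
      suc-pred-∸ : ∀ {j k} → suc j ≤ k → suc (k ∸ suc j) ≡ k ∸ j
      suc-pred-∸ le = sym (+-∸-assoc 1 le)

    -- Dividing r by the width names the node of level i + 1 responsible for it; if r belongs below
    -- x, that node is a sibling beyond c on the side h.
    alien-parent : ∀ h i x c → suc i ≤ k → c < g → ∀ r →
      alien h (suc i) (x * g + c) r ≤ alien h i x r + ∑ g (λ c′ → beyond h c c′ * native (suc i) (x * g + c′) r)
    alien-parent h i x c i<k c<g r = go h
      where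
      G = width (suc i)
      instance
        G≢0 : NonZero G
        G≢0 = >-nonZero (width>0 (suc i))
      d = r / G
      dG≤r : d * G ≤ r
      dG≤r = m/n*n≤m r G
      r<d+1G : r < suc d * G
      r<d+1G = ≤-<-trans (≤-reflexive (m≡m%n+[m/n]*n r G)) (+-monoˡ-< (d * G) (m%n<n r G))
      found : ∀ h → d ∸ x * g < g → x * g ≤ d → beyond h c (d ∸ x * g) ≡ 1 →
              1 ≤ ∑ g (λ c′ → beyond h c c′ * native (suc i) (x * g + c′) r)
      found h d<g xg≤d sel = ≤-trans (≤-reflexive (sym (cong₂ _*_ sel nat))) (∑-≥ g (d ∸ x * g) (λ c′ → beyond h c c′ * native (suc i) (x * g + c′) r) d<g)
        where
        nat : native (suc i) (x * g + (d ∸ x * g)) r ≡ 1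
        nat = trans (cong (λ z → native (suc i) z r) (m+[n∸m]≡n xg≤d)) (cong₂ _*_ (ones-≥ dG≤r) (zeros-< r<d+1G))
      go : ∀ h → alien h (suc i) (x * g + c) r ≤ alien h i x r + ∑ g (λ c′ → beyond h c c′ * native (suc i) (x * g + c′) r)
      go true with r <? suc (x * g + c) * G | suc x * width i ≤? r
      ... | yes lt | _ = ≤-trans (≤-reflexive (ones-< lt)) z≤n
      ... | no _ | yes le = ≤-trans (χ≤1 _) (≤-trans (≤-reflexive (sym (ones-≥ le))) (m≤m+n (alien true i x r) _))
      ... | no ≮ | no ≰ = ≤-trans (χ≤1 _) (≤-trans (found true c′<g (≤-trans (m≤m+n (x * g) c) (<⇒≤ a<d)) (cong χ (dec-true (c <? d ∸ x * g) c<c′))) (m≤n+m _ (alien true i x r)))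
        where
        a<d : x * g + c < d
        a<d = s≤s⁻¹ (*-cancelʳ-< G (suc (x * g + c)) (suc d) (≤-<-trans (≮⇒≥ ≮) r<d+1G))
        c<c′ : c < d ∸ x * g
        c<c′ = m+n≤o⇒m≤o∸n (suc c) (≤-trans (≤-reflexive (cong suc (+-comm c (x * g)))) a<d)
        c′<g : d ∸ x * g < g
        c′<g = +-cancelʳ-< (x * g) (d ∸ x * g) g (≤-<-trans (≤-reflexive (m∸n+n≡m (≤-trans (m≤m+n (x * g) c) (<⇒≤ a<d))))
          (*-cancelʳ-< G d (suc x * g) (≤-<-trans dG≤r (<-≤-trans (≰⇒> ≰) (≤-reflexive (trans (cong (suc x *_) (width-suc i i<k)) (sym (*-assoc (suc x) g G))))))))
      go false with r <? (x * g + c) * G | r <? x * width i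
      ... | no ≮ | _ = ≤-trans (≤-reflexive (zeros-≥ (≮⇒≥ ≮))) z≤n
      ... | yes _ | yes lt = ≤-trans (χ≤1 _) (≤-trans (≤-reflexive (sym (zeros-< lt))) (m≤m+n (alien false i x r) _))
      ... | yes lt | no ≮ = ≤-trans (χ≤1 _) (≤-trans (found false (<-trans c′<c c<g) xg≤d (cong χ (dec-true (d ∸ x * g <? c) c′<c))) (m≤n+m _ (alien false i x r)))
        where
        d<a : d < x * g + c
        d<a = *-cancelʳ-< G d (x * g + c) (≤-<-trans dG≤r lt)
        xg≤d : x * g ≤ d
        xg≤d = s≤s⁻¹ (*-cancelʳ-< G (x * g) (suc d) (≤-<-trans (≤-trans (≤-reflexive (trans (*-assoc x g G) (cong (x *_) (sym (width-suc i i<k))))) (≮⇒≥ ≮)) r<d+1G))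
        c′<c : d ∸ x * g < c
        c′<c = +-cancelʳ-< (x * g) (d ∸ x * g) c (≤-<-trans (≤-reflexive (m∸n+n≡m xg≤d)) (<-≤-trans d<a (≤-reflexive (+-comm (x * g) c))))

    -- `u r` is the exact run: the rank in each register after r rounds, initially a permutation.
    -- Four rounds make a time step, hence the indices t * 4.
    module Run (τ : ℕ) (τ≤ : τ + 17 ≤ k + 12 * k) (u : ℕ → ℕ → ℕ)
      (stages : ∀ t → t < τ → ∀ i → i ≤ k → ∀ q → q < g ^ i →
                BagStage t i (bag t i q) (u (t * 4)) (u (1 + t * 4)) (u (2 + t * 4)) (u (3 + t * 4)) (u (4 + t * 4)))
      (ranks : ∀ W → ∑ N (λ x → W (u 0 x)) ≡ ∑ N W) where

      count : ℕ → (ℕ → ℕ) → ℕ → ℕ → ℕ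
      count t W i q = wt (λ x → W (u (t * 4) x)) (bag t i q)

      invariant : ∀ t → t ≤ τ → Inv t
      invariant t le = inv t (≤-trans (+-monoˡ-≤ 17 le) τ≤)

      running : ∀ t → t < τ → t + 18 ≤ k + 12 * k
      running t lt = ≤-trans (≤-reflexive (+-suc t 17)) (≤-trans (+-monoˡ-≤ 17 lt) τ≤)

      ranks-at : ∀ t → t ≤ τ → ∀ W → ∑ N (λ x → W (u (t * 4) x)) ≡ ∑ N W
      ranks-at zero _ W = ranks W
      ranks-at (suc t) t<τ W = begin
        ∑ N (λ x → W (u (4 + t * 4) x)) ≡⟨ sym (conserved t _) ⟩
        ∑ (suc k) (λ i → ∑ (g ^ i) (λ q → wt (λ x → W (u (4 + t * 4) x)) (bag t i q)))
          ≡⟨ ∑-cong< (suc k) (λ i i≤k → ∑-cong< (g ^ i) (λ q q< → stage-total (length-bag t i q) (stages t t<τ i (s≤s⁻¹ i≤k) q q<) W)) ⟩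
        ∑ (suc k) (λ i → ∑ (g ^ i) (λ q → wt (λ x → W (u (t * 4) x)) (bag t i q))) ≡⟨ conserved t _ ⟩
        ∑ N (λ x → W (u (t * 4) x)) ≡⟨ ranks-at t (<⇒≤ t<τ) W ⟩
        ∑ N W ∎
        where open ≡-Reasoning

      count-≤-sz : ∀ t W i q → (∀ r → W r ≤ 1) → count t W i q ≤ sz t i
      count-≤-sz t W i q le = ≤-trans (wt-mono (λ x → le (u (t * 4) x)) (bag t i q)) (≤-reflexive (trans (wt-1 (bag t i q)) (length-bag t i q)))

      count-≤-∑ : ∀ t → t ≤ τ → ∀ W i q → i ≤ k → q < g ^ i → count t W i q ≤ ∑ N W
      count-≤-∑ t t≤τ W i q i≤k q< = ≤-trans (∑-≥ (g ^ i) q (count t W i) q<)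
        (≤-trans (∑-≥ (suc k) i (λ i → ∑ (g ^ i) (count t W i)) (s≤s i≤k)) (≤-reflexive (trans (conserved t _) (ranks-at t t≤τ W))))

      root-native : ∀ t → t ≤ τ → ∀ h → count t (alien h 0 0) 0 0 ≡ 0
      root-native t t≤τ h = n≤0⇒n≡0 (≤-trans (count-≤-∑ t t≤τ (alien h 0 0) 0 0 z≤n (s≤s z≤n)) (≤-reflexive (none h)))
        where
        none : ∀ h → ∑ N (alien h 0 0) ≡ 0
        none true = ∑-zero N (λ r r<N → ones-< (<-≤-trans r<N (≤-reflexive (sym (+-identityʳ N)))))
        none false = ∑-zero N (λ r _ → zeros-≥ {0} {r} z≤n)

      -- The central invariant: strangers to node a make up at most a share g^-(20 + 19 ρ) of the
      -- capacity of a bag at depth ρ below a. The slope 19 exceeds 12 + 1, the growth of capacity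
      -- and number of bags per level, so strays in a subtree form a convergent series.
      Few : ℕ → Set
      Few t = ∀ h j ρ a b → 1 ≤ j → j + ρ ≤ k → a < g ^ j → b < g ^ ρ →
              Bd (count t (alien h j a) (j + ρ) (a * g ^ ρ + b)) (t + 20 + 19 * ρ) (k + 12 * (j + ρ))

      node< : ∀ {j ρ a b} → a < g ^ j → b < g ^ ρ → a * g ^ ρ + b < g ^ (j + ρ)
      node< {j} {ρ} {a} {b} a< b< = begin-strict
        a * g ^ ρ + b        <⟨ +-monoʳ-< (a * g ^ ρ) b< ⟩
        a * g ^ ρ + g ^ ρ    ≡⟨ +-comm (a * g ^ ρ) (g ^ ρ) ⟩
        suc a * g ^ ρ        ≤⟨ *-monoˡ-≤ (g ^ ρ) a< ⟩
        g ^ j * g ^ ρ        ≡⟨ sym (^-distribˡ-+-* g j ρ) ⟩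
        g ^ (j + ρ)          ∎
        where open ≤-Reasoning

      module _ (t : ℕ) (t<τ : t < τ) (IH : Few t) where

        private
          I = invariant t (<⇒≤ t<τ)

          stage : ∀ i → i ≤ k → ∀ q → q < g ^ i → BagStage t i (bag t i q) (u (t * 4)) (u (1 + t * 4)) (u (2 + t * 4)) (u (3 + t * 4)) (u (4 + t * 4))
          stage = stages t t<τ

          later : (ℕ → ℕ) → ℕ → ℕ
          later W x = W (u (4 + t * 4) x)

        kids-few : ∀ W i q {x y} → i ≤ k → q < g ^ i →
                   (∀ c → c < g → suc i ≤ k → Bd (count t W (suc i) (q * g + c)) (suc x) y) → Bd (wt (later W) (kids t i q)) x y
        kids-few W i q i≤k q< b with i <? k
        ... | no i≮k = subst (λ z → Bd (wt (later W) z) _ _) (sym (kids-≮ t q i≮k)) Bd-vac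
        ... | yes i<k = subst (λ z → Bd (wt (later W) z) _ _) (sym (kids-< t q i<k))
          (Bd-≤ (≤-reflexive (wt-collect (later W) g (λ c → ups t (suc i) (q * g + c))))
            (Bd-∑ g (λ c → wt (later W) (ups t (suc i) (q * g + c))) ≤-refl (λ c c<g → Bd-≤ (sent-total (length-bag t (suc i) (q * g + c)) (stage (suc i) i<k (q * g + c) (child< c<g)) W) (b c c<g i<k))))
          where
          child< : ∀ {c} → c < g → q * g + c < g ^ suc i
          child< {c} c<g = begin-strict
            q * g + c      <⟨ +-monoʳ-< (q * g) c<g ⟩
            q * g + g      ≡⟨ +-comm (q * g) g ⟩
            suc q * g      ≤⟨ *-monoˡ-≤ g q< ⟩
            g ^ i * g      ≡⟨ *-comm (g ^ i) g ⟩
            g ^ suc i      ∎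
            where open ≤-Reasoning

        -- In a closed bag the inductive bound is below 1, so there is nothing to filter; in an open
        -- one the strangers fill at most half the fringe, as `extract` requires.
        filtered : ∀ h j a i q c ρ → 1 ≤ i → i ≤ k → q < g ^ i →
                   Bd (count t (alien h j a) i q) (t + 20 + 19 * ρ) (k + 12 * i) →
                   Bd (wt (later (alien h j a)) (block t i q c)) (t + 20 + 19 * ρ + 18) (k + 12 * i)
        filtered h j a i q c ρ i≥1 i≤k q< b with t + 18 ≤? k + 12 * i
        ... | no ≰ = Bd-≤ (≤-trans (part-total (length-bag t i q) (stage i i≤k q q<) (alien h j a) c) (≤-reflexive (Bd-zero lt b))) Bd-vac
          where
          lt : k + 12 * i < t + 20 + 19 * ρ
          lt = <-≤-trans (≰⇒> ≰) (≤-trans (+-monoʳ-≤ t (m≤m+n 18 2)) (m≤m+n (t + 20) (19 * ρ)))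
        ... | yes open′ = Bd-scale 18 (by h 2S≤F) b
          where
          open ≤-Reasoning
          S = count t (alien h j a) i q
          F≡ = F-scale t i i≥1 open′
          2S≤F : 2 * S ≤ F t i
          2S≤F = *-cancelʳ-≤ (2 * S) (F t i) (g ^ (t + 17)) {{g^≢0 (t + 17)}} (begin
            2 * S * g ^ (t + 17) ≡⟨ lem S (g ^ (t + 17)) ⟩
            S * (2 * g ^ (t + 17)) ≤⟨ *-monoʳ-≤ S (*-monoˡ-≤ (g ^ (t + 17)) g≥2) ⟩
            S * g ^ suc (t + 17) ≤⟨ unbd (Bd-shift (suc (t + 17)) (k + 12 * i) (2 + 19 * ρ) (lem′ t ρ (k + 12 * i)) b) ⟩
            g ^ (k + 12 * i) ≡⟨ sym F≡ ⟩
            F t i * g ^ (t + 17) ∎)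
            where
            lem : ∀ s x → 2 * s * x ≡ s * (2 * x)
            lem = solve-∀
            lem′ : ∀ t ρ y → suc (t + 17) + y + (2 + 19 * ρ) ≡ t + 20 + 19 * ρ + y
            lem′ = solve-∀
          sz≤ : sz t i ≤ g ^ 17 * F t i
          sz≤ = *-cancelʳ-≤ (sz t i) (g ^ 17 * F t i) (g ^ t) {{g^≢0 t}} (begin
            sz t i * g ^ t ≤⟨ unbd (cap I i i≤k) ⟩
            g ^ (k + 12 * i) ≡⟨ sym F≡ ⟩
            F t i * g ^ (t + 17) ≡⟨ cong (F t i *_) (^-distribˡ-+-* g t 17) ⟩
            F t i * (g ^ t * g ^ 17) ≡⟨ lem (F t i) (g ^ t) (g ^ 17) ⟩
            g ^ 17 * F t i * g ^ t ∎)
            where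
            lem : ∀ a b c → a * (b * c) ≡ c * a * b
            lem = solve-∀
          by : ∀ h → 2 * count t (alien h j a) i q ≤ F t i → wt (later (alien h j a)) (block t i q c) * g ^ 18 ≤ count t (alien h j a) i q
          by true le = filter-ones (length-bag t i q) (stage i i≤k q q<) (suc a * width j) c sz≤ le
          by false le = filter-zeros (length-bag t i q) (stage i i≤k q q<) (a * width j) c sz≤ le

        -- Node x divides its bag among children whose own bags are empty at this time. The aim is
        -- that no child has many more natives in bag x than its share w.
        module Sibling (i x : ℕ) (i<k : suc i ≤ k) (x< : x < g ^ i) (odd : sz t (suc i) ≡ 0) where
          private
            j = suc i
            G = width j

          subtree : (ℕ → ℕ) → ℕ → ℕ
          subtree W a = ∑ (suc (k ∸ j)) (λ y → ∑ (g ^ y) (λ b → count t W (j + y) (a * g ^ y + b)))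

          strays : ℕ → ℕ
          strays a = ∑ (suc (k ∸ j)) (λ y → ∑ (g ^ y) (λ b → count t (alien true j a) (j + y) (a * g ^ y + b) + count t (alien false j a) (j + y) (a * g ^ y + b)))

          below : ℕ
          below = ∑ (suc (k ∸ j)) (λ y → g ^ y * sz t (j + y))

          lower : ℕ
          lower = ∑ i (λ i′ → g ^ i′ * sz t i′)

          suck≡ : suc k ≡ j + suc (k ∸ j)
          suck≡ = trans (cong suc (sym (m+[n∸m]≡n i<k))) (sym (+-suc j (k ∸ j)))

          node-and-subtree : ∀ W a → a < g ^ j → count t W i x + subtree W a ≤ ∑ N W
          node-and-subtree W a a< = begin
            count t W i x + subtree W a
              ≤⟨ +-mono-≤ (≤-trans (∑-≥ (g ^ i) x (count t W i) x<) (∑-≥ j i L ≤-refl)) (∑-mono (suc (k ∸ j)) level) ⟩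
            ∑ j L + ∑ (suc (k ∸ j)) (λ y → L (j + y)) ≡⟨ sym (∑-split j (suc (k ∸ j)) L) ⟩
            ∑ (j + suc (k ∸ j)) L ≡⟨ cong (λ z → ∑ z L) (sym suck≡) ⟩
            ∑ (suc k) L ≡⟨ trans (conserved t _) (ranks-at t (<⇒≤ t<τ) W) ⟩
            ∑ N W ∎
            where
            open ≤-Reasoning
            L : ℕ → ℕ
            L i′ = ∑ (g ^ i′) (count t W i′)
            level : ∀ y → ∑ (g ^ y) (λ b → count t W (j + y) (a * g ^ y + b)) ≤ L (j + y)
            level y = ≤-trans (∑-≥ (g ^ j) a (λ a → ∑ (g ^ y) (λ b → count t W (j + y) (a * g ^ y + b))) a<)
              (≤-reflexive (trans (sym (∑-grid (g ^ j) (g ^ y) (count t W (j + y)))) (cong (λ z → ∑ z (count t W (j + y))) (sym (^-distribˡ-+-* g j y)))))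

          below-≤ : ∀ a → below ≤ subtree (native j a) a + strays a
          below-≤ a = begin
            below ≤⟨ ∑-mono (suc (k ∸ j)) level ⟩
            ∑ (suc (k ∸ j)) (λ y → Nat y + Str y) ≡⟨ ∑-+ (suc (k ∸ j)) Nat Str ⟩
            subtree (native j a) a + strays a ∎
            where
            open ≤-Reasoning
            Nat Str : ℕ → ℕ
            Nat y = ∑ (g ^ y) (λ b → count t (native j a) (j + y) (a * g ^ y + b))
            Str y = ∑ (g ^ y) (λ b → count t (alien true j a) (j + y) (a * g ^ y + b) + count t (alien false j a) (j + y) (a * g ^ y + b))
            node : ∀ i′ q → sz t i′ ≤ count t (native j a) i′ q + (count t (alien true j a) i′ q + count t (alien false j a) i′ q)
            node i′ q = begin
              sz t i′ ≡⟨ sym (trans (wt-1 (bag t i′ q)) (length-bag t i′ q)) ⟩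
              wt (λ _ → 1) (bag t i′ q) ≤⟨ wt-mono (λ r → native-or-alien j a (u (t * 4) r)) (bag t i′ q) ⟩
              wt (λ r → native j a (u (t * 4) r) + (alien true j a (u (t * 4) r) + alien false j a (u (t * 4) r))) (bag t i′ q)
                ≡⟨ trans (wt-+ _ _ (bag t i′ q)) (cong (λ z → count t (native j a) i′ q + z) (wt-+ _ _ (bag t i′ q))) ⟩
              count t (native j a) i′ q + (count t (alien true j a) i′ q + count t (alien false j a) i′ q) ∎
            level : ∀ y → g ^ y * sz t (j + y) ≤ Nat y + Str y
            level y = begin
              g ^ y * sz t (j + y) ≡⟨ sym (∑-const (g ^ y) (sz t (j + y))) ⟩
              ∑ (g ^ y) (λ _ → sz t (j + y)) ≤⟨ ∑-mono (g ^ y) (λ b → node (j + y) (a * g ^ y + b)) ⟩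
              ∑ (g ^ y) (λ b → count t (native j a) (j + y) (a * g ^ y + b) + (count t (alien true j a) (j + y) (a * g ^ y + b) + count t (alien false j a) (j + y) (a * g ^ y + b)))
                ≡⟨ ∑-+ (g ^ y) _ _ ⟩
              Nat y + Str y ∎

          -- At distance y there are g^y bags, capacity grows by g^12 per level and the share of
          -- strangers falls by g^19, so the terms decay like g^-6. The term y = 0 vanishes by
          -- `odd`.
          strays-few : ∀ a → a < g ^ j → Bd (strays a) (t + 24) (k + 12 * j)
          strays-few a a< = Bd-≤ (≤-reflexive (trans (∑-suc (k ∸ j) R) (cong (_+ ∑ (k ∸ j) (λ y → R (suc y))) R0≡0)))
            (Bd-geometric (k ∸ j) (λ y → R (suc y)) layer)
            where
            f : ℕ → ℕ → ℕ
            f y b = count t (alien true j a) (j + y) (a * g ^ y + b) + count t (alien false j a) (j + y) (a * g ^ y + b)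
            R : ℕ → ℕ
            R y = ∑ (g ^ y) (f y)
            empty : ∀ h b → count t (alien h j a) (j + 0) (a * g ^ 0 + b) ≡ 0
            empty h b = n≤0⇒n≡0 (≤-trans (count-≤-sz t (alien h j a) (j + 0) (a * g ^ 0 + b) (alien≤1 h j a)) (≤-reflexive (trans (cong (sz t) (+-identityʳ j)) odd)))
            R0≡0 : R 0 ≡ 0
            R0≡0 = ∑-zero 1 (λ b _ → cong₂ _+_ (empty true b) (empty false b))
            layer : ∀ y → y < k ∸ j → Bd (R (suc y)) (suc (t + 24) + 6 * y) (k + 12 * j)
            layer y y< = Bd-shift (suc (t + 24) + 6 * y) (k + 12 * j) 0 (lem t k j y)
              (Bd-∑^ (suc y) (f (suc y)) (λ b b< → Bd-+ (bnd true b b<) (bnd false b b<)))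
              where
              bnd : ∀ h b → b < g ^ suc y → Bd (count t (alien h j a) (j + suc y) (a * g ^ suc y + b)) (suc (t + 19 + 19 * suc y)) (k + 12 * (j + suc y))
              bnd h b b< = subst (λ z → Bd (count t (alien h j a) (j + suc y) (a * g ^ suc y + b)) z (k + 12 * (j + suc y))) (lem′ t y)
                (IH h j (suc y) a b (s≤s z≤n) (≤-trans (+-monoʳ-≤ j y<) (≤-reflexive (m+[n∸m]≡n i<k))) a< b<)
                where
                lem′ : ∀ t y → t + 20 + 19 * suc y ≡ suc (t + 19 + 19 * suc y)
                lem′ = solve-∀
              lem : ∀ t k j y → suc (t + 24) + 6 * y + (suc y + (k + 12 * (j + suc y))) + 0 ≡ t + 19 + 19 * suc y + (k + 12 * j)
              lem = solve-∀

          balance-sheet : g ^ j * below + (lower + g ^ i * sz t i) ≡ g ^ j * G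
          balance-sheet = begin
            g ^ j * below + (lower + g ^ i * sz t i) ≡⟨ +-comm (g ^ j * below) _ ⟩
            ∑ j L + g ^ j * below ≡⟨ cong (∑ j L +_) (trans (sym (∑-* (suc (k ∸ j)) (g ^ j) _)) (∑-cong (suc (k ∸ j)) (λ y → trans (sym (*-assoc (g ^ j) (g ^ y) _)) (cong (_* sz t (j + y)) (sym (^-distribˡ-+-* g j y)))))) ⟩
            ∑ j L + ∑ (suc (k ∸ j)) (λ y → L (j + y)) ≡⟨ sym (∑-split j (suc (k ∸ j)) L) ⟩
            ∑ (j + suc (k ∸ j)) L ≡⟨ cong (λ z → ∑ z L) (sym suck≡) ⟩
            ∑ (suc k) L ≡⟨ total I ⟩
            g ^ k ≡⟨ cong (g ^_) (sym (m+[n∸m]≡n i<k)) ⟩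
            g ^ (j + (k ∸ j)) ≡⟨ ^-distribˡ-+-* g j (k ∸ j) ⟩
            g ^ j * G ∎
            where
            open ≡-Reasoning
            L : ℕ → ℕ
            L i′ = g ^ i′ * sz t i′

          below≤G : below ≤ G
          below≤G = *-cancelˡ-≤ (g ^ j) {{g^≢0 j}} (≤-trans (m≤m+n _ _) (≤-reflexive balance-sheet))

          -- The natives of a child for which its subtree has no place yet; equal for all children,
          -- since sizes depend on the level only.
          slack : ℕ
          slack = G ∸ below

          slack-sheet : g ^ i * (g * slack) ≡ lower + g ^ i * sz t i
          slack-sheet = +-cancelˡ-≡ (g ^ j * below) _ _ (begin
            g ^ j * below + g ^ i * (g * slack) ≡⟨ lem g (g ^ i) below slack ⟩
            g ^ j * (below + slack) ≡⟨ cong (g ^ j *_) (m+[n∸m]≡n below≤G) ⟩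
            g ^ j * G ≡⟨ sym balance-sheet ⟩
            g ^ j * below + (lower + g ^ i * sz t i) ∎)
            where
            open ≡-Reasoning
            lem : ∀ g a b s → g * a * b + a * (g * s) ≡ g * a * (b + s)
            lem = solve-∀

          -- Of the places missing below the children of x, bag x accounts for sz t i; `extra` is
          -- the share of x in what is still nearer the root.
          extra : ℕ
          extra = g * slack ∸ sz t i

          sz≤ : sz t i ≤ g * slack
          sz≤ = *-cancelˡ-≤ (g ^ i) {{g^≢0 i}} (≤-trans (m≤n+m _ lower) (≤-reflexive (sym slack-sheet)))

          extra-sheet : extra * g ^ i ≡ lower
          extra-sheet = +-cancelʳ-≡ (g ^ i * sz t i) _ _ (trans (trans (lem extra (g ^ i) (sz t i)) (cong (g ^ i *_) (m∸n+n≡m sz≤))) slack-sheet)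
            where
            lem : ∀ e a s → e * a + a * s ≡ a * (e + s)
            lem = solve-∀

          -- The levels nearer the root are bounded by a series dominated by level i - 1, whose
          -- capacity is g^24 times smaller than that of level j.
          extra-few : Bd extra (t + 23) (k + 12 * j)
          extra-few = go i i<k extra-sheet
            where
            prefix : ∀ n → n ≤ k → ∑ (suc n) (λ i′ → g ^ i′ * sz t i′) * g ^ t ≤ 2 * g ^ (k + 13 * n)
            term : ∀ n → n ≤ k → g ^ n * sz t n * g ^ t ≤ g ^ (k + 13 * n)
            term n n≤k = begin
              g ^ n * sz t n * g ^ t     ≡⟨ *-assoc (g ^ n) (sz t n) (g ^ t) ⟩
              g ^ n * (sz t n * g ^ t)   ≤⟨ *-monoʳ-≤ (g ^ n) (unbd (cap I n n≤k)) ⟩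
              g ^ n * g ^ (k + 12 * n)   ≡⟨ sym (^-distribˡ-+-* g n (k + 12 * n)) ⟩
              g ^ (n + (k + 12 * n))     ≡⟨ cong (g ^_) (lem n k) ⟩
              g ^ (k + 13 * n)           ∎
              where
              open ≤-Reasoning
              lem : ∀ n k → n + (k + 12 * n) ≡ k + 13 * n
              lem = solve-∀
            prefix zero n≤k = ≤-trans (term 0 n≤k) (m≤n*m _ 2)
            prefix (suc n) n≤k = begin
              (∑ (suc n) (λ i′ → g ^ i′ * sz t i′) + g ^ suc n * sz t (suc n)) * g ^ t
                ≡⟨ *-distribʳ-+ (g ^ t) (∑ (suc n) (λ i′ → g ^ i′ * sz t i′)) (g ^ suc n * sz t (suc n)) ⟩
              ∑ (suc n) (λ i′ → g ^ i′ * sz t i′) * g ^ t + g ^ suc n * sz t (suc n) * g ^ t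
                ≤⟨ +-mono-≤ (prefix n (≤-trans (n≤1+n n) n≤k)) (term (suc n) n≤k) ⟩
              2 * g ^ (k + 13 * n) + g ^ (k + 13 * suc n)
                ≤⟨ +-monoˡ-≤ _ (≤-trans (*-monoˡ-≤ (g ^ (k + 13 * n)) g≥2) (^-monoʳ-≤ g {suc (k + 13 * n)} {k + 13 * suc n} (≤-trans (m≤m+n (suc (k + 13 * n)) 12) (≤-reflexive (lem k n))))) ⟩
              g ^ (k + 13 * suc n) + g ^ (k + 13 * suc n) ≡⟨ cong (λ z → g ^ (k + 13 * suc n) + z) (sym (+-identityʳ _)) ⟩
              2 * g ^ (k + 13 * suc n) ∎
              where
              open ≤-Reasoning
              lem : ∀ k n → suc (k + 13 * n) + 12 ≡ k + 13 * suc n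
              lem = solve-∀
            go : ∀ n → suc n ≤ k → extra * g ^ n ≡ ∑ n (λ i′ → g ^ i′ * sz t i′) → Bd extra (t + 23) (k + 12 * suc n)
            go zero _ e = Bd-≤ (≤-reflexive (trans (sym (*-identityʳ extra)) e)) Bd-vac
            go (suc n) le e = Bd-shift (t + 23) (k + 12 * suc (suc n)) 1 (lem t k n)
              (Bd-scale {extra} {extra * g ^ suc n} {t} {suc (k + 13 * n)} (suc n) ≤-refl (bd (begin
                extra * g ^ suc n * g ^ t ≡⟨ cong (_* g ^ t) e ⟩
                ∑ (suc n) (λ i′ → g ^ i′ * sz t i′) * g ^ t ≤⟨ prefix n (≤-trans (n≤1+n n) (≤-trans (n≤1+n (suc n)) le)) ⟩
                2 * g ^ (k + 13 * n) ≤⟨ *-monoˡ-≤ (g ^ (k + 13 * n)) g≥2 ⟩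
                g ^ suc (k + 13 * n) ∎)))
              where
              open ≤-Reasoning
              lem : ∀ t k n → t + 23 + suc (k + 13 * n) + 1 ≡ t + suc n + (k + 12 * suc (suc n))
              lem = solve-∀

          module _ (h : Bool) (c : ℕ) (c<g : c < g) where
            private
              a = x * g + c
              n = number-beyond h c
              S = count t (alien h j a) i x
              A = count t (alien h i x) i x

            sibling< : ∀ {c′} → c′ < g → x * g + c′ < g ^ j
            sibling< {c′} c′<g = begin-strict
              x * g + c′     <⟨ +-monoʳ-< (x * g) c′<g ⟩
              x * g + g      ≡⟨ +-comm (x * g) g ⟩
              suc x * g      ≤⟨ *-monoˡ-≤ g x< ⟩
              g ^ i * g      ≡⟨ *-comm (g ^ i) g ⟩
              g ^ j          ∎
              where open ≤-Reasoning

            -- A child has at most G natives in all, and the `below` registers of its subtree are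
            -- natives up to the strays, which leaves few for bag x.
            natives : ∀ c′ → c′ < g → count t (native j (x * g + c′)) i x ≤ slack + strays (x * g + c′)
            natives c′ c′<g = +-cancelʳ-≤ below _ _ (begin
              count t (native j a′) i x + below ≤⟨ +-monoʳ-≤ (count t (native j a′) i x) (below-≤ a′) ⟩
              count t (native j a′) i x + (subtree (native j a′) a′ + strays a′) ≡⟨ sym (+-assoc (count t (native j a′) i x) _ _) ⟩
              count t (native j a′) i x + subtree (native j a′) a′ + strays a′ ≤⟨ +-monoˡ-≤ (strays a′) (≤-trans (node-and-subtree (native j a′) a′ (sibling< c′<g)) (∑-native j a′)) ⟩
              G + strays a′ ≡⟨ cong (_+ strays a′) (sym (m+[n∸m]≡n below≤G)) ⟩
              below + slack + strays a′ ≡⟨ lem below slack (strays a′) ⟩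
              slack + strays a′ + below ∎)
              where
              open ≤-Reasoning
              a′ = x * g + c′
              lem : ∀ a b c → a + b + c ≡ b + c + a
              lem = solve-∀

            intruders : S ≤ A + (n * slack + ∑ g (λ c′ → strays (x * g + c′)))
            intruders = begin
              S ≤⟨ wt-mono (λ r → alien-parent h i x c i<k c<g (u (t * 4) r)) (bag t i x) ⟩
              wt (λ r → alien h i x (u (t * 4) r) + ∑ g (λ c′ → beyond h c c′ * native j (x * g + c′) (u (t * 4) r))) (bag t i x)
                ≡⟨ wt-+ (λ r → alien h i x (u (t * 4) r)) (λ r → ∑ g (λ c′ → beyond h c c′ * native j (x * g + c′) (u (t * 4) r))) (bag t i x) ⟩
              A + wt (λ r → ∑ g (λ c′ → beyond h c c′ * native j (x * g + c′) (u (t * 4) r))) (bag t i x)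
                ≡⟨ cong (A +_) (wt-∑ (λ c′ r → beyond h c c′ * native j (x * g + c′) (u (t * 4) r)) (bag t i x)) ⟩
              A + ∑ g (λ c′ → wt (λ r → beyond h c c′ * native j (x * g + c′) (u (t * 4) r)) (bag t i x))
                ≡⟨ cong (A +_) (∑-cong g (λ c′ → wt-* (beyond h c c′) (λ r → native j (x * g + c′) (u (t * 4) r)) (bag t i x))) ⟩
              A + ∑ g (λ c′ → beyond h c c′ * count t (native j (x * g + c′)) i x)
                ≤⟨ +-monoʳ-≤ A (∑-mono< g (λ c′ c′<g → ≤-trans (*-monoʳ-≤ (beyond h c c′) (natives c′ c′<g)) (split h c′))) ⟩
              A + ∑ g (λ c′ → beyond h c c′ * slack + strays (x * g + c′))
                ≡⟨ cong (A +_) (trans (∑-+ g (λ c′ → beyond h c c′ * slack) (λ c′ → strays (x * g + c′))) (cong (_+ ∑ g (λ c′ → strays (x * g + c′))) (∑-*ʳ g slack (beyond h c)))) ⟩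
              A + (∑ g (beyond h c) * slack + ∑ g (λ c′ → strays (x * g + c′)))
                ≤⟨ +-monoʳ-≤ A (+-monoˡ-≤ _ (*-monoˡ-≤ slack (∑-beyond h c c<g))) ⟩
              A + (n * slack + ∑ g (λ c′ → strays (x * g + c′))) ∎
              where
              open ≤-Reasoning
              wt-∑ : ∀ (f : ℕ → ℕ → ℕ) xs → wt (λ r → ∑ g (λ c′ → f c′ r)) xs ≡ ∑ g (λ c′ → wt (f c′) xs)
              wt-∑ f [] = sym (∑-zero g (λ _ _ → refl))
              wt-∑ f (y ∷ ys) = trans (cong (λ z → ∑ g (λ c′ → f c′ y) + z) (wt-∑ f ys)) (sym (∑-+ g (λ c′ → f c′ y) (λ c′ → wt (f c′) ys)))
              wt-* : ∀ b (f : ℕ → ℕ) xs → wt (λ r → b * f r) xs ≡ b * wt f xs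
              wt-* b f [] = sym (*-zeroʳ b)
              wt-* b f (y ∷ ys) = trans (cong (λ z → b * f y + z) (wt-* b f ys)) (sym (*-distribˡ-+ b (f y) (wt f ys)))
              split : ∀ h c′ → beyond h c c′ * (slack + strays (x * g + c′)) ≤ beyond h c c′ * slack + strays (x * g + c′)
              split h c′ = ≤-trans (≤-reflexive (*-distribˡ-+ (beyond h c c′) slack _)) (+-monoʳ-≤ (beyond h c c′ * slack) (≤-trans (*-monoˡ-≤ (strays (x * g + c′)) (b≤1 h)) (≤-reflexive (*-identityˡ _))))
                where
                b≤1 : ∀ h → beyond h c c′ ≤ 1
                b≤1 true = χ≤1 (does (c <? c′))
                b≤1 false = χ≤1 (does (c′ <? c))

            -- g slack = g w + up + extra by the bookkeeping above; since n ≤ g, the fraction n / g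
            -- of the last two terms is at most their full size.
            slack-≤ : n * slack ≤ n * w t i + (up t i + extra)
            slack-≤ = *-cancelˡ-≤ g (begin
              g * (n * slack) ≡⟨ l₁ g n slack ⟩
              n * (g * slack) ≡⟨ cong (n *_) (trans (sym (m+[n∸m]≡n sz≤)) (cong (_+ extra) (sym (sz≡ t i)))) ⟩
              n * (g * w t i + up t i + extra) ≡⟨ l₂ n g (w t i) (up t i) extra ⟩
              g * (n * w t i) + n * (up t i + extra) ≤⟨ +-monoʳ-≤ (g * (n * w t i)) (*-monoˡ-≤ (up t i + extra) (number-beyond≤g h c c<g)) ⟩
              g * (n * w t i) + g * (up t i + extra) ≡⟨ sym (*-distribˡ-+ g (n * w t i) _) ⟩
              g * (n * w t i + (up t i + extra)) ∎)
              where
              open ≤-Reasoning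
              l₁ : ∀ g n s → g * (n * s) ≡ n * (g * s)
              l₁ = solve-∀
              l₂ : ∀ n g w u e → n * (g * w + u + e) ≡ g * (n * w) + n * (u + e)
              l₂ = solve-∀

            balanced-block : Σ[ e ∈ ℕ ] (wt (later (alien h j a)) (block t i x c) ≤ (S ∸ n * w t i) + e × e * g ^ 17 ≤ sz t i)
            balanced-block = by h
              where
              by : ∀ h → Σ[ e ∈ ℕ ] (wt (later (alien h j a)) (block t i x c) ≤ (count t (alien h j a) i x ∸ number-beyond h c * w t i) + e × e * g ^ 17 ≤ sz t i)
              by true = balance-ones (length-bag t i x) (stage i (≤-trans (n≤1+n i) i<k) x x<) (suc a * width j) c c<g
              by false = balance-zeros (length-bag t i x) (stage i (≤-trans (n≤1+n i) i<k) x x<) (a * width j) c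

            A-few : Bd A (t + 23) (k + 12 * j)
            A-few = by i x (≤-trans (n≤1+n i) i<k) x<
              where
              by : ∀ i x → i ≤ k → x < g ^ i → Bd (count t (alien h i x) i x) (t + 23) (k + 12 * suc i)
              by zero zero _ _ = Bd-≤ (≤-reflexive (root-native t (<⇒≤ t<τ) h)) Bd-vac
              by zero (suc x) _ (s≤s ())
              by (suc i) x i≤k x< = Bd-shift (t + 23) (k + 12 * suc (suc i)) 9 (lem t k i)
                (subst₂ (λ q l → Bd (count t (alien h (suc i) x) l q) (t + 20 + 19 * 0) (k + 12 * l)) (lem′ x) (+-identityʳ (suc i))
                  (IH h (suc i) 0 x 0 (s≤s z≤n) (≤-trans (≤-reflexive (+-identityʳ (suc i))) i≤k) x< (s≤s z≤n)))
                where
                lem : ∀ t k i → t + 23 + (k + 12 * suc i) + 9 ≡ t + 20 + 19 * 0 + (k + 12 * suc (suc i))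
                lem = solve-∀
                lem′ : ∀ x → x * 1 + 0 ≡ x
                lem′ = solve-∀

            -- Balancing subtracts n w, the room of the n blocks beyond c, and this cancels the main
            -- part of n slack. What remains are strangers to x, up, extra, strays and the
            -- near-sorting error, each at most g^-23 times the scale of level j.
            block-few : Bd (wt (later (alien h j a)) (block t i x c)) (t + 22) (k + 12 * j)
            block-few with balanced-block
            ... | e , le , small = Bd-≤ (≤-trans le (begin
                (S ∸ n * w t i) + e ≤⟨ +-monoˡ-≤ e (m≤n+o⇒m∸n≤o S (n * w t i) (begin
                  S ≤⟨ intruders ⟩
                  A + (n * slack + Σs) ≤⟨ +-monoʳ-≤ A (+-monoˡ-≤ Σs slack-≤) ⟩
                  A + (n * w t i + (up t i + extra) + Σs) ≡⟨ l₁ A (n * w t i) (up t i) extra Σs ⟩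
                  n * w t i + (A + (up t i + (extra + Σs))) ∎)) ⟩
                A + (up t i + (extra + Σs)) + e ≡⟨ l₂ A (up t i) extra Σs e ⟩
                A + (up t i + (extra + (Σs + e))) ∎))
              (Bd-+₅ (Bd-shift (suc (t + 22)) (k + 12 * j) 0 (same t k i) A-few)
                (Bd-shift (suc (t + 22)) (k + 12 * j) 5 (l₃ t k i) (up-bound I (running t t<τ) i i≤k))
                (Bd-shift (suc (t + 22)) (k + 12 * j) 0 (same t k i) extra-few)
                (Bd-shift (suc (t + 22)) (k + 12 * j) 0 (same t k i) Σs-few)
                (Bd-shift (suc (t + 22)) (k + 12 * j) 6 (l₄ t k i) (Bd-scale 17 small (cap I i i≤k))))
              where
              open ≤-Reasoning
              i≤k = ≤-trans (n≤1+n i) i<k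
              Σs = ∑ g (λ c′ → strays (x * g + c′))
              Σs-few : Bd Σs (t + 23) (k + 12 * j)
              Σs-few = Bd-∑ g (λ c′ → strays (x * g + c′)) ≤-refl (λ c′ c′<g → Bd-shift (suc (t + 23)) (k + 12 * j) 0 (lem t k i) (strays-few (x * g + c′) (sibling< c′<g)))
                where
                lem : ∀ t k i → suc (t + 23) + (k + 12 * suc i) + 0 ≡ t + 24 + (k + 12 * suc i)
                lem = solve-∀
              same : ∀ t k i → suc (t + 22) + (k + 12 * suc i) + 0 ≡ t + 23 + (k + 12 * suc i)
              same = solve-∀
              l₁ : ∀ A n u e s → A + (n + (u + e) + s) ≡ n + (A + (u + (e + s)))
              l₁ = solve-∀
              l₂ : ∀ A u x s e → A + (u + (x + s)) + e ≡ A + (u + (x + (s + e)))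
              l₂ = solve-∀
              l₃ : ∀ t k i → suc (t + 22) + (k + 12 * i) + 5 ≡ t + 16 + (k + 12 * suc i)
              l₃ = solve-∀
              l₄ : ∀ t k i → suc (t + 22) + (k + 12 * i) + 6 ≡ t + 17 + (k + 12 * suc i)
              l₄ = solve-∀

        private
          parity-shift : ∀ n → par n ≢ true → par (suc n) ≡ true
          parity-shift n ne with par n
          ... | true = contradiction refl ne
          ... | false = refl

        -- An empty parent sends nothing; if the parent is not empty, parity empties level i + 1, as
        -- `Sibling` requires.
        own-block : ∀ h i a → suc i ≤ k → a < g ^ suc i →
                    Bd (wt (later (alien h (suc i) a)) (block t i (a / g) (a % g))) (t + 22) (k + 12 * suc i)
        own-block h i a i<k a< with sz t i ≟ 0
        ... | yes e = Bd-≤ (≤-trans (part-total (length-bag t i (a / g)) (stage i (≤-trans (n≤1+n i) i<k) (a / g) x<) (alien h (suc i) a) (a % g))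
                (≤-trans (count-≤-sz t (alien h (suc i) a) i (a / g) (alien≤1 h (suc i) a)) (≤-reflexive e))) Bd-vac
          where
          x< : a / g < g ^ i
          x< = m<n*o⇒m/o<n (<-≤-trans a< (≤-reflexive (*-comm g (g ^ i))))
        ... | no ne = subst (λ z → Bd (wt (later (alien h (suc i) z)) (block t i (_/_ a g {{g≢0}}) (_%_ a g {{g≢0}}))) (t + 22) (k + 12 * suc i)) (sym a≡)
            (Sibling.block-few i (a / g) i<k x< odd h (a % g) (m%n<n a g))
          where
          x< : a / g < g ^ i
          x< = m<n*o⇒m/o<n (<-≤-trans a< (≤-reflexive (*-comm g (g ^ i))))
          a≡ : a ≡ a / g * g + a % g
          a≡ = trans (m≡m%n+[m/n]*n a g) (+-comm (a % g) _)
          odd : sz t (suc i) ≡ 0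
          odd = parity I (suc i) (trans (cong par (+-suc t i)) (parity-shift (t + i) (λ e → ne (parity I i e))))

        -- A bag receives a block from its parent and fringes from its children. For ρ = 0 the block
        -- is controlled by balancing, otherwise by the factor g^18 filtered out at the parent. What
        -- comes up was at distance ρ + 1, where the share is smaller by g^19 against g^12 in
        -- capacity.
        few-suc : Few (suc t)
        few-suc h (suc i) zero a b (s≤s z≤n) le a< (s≤s z≤n) =
          subst₂ (λ l q → Bd (count (suc t) (alien h (suc i) a) l q) (suc t + 20 + 19 * 0) (k + 12 * l)) (sym (+-identityʳ (suc i))) (sym (lem a))
            (Bd-≤ (≤-reflexive (wt-++ (later (alien h (suc i) a)) (block t i (a / g) (a % g)) (kids t (suc i) a)))
              (Bd-+ (Bd-shift (suc (suc t + 20 + 19 * 0)) (k + 12 * suc i) 0 (l₁ t k i) (own-block h i a i<k a<))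
                (kids-few (alien h (suc i) a) (suc i) a i<k a< (λ c c<g l → Bd-shift (suc (suc (suc t + 20 + 19 * 0))) (k + 12 * suc i) 4 (l₂ t k i)
                  (subst₂ (λ l q → Bd (count t (alien h (suc i) a) l q) (t + 20 + 19 * 1) (k + 12 * l)) (+-comm (suc i) 1) (cong (λ z → a * z + c) (*-identityʳ g))
                    (IH h (suc i) 1 a c (s≤s z≤n) (≤-trans (≤-reflexive (+-comm (suc i) 1)) l) a< (subst (c <_) (sym (*-identityʳ g)) c<g)))))))
          where
          i<k : suc i ≤ k
          i<k = ≤-trans (≤-reflexive (sym (+-identityʳ (suc i)))) le
          lem : ∀ a → a * 1 + 0 ≡ a
          lem = solve-∀
          l₁ : ∀ t k i → suc (suc t + 20 + 19 * 0) + (k + 12 * suc i) + 0 ≡ t + 22 + (k + 12 * suc i)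
          l₁ = solve-∀
          l₂ : ∀ t k i → suc (suc (suc t + 20 + 19 * 0)) + (k + 12 * suc (suc i)) + 4 ≡ t + 20 + 19 * 1 + (k + 12 * suc i)
          l₂ = solve-∀
        few-suc h j@(suc _) (suc ρ) a b j≥1 le a< b< =
          subst (λ l → Bd (count (suc t) W l q) (suc t + 20 + 19 * suc ρ) (k + 12 * l)) (sym (+-suc j ρ))
            (Bd-≤ (≤-reflexive (wt-++ (later W) (block t (j + ρ) (q / g) (q % g)) (kids t (suc (j + ρ)) q)))
              (Bd-+ blocks (kids-few W (suc (j + ρ)) q i<k q< (λ c c<g l → Bd-shift (suc (suc (suc t + 20 + 19 * suc ρ))) (k + 12 * suc (j + ρ)) 4 (l₁ t k j ρ)
                (subst₂ (λ l q → Bd (count t W l q) (t + 20 + 19 * suc (suc ρ)) (k + 12 * l)) (lev j ρ) (node c)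
                  (IH h j (suc (suc ρ)) a (b * g + c) j≥1 (≤-trans (≤-reflexive (lev j ρ)) l) a< (kid< c<g)))))))
          where
          W = alien h j a
          q = a * g ^ suc ρ + b
          q′ = a * g ^ ρ + b / g
          i<k : suc (j + ρ) ≤ k
          i<k = ≤-trans (≤-reflexive (sym (+-suc j ρ))) le
          q< : q < g ^ suc (j + ρ)
          q< = <-≤-trans (node< {j} {suc ρ} a< b<) (≤-reflexive (cong (g ^_) (+-suc j ρ)))
          lev : ∀ j ρ → j + suc (suc ρ) ≡ suc (suc (j + ρ))
          lev = solve-∀
          node : ∀ c → a * g ^ suc (suc ρ) + (b * g + c) ≡ q * g + c
          node c = lem a g (g ^ ρ) b c
            where
            lem : ∀ a g x b c → a * (g * (g * x)) + (b * g + c) ≡ (a * (g * x) + b) * g + c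
            lem = solve-∀
          kid< : ∀ {c} → c < g → b * g + c < g ^ suc (suc ρ)
          kid< {c} c<g = begin-strict
            b * g + c      <⟨ +-monoʳ-< (b * g) c<g ⟩
            b * g + g      ≡⟨ +-comm (b * g) g ⟩
            suc b * g      ≤⟨ *-monoˡ-≤ g b< ⟩
            g ^ suc ρ * g  ≡⟨ *-comm (g ^ suc ρ) g ⟩
            g ^ suc (suc ρ) ∎
            where open ≤-Reasoning
          q≡ : q ≡ q′ * g + b % g
          q≡ = trans (cong (a * g ^ suc ρ +_) (trans (m≡m%n+[m/n]*n b g) (+-comm (b % g) _))) (lem a g (g ^ ρ) (b / g) (b % g))
            where
            lem : ∀ a g x d r → a * (g * x) + (d * g + r) ≡ (a * x + d) * g + r
            lem = solve-∀
          q/g≡ : q / g ≡ q′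
          q/g≡ = trans (cong (_/ g) q≡) (div-child q′ (b % g) g (m%n<n b g))
          b/g< : b / g < g ^ ρ
          b/g< = m<n*o⇒m/o<n (<-≤-trans b< (≤-reflexive (*-comm g (g ^ ρ))))
          l₁ : ∀ t k j ρ → suc (suc (suc t + 20 + 19 * suc ρ)) + (k + 12 * suc (suc (j + ρ))) + 4 ≡ t + 20 + 19 * suc (suc ρ) + (k + 12 * suc (j + ρ))
          l₁ = solve-∀
          l₂ : ∀ t k j ρ → suc (suc t + 20 + 19 * suc ρ) + (k + 12 * (j + ρ)) + 9 ≡ t + 20 + 19 * ρ + 18 + (k + 12 * suc (j + ρ))
          l₂ = solve-∀
          blocks : Bd (wt (later W) (block t (j + ρ) (q / g) (q % g))) (suc (suc t + 20 + 19 * suc ρ)) (k + 12 * suc (j + ρ))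
          blocks = Bd-shift (suc (suc t + 20 + 19 * suc ρ)) (k + 12 * suc (j + ρ)) 9 (l₂ t k j ρ)
            (filtered h j a (j + ρ) (q / g) (q % g) ρ (≤-trans j≥1 (m≤m+n j ρ)) (≤-trans (n≤1+n (j + ρ)) i<k) (subst (_< g ^ (j + ρ)) (sym q/g≡) (node< {j} {ρ} a< b/g<))
              (subst (λ q → Bd (count t W (j + ρ) q) (t + 20 + 19 * ρ) (k + 12 * (j + ρ))) (sym q/g≡) (IH h j ρ a (b / g) j≥1 (≤-trans (n≤1+n (j + ρ)) i<k) a< b/g<)))

      few : ∀ t → t ≤ τ → Few t
      few zero _ h (suc i) ρ a b (s≤s z≤n) _ _ _ = Bd-vac
      few (suc t) t<τ = few-suc t t<τ (few t (<⇒≤ t<τ))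

      no-aliens : ∀ h j ρ a b → 1 ≤ j → j + ρ ≤ k → a < g ^ j → b < g ^ ρ → k + 12 * (j + ρ) < τ + 20 + 19 * ρ →
                  count τ (alien h j a) (j + ρ) (a * g ^ ρ + b) ≡ 0
      no-aliens h j ρ a b j≥1 le a< b< lt = Bd-zero lt (few τ ≤-refl h j ρ a b j≥1 le a< b<)

-- The complete sorting network.

module Networks where

  open import Data.Nat hiding (parity)
  open import Data.Nat.Properties
  open import Data.Nat.Tactic.RingSolver using (solve-∀)
  open import Data.List.Base using (List; []; _∷_; _++_; length; map; reverse)
  open import Data.List.Properties using (unfold-reverse; reverse-involutive; length-reverse; length-++)
  import Data.List.Relation.Unary.AllPairs.Properties as AllPairsₚ
  open ExpanderFamily
  open Integral using (size)
  open Sums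
  open Separator
  open Stages
  open StrangerBounds

  -- Runs are characterised, not computed: `sorts` holds for any contents `u` that begin as a
  -- permutation of the ranks and are sorted groupwise by every round.
  record Network : Set where
    field
      N R m  : ℕ
      rounds : ℕ → List (List ℕ)
      order  : List ℕ
      small  : ∀ r → r < R → All (λ g → length g ≤ m) (rounds r)
      covers : ∀ r → r < R → ∀ f → wt (wt f) (rounds r) ≡ ∑ N f
      orders : ∀ f → wt f order ≡ ∑ N f
      sorts  : ∀ (u : ℕ → ℕ → ℕ) → (∀ W → ∑ N (λ x → W (u 0 x)) ≡ ∑ N W) →
               (∀ r → r < R → All (SortsUp (u r) (u (suc r))) (rounds r)) →
               AllPairs (λ x y → u R x ≤ u R y) order

  AllPairs-reverse : ∀ {A : Set} {R : A → A → Set} xs → AllPairs R xs → AllPairs (λ x y → R y x) (reverse xs)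
  AllPairs-reverse [] [] = []
  AllPairs-reverse {R = R} (x ∷ xs) (p ∷ ps) = subst (AllPairs (λ x y → R y x)) (sym (unfold-reverse x xs))
    (AllPairsₚ.++⁺ (AllPairs-reverse xs ps) ([] ∷ []) (All.map (λ r → r ∷ []) (All-reverse xs p)))
    where
    All-reverse : ∀ {P : _ → Set} ys → All P ys → All P (reverse ys)
    All-reverse [] [] = []
    All-reverse {P} (y ∷ ys) (q ∷ qs) = subst (All P) (sym (unfold-reverse y ys)) (++⁺ (All-reverse ys qs) (q ∷ []))

  wt-reverse : ∀ {A : Set} (f : A → ℕ) xs → wt f (reverse xs) ≡ wt f xs
  wt-reverse f [] = refl
  wt-reverse f (x ∷ xs) = trans (cong (wt f) (unfold-reverse x xs)) (trans (wt-++ f (reverse xs) (x ∷ []))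
    (trans (cong₂ _+_ (wt-reverse f xs) (+-identityʳ (f x))) (+-comm (wt f xs) (f x))))

  wt-map-reverse : ∀ (f : ℕ → ℕ) gs → wt (wt f) (map reverse gs) ≡ wt (wt f) gs
  wt-map-reverse f [] = refl
  wt-map-reverse f (g ∷ gs) = cong₂ _+_ (wt-reverse f g) (wt-map-reverse f gs)

  -- The network has ascending sorters only; a descending round lists its groups backwards.
  SortsDown-reverse : ∀ {u u′} xs → SortsUp u u′ (reverse xs) → SortsDown u u′ xs
  SortsDown-reverse {u} {u′} xs (r , a) =
    (λ W → trans (sym (wt-reverse (λ x → W (u′ x)) xs)) (trans (r W) (wt-reverse (λ x → W (u x)) xs))) ,
    subst (AllPairs (λ x y → u′ y ≤ u′ x)) (reverse-involutive xs) (AllPairs-reverse (reverse xs) a)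

  wt≡0⇒All : ∀ {A : Set} (f : A → ℕ) xs → wt f xs ≡ 0 → All (λ x → f x ≡ 0) xs
  wt≡0⇒All f [] e = []
  wt≡0⇒All f (x ∷ xs) e = m+n≡0⇒m≡0 (f x) e ∷ wt≡0⇒All f xs (m+n≡0⇒n≡0 (f x) e)

  module Sorter (fam : Family) (p k′ : ℕ) (B>1 : 1 < size (Family.W fam)) (g-large : 6 * size (Family.W fam) ≤ 4 ^ p)
                (g≥8 : 8 ≤ 4 ^ p) (k≥2 : 2 ≤ suc k′) where

    private k = suc k′
    open StrangerBounds.Strangers fam p k B>1 g-large g≥8 k≥2 public

    -- At this time the stranger bound is below 1 both in level k′ and in the leaves under it, and
    -- all levels nearer the root are empty.
    τ : ℕ
    τ = (k + 12 * k) ∸ 18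

    τ+18 : τ + 18 ≡ k + 12 * k
    τ+18 = m∸n+n≡m (≤-trans (m≤m+n 18 8) (+-mono-≤ k≥2 (*-monoʳ-≤ 12 k≥2)))

    each-bag : ℕ → (ℕ → ℕ → List ℕ → List (List ℕ)) → List (List ℕ)
    each-bag t round = collect (suc k) (λ i → collect (g ^ i) (λ q → round t i (bag t i q)))

    stage₁ stage₂ stage₃ stage₄ : ℕ → List (List ℕ)
    stage₁ t = each-bag t (λ t i xs → map reverse (round₁ t i xs))
    stage₂ t = each-bag t (λ t i xs → map reverse (round₂ t i xs))
    stage₃ t = each-bag t round₃
    stage₄ t = each-bag t round₄

    -- A node of level k′ and its leaves now hold exactly the registers with the ranks of that node,
    -- at most g of them, so one exact sorter finishes.
    group : ℕ → List ℕ
    group q = bag τ k′ q ++ collect g (λ c → bag τ k (q * g + c))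

    final : List (List ℕ)
    final = collect (g ^ k′) (λ q → group q ∷ [])

    schedule : ℕ → ℕ → ℕ → List (List ℕ)
    schedule zero t zero = final
    schedule zero t (suc r) = []
    schedule (suc n) t zero = stage₁ t
    schedule (suc n) t (suc zero) = stage₂ t
    schedule (suc n) t (suc (suc zero)) = stage₃ t
    schedule (suc n) t (suc (suc (suc zero))) = stage₄ t
    schedule (suc n) t (suc (suc (suc (suc r)))) = schedule n (suc t) r

    schedule-skip : ∀ s n t r → schedule (s + n) t (s * 4 + r) ≡ schedule n (t + s) r
    schedule-skip zero n t r = cong (λ z → schedule n z r) (sym (+-identityʳ t))
    schedule-skip (suc s) n t r = trans (schedule-skip s n (suc t) r) (cong (λ z → schedule n z r) (sym (+-suc t s)))

    rounds : ℕ → List (List ℕ)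
    rounds = schedule τ 0

    rounds-stage : ∀ t r → t < τ → rounds (r + t * 4) ≡ schedule (suc (τ ∸ suc t)) t r
    rounds-stage t r t<τ = trans (cong₂ (λ n x → schedule n 0 x) (trans (sym (m+[n∸m]≡n t<τ)) (sym (+-suc t (τ ∸ suc t)))) (+-comm r (t * 4)))
      (schedule-skip t (suc (τ ∸ suc t)) 0 r)

    rounds-final : rounds (τ * 4) ≡ final
    rounds-final = trans (cong₂ (λ n x → schedule n 0 x) (sym (+-identityʳ τ)) (sym (+-identityʳ (τ * 4)))) (schedule-skip τ 0 0 0)

    private
      empty-above : ∀ j → j < k′ → sz τ j ≡ 0
      empty-above j j<k′ = closed (inv τ (≤-trans (+-monoʳ-≤ τ (n≤1+n 17)) (≤-reflexive τ+18))) j (s≤s j<k′)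
        (+-cancelʳ-≤ 18 _ _ (begin
          k + 12 * j + 18     ≤⟨ +-monoˡ-≤ 18 (+-monoʳ-≤ k (*-monoʳ-≤ 12 (≤-refl {j}))) ⟩
          k + 12 * j + 18     ≤⟨ +-monoʳ-≤ (k + 12 * j) (m≤m+n 18 6) ⟩
          k + 12 * j + 24     ≡⟨ lem k j ⟩
          k + 12 * (2 + j)    ≤⟨ +-monoʳ-≤ k (*-monoʳ-≤ 12 (s≤s j<k′)) ⟩
          k + 12 * k          ≡⟨ sym τ+18 ⟩
          τ + 18              ∎))
        where
        open ≤-Reasoning
        lem : ∀ k j → k + 12 * j + 24 ≡ k + 12 * (2 + j)
        lem = solve-∀

      wt-groups : ∀ f → ∑ (g ^ k′) (λ q → wt f (group q)) ≡ ∑ N f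
      wt-groups f = begin
        ∑ (g ^ k′) (λ q → wt f (group q)) ≡⟨ trans (∑-cong (g ^ k′) (λ q → trans (wt-++ f (bag τ k′ q) _) (cong (wt f (bag τ k′ q) +_) (wt-collect f g (λ c → bag τ k (q * g + c)))))) (∑-+ (g ^ k′) _ _) ⟩
        L k′ + ∑ (g ^ k′) (λ q → ∑ g (λ c → wt f (bag τ k (q * g + c)))) ≡⟨ cong (L k′ +_) (sym (∑-children k′ (λ q → wt f (bag τ k q)))) ⟩
        L k′ + L k ≡⟨ cong (λ z → z + L k′ + L k) (sym (∑-zero k′ (λ j j<k′ → ∑-zero (g ^ j) (λ q _ → none j q j<k′)))) ⟩
        ∑ k′ L + L k′ + L k ≡⟨ conserved τ f ⟩
        ∑ N f ∎
        where
        open ≡-Reasoning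
        L : ℕ → ℕ
        L i = ∑ (g ^ i) (λ q → wt f (bag τ i q))
        none : ∀ j q → j < k′ → wt f (bag τ j q) ≡ 0
        none j q j<k′ = cong (wt f) (length≡0 (bag τ j q) (trans (length-bag τ j q) (empty-above j j<k′)))
          where
          length≡0 : ∀ (xs : List ℕ) → length xs ≡ 0 → xs ≡ []
          length≡0 [] _ = refl

      wt-stage : ∀ t round → (∀ i xs f → wt (wt f) (round t i xs) ≡ wt f xs) → ∀ f → wt (wt f) (each-bag t round) ≡ ∑ N f
      wt-stage t round e f = trans (wt-collect (wt f) (suc k) _) (trans (∑-cong (suc k) (λ i → trans (wt-collect (wt f) (g ^ i) (λ q → round t i (bag t i q))) (∑-cong (g ^ i) (λ q → e i (bag t i q) f)))) (conserved t f))

      wt-schedule : ∀ n t r → r < suc (n * 4) → ∀ f → wt (wt f) (schedule n t r) ≡ ∑ N f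
      wt-schedule zero t zero _ f = trans (wt-collect (wt f) (g ^ k′) (λ q → group q ∷ [])) (trans (∑-cong (g ^ k′) (λ q → +-identityʳ _)) (wt-groups f))
      wt-schedule zero t (suc r) (s≤s ()) f
      wt-schedule (suc n) t zero _ = wt-stage t (λ t i xs → map reverse (round₁ t i xs)) (λ i xs f → trans (wt-map-reverse f (nearSort₁ xs)) (wt-nearSort₁ xs f))
      wt-schedule (suc n) t (suc zero) _ = wt-stage t (λ t i xs → map reverse (round₂ t i xs)) (λ i xs f → trans (wt-map-reverse f (nearSort₂ xs)) (wt-nearSort₂ xs f))
      wt-schedule (suc n) t (suc (suc zero)) _ = wt-stage t round₃ (λ i xs f → wt-round₃ t i xs f)
      wt-schedule (suc n) t (suc (suc (suc zero))) _ = wt-stage t round₄ (λ i xs f → wt-round₄ t i xs f)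
      wt-schedule (suc n) t (suc (suc (suc (suc r)))) (s≤s (s≤s (s≤s (s≤s lt)))) = wt-schedule n (suc t) r lt

      Small : List (List ℕ) → Set
      Small = All (λ xs → length xs ≤ m)

      small-reverse : ∀ gs → Small gs → Small (map reverse gs)
      small-reverse gs all = map⁺ (All.map (λ {xs} le → subst (_≤ m) (sym (length-reverse xs)) le) all)

      small-singletons : ∀ xs → Small (singletons xs)
      small-singletons [] = []
      small-singletons (x ∷ xs) = m>0 ∷ small-singletons xs

      small-stage : ∀ t round → (∀ i xs → Small (round t i xs)) → Small (each-bag t round)
      small-stage t round s = All-collect⁺ (suc k) (λ i _ → All-collect⁺ (g ^ i) (λ q _ → s i (bag t i q)))

      length-group : ∀ q → length (group q) ≤ m
      length-group q = ≤-trans (≤-reflexive (trans (length-++ (bag τ k′ q)) (cong₂ _+_ (length-bag τ k′ q) (trans (sym (wt-1 (collect g (λ c → bag τ k (q * g + c))))) (trans (wt-collect (λ _ → 1) g (λ c → bag τ k (q * g + c))) (trans (∑-cong g (λ c → trans (wt-1 (bag τ k (q * g + c))) (length-bag τ k (q * g + c)))) (∑-const g (sz τ k))))))))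
        (≤-trans (*-cancelˡ-≤ (g ^ k′) {{g^≢0 k′}} (begin
          g ^ k′ * (sz τ k′ + g * sz τ k) ≡⟨ lem (g ^ k′) (sz τ k′) g (sz τ k) ⟩
          g ^ k′ * sz τ k′ + g ^ k * sz τ k ≤⟨ +-monoˡ-≤ (g ^ k * sz τ k) (m≤n+m (g ^ k′ * sz τ k′) (∑ k′ (λ i → g ^ i * sz τ i))) ⟩
          ∑ (suc k) (λ i → g ^ i * sz τ i) ≡⟨ total (inv τ (≤-trans (+-monoʳ-≤ τ (n≤1+n 17)) (≤-reflexive τ+18))) ⟩
          g * g ^ k′ ≡⟨ *-comm g (g ^ k′) ⟩
          g ^ k′ * g ∎)) (≤-trans (≤-trans (≤-reflexive (sym (^-identityʳ g))) (^-monoʳ-≤ g {1} {18} (s≤s z≤n))) (m≤m*n D K {{>-nonZero K>0}})))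
        where
        open ≤-Reasoning
        lem : ∀ a s g z → a * (s + g * z) ≡ a * s + g * a * z
        lem = solve-∀

      small-schedule : ∀ n t r → r < suc (n * 4) → Small (schedule n t r)
      small-schedule zero t zero _ = All-collect⁺ (g ^ k′) (λ q _ → length-group q ∷ [])
      small-schedule zero t (suc r) (s≤s ())
      small-schedule (suc n) t zero _ = small-stage t (λ t i xs → map reverse (round₁ t i xs)) (λ i xs → small-reverse (nearSort₁ xs) (small₁ xs))
      small-schedule (suc n) t (suc zero) _ = small-stage t (λ t i xs → map reverse (round₂ t i xs)) (λ i xs → small-reverse (nearSort₂ xs) (small₂ xs))
      small-schedule (suc n) t (suc (suc zero)) _ = small-stage t round₃ (λ i xs → ++⁺ (small₁ (Split.rest t i xs)) (small-singletons (Split.hi t i xs)))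
      small-schedule (suc n) t (suc (suc (suc zero))) _ = small-stage t round₄ (λ i xs → ++⁺ (small₂ (Split.rest t i xs)) (small-singletons (Split.hi t i xs)))
      small-schedule (suc n) t (suc (suc (suc (suc r)))) (s≤s (s≤s (s≤s (s≤s lt)))) = small-schedule n (suc t) r lt

    module _ (u : ℕ → ℕ → ℕ) (ranks : ∀ W → ∑ N (λ x → W (u 0 x)) ≡ ∑ N W)
             (steps : ∀ r → r < suc (τ * 4) → All (SortsUp (u r) (u (suc r))) (rounds r)) where

      private
        in-stage : ∀ t r → t < τ → r < 4 → All (SortsUp (u (r + t * 4)) (u (suc (r + t * 4)))) (schedule (suc (τ ∸ suc t)) t r)
        in-stage t r t<τ r<4 = subst (All (SortsUp (u (r + t * 4)) (u (suc (r + t * 4))))) (rounds-stage t r t<τ)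
          (steps (r + t * 4) (m≤n⇒m≤1+n (≤-trans (+-monoˡ-≤ (t * 4) r<4) (*-monoˡ-≤ 4 t<τ))))

        at-bag : ∀ {P : List ℕ → Set} t round → All P (each-bag t round) → ∀ i → i ≤ k → ∀ q → q < g ^ i → All P (round t i (bag t i q))
        at-bag t round all i i≤k q q< = All-collect⁻ (g ^ i) (All-collect⁻ (suc k) all i (s≤s i≤k)) q q<

        stages : ∀ t → t < τ → ∀ i → i ≤ k → ∀ q → q < g ^ i →
                 BagStage t i (bag t i q) (u (t * 4)) (u (1 + t * 4)) (u (2 + t * 4)) (u (3 + t * 4)) (u (4 + t * 4))
        stages t t<τ i i≤k q q< = record
          { step₁ = All.map (λ {xs} → SortsDown-reverse xs) (map⁻ (at-bag t (λ t i xs → map reverse (round₁ t i xs)) (in-stage t 0 t<τ (s≤s z≤n)) i i≤k q q<))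
          ; step₂ = All.map (λ {xs} → SortsDown-reverse xs) (map⁻ (at-bag t (λ t i xs → map reverse (round₂ t i xs)) (in-stage t 1 t<τ (s≤s (s≤s z≤n))) i i≤k q q<))
          ; step₃ = at-bag t round₃ (in-stage t 2 t<τ (s≤s (s≤s (s≤s z≤n)))) i i≤k q q<
          ; step₄ = at-bag t round₄ (in-stage t 3 t<τ (s≤s (s≤s (s≤s (s≤s z≤n))))) i i≤k q q<
          }

        module 𝓡 = Run τ (≤-trans (+-monoʳ-≤ τ (n≤1+n 17)) (≤-reflexive τ+18)) u stages ranks

        last : All (SortsUp (u (τ * 4)) (u (suc (τ * 4)))) final
        last = subst (All (SortsUp (u (τ * 4)) (u (suc (τ * 4))))) rounds-final (steps (τ * 4) ≤-refl)

        G = width k′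

        group-native : ∀ h q → q < g ^ k′ → wt (λ x → alien h k′ q (u (suc (τ * 4)) x)) (group q) ≡ 0
        group-native h q q< = trans (proj₁ (All.head (All-collect⁻ (g ^ k′) last q q<)) (alien h k′ q))
          (trans (wt-++ _ (bag τ k′ q) _) (cong₂ _+_ inner
            (trans (wt-collect _ g (λ c → bag τ k (q * g + c))) (∑-zero g (λ c c<g → leaf c c<g)))))
          where
          inner : 𝓡.count τ (alien h k′ q) k′ q ≡ 0
          inner = subst₂ (λ l x → 𝓡.count τ (alien h k′ q) l x ≡ 0) (+-identityʳ k′) (lem q)
            (𝓡.no-aliens h k′ 0 q 0 (s≤s⁻¹ k≥2) (≤-trans (≤-reflexive (+-identityʳ k′)) (n≤1+n k′)) q< (s≤s z≤n) (begin-strict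
              k + 12 * (k′ + 0) ≤⟨ +-monoʳ-≤ k (*-monoʳ-≤ 12 (≤-trans (≤-reflexive (+-identityʳ k′)) (n≤1+n k′))) ⟩
              k + 12 * k        ≡⟨ sym τ+18 ⟩
              τ + 18            <⟨ +-monoʳ-< τ (n<1+n 18) ⟩
              τ + 19            ≤⟨ +-monoʳ-≤ τ (n≤1+n 19) ⟩
              τ + 20            ≡⟨ sym (+-identityʳ (τ + 20)) ⟩
              τ + 20 + 19 * 0   ∎))
            where
            open ≤-Reasoning
            lem : ∀ q → q * 1 + 0 ≡ q
            lem = solve-∀
          leaf : ∀ c → c < g → 𝓡.count τ (alien h k′ q) k (q * g + c) ≡ 0
          leaf c c<g = subst₂ (λ l x → 𝓡.count τ (alien h k′ q) l x ≡ 0) (+-comm k′ 1) (cong (λ z → q * z + c) (*-identityʳ g))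
            (𝓡.no-aliens h k′ 1 q c (s≤s⁻¹ k≥2) (≤-reflexive (+-comm k′ 1)) q< (subst (c <_) (sym (*-identityʳ g)) c<g) (begin-strict
              k + 12 * (k′ + 1) ≡⟨ cong (λ z → k + 12 * z) (+-comm k′ 1) ⟩
              k + 12 * k        ≡⟨ sym τ+18 ⟩
              τ + 18            <⟨ +-monoʳ-< τ (n<1+n 18) ⟩
              τ + 19            ≤⟨ +-monoʳ-≤ τ (n≤1+n 19) ⟩
              τ + 20            ≤⟨ m≤m+n (τ + 20) (19 * 1) ⟩
              τ + 20 + 19 * 1   ∎))
            where open ≤-Reasoning

        v = u (suc (τ * 4))

        under : ∀ q → q < g ^ k′ → All (λ x → v x < suc q * G) (group q)
        under q q< = All.map (λ {x} e → ≰⇒> (λ le → contradiction (trans (sym (ones-≥ le)) e) (λ ()))) (wt≡0⇒All _ (group q) (group-native true q q<))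

        over : ∀ q → q < g ^ k′ → All (λ x → q * G ≤ v x) (group q)
        over q q< = All.map (λ {x} e → ≮⇒≥ (λ lt → contradiction (trans (sym (zeros-< lt)) e) (λ ()))) (wt≡0⇒All _ (group q) (group-native false q q<))

        build : ∀ n → n ≤ g ^ k′ → AllPairs (λ x y → v x ≤ v y) (collect n group) × All (λ x → v x < n * G) (collect n group)
        build zero _ = [] , []
        build (suc n) n< with build n (<⇒≤ n<)
        ... | ps , bs = AllPairsₚ.++⁺ ps (proj₂ (All.head (All-collect⁻ (g ^ k′) last n n<)))
                (All.map (λ lt → All.map (λ le → ≤-trans (<⇒≤ lt) le) (over n n<)) bs) ,
              ++⁺ (All.map (λ lt → <-≤-trans lt (m≤n+m (n * G) G)) bs) (under n n<)

      sorted : AllPairs (λ x y → u (suc (τ * 4)) x ≤ u (suc (τ * 4)) y) (collect (g ^ k′) group)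
      sorted = proj₁ (build (g ^ k′) ≤-refl)

    network : Network
    network = record
      { N = N ; R = suc (τ * 4) ; m = m ; rounds = rounds ; order = collect (g ^ k′) group
      ; small = small-schedule τ 0
      ; covers = wt-schedule τ 0
      ; orders = λ f → trans (wt-collect f (g ^ k′) group) (wt-groups f)
      ; sorts = sorted
      }

-- Comparison of an approximate run with the exact one.

module Lipschitz where

  open import Data.Nat hiding (parity)
  open import Data.Nat.Properties
  open import Data.List.Base using (List; []; _∷_; _++_; length; map)
  open import Data.List.Properties using (++-assoc)
  import Data.Rational as ℚ
  open ℚ using (ℚ; 0ℚ)
  import Data.Rational.Properties as ℚₚ
  import Data.Rational.Unnormalised as ℚᵘ
  import Data.Rational.Unnormalised.Properties as ℚᵘₚ
  open import Data.Integer as ℤ using (+_)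
  import Data.Integer.Properties as ℤₚ
  open import Relation.Binary using (tri<; tri≈; tri>)
  open import Defs using (ℕ→ℚ)
  open Sums
  open Stages using (χ; χ≤1; SortsUp)
  open Networks

  ℕ→ℚ-+ : ∀ m n → ℕ→ℚ (m + n) ≡ ℕ→ℚ m ℚ.+ ℕ→ℚ n
  ℕ→ℚ-+ m n = ℚₚ.toℚᵘ-injective (begin
    ℚ.toℚᵘ (ℕ→ℚ (m + n)) ≈⟨ ℚₚ.toℚᵘ-fromℚᵘ (ℚᵘ.mkℚᵘ (+ (m + n)) 0) ⟩
    ℚᵘ.mkℚᵘ (+ (m + n)) 0 ≡⟨ cong (λ z → ℚᵘ.mkℚᵘ z 0) (cong₂ ℤ._+_ (sym (ℤₚ.*-identityʳ (+ m))) (sym (ℤₚ.*-identityʳ (+ n)))) ⟩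
    ℚᵘ.mkℚᵘ (+ m) 0 ℚᵘ.+ ℚᵘ.mkℚᵘ (+ n) 0
      ≈⟨ ℚᵘₚ.+-cong (ℚᵘₚ.≃-sym (ℚₚ.toℚᵘ-fromℚᵘ (ℚᵘ.mkℚᵘ (+ m) 0))) (ℚᵘₚ.≃-sym (ℚₚ.toℚᵘ-fromℚᵘ (ℚᵘ.mkℚᵘ (+ n) 0))) ⟩
    ℚ.toℚᵘ (ℕ→ℚ m) ℚᵘ.+ ℚ.toℚᵘ (ℕ→ℚ n) ≈⟨ ℚᵘₚ.≃-sym (ℚₚ.toℚᵘ-homo-+ (ℕ→ℚ m) (ℕ→ℚ n)) ⟩
    ℚ.toℚᵘ (ℕ→ℚ m ℚ.+ ℕ→ℚ n) ∎)
    where open ℚᵘₚ.≃-Reasoning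

  -- A record rather than a plain inequality, so that unification recovers k, a and b.
  record Le (k : ℕ) (a b : ℚ) : Set where
    constructor mk≤
    field bound : a ℚ.≤ b ℚ.+ ℕ→ℚ k

  Le? : ∀ k a b → Dec (Le k a b)
  Le? k a b = map′ mk≤ Le.bound (a ℚ.≤? b ℚ.+ ℕ→ℚ k)

  Le-trans : ∀ {k l a b c} → Le k a b → Le l b c → Le (k + l) a c
  Le-trans {k} {l} {a} {b} {c} (mk≤ p) (mk≤ q) = mk≤ (begin
    a                             ≤⟨ p ⟩
    b ℚ.+ ℕ→ℚ k                   ≤⟨ ℚₚ.+-monoˡ-≤ (ℕ→ℚ k) q ⟩
    (c ℚ.+ ℕ→ℚ l) ℚ.+ ℕ→ℚ k       ≡⟨ ℚₚ.+-assoc c (ℕ→ℚ l) (ℕ→ℚ k) ⟩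
    c ℚ.+ (ℕ→ℚ l ℚ.+ ℕ→ℚ k)       ≡⟨ cong (c ℚ.+_) (trans (sym (ℕ→ℚ-+ l k)) (cong ℕ→ℚ (+-comm l k))) ⟩
    c ℚ.+ ℕ→ℚ (k + l)             ∎)
    where open ℚₚ.≤-Reasoning

  ≤⇒Le0 : ∀ {a b} → a ℚ.≤ b → Le 0 a b
  ≤⇒Le0 {a} {b} p = mk≤ (subst (a ℚ.≤_) (sym (ℚₚ.+-identityʳ b)) p)

  ℕ→ℚ-≥0 : ∀ k → 0ℚ ℚ.≤ ℕ→ℚ k
  ℕ→ℚ-≥0 k = ℚₚ.nonNegative⁻¹ (ℕ→ℚ k) {{ℚₚ.normalize-nonNeg k 1}}

  Le-refl : ∀ k {a} → Le k a a
  Le-refl k {a} = mk≤ (subst (ℚ._≤ a ℚ.+ ℕ→ℚ k) (ℚₚ.+-identityʳ a) (ℚₚ.+-monoʳ-≤ a (ℕ→ℚ-≥0 k)))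

  Le-≤ : ∀ {k l a b} → k ≤ l → Le k a b → Le l a b
  Le-≤ {k} {l} {a} {b} k≤l p = subst (λ z → Le z a b) (m+[n∸m]≡n k≤l) (Le-trans {k} {l ∸ k} {a} {b} {b} p (Le-refl (l ∸ k) {b}))

  -- A ranking of N values: the register x holds the u x-th smallest value X (u x).
  record Ranking (N : ℕ) (a : ℕ → ℚ) : Set where
    field
      u     : ℕ → ℕ
      X     : ℕ → ℚ
      u<    : ∀ x → x < N → u x < N
      value : ∀ x → x < N → X (u x) ≡ a x
      mono  : ∀ r s → r ≤ s → s < N → X r ℚ.≤ X s
      ranks : ∀ W → ∑ N (λ x → W (u x)) ≡ ∑ N W

  -- Insertion of one value at a time behind its equals: it takes rank `pos`, and `bump` moves the
  -- later ranks up by one.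
  ranking : ∀ N a → Ranking N a
  ranking zero a = record { u = λ x → x ; X = λ _ → 0ℚ ; u< = λ _ () ; value = λ _ () ; mono = λ _ _ _ () ; ranks = λ W → refl }
  ranking (suc N) a = record
    { u = u′ ; X = X′ ; u< = u′< ; value = value′ ; mono = mono′ ; ranks = ranks′ }
    where
    open Ranking (ranking N a)
    search : ∀ n → n ≤ N → Σ[ p ∈ ℕ ] (p ≤ n × (∀ r → r < p → X r ℚ.≤ a N) × (∀ r → p ≤ r → r < n → a N ℚ.≤ X r))
    search zero _ = 0 , z≤n , (λ _ ()) , λ _ _ ()
    search (suc n) n<N with X n ℚ.≤? a N
    ... | yes le = suc n , ≤-refl , (λ r r≤n → ℚₚ.≤-trans (mono r n (s≤s⁻¹ r≤n) n<N) le) , λ r n<r r≤n → contradiction (s≤s⁻¹ r≤n) (<⇒≱ n<r)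
    ... | no ≰ with search n (<⇒≤ n<N)
    ...   | p , p≤n , lo , hi = p , m≤n⇒m≤1+n p≤n , lo , λ r p≤r r<1+n → by r p≤r (m≤n⇒m<n∨m≡n (s≤s⁻¹ r<1+n))
      where
      by : ∀ r → p ≤ r → r < n ⊎ r ≡ n → a N ℚ.≤ X r
      by r p≤r (inj₁ r<n) = hi r p≤r r<n
      by r p≤r (inj₂ refl) = ℚₚ.<⇒≤ (ℚₚ.≰⇒> ≰)
    found = search N ≤-refl
    pos = proj₁ found
    pos≤N : pos ≤ N
    pos≤N = proj₁ (proj₂ found)
    bump : ℕ → ℕ
    bump r = if does (r <? pos) then r else suc r
    bump-< : ∀ {r} → r < pos → bump r ≡ r
    bump-< {r} lt = cong (λ b → if b then r else suc r) (dec-true (r <? pos) lt)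
    bump-≥ : ∀ {r} → pos ≤ r → bump r ≡ suc r
    bump-≥ {r} le = cong (λ b → if b then r else suc r) (dec-false (r <? pos) (≤⇒≯ le))
    u′ : ℕ → ℕ
    u′ x = if does (x ≟ N) then pos else bump (u x)
    u′-N : u′ N ≡ pos
    u′-N = cong (λ b → if b then pos else bump (u N)) (dec-true (N ≟ N) refl)
    u′-< : ∀ {x} → x < N → u′ x ≡ bump (u x)
    u′-< {x} lt = cong (λ b → if b then pos else bump (u x)) (dec-false (x ≟ N) (<⇒≢ lt))
    X′ : ℕ → ℚ
    X′ r = if does (r <? pos) then X r else (if does (r ≟ pos) then a N else X (pred r))
    X′-< : ∀ {r} → r < pos → X′ r ≡ X r
    X′-< {r} lt = cong (λ b → if b then X r else (if does (r ≟ pos) then a N else X (pred r))) (dec-true (r <? pos) lt)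
    X′-pos : X′ pos ≡ a N
    X′-pos = trans (cong (λ b → if b then X pos else (if does (pos ≟ pos) then a N else X (pred pos))) (dec-false (pos <? pos) (n≮n pos)))
      (cong (λ b → if b then a N else X (pred pos)) (dec-true (pos ≟ pos) refl))
    X′-> : ∀ {r} → pos ≤ r → X′ (suc r) ≡ X r
    X′-> {r} le = trans (cong (λ b → if b then X (suc r) else (if does (suc r ≟ pos) then a N else X r)) (dec-false (suc r <? pos) (≤⇒≯ (m≤n⇒m≤1+n le))))
      (cong (λ b → if b then a N else X r) (dec-false (suc r ≟ pos) (λ e → 1+n≰n (≤-trans (≤-reflexive e) le))))
    X′-bump : ∀ r → X′ (bump r) ≡ X r
    X′-bump r with r <? pos
    ... | yes lt = trans (cong X′ (bump-< lt)) (X′-< lt)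
    ... | no ≮ = trans (cong X′ (bump-≥ (≮⇒≥ ≮))) (X′-> (≮⇒≥ ≮))
    last-or : ∀ x → x < suc N → x < N ⊎ x ≡ N
    last-or x lt = m≤n⇒m<n∨m≡n (s≤s⁻¹ lt)
    u′< : ∀ x → x < suc N → u′ x < suc N
    u′< x lt with last-or x lt
    ... | inj₂ refl = s≤s (≤-trans (≤-reflexive u′-N) pos≤N)
    ... | inj₁ x<N = s≤s (≤-trans (≤-reflexive (u′-< x<N)) (≤-trans (bump-≤ (u x)) (u< x x<N)))
      where
      bump-≤ : ∀ r → bump r ≤ suc r
      bump-≤ r with r <? pos
      ... | yes l = ≤-trans (≤-reflexive (bump-< l)) (n≤1+n r)
      ... | no ≮ = ≤-reflexive (bump-≥ (≮⇒≥ ≮))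
    value′ : ∀ x → x < suc N → X′ (u′ x) ≡ a x
    value′ x lt with last-or x lt
    ... | inj₂ refl = trans (cong X′ u′-N) X′-pos
    ... | inj₁ x<N = trans (cong X′ (u′-< x<N)) (trans (X′-bump (u x)) (value x x<N))
    below : ∀ r → r < pos → X r ℚ.≤ a N
    below = proj₁ (proj₂ (proj₂ found))
    above : ∀ r → pos ≤ r → r < N → a N ℚ.≤ X r
    above = proj₂ (proj₂ (proj₂ found))
    data View : ℕ → Set where
      low  : ∀ {r} → r < pos → View r
      mid  : View pos
      high : ∀ {r} → pos ≤ r → View (suc r)
    view : ∀ r → View r
    view r with <-cmp r pos
    ... | tri< lt _ _ = low lt
    ... | tri≈ _ refl _ = mid
    view (suc r) | tri> _ _ (s≤s le) = high le
    mono′ : ∀ r s → r ≤ s → s < suc N → X′ r ℚ.≤ X′ s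
    mono′ r s r≤s s< with view r | view s
    ... | low p | low q = subst₂ ℚ._≤_ (sym (X′-< p)) (sym (X′-< q)) (mono r s r≤s (<-≤-trans q pos≤N))
    ... | low p | mid = subst₂ ℚ._≤_ (sym (X′-< p)) (sym X′-pos) (below r p)
    ... | low p | high q = subst₂ ℚ._≤_ (sym (X′-< p)) (sym (X′-> q)) (mono r _ (≤-trans (<⇒≤ p) q) (s≤s⁻¹ s<))
    ... | mid | low q = contradiction r≤s (<⇒≱ q)
    ... | mid | mid = ℚₚ.≤-refl
    ... | mid | high q = subst₂ ℚ._≤_ (sym X′-pos) (sym (X′-> q)) (above _ q (s≤s⁻¹ s<))
    ... | high p | low q = contradiction r≤s (<⇒≱ (<-trans q (s≤s p)))
    ... | high p | mid = contradiction r≤s (<⇒≱ (s≤s p))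
    ... | high p | high q = subst₂ ℚ._≤_ (sym (X′-> p)) (sym (X′-> q)) (mono _ _ (s≤s⁻¹ r≤s) (s≤s⁻¹ s<))
    ranks′ : ∀ W → ∑ (suc N) (λ x → W (u′ x)) ≡ ∑ (suc N) W
    ranks′ W = begin
      ∑ N (λ x → W (u′ x)) + W (u′ N) ≡⟨ cong₂ _+_ (∑-cong< N (λ x x<N → cong W (u′-< x<N))) (cong W u′-N) ⟩
      ∑ N (λ x → W (bump (u x))) + W pos ≡⟨ cong (_+ W pos) (ranks (λ r → W (bump r))) ⟩
      ∑ N (λ r → W (bump r)) + W pos ≡⟨ cong (λ n → ∑ n (λ r → W (bump r)) + W pos) (sym N≡) ⟩
      ∑ (pos + (N ∸ pos)) (λ r → W (bump r)) + W pos ≡⟨ cong (_+ W pos) (∑-split pos (N ∸ pos) (λ r → W (bump r))) ⟩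
      ∑ pos (λ r → W (bump r)) + ∑ (N ∸ pos) (λ r → W (bump (pos + r))) + W pos
        ≡⟨ cong (_+ W pos) (cong₂ _+_ (∑-cong< pos (λ r lt → cong W (bump-< lt))) (∑-cong (N ∸ pos) (λ r → cong W (trans (bump-≥ (m≤m+n pos r)) (sym (+-suc pos r)))))) ⟩
      ∑ pos W + ∑ (N ∸ pos) (λ r → W (pos + suc r)) + W pos ≡⟨ lem (∑ pos W) _ (W pos) ⟩
      ∑ pos W + (W pos + ∑ (N ∸ pos) (λ r → W (pos + suc r))) ≡⟨ cong (λ z → ∑ pos W + (W z + ∑ (N ∸ pos) (λ r → W (pos + suc r)))) (sym (+-identityʳ pos)) ⟩
      ∑ pos W + (W (pos + 0) + ∑ (N ∸ pos) (λ r → W (pos + suc r))) ≡⟨ cong (λ z → ∑ pos W + z) (sym (∑-suc (N ∸ pos) (λ r → W (pos + r)))) ⟩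
      ∑ pos W + ∑ (suc (N ∸ pos)) (λ r → W (pos + r)) ≡⟨ sym (∑-split pos (suc (N ∸ pos)) W) ⟩
      ∑ (pos + suc (N ∸ pos)) W ≡⟨ cong (λ n → ∑ n W) (trans (+-suc pos (N ∸ pos)) (cong suc N≡)) ⟩
      ∑ (suc N) W ∎
      where
      open ≡-Reasoning
      N≡ : pos + (N ∸ pos) ≡ N
      N≡ = m+[n∸m]≡n pos≤N
      lem : ∀ a b c → a + b + c ≡ a + (c + b)
      lem a b c = trans (+-assoc a b c) (cong (λ z → a + z) (+-comm b c))

  AllPairs-middle : ∀ {A : Set} {R : A → A → Set} pre {x post} → AllPairs R (pre ++ x ∷ post) → All (λ e → R e x) pre × All (R x) post
  AllPairs-middle [] (p ∷ _) = [] , p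
  AllPairs-middle (y ∷ pre) (p ∷ ps) with AllPairs-middle pre ps
  ... | before , after = All.head (++⁻ʳ pre p) ∷ before , after

  All-zipper : ∀ {A : Set} {P : A → Set} xs → (∀ pre x post → pre ++ x ∷ post ≡ xs → P x) → All P xs
  All-zipper {A} {P} xs f = go [] xs refl
    where
    go : ∀ pre ys → pre ++ ys ≡ xs → All P ys
    go pre [] e = []
    go pre (y ∷ ys) e = f pre y ys e ∷ go (pre ++ (y ∷ [])) ys (trans (++-assoc pre (y ∷ []) ys) e)

  wt-All-0 : ∀ {A : Set} (f : A → ℕ) xs → All (λ x → f x ≡ 0) xs → wt f xs ≡ 0
  wt-All-0 f [] [] = refl
  wt-All-0 f (x ∷ xs) (p ∷ ps) = cong₂ _+_ p (wt-All-0 f xs ps)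

  wt-All-1 : ∀ {A : Set} (f : A → ℕ) xs → All (λ x → f x ≡ 1) xs → wt f xs ≡ length xs
  wt-All-1 f [] [] = refl
  wt-All-1 f (x ∷ xs) (p ∷ ps) = cong₂ _+_ p (wt-All-1 f xs ps)

  wt-≤-length : ∀ {A : Set} (f : A → ℕ) xs → (∀ x → f x ≤ 1) → wt f xs ≤ length xs
  wt-≤-length f xs le = ≤-trans (wt-mono le xs) (≤-reflexive (wt-1 xs))

  wt-mono-All : ∀ {A : Set} {f h : A → ℕ} xs → All (λ x → f x ≤ h x) xs → wt f xs ≤ wt h xs
  wt-mono-All [] [] = z≤n
  wt-mono-All (x ∷ xs) (p ∷ ps) = +-mono-≤ p (wt-mono-All xs ps)

  χ-yes : ∀ {P : Set} (d : Dec P) → P → χ (does d) ≡ 1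
  χ-yes d p = cong χ (dec-true d p)

  χ-no : ∀ {P : Set} (d : Dec P) → ¬ P → χ (does d) ≡ 0
  χ-no d ¬p = cong χ (dec-false d ¬p)

  χ-mono : ∀ {P Q : Set} (d : Dec P) (e : Dec Q) → (P → Q) → χ (does d) ≤ χ (does e)
  χ-mono (yes p) e f = ≤-reflexive (sym (χ-yes e (f p)))
  χ-mono (no _) e f = z≤n

  ApproxSorts : {J : Set} → (J → ℚ) → (ℕ → J) → (ℕ → J) → List ℕ → Set
  ApproxSorts {J} val c c′ xs = (∀ (f : J → ℕ) → wt (λ x → f (c′ x)) xs ≡ wt (λ x → f (c x)) xs) × AllPairs (λ x y → Le 2 (val (c′ x)) (val (c′ y))) xs

  module Group {J : Set} (val : J → ℚ) {N : ℕ} (X : ℕ → ℚ) (mono : ∀ r s → r ≤ s → s < N → X r ℚ.≤ X s) where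

    Close : ℕ → (ℕ → J) → (ℕ → ℕ) → ℕ → Set
    Close ε c u x = Le ε (X (u x)) (val (c x)) × Le ε (val (c x)) (X (u x))

    -- Order statistics are 1-Lipschitz in the sup norm, so sorting exactly on one side and
    -- with error 2 on the other increases the distance by at most 2.
    close-step : ∀ {ε c c′ u u′} xs → All (λ x → u′ x < N) xs → ApproxSorts val c c′ xs → SortsUp u u′ xs →
                 All (Close ε c u) xs → All (Close (ε + 2) c′ u′) xs
    close-step {ε} {c} {c′} {u} {u′} xs u′<N (keep , approx) (rearr , up) close = All-zipper xs at-x
      where
      at-x : ∀ pre x post → pre ++ x ∷ post ≡ xs → Close (ε + 2) c′ u′ x
      at-x pre x post refl = low , high
        where
        y = X (u′ x)
        ux<N : u′ x < N
        ux<N = All.head (++⁻ʳ pre u′<N)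
        low : Le (ε + 2) y (val (c′ x))
        low with Le? (ε + 2) y (val (c′ x))
        ... | yes p = p
        ... | no ¬p = contradiction count (1+n≰n)
          where
          open ≤-Reasoning
          f : J → ℕ
          f j = χ (does (Le? ε y (val j)))
          h : ℕ → ℕ
          h r = χ (does (y ℚ.≤? X r))
          -- In the exact round x and all after it reach y, so at least 1 + length post items were
          -- at least y - ε before. After the approximate round x is not, nor is anything before it,
          -- all of which is at most 2 above x; only `post` is left.
          count : suc (length post) ≤ length post
          count = begin
            suc (length post) ≡⟨ sym (wt-All-1 (λ e → h (u′ e)) (x ∷ post) (χ-yes (y ℚ.≤? y) ℚₚ.≤-refl ∷
              All.map (λ {e} (l , e<N) → χ-yes (y ℚ.≤? X (u′ e)) (mono (u′ x) (u′ e) l e<N)) (All.zip (proj₂ (AllPairs-middle pre up) , All.tail (++⁻ʳ pre u′<N))))) ⟩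
            wt (λ e → h (u′ e)) (x ∷ post) ≤⟨ m≤n+m _ (wt (λ e → h (u′ e)) pre) ⟩
            wt (λ e → h (u′ e)) pre + wt (λ e → h (u′ e)) (x ∷ post) ≡⟨ sym (wt-++ _ pre (x ∷ post)) ⟩
            wt (λ e → h (u′ e)) (pre ++ x ∷ post) ≡⟨ rearr h ⟩
            wt (λ e → h (u e)) (pre ++ x ∷ post) ≤⟨ wt-mono-All (pre ++ x ∷ post) (All.map (λ {e} cl → χ-mono (y ℚ.≤? X (u e)) (Le? ε y (val (c e))) (λ l → Le-trans {0} {ε} (≤⇒Le0 l) (proj₁ cl))) close) ⟩
            wt (λ e → f (c e)) (pre ++ x ∷ post) ≡⟨ sym (keep f) ⟩
            wt (λ e → f (c′ e)) (pre ++ x ∷ post) ≡⟨ wt-++ _ pre (x ∷ post) ⟩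
            wt (λ e → f (c′ e)) pre + (f (c′ x) + wt (λ e → f (c′ e)) post)
              ≡⟨ cong₂ _+_ (wt-All-0 (λ e → f (c′ e)) pre (All.map (λ {e} l → χ-no (Le? ε y (val (c′ e))) (λ q → ¬p (Le-trans q l))) (proj₁ (AllPairs-middle pre approx))))
                   (cong (_+ wt (λ e → f (c′ e)) post) (χ-no (Le? ε y (val (c′ x))) (λ q → ¬p (Le-≤ (m≤m+n ε 2) q)))) ⟩
            wt (λ e → f (c′ e)) post ≤⟨ wt-≤-length _ post (λ e → χ≤1 _) ⟩
            length post ∎
        high : Le (ε + 2) (val (c′ x)) y
        high with Le? (ε + 2) (val (c′ x)) y
        ... | yes p = p
        ... | no ¬p = contradiction count (1+n≰n)
          where
          open ≤-Reasoning
          f : J → ℕ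
          f j = χ (does (Le? ε (val j) y))
          h : ℕ → ℕ
          h r = χ (does (X r ℚ.≤? y))
          count : suc (length pre) ≤ length pre
          count = begin
            suc (length pre) ≡⟨ +-comm 1 (length pre) ⟩
            length pre + 1 ≡⟨ cong₂ _+_ (sym (wt-All-1 (λ e → h (u′ e)) pre (All.map (λ {e} l → χ-yes (X (u′ e) ℚ.≤? y) (mono (u′ e) (u′ x) l ux<N)) (proj₁ (AllPairs-middle pre up)))))
                (sym (χ-yes (y ℚ.≤? y) ℚₚ.≤-refl)) ⟩
            wt (λ e → h (u′ e)) pre + h (u′ x) ≤⟨ +-monoʳ-≤ (wt (λ e → h (u′ e)) pre) (m≤m+n (h (u′ x)) _) ⟩
            wt (λ e → h (u′ e)) pre + wt (λ e → h (u′ e)) (x ∷ post) ≡⟨ sym (wt-++ _ pre (x ∷ post)) ⟩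
            wt (λ e → h (u′ e)) (pre ++ x ∷ post) ≡⟨ rearr h ⟩
            wt (λ e → h (u e)) (pre ++ x ∷ post) ≤⟨ wt-mono-All (pre ++ x ∷ post) (All.map (λ {e} cl → χ-mono (X (u e) ℚ.≤? y) (Le? ε (val (c e)) y) (λ l → Le-≤ (≤-reflexive (+-identityʳ ε)) (Le-trans {ε} {0} (proj₂ cl) (≤⇒Le0 l)))) close) ⟩
            wt (λ e → f (c e)) (pre ++ x ∷ post) ≡⟨ sym (keep f) ⟩
            wt (λ e → f (c′ e)) (pre ++ x ∷ post) ≡⟨ wt-++ _ pre (x ∷ post) ⟩
            wt (λ e → f (c′ e)) pre + (f (c′ x) + wt (λ e → f (c′ e)) post)
              ≡⟨ cong (λ z → wt (λ e → f (c′ e)) pre + z) (cong₂ _+_ (χ-no (Le? ε (val (c′ x)) y) (λ q → ¬p (Le-≤ (m≤m+n ε 2) q)))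
                   (wt-All-0 (λ e → f (c′ e)) post (All.map (λ {e} l → χ-no (Le? ε (val (c′ e)) y) (λ q → ¬p (Le-≤ (≤-reflexive (+-comm 2 ε)) (Le-trans l q)))) (proj₂ (AllPairs-middle pre approx))))) ⟩
            wt (λ e → f (c′ e)) pre + 0 ≡⟨ +-identityʳ _ ⟩
            wt (λ e → f (c′ e)) pre ≤⟨ wt-≤-length _ pre (λ e → χ≤1 _) ⟩
            length pre ∎

-- Executing a network on ranks and on items.

module Simulation where

  open import Data.Nat hiding (parity)
  open import Data.Nat.Properties
  open import Data.List.Base using (List; []; _∷_; length; map; upTo)
  open import Data.List.Properties using (map-cong-local; length-upTo)
  import Data.List.Relation.Unary.AllPairs.Properties as AllPairsₚ
  open import Data.Rational using (ℚ)
  open Sums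
  open Bags using (wt-upTo)
  open Stages using (ones; ones-<; ones-≥; SortsUp)
  open Networks
  open Lipschitz

  private variable
    A B : Set

  wt-map : ∀ (h : B → ℕ) (c : A → B) xs → wt h (map c xs) ≡ wt (λ x → h (c x)) xs
  wt-map h c [] = refl
  wt-map h c (x ∷ xs) = cong (h (c x) +_) (wt-map h c xs)

  wt-∈ : ∀ (f : A → ℕ) {x xs} → x ∈ xs → f x ≤ wt f xs
  wt-∈ f (here refl) = m≤m+n _ _
  wt-∈ f (there x∈xs) = ≤-trans (wt-∈ f x∈xs) (m≤n+m _ _)

  wt-positive : ∀ (f : A → ℕ) xs → 1 ≤ wt f xs → ∃[ x ] (x ∈ xs × 1 ≤ f x)
  wt-positive f (x ∷ xs) le with 1 ≤? f x
  ... | yes 1≤fx = x , here refl , 1≤fx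
  ... | no 1≰fx with wt-positive f xs (subst (λ z → 1 ≤ z + wt f xs) (n<1⇒n≡0 (≰⇒> 1≰fx)) le)
  ...   | y , y∈xs , 1≤fy = y , there y∈xs , 1≤fy

  insert : (A → ℕ) → A → List A → List A
  insert key x [] = x ∷ []
  insert key x (y ∷ ys) with key x ≤? key y
  ... | yes _ = x ∷ y ∷ ys
  ... | no _ = y ∷ insert key x ys

  sortBy : (A → ℕ) → List A → List A
  sortBy key [] = []
  sortBy key (x ∷ xs) = insert key x (sortBy key xs)

  record Shuffle (f : List A → List A) : Set where
    constructor shuffle
    field weight : ∀ (h : A → ℕ) xs → wt h (f xs) ≡ wt h xs

  open Shuffle

  wt-insert : ∀ key (h : A → ℕ) x xs → wt h (insert key x xs) ≡ h x + wt h xs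
  wt-insert key h x [] = refl
  wt-insert key h x (y ∷ ys) with key x ≤? key y
  ... | yes _ = refl
  ... | no _ = begin
    h y + wt h (insert key x ys) ≡⟨ cong (h y +_) (wt-insert key h x ys) ⟩
    h y + (h x + wt h ys)        ≡⟨ sym (+-assoc (h y) (h x) (wt h ys)) ⟩
    h y + h x + wt h ys          ≡⟨ cong (_+ wt h ys) (+-comm (h y) (h x)) ⟩
    h x + h y + wt h ys          ≡⟨ +-assoc (h x) (h y) (wt h ys) ⟩
    h x + (h y + wt h ys)        ∎
    where open ≡-Reasoning

  sortBy-shuffle : ∀ (key : A → ℕ) → Shuffle (sortBy key)
  sortBy-shuffle {A} key = shuffle go
    where
    go : ∀ (h : A → ℕ) xs → wt h (sortBy key xs) ≡ wt h xs
    go h [] = refl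
    go h (x ∷ xs) = trans (wt-insert key h x (sortBy key xs)) (cong (h x +_) (go h xs))

  All-insert : ∀ {key : A → ℕ} {P : A → Set} {x xs} → P x → All P xs → All P (insert key x xs)
  All-insert {xs = []} p ps = p ∷ []
  All-insert {key = key} {x = x} {xs = y ∷ ys} p (q ∷ qs) with key x ≤? key y
  ... | yes _ = p ∷ q ∷ qs
  ... | no _ = q ∷ All-insert p qs

  All-sortBy : ∀ {key : A → ℕ} {P : A → Set} {xs} → All P xs → All P (sortBy key xs)
  All-sortBy [] = []
  All-sortBy (p ∷ ps) = All-insert p (All-sortBy ps)

  module _ (key : A → ℕ) where

    private
      _⊑_ : A → A → Set
      x ⊑ y = key x ≤ key y

      insert-sorted : ∀ x xs → AllPairs _⊑_ xs → AllPairs _⊑_ (insert key x xs)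
      insert-sorted x [] [] = [] ∷ []
      insert-sorted x (y ∷ ys) (p ∷ ps) with key x ≤? key y
      ... | yes x⊑y = (x⊑y ∷ All.map (≤-trans x⊑y) p) ∷ p ∷ ps
      ... | no x⋢y = All-insert (≰⇒≥ x⋢y) p ∷ insert-sorted x ys ps

    sortBy-sorted : ∀ xs → AllPairs (λ x y → key x ≤ key y) (sortBy key xs)
    sortBy-sorted [] = []
    sortBy-sorted (x ∷ xs) = insert-sorted x (sortBy key xs) (sortBy-sorted xs)

  shuffle-length : ∀ {f : List A → List A} → Shuffle f → ∀ xs → length (f xs) ≡ length xs
  shuffle-length {f = f} sh xs = trans (sym (wt-1 (f xs))) (trans (weight sh (λ _ → 1) xs) (wt-1 xs))

  δ : ℕ → ℕ → ℕ
  δ p x with p ≟ x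
  ... | yes _ = 1
  ... | no _ = 0

  δ-refl : ∀ p → δ p p ≡ 1
  δ-refl p with p ≟ p
  ... | yes _ = refl
  ... | no p≢p = contradiction refl p≢p

  δ-≢ : ∀ {p x} → p ≢ x → δ p x ≡ 0
  δ-≢ {p} {x} p≢x with p ≟ x
  ... | yes e = contradiction e p≢x
  ... | no _ = refl

  δ≥1 : ∀ {p x} → 1 ≤ δ p x → p ≡ x
  δ≥1 {p} {x} le with p ≟ x
  ... | yes e = e

  ∑-δ≤1 : ∀ n p → ∑ n (δ p) ≤ 1
  ∑-δ≤1 zero p = z≤n
  ∑-δ≤1 (suc n) p with p ≟ n
  ... | yes refl = ≤-reflexive (cong (_+ 1) (∑-zero n (λ x x<n → δ-≢ (λ e → <⇒≢ x<n (sym e)))))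
  ... | no _ = ≤-trans (≤-reflexive (+-identityʳ _)) (∑-δ≤1 n p)

  assign : List ℕ → List B → (ℕ → B) → ℕ → B
  assign [] vs c p = c p
  assign (x ∷ xs) [] c p = c p
  assign (x ∷ xs) (v ∷ vs) c p with p ≟ x
  ... | yes _ = v
  ... | no _ = assign xs vs c p

  -- Writes the rearranged contents of each group back to its registers; the same operation drives
  -- the exact ranks and the adversarial items.
  update : (List B → List B) → List (List ℕ) → (ℕ → B) → ℕ → B
  update f [] c = c
  update f (g ∷ gs) c = assign g (f (map c g)) (update f gs c)

  assign-outside : ∀ xs vs (c : ℕ → B) p → wt (δ p) xs ≡ 0 → assign xs vs c p ≡ c p
  assign-outside [] vs c p e = refl
  assign-outside (x ∷ xs) [] c p e = refl
  assign-outside (x ∷ xs) (v ∷ vs) c p e with p ≟ x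
  ... | no _ = assign-outside xs vs c p e

  assign-here : ∀ x xs v vs (c : ℕ → B) → assign (x ∷ xs) (v ∷ vs) c x ≡ v
  assign-here x xs v vs c with x ≟ x
  ... | yes _ = refl
  ... | no x≢x = contradiction refl x≢x

  assign-there : ∀ {x p} xs v vs (c : ℕ → B) → p ≢ x → assign (x ∷ xs) (v ∷ vs) c p ≡ assign xs vs c p
  assign-there {x = x} {p} xs v vs c p≢x with p ≟ x
  ... | yes e = contradiction e p≢x
  ... | no _ = refl

  map-assign : ∀ xs vs (c : ℕ → B) → (∀ p → wt (δ p) xs ≤ 1) → length vs ≡ length xs → map (assign xs vs c) xs ≡ vs
  map-assign [] [] c once e = refl
  map-assign (x ∷ xs) (v ∷ vs) c once e = cong₂ _∷_
    (assign-here x xs v vs c)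
    (trans (map-cong-local (All.map (λ {y} δ≡0 → assign-there xs v vs c (distinct y δ≡0))
              (wt≡0⇒All (δ x) xs absent)))
           (map-assign xs vs c (λ p → ≤-trans (m≤n+m _ _) (once p)) (suc-injective e)))
    where
    distinct : ∀ y → δ x y ≡ 0 → y ≢ x
    distinct y δ≡0 refl = 1+n≢0 (trans (sym (δ-refl y)) δ≡0)
    absent : wt (δ x) xs ≡ 0
    absent = n≤0⇒n≡0 (s≤s⁻¹ (subst (λ z → z + wt (δ x) xs ≤ 1) (δ-refl x) (once x)))

  -- Each register has weight at most 1 in all groups together, so the groups are disjoint and their
  -- writes do not interfere.
  map-update : ∀ {f : List B → List B} → Shuffle f → ∀ gs c → (∀ p → wt (wt (δ p)) gs ≤ 1) →
               All (λ g → map (update f gs c) g ≡ f (map c g)) gs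
  map-update sh [] c once = []
  map-update {f = f} sh (g ∷ gs) c once =
    map-assign g (f (map c g)) (update f gs c) (λ p → ≤-trans (m≤m+n _ _) (once p)) (trans (shuffle-length sh (map c g)) (Data.List.Properties.length-map c g))
    ∷ All.tabulate (λ {g′} g′∈gs → trans
        (map-cong-local (All.tabulate (λ {y} y∈g′ → assign-outside g _ (update f gs c) y
           (n≤0⇒n≡0 (+-cancelʳ-≤ 1 _ _ (≤-trans (+-monoʳ-≤ _ (inside y y∈g′ g′∈gs)) (once y)))))))
        (All.lookup (map-update sh gs c (λ p → ≤-trans (m≤n+m _ _) (once p))) g′∈gs))
    where
    import Data.List.Properties
    inside : ∀ y {g′} → y ∈ g′ → g′ ∈ gs → 1 ≤ wt (wt (δ y)) gs
    inside y {g′} y∈g′ g′∈gs = ≤-trans (≤-reflexive (sym (δ-refl y))) (≤-trans (wt-∈ (δ y) y∈g′) (wt-∈ (wt (δ y)) g′∈gs))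

  record Covers (N : ℕ) (gs : List (List ℕ)) : Set where
    constructor covering
    field sum : ∀ f → wt (wt f) gs ≡ ∑ N f

  module _ {N : ℕ} {gs : List (List ℕ)} (covers : Covers N gs) where
    open Covers covers

    covers-once : ∀ p → wt (wt (δ p)) gs ≤ 1
    covers-once p = ≤-trans (≤-reflexive (sum (δ p))) (∑-δ≤1 N p)

    covers-All⁺ : ∀ {P : ℕ → Set} → (∀ p → p < N → P p) → All (All P) gs
    covers-All⁺ {P} f = All.map (λ {g} e → All.map (λ {p} e → f p (≰⇒> (λ N≤p → 1+n≢0 (trans (sym (ones-≥ N≤p)) e)))) (wt≡0⇒All (ones N) g e))
      (wt≡0⇒All (wt (ones N)) gs (trans (sum (ones N)) (∑-zero N (λ x x<N → ones-< x<N))))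

    covers-All⁻ : ∀ {P : ℕ → Set} → All (All P) gs → ∀ p → p < N → P p
    covers-All⁻ {P} all p p<N with wt-positive (wt (δ p)) gs (≤-trans (≤-trans (≤-reflexive (sym (δ-refl p))) (∑-≥ N p (δ p) p<N)) (≤-reflexive (sym (sum (δ p)))))
    ... | g , g∈gs , le with wt-positive (δ p) g le
    ...   | x , x∈g , le′ = subst P (sym (δ≥1 {p} {x} le′)) (All.lookup (All.lookup all g∈gs) x∈g)

    update-sum : ∀ {f : List B → List B} → Shuffle f → ∀ c (h : B → ℕ) → ∑ N (λ p → h (update f gs c p)) ≡ ∑ N (λ p → h (c p))
    update-sum {f = f} sh c h = trans (sym (sum _)) (trans (go gs (map-update sh gs c covers-once)) (sum _))
      where
      go : ∀ xs → All (λ g → map (update f gs c) g ≡ f (map c g)) xs → wt (wt (λ p → h (update f gs c p))) xs ≡ wt (wt (λ p → h (c p))) xs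
      go [] [] = refl
      go (g ∷ xs) (e ∷ es) = cong₂ _+_ (trans (sym (wt-map h (update f gs c) g)) (trans (cong (wt h) e) (trans (weight sh h (map c g)) (wt-map h c g)))) (go xs es)

  AllPairs-with : ∀ {P : A → Set} {R S : A → A → Set} {xs} → (∀ {x y} → P x → P y → R x y → S x y) → All P xs → AllPairs R xs → AllPairs S xs
  AllPairs-with f [] [] = []
  AllPairs-with f (p ∷ ps) (r ∷ rs) = All.zipWith (λ (q , r) → f p q r) (ps , r) ∷ AllPairs-with f ps rs

  -- Common interface of the simulated network and of the single all-pairs round, which differ in
  -- the final error Λ.
  record ApproxNetwork (Λ : ℕ) : Set₁ where
    field
      N R m  : ℕ
      rounds : ℕ → List (List ℕ)
      order  : List ℕ
      small  : ∀ r → r < R → All (λ g → length g ≤ m) (rounds r)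
      covers : ∀ r → r < R → Covers N (rounds r)
      orders : ∀ f → wt f order ≡ ∑ N f
      sorts  : ∀ {J : Set} (val : J → ℚ) (c : ℕ → ℕ → J) → (∀ r → r < R → All (ApproxSorts val (c r) (c (suc r))) (rounds r)) →
               AllPairs (λ x y → Le Λ (val (c R x)) (val (c R y))) order

  singleRound : ℕ → ApproxNetwork 2
  singleRound n = record
    { N = n ; R = 1 ; m = n ; rounds = λ _ → upTo n ∷ [] ; order = upTo n
    ; small = λ _ _ → ≤-reflexive (length-upTo n) ∷ []
    ; covers = λ _ _ → covering λ f → trans (+-identityʳ _) (wt-upTo f n)
    ; orders = λ f → wt-upTo f n
    ; sorts = λ val c approx → proj₂ (All.head (approx 0 ≤-refl))
    }

  module Run (net : Network) {J : Set} (val : J → ℚ) (c : ℕ → ℕ → J) where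
    open Networks.Network net
    open Ranking (ranking N (λ p → val (c 0 p))) renaming (u to u₀)
    open Group {J} val {N} X mono

    private
      covered : ∀ r → r < R → Covers N (rounds r)
      covered r r<R = covering (covers r r<R)

    u : ℕ → ℕ → ℕ
    u zero = u₀
    u (suc r) = update (sortBy id) (rounds r) (u r)

    u-sorts : ∀ r → r < R → All (SortsUp (u r) (u (suc r))) (rounds r)
    u-sorts r r<R = All.map (λ {g} → sorted g) (map-update (sortBy-shuffle id) (rounds r) (u r) (covers-once (covered r r<R)))
      where
      sorted : ∀ g → map (u (suc r)) g ≡ sortBy id (map (u r) g) → SortsUp (u r) (u (suc r)) g
      sorted g e = (λ W → trans (sym (wt-map W (u (suc r)) g)) (trans (cong (wt W) e) (trans (weight (sortBy-shuffle id) W (map (u r) g)) (wt-map W (u r) g)))) ,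
        AllPairsₚ.map⁻ (subst (AllPairs _≤_) (sym e) (sortBy-sorted id (map (u r) g)))

    u-ranks : ∀ r → r ≤ R → ∀ W → ∑ N (λ x → W (u r x)) ≡ ∑ N W
    u-ranks zero _ = ranks
    u-ranks (suc r) r<R W = trans (update-sum (covered r r<R) (sortBy-shuffle id) (u r) W) (u-ranks r (<⇒≤ r<R) W)

    u-< : ∀ r → r ≤ R → ∀ x → x < N → u r x < N
    u-< r r≤R x x<N = ≰⇒> λ N≤u → 1+n≰n (begin
      1                            ≡⟨ sym (ones-≥ N≤u) ⟩
      ones N (u r x)               ≤⟨ ∑-≥ N x (λ x → ones N (u r x)) x<N ⟩
      ∑ N (λ x → ones N (u r x))   ≡⟨ u-ranks r r≤R (ones N) ⟩
      ∑ N (ones N)                 ≡⟨ ∑-zero N (λ x x<N → ones-< x<N) ⟩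
      0                            ∎)
      where open ≤-Reasoning

    module _ (approx : ∀ r → r < R → All (ApproxSorts val (c r) (c (suc r))) (rounds r)) where

      close : ∀ r → r ≤ R → ∀ x → x < N → Close (r * 2) (c r) (u r) x
      close zero _ x x<N = ≤⇒Le0 (ℚₚ.≤-reflexive (value x x<N)) , ≤⇒Le0 (ℚₚ.≤-reflexive (sym (value x x<N)))
        where import Data.Rational.Properties as ℚₚ
      close (suc r) r<R = covers-All⁻ (covered r r<R) (go (rounds r) (covers-All⁺ (covered r r<R) (λ x x<N → close r (<⇒≤ r<R) x x<N , u-< (suc r) r<R x x<N)) (approx r r<R) (u-sorts r r<R))
        where
        go : ∀ gs → All (All (λ x → Close (r * 2) (c r) (u r) x × u (suc r) x < N)) gs → All (ApproxSorts val (c r) (c (suc r))) gs →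
             All (SortsUp (u r) (u (suc r))) gs → All (All (Close (suc r * 2) (c (suc r)) (u (suc r)))) gs
        go [] [] [] [] = []
        go (g ∷ gs) (p ∷ ps) (a ∷ as) (s ∷ ss) =
          subst (λ ε → All (Close ε (c (suc r)) (u (suc r))) g) (+-comm (r * 2) 2)
            (close-step {r * 2} {c r} {c (suc r)} {u r} {u (suc r)} g (All.map proj₂ p) a s (All.map proj₁ p)) ∷ go gs ps as ss

      -- 2 R from the adversarial contents to the exact ones, nothing between ordered ranks, and 2 R
      -- back.
      output-sorted : AllPairs (λ x y → Le (4 * R) (val (c R x)) (val (c R y))) order
      output-sorted = AllPairs-with within in-range (sorts u ranks u-sorts)
        where
        in-range : All (_< N) order
        in-range = All.map (λ {x} e → ≰⇒> (λ N≤x → 1+n≢0 (trans (sym (ones-≥ N≤x)) e)))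
          (wt≡0⇒All (ones N) order (trans (orders (ones N)) (∑-zero N (λ x x<N → ones-< x<N))))
        within : ∀ {x y} → x < N → y < N → u R x ≤ u R y → Le (4 * R) (val (c R x)) (val (c R y))
        within {x} {y} x<N y<N le = subst (λ k → Le k (val (c R x)) (val (c R y))) (solve R)
          (Le-trans {R * 2} {R * 2} (proj₂ (close R ≤-refl x x<N))
            (Le-trans {0} {R * 2} (≤⇒Le0 (mono (u R x) (u R y) le (u-< R ≤-refl y y<N))) (proj₁ (close R ≤-refl y y<N))))
          where
          solve : ∀ R → R * 2 + R * 2 ≡ 4 * R
          solve R = trans (sym (*-distribˡ-+ R 2 2)) (*-comm R 4)

  approximate : (net : Network) → ApproxNetwork (4 * Networks.Network.R net)
  approximate net = record
    { Networks.Network net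
    ; covers = λ r r<R → covering (Networks.Network.covers net r r<R)
    ; sorts = λ val c approx → Run.output-sorted net val c approx
    }

-- From networks to algorithms against an adaptive adversary.

module Protocols where

  open import Data.Nat hiding (parity)
  open import Data.Nat.Properties
  open import Data.Nat.ListAction using (sum)
  open import Data.Nat.ListAction.Properties using (sum-++)
  open import Data.Fin.Base as Fin using (Fin; toℕ; fromℕ<)
  import Data.Fin.Properties as Fin
  open import Data.Fin.Permutation using (Permutation′; permutation; _⟨$⟩ʳ_)
  open import Data.List.Base using (List; []; _∷_; _++_; [_]; length; map; lookup; catMaybes; cartesianProduct)
  open import Data.List.Properties using (length-++; length-map; map-++; length-catMaybes)
  open import Data.List.Membership.Propositional.Properties using (∈-cartesianProduct⁺; ∈-++⁺ˡ; ∈-++⁺ʳ; ∈-lookup)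
  open import Data.List.Relation.Unary.Any.Properties using (lookup-index)
  import Data.List.Relation.Unary.AllPairs.Properties as AllPairsₚ
  open import Data.List.Relation.Binary.Pointwise using (Pointwise; []; _∷_)
  open import Data.Maybe.Base using (Maybe; just; nothing; maybe′)
  open import Data.Product.Properties using (≡-dec)
  open import Data.Rational as ℚ using (ℚ; 0ℚ; 1ℚ)
  import Data.Rational.Properties as ℚₚ
  open import Defs
  open Sums
  open Stages using (χ; χ≤1)
  open Lipschitz
  open Simulation

  AllPairs-lookup : ∀ {A : Set} {R : A → A → Set} {xs} → AllPairs R xs → ∀ i j → i Fin.< j → R (lookup xs i) (lookup xs j)
  AllPairs-lookup (p ∷ ps) Fin.zero (Fin.suc j) _ = All.lookup p (∈-lookup j)
  AllPairs-lookup (p ∷ ps) (Fin.suc i) (Fin.suc j) (s≤s i<j) = AllPairs-lookup ps i j i<j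

  module _ {n : ℕ} where

    once : Fin n → Fin n → ℕ
    once i j = δ (toℕ i) (toℕ j)

    lookup-unique : ∀ i ys → wt (once i) ys ≤ 1 → ∀ p q → lookup ys p ≡ i → lookup ys q ≡ i → p ≡ q
    lookup-unique i (y ∷ ys) le = go
      where
      not-twice : ∀ q → y ≡ i → lookup ys q ≢ i
      not-twice q refl f = contradiction (≤-trans (+-mono-≤ (≤-reflexive (sym (δ-refl (toℕ i)))) found) le) λ { (s≤s ()) }
        where
        found : 1 ≤ wt (once i) ys
        found = ≤-trans (≤-reflexive (trans (sym (δ-refl (toℕ i))) (cong (once i) (sym f)))) (wt-∈ (once i) (∈-lookup {xs = ys} q))
      go : ∀ p q → lookup (y ∷ ys) p ≡ i → lookup (y ∷ ys) q ≡ i → p ≡ q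
      go Fin.zero Fin.zero e f = refl
      go Fin.zero (Fin.suc q) e f = contradiction f (not-twice q e)
      go (Fin.suc p) Fin.zero e f = contradiction e (not-twice p f)
      go (Fin.suc p) (Fin.suc q) e f = cong Fin.suc (lookup-unique i ys (≤-trans (m≤n+m _ _) le) p q e f)

    record Listing (ys : List (Fin n)) : Set where
      field
        total : length ys ≡ n
        at-most  : ∀ i → wt (once i) ys ≤ 1
        at-least : ∀ i → 1 ≤ wt (once i) ys

    module _ {ys : List (Fin n)} (listing : Listing ys) where
      open Listing listing

      private
        occurs : ∀ i → i ∈ ys
        occurs i with wt-positive (once i) ys (at-least i)
        ... | j , j∈ys , le = subst (_∈ ys) (sym (Fin.toℕ-injective (δ≥1 {toℕ i} {toℕ j} le))) j∈ys

        to : Fin n → Fin n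
        to k = lookup ys (Fin.cast (sym total) k)

        from : Fin n → Fin n
        from i = Fin.cast total (index (occurs i))

      ordering : Permutation′ n
      ordering = permutation to from
        (λ i → trans (cong (lookup ys) (Fin.cast-involutive (sym total) total (index (occurs i)))) (sym (lookup-index (occurs i))))
        (λ k → trans (cong (Fin.cast total) (lookup-unique (to k) ys (at-most (to k)) (index (occurs (to k))) (Fin.cast (sym total) k) (sym (lookup-index (occurs (to k)))) refl))
          (Fin.cast-involutive total (sym total) k))

      ordering-lookup : ∀ {R : Fin n → Fin n → Set} → AllPairs R ys → ∀ i j → i Fin.< j → R (ordering ⟨$⟩ʳ i) (ordering ⟨$⟩ʳ j)
      ordering-lookup rel i j i<j = AllPairs-lookup rel (Fin.cast (sym total) i) (Fin.cast (sym total) j)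
        (subst₂ _<_ (sym (Fin.toℕ-cast (sym total) i)) (sym (Fin.toℕ-cast (sym total) j)) i<j)

  wt-catMaybes : ∀ {A : Set} (h : A → ℕ) js → wt h (catMaybes js) ≡ wt (maybe′ h 0) js
  wt-catMaybes h [] = refl
  wt-catMaybes h (just x ∷ js) = cong (h x +_) (wt-catMaybes h js)
  wt-catMaybes h (nothing ∷ js) = wt-catMaybes h js

  ∈-catMaybes : ∀ {A : Set} {x : A} {js} → just x ∈ js → x ∈ catMaybes js
  ∈-catMaybes {js = just y ∷ js} (here refl) = here refl
  ∈-catMaybes {js = just y ∷ js} (there e) = there (∈-catMaybes e)
  ∈-catMaybes {js = nothing ∷ js} (there e) = ∈-catMaybes e

  AllPairs-catMaybes : ∀ {A : Set} {R : Maybe A → Maybe A → Set} {js} → AllPairs R js → AllPairs (λ x y → R (just x) (just y)) (catMaybes js)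
  AllPairs-catMaybes {js = []} [] = []
  AllPairs-catMaybes {js = nothing ∷ js} (p ∷ ps) = AllPairs-catMaybes ps
  AllPairs-catMaybes {A} {R} {js = just x ∷ js} (p ∷ ps) = All-catMaybes js p ∷ AllPairs-catMaybes ps
    where
    All-catMaybes : ∀ js → All (R (just x)) js → All (λ y → R (just x) (just y)) (catMaybes js)
    All-catMaybes [] [] = []
    All-catMaybes (just y ∷ js) (q ∷ qs) = q ∷ All-catMaybes js qs
    All-catMaybes (nothing ∷ js) (q ∷ qs) = All-catMaybes js qs

  length-product : ∀ {A B : Set} (xs : List A) (ys : List B) → length (cartesianProduct xs ys) ≡ length xs * length ys
  length-product [] ys = refl
  length-product (x ∷ xs) ys = trans (length-++ (map (x ,_) ys)) (cong₂ _+_ (length-map (x ,_) ys) (length-product xs ys))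

  wt-< : ∀ {A : Set} {f h : A → ℕ} {x} xs → All (λ y → f y ≤ h y) xs → x ∈ xs → f x < h x → wt f xs < wt h xs
  wt-< (y ∷ xs) (p ∷ ps) (here refl) lt = +-mono-<-≤ lt (wt-mono-All xs ps)
  wt-< (y ∷ xs) (p ∷ ps) (there x∈xs) lt = +-mono-≤-< p (wt-< xs ps x∈xs lt)

  χ-implies : ∀ a b → (a ≡ true → b ≡ false → ⊥) → χ a ≤ χ b
  χ-implies false b f = z≤n
  χ-implies true true f = ≤-refl
  χ-implies true false f = ⊥-elim (f refl refl)

  χ-strict : ∀ a b → a ≡ false → b ≡ true → χ a < χ b
  χ-strict _ _ refl refl = ≤-refl

  -- No consistency is demanded: two distinct items may beat each other, and cycles may occur.
  record Comparator {J : Set} (val : J → ℚ) (beats : J → J → Bool) (xs : List J) : Set where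
    field
      self : ∀ y → beats y y ≡ true
      won  : ∀ {y z} → y ∈ xs → z ∈ xs → beats y z ≡ true → Le 1 (val z) (val y)
      lost : ∀ {y z} → y ∈ xs → z ∈ xs → beats y z ≡ false → Le 1 (val y) (val z)

  -- A round-robin tournament: an item more than 2 above another one beats everything the latter
  -- beats, and itself.
  module _ {J : Set} (beats : J → J → Bool) where

    wins : List J → J → ℕ
    wins xs y = wt (λ w → χ (beats y w)) xs

    tournament : List J → List J
    tournament xs = sortBy (wins xs) xs

    tournament-shuffle : Shuffle tournament
    tournament-shuffle = shuffle λ h xs → Shuffle.weight (sortBy-shuffle (wins xs)) h xs

    tournament-sorted : ∀ {val xs} → Comparator val beats xs → AllPairs (λ y z → Le 2 (val y) (val z)) (tournament xs)
    tournament-sorted {val} {xs} comp = AllPairs-with approx (All-sortBy (All.tabulate (λ y∈xs → y∈xs))) (sortBy-sorted (wins xs) xs)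
      where
      open Comparator comp
      approx : ∀ {y z} → y ∈ xs → z ∈ xs → wins xs y ≤ wins xs z → Le 2 (val y) (val z)
      approx {y} {z} y∈xs z∈xs fewer with Le? 2 (val y) (val z)
      ... | yes le = le
      ... | no ≰ = contradiction fewer (<⇒≱ (wt-< xs
        (All.tabulate (λ {w} w∈xs → χ-implies (beats z w) (beats y w) (λ zw yw → ≰ (Le-trans {1} {1} (lost y∈xs w∈xs yw) (won z∈xs w∈xs zw)))))
        y∈xs (χ-strict (beats z y) (beats y y) (not-won (beats z y) refl) (self y))))
        where
        not-won : ∀ b → beats z y ≡ b → b ≡ false
        not-won false e = refl
        not-won true e = contradiction (Le-≤ (s≤s z≤n) (won z∈xs y∈xs e)) ≰

  -- Reads the answer at the first occurrence of the query; the default false stands for queries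
  -- without an answer.
  answer : ∀ {n} → List (Query n) → List Bool → Query n → Bool
  answer [] as q = false
  answer (q′ ∷ qs) [] q = false
  answer (q′ ∷ qs) (a ∷ as) q with ≡-dec Fin._≟_ Fin._≟_ q q′
  ... | yes _ = a
  ... | no _ = answer qs as q

  answer-legal : ∀ {n} {x : Fin n → ℚ} {qs as q} → Pointwise (LegalAnswer x) qs as → q ∈ qs → LegalAnswer x q (answer qs as q)
  answer-legal {x = x} {qs = q′ ∷ qs} {q = q} (l ∷ ls) q∈ with ≡-dec Fin._≟_ Fin._≟_ q q′ | q∈
  ... | yes refl | _ = l
  ... | no q≢q′ | here refl = contradiction refl q≢q′
  ... | no _ | there q∈qs = answer-legal {x = x} ls q∈qs

  ≮1⇒Le : ∀ a b → ¬ (1ℚ ℚ.< a ℚ.- b) → Le 1 a b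
  ≮1⇒Le a b ≮ = mk≤ (begin
    a                      ≡⟨ sym (ℚₚ.+-identityʳ a) ⟩
    a ℚ.+ 0ℚ               ≡⟨ cong (a ℚ.+_) (sym (ℚₚ.+-inverseˡ b)) ⟩
    a ℚ.+ (ℚ.- b ℚ.+ b)    ≡⟨ sym (ℚₚ.+-assoc a (ℚ.- b) b) ⟩
    (a ℚ.- b) ℚ.+ b        ≤⟨ ℚₚ.+-monoˡ-≤ b (ℚₚ.≮⇒≥ ≮) ⟩
    1ℚ ℚ.+ b               ≡⟨ ℚₚ.+-comm 1ℚ b ⟩
    b ℚ.+ ℕ→ℚ 1            ∎)
    where open ℚₚ.≤-Reasoning

  Le⇒≥ : ∀ {k a b} → Le k a b → b ≥[ ℕ→ℚ k ] a
  Le⇒≥ {k} {a} {b} (mk≤ le) = begin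
    a ℚ.- ℕ→ℚ k                     ≤⟨ ℚₚ.+-monoˡ-≤ (ℚ.- ℕ→ℚ k) le ⟩
    (b ℚ.+ ℕ→ℚ k) ℚ.- ℕ→ℚ k         ≡⟨ ℚₚ.+-assoc b (ℕ→ℚ k) (ℚ.- ℕ→ℚ k) ⟩
    b ℚ.+ (ℕ→ℚ k ℚ.- ℕ→ℚ k)         ≡⟨ cong (b ℚ.+_) (ℚₚ.+-inverseʳ (ℕ→ℚ k)) ⟩
    b ℚ.+ 0ℚ                        ≡⟨ ℚₚ.+-identityʳ b ⟩
    b                               ∎
    where open ℚₚ.≤-Reasoning

  lower-bound : ∀ n (x : Fin n → ℚ) → Σ[ l ∈ ℚ ] (∀ i → l ℚ.≤ x i)
  lower-bound zero x = 0ℚ , λ ()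
  lower-bound (suc n) x with lower-bound n (x ∘ Fin.suc)
  ... | l , l≤ = x Fin.zero ℚ.⊓ l , λ { Fin.zero → ℚₚ.p⊓q≤p (x Fin.zero) l ; (Fin.suc i) → ℚₚ.≤-trans (ℚₚ.p⊓q≤q (x Fin.zero) l) (l≤ i) }

  -- Unused registers hold the dummy item nothing, which is compared without queries and counts as lowest.
  beats : ∀ {n} → (Query n → Bool) → Maybe (Fin n) → Maybe (Fin n) → Bool
  beats ans nothing nothing = true
  beats ans nothing (just j) = false
  beats ans (just i) nothing = true
  beats ans (just i) (just j) with i Fin.≟ j
  ... | yes _ = true
  ... | no _ = ans (i , j)

  module _ {n} (x : Fin n → ℚ) where

    val : Maybe (Fin n) → ℚ
    val = maybe′ x (proj₁ (lower-bound n x))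

    legal-comparator : ∀ (ans : Query n → Bool) (xs : List (Maybe (Fin n))) →
      (∀ {i j} → just i ∈ xs → just j ∈ xs → LegalAnswer x (i , j) (ans (i , j))) → Comparator val (beats ans) xs
    legal-comparator ans xs legal = record { self = self ; won = λ {y} {z} → won y z ; lost = λ {y} {z} → lost y z }
      where
      low : ∀ i → Le 1 (val nothing) (x i)
      low i = Le-≤ z≤n (≤⇒Le0 (proj₂ (lower-bound n x) i))
      self : ∀ y → beats ans y y ≡ true
      self nothing = refl
      self (just i) with i Fin.≟ i
      ... | yes _ = refl
      ... | no i≢i = contradiction refl i≢i
      won : ∀ y z → y ∈ xs → z ∈ xs → beats ans y z ≡ true → Le 1 (val z) (val y)
      won nothing nothing _ _ _ = Le-refl 1
      won (just i) nothing _ _ _ = low i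
      won (just i) (just j) y∈ z∈ e with i Fin.≟ j
      ... | yes refl = Le-refl 1
      ... | no _ = ≮1⇒Le (x j) (x i) (λ lt → contradiction (trans (sym e) (proj₂ (legal y∈ z∈) lt)) λ ())
      lost : ∀ y z → y ∈ xs → z ∈ xs → beats ans y z ≡ false → Le 1 (val y) (val z)
      lost nothing (just j) _ _ _ = low j
      lost (just i) (just j) y∈ z∈ e with i Fin.≟ j
      ... | no _ = ≮1⇒Le (x i) (x j) (λ lt → contradiction (trans (sym e) (proj₁ (legal y∈ z∈) lt)) λ ())

  module _ {n : ℕ} where

    Contents : Set
    Contents = ℕ → Maybe (Fin n)

    -- Ordered pairs in both directions, so that `beats` can look up any two items as they stand;
    -- the square of the group size is within the budget.
    pairs : List (Maybe (Fin n)) → List (Query n)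
    pairs js = cartesianProduct (catMaybes js) (catMaybes js)

    pairs-length : ∀ js → length (pairs js) ≤ length js * length js
    pairs-length js = ≤-trans (≤-reflexive (length-product (catMaybes js) (catMaybes js))) (*-mono-≤ (length-catMaybes js) (length-catMaybes js))

    queries : List (List ℕ) → Contents → List (Query n)
    queries [] c = []
    queries (g ∷ gs) c = pairs (map c g) ++ queries gs c

    queries-length : ∀ m gs c → All (λ g → length g ≤ m) gs → length (queries gs c) ≤ m * wt length gs
    queries-length m [] c [] = z≤n
    queries-length m (g ∷ gs) c (p ∷ ps) = begin
      length (pairs (map c g) ++ queries gs c)        ≡⟨ length-++ (pairs (map c g)) ⟩
      length (pairs (map c g)) + length (queries gs c) ≤⟨ +-mono-≤ (pairs-length (map c g)) (queries-length m gs c ps) ⟩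
      length (map c g) * length (map c g) + m * wt length gs ≡⟨ cong (λ l → l * l + m * wt length gs) (length-map c g) ⟩
      length g * length g + m * wt length gs          ≤⟨ +-monoˡ-≤ (m * wt length gs) (*-monoˡ-≤ (length g) p) ⟩
      m * length g + m * wt length gs                 ≡⟨ sym (*-distribˡ-+ m (length g) (wt length gs)) ⟩
      m * (length g + wt length gs)                   ∎
      where open ≤-Reasoning

    ∈-queries : ∀ {i j g gs c} → g ∈ gs → just i ∈ map c g → just j ∈ map c g → (i , j) ∈ queries gs c
    ∈-queries {gs = g ∷ gs} {c} (here refl) i∈ j∈ = ∈-++⁺ˡ (∈-cartesianProduct⁺ (∈-catMaybes i∈) (∈-catMaybes j∈))
    ∈-queries {gs = g ∷ gs} {c} (there g∈) i∈ j∈ = ∈-++⁺ʳ (pairs (map c g)) (∈-queries {gs = gs} g∈ i∈ j∈)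

    start : Contents
    start p with p <? n
    ... | yes p<n = just (fromℕ< p<n)
    ... | no _ = nothing

    start-< : ∀ (h : ℕ → ℕ) p → p < n → maybe′ (h ∘ toℕ) 0 (start p) ≡ h p
    start-< h p p<n with p <? n
    ... | yes lt = cong h (Fin.toℕ-fromℕ< lt)
    ... | no p≮n = contradiction p<n p≮n

    start-≥ : ∀ (h : ℕ → ℕ) p → n ≤ p → maybe′ (h ∘ toℕ) 0 (start p) ≡ 0
    start-≥ h p n≤p with p <? n
    ... | yes p<n = contradiction p<n (≤⇒≯ n≤p)
    ... | no _ = refl

    start-sum : ∀ {N} → n ≤ N → ∀ h → ∑ N (λ p → maybe′ (h ∘ toℕ) 0 (start p)) ≡ ∑ n h
    start-sum {N} n≤N h = begin
      ∑ N f                                    ≡⟨ cong (λ z → ∑ z f) (sym (m+[n∸m]≡n n≤N)) ⟩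
      ∑ (n + (N ∸ n)) f                        ≡⟨ ∑-split n (N ∸ n) f ⟩
      ∑ n f + ∑ (N ∸ n) (λ p → f (n + p))      ≡⟨ cong₂ _+_ (∑-cong< n (λ p → start-< h p)) (∑-zero (N ∸ n) (λ p _ → start-≥ h (n + p) (m≤m+n n p))) ⟩
      ∑ n h + 0                                ≡⟨ +-identityʳ _ ⟩
      ∑ n h                                    ∎
      where
      open ≡-Reasoning
      f : ℕ → ℕ
      f p = maybe′ (h ∘ toℕ) 0 (start p)

  module Protocol {Λ : ℕ} (net : ApproxNetwork Λ) (n : ℕ) (n≤N : n ≤ ApproxNetwork.N net) where
    open ApproxNetwork net

    -- After round R nothing is asked, so the algorithm idles until round d.
    groups : ℕ → List (List ℕ)
    groups r with r <? R
    ... | yes _ = rounds r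
    ... | no _ = []

    groups-< : ∀ {r} → r < R → groups r ≡ rounds r
    groups-< {r} r<R with r <? R
    ... | yes _ = refl
    ... | no r≮R = contradiction r<R r≮R

    groups-≥ : ∀ {r} → R ≤ r → groups r ≡ []
    groups-≥ {r} R≤r with r <? R
    ... | yes r<R = contradiction r<R (≤⇒≯ R≤r)
    ... | no _ = refl

    next : ℕ → Contents {n} → RoundAnswers → Contents {n}
    next r c as = update (tournament (beats (answer (queries (groups r) c) as))) (groups r) c

    -- The state is replayed from the answers, as an algorithm of the model sees nothing else.
    contents : ℕ → Contents {n} → List RoundAnswers → Contents {n}
    contents r c [] = c
    contents r c (as ∷ h) = contents (suc r) (next r c as) h

    contents-snoc : ∀ r c h as → contents r c (h ++ [ as ]) ≡ next (r + length h) (contents r c h) as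
    contents-snoc r c [] as = cong (λ z → next z c as) (sym (+-identityʳ r))
    contents-snoc r c (b ∷ h) as = trans (contents-snoc (suc r) (next r c b) h as) (cong (λ z → next z (contents (suc r) (next r c b) h) as) (sym (+-suc r (length h))))

    next-sum : ∀ r c as (h : Maybe (Fin n) → ℕ) → ∑ N (λ p → h (next r c as p)) ≡ ∑ N (λ p → h (c p))
    next-sum r c as h with r <? R
    ... | yes r<R = update-sum (covers r r<R) (tournament-shuffle (beats (answer (queries (rounds r) c) as))) c h
    ... | no _ = refl

    contents-sum : ∀ r c hist (h : Maybe (Fin n) → ℕ) → ∑ N (λ p → h (contents r c hist p)) ≡ ∑ N (λ p → h (c p))
    contents-sum r c [] h = refl
    contents-sum r c (as ∷ hist) h = trans (contents-sum (suc r) (next r c as) hist h) (next-sum r c as h)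

    output : List RoundAnswers → List (Fin n)
    output hist = catMaybes (map (contents 0 start hist) order)

    output-weight : ∀ hist h → wt (h ∘ toℕ) (output hist) ≡ ∑ n h
    output-weight hist h = begin
      wt (h ∘ toℕ) (output hist)                                       ≡⟨ wt-catMaybes (h ∘ toℕ) (map (contents 0 start hist) order) ⟩
      wt (maybe′ (h ∘ toℕ) 0) (map (contents 0 start hist) order)       ≡⟨ wt-map (maybe′ (h ∘ toℕ) 0) (contents 0 start hist) order ⟩
      wt (λ p → maybe′ (h ∘ toℕ) 0 (contents 0 start hist p)) order     ≡⟨ orders _ ⟩
      ∑ N (λ p → maybe′ (h ∘ toℕ) 0 (contents 0 start hist p))          ≡⟨ contents-sum 0 (start {n}) hist (maybe′ (h ∘ toℕ) 0) ⟩
      ∑ N (λ p → maybe′ (h ∘ toℕ) 0 (start {n} p))                      ≡⟨ start-sum n≤N h ⟩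
      ∑ n h                                                            ∎
      where open ≡-Reasoning

    listing : ∀ hist → Listing (output hist)
    listing hist = record
      { total = trans (sym (wt-1 (output hist))) (trans (output-weight hist (λ _ → 1)) (trans (∑-const n 1) (*-identityʳ n)))
      ; at-most = λ i → ≤-trans (≤-reflexive (output-weight hist (δ (toℕ i)))) (∑-δ≤1 n (toℕ i))
      ; at-least = λ i → ≤-trans (≤-trans (≤-reflexive (sym (δ-refl (toℕ i)))) (∑-≥ n (toℕ i) (δ (toℕ i)) (Fin.toℕ<n i))) (≤-reflexive (sym (output-weight hist (δ (toℕ i)))))
      }

    algorithm : Algorithm n
    algorithm = record
      { query  = λ hist → queries (groups (length hist)) (contents 0 start hist)
      ; output = λ hist → ordering (listing hist)
      }

    module _ (x : Fin n → ℚ) (adv : Adversary n) (legal : LegalAdversary x adv) where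

      history : ℕ → List RoundAnswers
      history r = map proj₂ (transcript algorithm adv r)

      asked : ℕ → List (Query n)
      asked r = Algorithm.query algorithm (history r)

      replies : ℕ → RoundAnswers
      replies r = adv (transcript algorithm adv r) (asked r)

      state : ℕ → Contents {n}
      state r = contents 0 start (history r)

      history-suc : ∀ r → history (suc r) ≡ history r ++ [ replies r ]
      history-suc r = map-++ proj₂ (transcript algorithm adv r) [ (asked r , replies r) ]

      history-length : ∀ r → length (history r) ≡ r
      history-length zero = refl
      history-length (suc r) = trans (cong length (history-suc r)) (trans (length-++ (history r)) (trans (+-comm (length (history r)) 1) (cong suc (history-length r))))

      asked-groups : ∀ r → asked r ≡ queries (groups r) (state r)
      asked-groups r = cong (λ l → queries (groups l) (state r)) (history-length r)

      state-suc : ∀ r → state (suc r) ≡ next r (state r) (replies r)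
      state-suc r = trans (cong (contents 0 start) (history-suc r)) (trans (contents-snoc 0 start (history r) (replies r))
        (cong (λ l → next l (state r) (replies r)) (history-length r)))

      state-approx : ∀ r → r < R → All (ApproxSorts (val x) (state r) (state (suc r))) (rounds r)
      state-approx r r<R = subst (λ c → All (ApproxSorts (val x) (state r) c) (rounds r)) (sym state≡)
        (All.tabulate (λ {g} g∈ → keep g (All.lookup updated g∈) , sorted g g∈ (All.lookup updated g∈)))
        where
        qs = queries (rounds r) (state r)
        ans = answer qs (replies r)
        state≡ : state (suc r) ≡ update (tournament (beats ans)) (rounds r) (state r)
        state≡ = trans (state-suc r) (cong (λ gs → update (tournament (beats (answer (queries gs (state r)) (replies r)))) gs (state r)) (groups-< r<R))
        c′ = update (tournament (beats ans)) (rounds r) (state r)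
        updated : All (λ g → map c′ g ≡ tournament (beats ans) (map (state r) g)) (rounds r)
        updated = map-update (tournament-shuffle (beats ans)) (rounds r) (state r) (covers-once (covers r r<R))
        legal-answers : Pointwise (LegalAnswer x) qs (replies r)
        legal-answers = subst (λ z → Pointwise (LegalAnswer x) z (replies r)) (trans (asked-groups r) (cong (λ gs → queries gs (state r)) (groups-< r<R)))
          (legal (transcript algorithm adv r) (asked r))
        keep : ∀ g → map c′ g ≡ tournament (beats ans) (map (state r) g) → ∀ (f : Maybe (Fin n) → ℕ) → wt (λ p → f (c′ p)) g ≡ wt (λ p → f (state r p)) g
        keep g e f = trans (sym (wt-map f c′ g)) (trans (cong (wt f) e) (trans (Shuffle.weight (tournament-shuffle (beats ans)) f (map (state r) g)) (wt-map f (state r) g)))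
        sorted : ∀ g → g ∈ rounds r → map c′ g ≡ tournament (beats ans) (map (state r) g) → AllPairs (λ p q → Le 2 (val x (c′ p)) (val x (c′ q))) g
        sorted g g∈ e = AllPairsₚ.map⁻ (subst (AllPairs (λ y z → Le 2 (val x y) (val x z))) (sym e)
          (tournament-sorted (beats ans) (legal-comparator x ans (map (state r) g)
            (λ i∈ j∈ → answer-legal {x = x} legal-answers (∈-queries {gs = rounds r} g∈ i∈ j∈)))))

      state-final : ∀ e → state (e + R) ≡ state R
      state-final zero = refl
      state-final (suc e) = trans (state-suc (e + R)) (trans (cong (λ gs → update (tournament (beats (answer (queries gs (state (e + R))) (replies (e + R))))) gs (state (e + R)))
        (groups-≥ (m≤n+m R e))) (state-final e))

      result-approx : ∀ {k} d → Λ ≤ k → R ≤ d → ApproxSorting (ℕ→ℚ k) x (result algorithm adv d)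
      result-approx d Λ≤k R≤d i j i<j = Le⇒≥ (Le-≤ Λ≤k (ordering-lookup (listing (history d)) (AllPairs-catMaybes {R = λ y z → Le Λ (val x y) (val x z)} (AllPairsₚ.map⁺ pairwise)) i j i<j))
        where
        pairwise : AllPairs (λ p q → Le Λ (val x (state d p)) (val x (state d q))) order
        pairwise = subst (λ c → AllPairs (λ p q → Le Λ (val x (c p)) (val x (c q))) order)
          (trans (sym (state-final (d ∸ R))) (cong state (m∸n+n≡m R≤d))) (sorts (val x) state state-approx)

      asked-< : ∀ r → length (asked r) ≤ χ (does (r <? R)) * (m * N)
      asked-< r = ≤-trans (≤-reflexive (cong length (asked-groups r))) (by-round r)
        where
        by-round : ∀ r → length (queries (groups r) (state r)) ≤ χ (does (r <? R)) * (m * N)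
        by-round r with r <? R in eq
        ... | no _ = z≤n
        ... | yes r<R = subst (λ b → length (queries (rounds r) (state r)) ≤ χ b * (m * N)) (sym (cong does eq)) (begin
          length (queries (rounds r) (state r)) ≤⟨ queries-length m (rounds r) (state r) (small r r<R) ⟩
          m * wt length (rounds r)              ≡⟨ cong (m *_) (trans (sym (wt-cong wt-1 (rounds r))) (trans (Covers.sum (covers r r<R) (λ _ → 1)) (trans (∑-const N 1) (*-identityʳ N)))) ⟩
          m * N                                 ≡⟨ sym (+-identityʳ (m * N)) ⟩
          1 * (m * N)                           ∎)
          where open ≤-Reasoning

      cost-suc : ∀ r → cost algorithm adv (suc r) ≡ cost algorithm adv r + length (asked r)
      cost-suc r = trans (cong sum (map-++ (λ p → length (proj₁ p)) (transcript algorithm adv r) [ (asked r , replies r) ]))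
        (trans (sum-++ (map (λ p → length (proj₁ p)) (transcript algorithm adv r)) (length (asked r) ∷ []))
               (cong (cost algorithm adv r +_) (+-identityʳ (length (asked r)))))

      cost-≤ : ∀ d → cost algorithm adv d ≤ R * (m * N)
      cost-≤ d = begin
        cost algorithm adv d                           ≤⟨ go d ⟩
        ∑ d (λ r → χ (does (r <? R)) * (m * N))        ≡⟨ ∑-*ʳ d (m * N) (λ r → χ (does (r <? R))) ⟩
        ∑ d (λ r → χ (does (r <? R))) * (m * N)        ≤⟨ *-monoˡ-≤ (m * N) (∑-support d R (λ r → χ (does (r <? R))) (λ r → χ≤1 _) (λ r R≤r → χ-no (r <? R) (≤⇒≯ R≤r))) ⟩
        R * (m * N)                                    ∎
        where
        open ≤-Reasoning
        go : ∀ d → cost algorithm adv d ≤ ∑ d (λ r → χ (does (r <? R)) * (m * N))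
        go zero = z≤n
        go (suc d) = ≤-trans (≤-reflexive (cost-suc d)) (+-mono-≤ (go d) (asked-< d))

-- Choice of parameters and the cost estimate.

module Conclusion where

  open import Data.Nat hiding (parity)
  open import Data.Nat.Properties
  open import Data.Nat.DivMod using (_%_; /-monoˡ-≤; m/n*n≤m; m≡m%n+[m/n]*n; m%n<n)
  open import Data.Nat.Tactic.RingSolver using (solve-∀)
  open import Defs
  open ExpanderFamily
  open Integral using (size)
  open Separator using (n≤b^n)
  open Simulation
  open Protocols

  ^-distribʳ-* : ∀ a b n → (a * b) ^ n ≡ a ^ n * b ^ n
  ^-distribʳ-* a b zero = refl
  ^-distribʳ-* a b (suc n) = trans (cong ((a * b) *_) (^-distribʳ-* a b n)) (lem a b (a ^ n) (b ^ n))
    where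
    lem : ∀ a b x y → (a * b) * (x * y) ≡ (a * x) * (b * y)
    lem = solve-∀

  size-power : ∀ e L → size (power e L) ≡ size L ^ e
  size-power zero L = refl
  size-power (suc e) L = cong (size L *_) (size-power e L)

  -- The search runs downwards and stops at the first predecessor that fails; this failure is the
  -- form in which minimality is used.
  least : ∀ (f : ℕ → ℕ) n lo s → n ≤ f (lo + s) →
          Σ[ p ∈ ℕ ] (lo ≤ p × p ≤ lo + s × n ≤ f p × (p ≡ lo ⊎ Σ[ p′ ∈ ℕ ] (p ≡ suc p′ × lo ≤ p′ × f p′ < n)))
  least f n lo zero le = lo , ≤-refl , m≤m+n lo 0 , subst (λ z → n ≤ f z) (+-identityʳ lo) le , inj₁ refl
  least f n lo (suc s) le with n ≤? f (lo + s)
  ... | no ≰ = lo + suc s , m≤m+n lo (suc s) , ≤-refl , le , inj₂ (lo + s , +-suc lo s , m≤m+n lo s , ≰⇒> ≰)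
  ... | yes le′ with least f n lo s le′
  ...   | p , lo≤p , p≤ , n≤fp , minimal = p , lo≤p , ≤-trans p≤ (+-monoʳ-≤ lo (n≤1+n s)) , n≤fp , minimal

  -- The cost bound n^(1 + C / d) d is raised to the power d to stay within natural exponents.
  record Solves (C d n : ℕ) (A : Algorithm n) : Set where
    field
      cheap  : ∀ x adv → LegalAdversary x adv → cost A adv d ^ d ≤ n ^ (d + C) * d ^ d
      sorted : ∀ x adv → LegalAdversary x adv → ApproxSorting (ℕ→ℚ (2 * d)) x (result A adv d)

  solve-with : ∀ {Λ C d n} (net : ApproxNetwork Λ) (let open ApproxNetwork net) (n≤N : n ≤ N) → R ≤ d → Λ ≤ 2 * d →
               ∀ Y → R * (m * N) ≤ n * Y → Y ^ d ≤ n ^ C * d ^ d → Σ[ A ∈ Algorithm n ] Solves C d n A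
  solve-with {Λ} {C} {d} {n} net n≤N R≤d Λ≤2d Y cost≤ Y^d≤ = algorithm , record
    { cheap = λ x adv legal → begin
        cost algorithm adv d ^ d        ≤⟨ ^-monoˡ-≤ d (≤-trans (cost-≤ x adv legal d) cost≤) ⟩
        (n * Y) ^ d                     ≡⟨ ^-distribʳ-* n Y d ⟩
        n ^ d * Y ^ d                   ≤⟨ *-monoʳ-≤ (n ^ d) Y^d≤ ⟩
        n ^ d * (n ^ C * d ^ d)         ≡⟨ sym (*-assoc (n ^ d) (n ^ C) (d ^ d)) ⟩
        n ^ d * n ^ C * d ^ d           ≡⟨ cong (_* d ^ d) (sym (^-distribˡ-+-* n d C)) ⟩
        n ^ (d + C) * d ^ d             ∎
    ; sorted = λ x adv legal → result-approx x adv legal d Λ≤2d R≤d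
    }
    where
    open Protocols.Protocol net n n≤N
    open ≤-Reasoning

  solve-network : ∀ {C d n} (net : Networks.Network) (let open Networks.Network net) (n≤N : n ≤ N) → 2 * R ≤ d →
                  ∀ X → m * N ≤ n * X → (R * X) ^ d ≤ n ^ C * d ^ d → Σ[ A ∈ Algorithm n ] Solves C d n A
  solve-network {n = n} net n≤N 2R≤d X mN≤ few = solve-with (approximate net) n≤N (≤-trans (m≤m+n R (R + 0)) 2R≤d)
    (≤-trans (≤-reflexive (*-assoc 2 2 R)) (*-monoʳ-≤ 2 2R≤d)) (R * X)
    (≤-trans (*-monoʳ-≤ R mN≤) (≤-reflexive (lem R n X))) few
    where
    open Networks.Network net
    lem : ∀ R n X → R * (n * X) ≡ n * (R * X)
    lem = solve-∀

  module Parameters (fam : Family) where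
    open Family fam

    opaque
      -- m = g^18 |L|^(36 p), and |L| ≤ 4^|L| turns the second factor into a power of g. `p₀` makes
      -- g at least 6 |W| and at least 16.
      a p₀ : ℕ
      a = 18 + 36 * size L
      p₀ = 2 + 6 * size W

      p₀≥2 : 2 ≤ p₀
      p₀≥2 = m≤m+n 2 (6 * size W)

      p₀-large : 6 * size W ≤ 4 ^ p₀
      p₀-large = ≤-trans (m≤n+m (6 * size W) 2) (n≤b^n {4} (s≤s (s≤s z≤n)) p₀)

      size-bound : ∀ p → (4 ^ p) ^ 18 * size (power (p * 36) L) ≤ (4 ^ p) ^ a
      size-bound p = begin
        g ^ 18 * size (power (p * 36) L)  ≡⟨ cong (g ^ 18 *_) (size-power (p * 36) L) ⟩
        g ^ 18 * size L ^ (p * 36)        ≤⟨ *-monoʳ-≤ (g ^ 18) (^-monoˡ-≤ (p * 36) (n≤b^n {4} (s≤s (s≤s z≤n)) (size L))) ⟩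
        g ^ 18 * (4 ^ size L) ^ (p * 36)       ≡⟨ cong (g ^ 18 *_) (trans (^-*-assoc 4 (size L) (p * 36)) (trans (cong (4 ^_) (lem (size L) p 36)) (sym (^-*-assoc 4 p (36 * size L))))) ⟩
        g ^ 18 * g ^ (36 * size L)             ≡⟨ sym (^-distribˡ-+-* g 18 (36 * size L)) ⟩
        g ^ a                             ∎
        where
        open ≤-Reasoning
        g : ℕ
        g = 4 ^ p
        lem : ∀ h p s → h * (p * s) ≡ p * (s * h)
        lem = solve-∀

    c g₀ : ℕ
    c = suc a
    g₀ = 4 ^ p₀

    opaque
      -- The summands of C answer to three cases: d below `d₀`, a base g that had to grow with n,
      -- and the constant base `g₀`.
      d₀ C : ℕ
      d₀ = 208 + g₀
      C = d₀ + (416 * c + 104 * (c * g₀ ^ c))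

      d₀≥208 : 208 ≤ d₀
      d₀≥208 = m≤m+n 208 g₀

      d₀≥g₀ : g₀ ≤ d₀
      d₀≥g₀ = m≤n+m g₀ 208

      C≥d₀ : d₀ ≤ C
      C≥d₀ = m≤m+n d₀ (416 * c + 104 * (c * g₀ ^ c))

      C≥small-base : 104 * (c * g₀ ^ c) ≤ C
      C≥small-base = ≤-trans (m≤n+m (104 * (c * g₀ ^ c)) (416 * c)) (m≤n+m (416 * c + 104 * (c * g₀ ^ c)) d₀)

      C≥large-base : 416 * c ≤ C
      C≥large-base = ≤-trans (m≤m+n (416 * c) (104 * (c * g₀ ^ c))) (m≤n+m (416 * c + 104 * (c * g₀ ^ c)) d₀)

    module _ (d n : ℕ) (n>0 : 0 < n) where

      private instance
        n≢0 : NonZero n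
        n≢0 = >-nonZero n>0

      module Sorting (p k′ : ℕ) (p₀≤p : p₀ ≤ p) (k′>0 : 0 < k′) (k≤d : 104 * suc k′ ≤ d)
                     (below : (4 ^ p) ^ k′ < n) (above : n ≤ (4 ^ p) ^ suc k′) where

        private
          g = 4 ^ p
          g₀≤g : g₀ ≤ g
          g₀≤g = ^-monoʳ-≤ 4 p₀≤p

        open Networks.Sorter fam p k′ W>1 (≤-trans p₀-large g₀≤g)
          (≤-trans (m≤m+n 8 8) (^-monoʳ-≤ 4 {2} {p} (≤-trans p₀≥2 p₀≤p))) (s≤s k′>0)
          using (τ; τ+18; network)

        R : ℕ
        R = suc (τ * 4)

        -- Stopping 18 steps short of 13 k more than pays for the final round; doubling 4 * 13 gives
        -- the 104.
        R≤ : R ≤ 52 * suc k′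
        R≤ = begin
          suc (τ * 4)          ≡⟨ +-comm 1 (τ * 4) ⟩
          τ * 4 + 1            ≤⟨ +-monoʳ-≤ (τ * 4) (s≤s z≤n) ⟩
          τ * 4 + 18 * 4       ≡⟨ sym (*-distribʳ-+ 4 τ 18) ⟩
          (τ + 18) * 4         ≡⟨ cong (_* 4) τ+18 ⟩
          (13 * suc k′) * 4    ≡⟨ *-comm (13 * suc k′) 4 ⟩
          4 * (13 * suc k′)    ≡⟨ sym (*-assoc 4 13 (suc k′)) ⟩
          52 * suc k′          ∎
          where open ≤-Reasoning

        2R≤d : 2 * R ≤ d
        2R≤d = ≤-trans (*-monoʳ-≤ 2 R≤) (≤-trans (≤-reflexive (sym (*-assoc 2 52 (suc k′)))) k≤d)

        R≤d : R ≤ d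
        R≤d = ≤-trans (m≤m+n R (R + 0)) 2R≤d

        -- By `below`, N = g g^k′ exceeds n by less than a factor g; together with m ≤ g^a this
        -- makes g^c.
        volume : Networks.Network.m network * Networks.Network.N network ≤ n * g ^ c
        volume = begin
          g ^ 18 * size (power (p * 36) L) * (g * g ^ k′) ≤⟨ *-mono-≤ (size-bound p) (*-monoʳ-≤ g (<⇒≤ below)) ⟩
          g ^ a * (g * n)  ≡⟨ lem (g ^ a) g n ⟩
          n * (g * g ^ a)  ∎
          where
          open ≤-Reasoning
          lem : ∀ x g n → x * (g * n) ≡ n * (g * x)
          lem = solve-∀

        n≤N : n ≤ Networks.Network.N network
        n≤N = above

        sorting : (R * g ^ c) ^ d ≤ n ^ C * d ^ d → Σ[ A ∈ Algorithm n ] Solves C d n A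
        sorting few = solve-network {C} {d} {n} network n≤N 2R≤d (g ^ c) volume few

        bounded-power : ∀ e → e ≤ C → g ^ (c * d) ≤ n ^ e → (R * g ^ c) ^ d ≤ n ^ C * d ^ d
        bounded-power e e≤C le = begin
          (R * g ^ c) ^ d         ≡⟨ ^-distribʳ-* R (g ^ c) d ⟩
          R ^ d * (g ^ c) ^ d     ≤⟨ *-mono-≤ (^-monoˡ-≤ d R≤d) (≤-trans (≤-reflexive (^-*-assoc g c d)) (≤-trans le (^-monoʳ-≤ n e≤C))) ⟩
          d ^ d * n ^ C           ≡⟨ *-comm (d ^ d) (n ^ C) ⟩
          n ^ C * d ^ d           ∎
          where open ≤-Reasoning

      -- All pairs cost n * n, so the factor to bound is n itself: at most d if n ≤ d, and at most
      -- n^(C / d) if d ≤ C.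
      single : 0 < d → n ^ d ≤ n ^ C * d ^ d → Σ[ A ∈ Algorithm n ] Solves C d n A
      single d>0 le = solve-with (singleRound n) ≤-refl d>0 (*-monoʳ-≤ 2 d>0) n (≤-reflexive (+-identityʳ (n * n))) le

      module Large (d₀≤d : d₀ ≤ d) (d<n : d < n) where

        e : ℕ
        e = d / 104

        e≥2 : 2 ≤ e
        e≥2 = /-monoˡ-≤ 104 (≤-trans d₀≥208 d₀≤d)

        instance
          e≢0 : NonZero e
          e≢0 = >-nonZero (<⇒≤ e≥2)

        d≤208e : d ≤ 208 * e
        d≤208e = begin
          d                    ≡⟨ m≡m%n+[m/n]*n d 104 ⟩
          d % 104 + e * 104 ≤⟨ +-monoˡ-≤ (e * 104) (≤-trans (<⇒≤ (m%n<n d 104)) (*-monoˡ-≤ 104 (<⇒≤ e≥2))) ⟩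
          e * 104 + e * 104    ≡⟨ sym (*-distribˡ-+ e 104 104) ⟩
          e * 208              ≡⟨ *-comm e 208 ⟩
          208 * e              ∎
          where open ≤-Reasoning

        -- Either g is the constant `g₀`, or the next smaller power of 4 fails to reach n in e
        -- levels, which bounds g by a power of n.
        Base : ℕ → Set
        Base p = p ≡ p₀ ⊎ Σ[ p′ ∈ ℕ ] (p ≡ suc p′ × p₀ ≤ p′ × (4 ^ p′) ^ e < n)

        square : ∀ p′ → p₀ ≤ p′ → 4 ^ suc p′ ≤ (4 ^ p′) ^ 2
        square p′ p₀≤p′ = ≤-trans (*-monoˡ-≤ (4 ^ p′) (≤-trans (^-monoʳ-≤ 4 {1} {p₀} (<⇒≤ p₀≥2)) (^-monoʳ-≤ 4 p₀≤p′))) (≤-reflexive (cong (4 ^ p′ *_) (sym (*-identityʳ (4 ^ p′)))))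

        -- Ensures at least two levels, as the network requires.
        base-< : ∀ {p} → Base p → 4 ^ p < n
        base-< (inj₁ refl) = ≤-<-trans (≤-trans d₀≥g₀ d₀≤d) d<n
        base-< (inj₂ (p′ , refl , p₀≤p′ , lt)) = ≤-<-trans (≤-trans (square p′ p₀≤p′) (^-monoʳ-≤ (4 ^ p′) {{m^n≢0 4 p′}} e≥2)) lt

        module _ (p k′ : ℕ) (p₀≤p : p₀ ≤ p) (base : Base p) (k′>0 : 0 < k′) (k≤e : suc k′ ≤ e)
                 (below : (4 ^ p) ^ k′ < n) (above : n ≤ (4 ^ p) ^ suc k′) where

          k≤d : 104 * suc k′ ≤ d
          k≤d = ≤-trans (*-monoʳ-≤ 104 k≤e) (≤-trans (≤-reflexive (*-comm 104 e)) (m/n*n≤m d 104))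

          open Sorting p k′ p₀≤p k′>0 k≤d below above

          small-cost : Base p → (R * (4 ^ p) ^ c) ^ d ≤ n ^ C * d ^ d
          -- g is at most the square of 4 ^ p′, and d ≤ 208 e; hence 416 = 2 * 208.
          small-cost (inj₂ (p′ , refl , p₀≤p′ , lt)) = bounded-power (416 * c) C≥large-base (begin
            (4 ^ suc p′) ^ (c * d)    ≤⟨ ^-monoˡ-≤ (c * d) (square p′ p₀≤p′) ⟩
            ((4 ^ p′) ^ 2) ^ (c * d)  ≡⟨ ^-*-assoc (4 ^ p′) 2 (c * d) ⟩
            (4 ^ p′) ^ (2 * (c * d))  ≤⟨ ^-monoʳ-≤ (4 ^ p′) {{m^n≢0 4 p′}} exponent ⟩
            (4 ^ p′) ^ (e * (416 * c)) ≡⟨ sym (^-*-assoc (4 ^ p′) e (416 * c)) ⟩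
            ((4 ^ p′) ^ e) ^ (416 * c) ≤⟨ ^-monoˡ-≤ (416 * c) (<⇒≤ lt) ⟩
            n ^ (416 * c)             ∎)
            where
            open ≤-Reasoning
            lem : ∀ c e x → 2 * (c * (x * e)) ≡ e * ((2 * x) * c)
            lem = solve-∀
            exponent : 2 * (c * d) ≤ e * (416 * c)
            exponent = ≤-trans (*-monoʳ-≤ 2 (*-monoʳ-≤ c d≤208e)) (≤-reflexive (lem c e 208))
          small-cost (inj₁ refl) with R * g₀ ^ c ≤? d
          ... | yes le = ≤-trans (^-monoˡ-≤ d le) (m≤n*m (d ^ d) (n ^ C) {{m^n≢0 n C}})
          -- Here d is at most 104 k′ g₀ ^ c, so g₀ ^ (c d) is bounded by a constant power of g₀ ^
          -- k′ < n.
          ... | no ≰ = bounded-power (104 * (c * g₀ ^ c)) C≥small-base (begin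
            g₀ ^ (c * d)                       ≤⟨ ^-monoʳ-≤ g₀ {{m^n≢0 4 p₀}} exponent ⟩
            g₀ ^ (k′ * (104 * (c * g₀ ^ c)))   ≡⟨ sym (^-*-assoc g₀ k′ (104 * (c * g₀ ^ c))) ⟩
            (g₀ ^ k′) ^ (104 * (c * g₀ ^ c))   ≤⟨ ^-monoˡ-≤ (104 * (c * g₀ ^ c)) (<⇒≤ below) ⟩
            n ^ (104 * (c * g₀ ^ c))           ∎)
            where
            open ≤-Reasoning
            lem : ∀ c k x y → c * ((y * (k + k)) * x) ≡ k * ((2 * y) * (c * x))
            lem = solve-∀
            exponent : c * d ≤ k′ * (104 * (c * g₀ ^ c))
            exponent = ≤-trans (*-monoʳ-≤ c (≤-trans (≰⇒≥ ≰) (*-monoˡ-≤ (g₀ ^ c) (≤-trans R≤ (*-monoʳ-≤ 52 (+-monoˡ-≤ k′ k′>0))))))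
              (≤-reflexive (lem c k′ (g₀ ^ c) 52))

          solution : Σ[ A ∈ Algorithm n ] Solves C d n A
          solution = sorting (small-cost base)

        large : Σ[ A ∈ Algorithm n ] Solves C d n A
        large with least (λ p → (4 ^ p) ^ e) n p₀ n enough
          where
          enough : n ≤ (4 ^ (p₀ + n)) ^ e
          enough = ≤-trans (≤-trans (n≤b^n {4} (s≤s (s≤s z≤n)) n) (^-monoʳ-≤ 4 (m≤n+m n p₀)))
            (≤-trans (≤-reflexive (sym (^-identityʳ (4 ^ (p₀ + n))))) (^-monoʳ-≤ (4 ^ (p₀ + n)) {{m^n≢0 4 (p₀ + n)}} (<⇒≤ e≥2)))
        ... | p , p₀≤p , _ , n≤ , base with least (λ k → (4 ^ p) ^ k) n 0 e n≤
        ...   | _ , _ , _ , n≤1 , inj₁ refl = contradiction n≤1 (<⇒≱ (≤-<-trans (≤-trans (≤-trans (m≤m+n 1 207) d₀≥208) d₀≤d) d<n))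
        -- A single level would mean n ≤ g, against `base-<`.
        ...   | _ , _ , _ , n≤g , inj₂ (zero , refl , _ , _) = contradiction (≤-trans n≤g (≤-reflexive (*-identityʳ (4 ^ p)))) (<⇒≱ (base-< base))
        ...   | _ , _ , k≤e , above , inj₂ (suc k″ , refl , _ , below) = solution p (suc k″) p₀≤p base (s≤s z≤n) k≤e below above

    solve : ∀ d n → 0 < d → Σ[ A ∈ Algorithm n ] Solves C d n A
    -- Without items the cost factor is 0, and 0 ^ d = 0 because d > 0.
    solve d zero d>0 = solve-with (singleRound 0) ≤-refl d>0 (*-monoʳ-≤ 2 d>0) 0 z≤n (≤-trans (≤-reflexive (0^ d d>0)) z≤n)
      where
      0^ : ∀ d → 0 < d → 0 ^ d ≡ 0
      0^ (suc d) _ = refl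
    solve d n@(suc _) d>0 with n ≤? d | d₀ ≤? d
    ... | yes n≤d | _ = single d n (s≤s z≤n) d>0 (≤-trans (^-monoˡ-≤ d n≤d) (m≤n*m (d ^ d) (n ^ C) {{m^n≢0 n C}}))
    ... | no _ | no d₀≰d = single d n (s≤s z≤n) d>0 (≤-trans (^-monoʳ-≤ n (≤-trans (≰⇒≥ d₀≰d) C≥d₀)) (m≤m*n (n ^ C) (d ^ d) {{m^n≢0 d d {{>-nonZero d>0}}}}))
    ... | no n≰d | yes d₀≤d = Large.large d n (s≤s z≤n) d₀≤d (≰⇒> n≰d)

    C>0 : 0 < C
    C>0 = ≤-trans (≤-trans (m≤m+n 1 207) d₀≥208) C≥d₀

  open Parameters expanders public using (C; C>0; solve)

open import Defs
open import Data.Nat using (ℕ; _+_; _*_; _^_; _≤_; _<_)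
open import Data.Fin using (Fin)
open import Data.Rational using (ℚ)
open Conclusion using (C; C>0; solve; module Solves)

theorem1p7 : Σ[ C ∈ ℕ ] (0 < C × (∀ (d : ℕ) → 0 < d →
    Σ[ A ∈ ((n : ℕ) → Algorithm n) ] (∀ (n : ℕ) (x : Fin n → ℚ) (adv : Adversary n) → LegalAdversary x adv →
    (cost (A n) adv d ^ d ≤ n ^ (d + C) * d ^ d)
    × ApproxSorting (ℕ→ℚ (2 * d)) x (result (A n) adv d))))
theorem1p7 = C , C>0 , λ d d>0 → (λ n → proj₁ (solve d n d>0)) , λ n x adv legal →
  Solves.cheap (proj₂ (solve d n d>0)) x adv legal , Solves.sorted (proj₂ (solve d n d>0)) x adv legal
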